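{- For every real $C>1$ there exists a constant $\varepsilon>0$ such that for all sufficiently large positive integers $\ell$, \[R(\ell, C\ell)\geq \big(p_C^{ -1/2}+\varepsilon\big)^\ell,\] where $p_C\in(0,1/2)$ is the unique solution of the equation $C=\frac{\log p_C}{\log(1-p_C)}$.
   Context: For positive integers $\ell,k$, the Ramsey number $R(\ell,k)$ is the smallest integer $n$ such that every red/blue colouring of the edges of the complete graph $K_n$ contains either a red copy of $K_\ell$ (all edges red) or a blue copy of $K_k$ (all edges blue). In the statement $C\ell$ is used as the second argument of $R$, as printed in the paper. -}

module Defs where

open import Data.Bool.Base using (true; false)
open import Data.Fin.Base using (Fin; zero; suc)
import Data.Fin.Properties as Fin
open import Data.Fin.Subset
  using (Subset; Side; inside; outside; _∈_; _∉_; _⊆_; _∩_; _∪_; ∁; ⁅_⁆; ⊥; ⊤; ∣_∣)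
  renaming (_-_ to _∖_)
open import Data.Fin.Subset.Properties
open import Data.Integer.Base using (+_)
open import Data.Nat.Base using (ℕ; zero; suc; s≤s; z≤n; _!)
import Data.Nat.Base as ℕ
import Data.Nat.Properties as ℕ
import Data.Nat.Combinatorics as ℕ
open import Data.Product using (Σ; ∃; ∃-syntax; _×_; _,_; proj₁; proj₂)
open import Data.Rational.Base as ℚ using (ℚ; 0ℚ; 1ℚ; ½)
import Data.Rational.Properties as ℚ
open import Data.Rational.Solver using (module +-*-Solver)
open import Data.Sum.Base using (_⊎_; inj₁; inj₂)
open import Data.Vec.Base using (Vec; []; _∷_; lookup; map; here; there)
import Data.Vec.Properties as Vec
open import Relation.Binary.PropositionalEquality
open import Relation.Nullary
open import Relation.Nullary.Decidable using (_×-dec_; _⊎-dec_; _→-dec_; ¬?; map′)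
open import Relation.Unary using (Decidable)

-- Reals are Cauchy sequences of rationals; their equality is _≃_ below.

Cauchy : (ℕ → ℚ) → Set
Cauchy s = ∀ ε → 0ℚ ℚ.< ε →
  ∃[ N ] ∀ m n → N ℕ.≤ m → N ℕ.≤ n → ℚ.∣ s m ℚ.- s n ∣ ℚ.< ε

record ℝ : Set where
  constructor mkℝ
  field
    seq    : ℕ → ℚ
    cauchy : Cauchy seq

open ℝ public

private
  half-pos : ∀ {ε} → 0ℚ ℚ.< ε → 0ℚ ℚ.< ½ ℚ.* ε
  half-pos {ε} ε>0 = subst (ℚ._< ½ ℚ.* ε) (ℚ.*-zeroʳ ½) (ℚ.*-monoʳ-<-pos ½ ε>0)

  halves : ∀ ε → ½ ℚ.* ε ℚ.+ ½ ℚ.* ε ≡ ε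
  halves ε = trans (sym (ℚ.*-distribʳ-+ ε ½ ½)) (ℚ.*-identityˡ ε)

  const-cauchy : ∀ q → Cauchy (λ _ → q)
  const-cauchy q ε ε>0 = 0 , λ _ _ _ _ →
    subst (ℚ._< ε) (sym (cong ℚ.∣_∣ (ℚ.+-inverseʳ q))) ε>0

  +-cauchy : ∀ s t → Cauchy s → Cauchy t → Cauchy (λ n → s n ℚ.+ t n)
  +-cauchy s t cs ct ε ε>0
    with cs (½ ℚ.* ε) (half-pos ε>0) | ct (½ ℚ.* ε) (half-pos ε>0)
  ... | M , hs | N , ht = M ℕ.⊔ N , λ m n m≥ n≥ → begin-strict
      ℚ.∣ (s m ℚ.+ t m) ℚ.- (s n ℚ.+ t n) ∣
        ≡⟨ cong ℚ.∣_∣ (rearrange (s m) (t m) (s n) (t n)) ⟩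
      ℚ.∣ (s m ℚ.- s n) ℚ.+ (t m ℚ.- t n) ∣
        ≤⟨ ℚ.∣p+q∣≤∣p∣+∣q∣ (s m ℚ.- s n) (t m ℚ.- t n) ⟩
      ℚ.∣ s m ℚ.- s n ∣ ℚ.+ ℚ.∣ t m ℚ.- t n ∣
        <⟨ ℚ.+-mono-< (hs m n (ℕ.m⊔n≤o⇒m≤o M N m≥) (ℕ.m⊔n≤o⇒m≤o M N n≥))
                      (ht m n (ℕ.m⊔n≤o⇒n≤o M N m≥) (ℕ.m⊔n≤o⇒n≤o M N n≥)) ⟩
      ½ ℚ.* ε ℚ.+ ½ ℚ.* ε
        ≡⟨ halves ε ⟩
      ε ∎
    where
    open ℚ.≤-Reasoning
    rearrange : ∀ a b c d →
      (a ℚ.+ b) ℚ.- (c ℚ.+ d) ≡ (a ℚ.- c) ℚ.+ (b ℚ.- d)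
    rearrange = solve 4 (λ a b c d →
      (a :+ b) :- (c :+ d) := (a :- c) :+ (b :- d)) refl
      where open +-*-Solver

  neg-cauchy : ∀ s → Cauchy s → Cauchy (λ n → ℚ.- s n)
  neg-cauchy s cs ε ε>0 with cs ε ε>0
  ... | N , h = N , λ m n m≥ n≥ → subst (ℚ._< ε)
      (trans (sym (ℚ.∣-p∣≡∣p∣ (s m ℚ.- s n)))
             (cong ℚ.∣_∣ (ℚ.neg-distrib-+ (s m) (ℚ.- s n))))
      (h m n m≥ n≥)

  bounded : ∀ s → Cauchy s →
    ∃[ B ] (0ℚ ℚ.< B × ∃[ N ] ∀ n → N ℕ.≤ n → ℚ.∣ s n ∣ ℚ.≤ B)
  bounded s cs with cs 1ℚ (ℚ.positive⁻¹ 1ℚ)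
  ... | N , h = 1ℚ ℚ.+ ℚ.∣ s N ∣
      , ℚ.<-≤-trans (ℚ.positive⁻¹ 1ℚ)
          (subst (ℚ._≤ 1ℚ ℚ.+ ℚ.∣ s N ∣) (ℚ.+-identityʳ 1ℚ)
                 (ℚ.+-monoʳ-≤ 1ℚ (ℚ.0≤∣p∣ (s N))))
      , N , λ n n≥ → begin
      ℚ.∣ s n ∣                        ≡⟨ cong ℚ.∣_∣ (insert (s n) (s N)) ⟩
      ℚ.∣ (s n ℚ.- s N) ℚ.+ s N ∣      ≤⟨ ℚ.∣p+q∣≤∣p∣+∣q∣ (s n ℚ.- s N) (s N) ⟩
      ℚ.∣ s n ℚ.- s N ∣ ℚ.+ ℚ.∣ s N ∣  ≤⟨ ℚ.+-monoˡ-≤ ℚ.∣ s N ∣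
                                            (ℚ.<⇒≤ (h n N n≥ ℕ.≤-refl)) ⟩
      1ℚ ℚ.+ ℚ.∣ s N ∣                 ∎
    where
    open ℚ.≤-Reasoning
    insert : ∀ a b → a ≡ (a ℚ.- b) ℚ.+ b
    insert = solve 2 (λ a b → a := (a :- b) :+ b) refl
      where open +-*-Solver

  fraction : ∀ {B ε} → 0ℚ ℚ.< B → 0ℚ ℚ.< ε → ∃[ δ ] (0ℚ ℚ.< δ × B ℚ.* δ ≡ ε)
  fraction {B} {ε} B>0 ε>0 = B⁻¹ ℚ.* ε , δ>0 , Bδ≡ε
    where
    instance
      B-pos = ℚ.positive B>0
      B≢0   = ℚ.pos⇒nonZero B
    B⁻¹ = ℚ.1/ B
    instance
      B⁻¹-pos = ℚ.1/pos⇒pos B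
    δ>0 : 0ℚ ℚ.< B⁻¹ ℚ.* ε
    δ>0 = subst (ℚ._< B⁻¹ ℚ.* ε) (ℚ.*-zeroʳ B⁻¹) (ℚ.*-monoʳ-<-pos B⁻¹ ε>0)
    Bδ≡ε : B ℚ.* (B⁻¹ ℚ.* ε) ≡ ε
    Bδ≡ε = trans (sym (ℚ.*-assoc B B⁻¹ ε))
          (trans (cong (ℚ._* ε) (ℚ.*-inverseʳ B)) (ℚ.*-identityˡ ε))

  *-bound : ∀ {B a b δ} → 0ℚ ℚ.< B → ℚ.∣ a ∣ ℚ.≤ B → ℚ.∣ b ∣ ℚ.< δ →
    ℚ.∣ a ℚ.* b ∣ ℚ.< B ℚ.* δ
  *-bound {B} {a} {b} {δ} B>0 a≤ b< = begin-strict
      ℚ.∣ a ℚ.* b ∣         ≡⟨ ℚ.∣p*q∣≡∣p∣*∣q∣ a b ⟩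
      ℚ.∣ a ∣ ℚ.* ℚ.∣ b ∣   ≤⟨ ℚ.*-monoʳ-≤-nonNeg ℚ.∣ b ∣ a≤ ⟩
      B ℚ.* ℚ.∣ b ∣         <⟨ ℚ.*-monoʳ-<-pos B b< ⟩
      B ℚ.* δ               ∎
    where
    open ℚ.≤-Reasoning
    instance
      B-pos = ℚ.positive B>0
      b-nn  = ℚ.∣-∣-nonNeg b

  *-close : ∀ {A B α β ε a b c d} → 0ℚ ℚ.< A → 0ℚ ℚ.< B →
    A ℚ.* α ≡ ½ ℚ.* ε → B ℚ.* β ≡ ½ ℚ.* ε →
    ℚ.∣ a ∣ ℚ.≤ A → ℚ.∣ b ℚ.- d ∣ ℚ.< α →
    ℚ.∣ d ∣ ℚ.≤ B → ℚ.∣ a ℚ.- c ∣ ℚ.< β →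
    ℚ.∣ a ℚ.* b ℚ.- c ℚ.* d ∣ ℚ.< ε
  *-close {A} {B} {α} {β} {ε} {a} {b} {c} {d} A>0 B>0 Aα Bβ a≤ bd< d≤ ac< =
    begin-strict
      ℚ.∣ a ℚ.* b ℚ.- c ℚ.* d ∣
        ≡⟨ cong ℚ.∣_∣ (rearrange a b c d) ⟩
      ℚ.∣ a ℚ.* (b ℚ.- d) ℚ.+ d ℚ.* (a ℚ.- c) ∣
        ≤⟨ ℚ.∣p+q∣≤∣p∣+∣q∣ (a ℚ.* (b ℚ.- d)) (d ℚ.* (a ℚ.- c)) ⟩
      ℚ.∣ a ℚ.* (b ℚ.- d) ∣ ℚ.+ ℚ.∣ d ℚ.* (a ℚ.- c) ∣
        <⟨ ℚ.+-mono-< (*-bound A>0 a≤ bd<) (*-bound B>0 d≤ ac<) ⟩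
      A ℚ.* α ℚ.+ B ℚ.* β
        ≡⟨ cong₂ ℚ._+_ Aα Bβ ⟩
      ½ ℚ.* ε ℚ.+ ½ ℚ.* ε
        ≡⟨ halves ε ⟩
      ε ∎
    where
    open ℚ.≤-Reasoning
    rearrange : ∀ a b c d →
      a ℚ.* b ℚ.- c ℚ.* d ≡ a ℚ.* (b ℚ.- d) ℚ.+ d ℚ.* (a ℚ.- c)
    rearrange = solve 4 (λ a b c d →
      a :* b :- c :* d := a :* (b :- d) :+ d :* (a :- c)) refl
      where open +-*-Solver

  *-cauchy : ∀ s t → Cauchy s → Cauchy t → Cauchy (λ n → s n ℚ.* t n)
  *-cauchy s t cs ct ε ε>0 =
    let A , A>0 , M₀ , hA = bounded s cs
        B , B>0 , N₀ , hB = bounded t ct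
        α , α>0 , Aα      = fraction A>0 (half-pos ε>0)
        β , β>0 , Bβ      = fraction B>0 (half-pos ε>0)
        N₁ , ht           = ct α α>0
        M₁ , hs           = cs β β>0
    in (M₀ ℕ.⊔ N₀) ℕ.⊔ (M₁ ℕ.⊔ N₁) , λ m n m≥ n≥ →
      let m≥₀ = ℕ.m⊔n≤o⇒m≤o (M₀ ℕ.⊔ N₀) (M₁ ℕ.⊔ N₁) m≥
          n≥₀ = ℕ.m⊔n≤o⇒m≤o (M₀ ℕ.⊔ N₀) (M₁ ℕ.⊔ N₁) n≥
          m≥₁ = ℕ.m⊔n≤o⇒n≤o (M₀ ℕ.⊔ N₀) (M₁ ℕ.⊔ N₁) m≥
          n≥₁ = ℕ.m⊔n≤o⇒n≤o (M₀ ℕ.⊔ N₀) (M₁ ℕ.⊔ N₁) n≥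
      in *-close {A} {B} {α} {β} {ε} {s m} {t m} {s n} {t n} A>0 B>0 Aα Bβ
           (hA m (ℕ.m⊔n≤o⇒m≤o M₀ N₀ m≥₀))
           (ht m n (ℕ.m⊔n≤o⇒n≤o M₁ N₁ m≥₁) (ℕ.m⊔n≤o⇒n≤o M₁ N₁ n≥₁))
           (hB n (ℕ.m⊔n≤o⇒n≤o M₀ N₀ n≥₀))
           (hs m n (ℕ.m⊔n≤o⇒m≤o M₁ N₁ m≥₁) (ℕ.m⊔n≤o⇒m≤o M₁ N₁ n≥₁))

fromℚ : ℚ → ℝ
fromℚ q = mkℝ (λ _ → q) (const-cauchy q)

fromℕ : ℕ → ℝ
fromℕ n = fromℚ (+ n ℚ./ 1)

0ℝ 1ℝ ½ℝ : ℝ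
0ℝ = fromℚ 0ℚ
1ℝ = fromℚ 1ℚ
½ℝ = fromℚ ½

infix  8 -_
infixr 8 _^_
infixl 7 _*_
infixl 6 _+_ _-_
infix  4 _<_ _≤_ _≃_ _≄_ _⟶_

_+_ : ℝ → ℝ → ℝ
x + y = mkℝ (λ n → seq x n ℚ.+ seq y n) (+-cauchy (seq x) (seq y) (cauchy x) (cauchy y))

-_ : ℝ → ℝ
- x = mkℝ (λ n → ℚ.- seq x n) (neg-cauchy (seq x) (cauchy x))

_-_ : ℝ → ℝ → ℝ
x - y = x + (- y)

_*_ : ℝ → ℝ → ℝ
x * y = mkℝ (λ n → seq x n ℚ.* seq y n) (*-cauchy (seq x) (seq y) (cauchy x) (cauchy y))

_^_ : ℝ → ℕ → ℝ
x ^ zero  = 1ℝ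
x ^ suc n = x * x ^ n

-- The two sequences are eventually separated by a fixed positive gap.
_<_ : ℝ → ℝ → Set
x < y = ∃[ δ ] (0ℚ ℚ.< δ × ∃[ N ] ∀ n → N ℕ.≤ n → seq x n ℚ.+ δ ℚ.≤ seq y n)

_≤_ : ℝ → ℝ → Set
x ≤ y = ¬ (y < x)

_≃_ : ℝ → ℝ → Set
x ≃ y = x ≤ y × y ≤ x

-- Apartness, the positive form of inequality needed of a divisor.
_≄_ : ℝ → ℝ → Set
x ≄ y = x < y ⊎ y < x

_⟶_ : (ℕ → ℝ) → ℝ → Set
u ⟶ x = ∀ ε → 0ℝ < ε →
  ∃[ N ] ∀ n → N ℕ.≤ n → (x - ε < u n) × (u n < x + ε)

expSum : ℝ → ℕ → ℝ
expSum y zero    = 0ℝ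
expSum y (suc n) = expSum y n + fromℚ (ℚ._/_ (+ 1) (n !) {{ n ℕ.!≢0 }}) * y ^ n

-- y = log x, the natural logarithm as the inverse of exp y = Σₙ yⁿ / n!.
IsLog : ℝ → ℝ → Set
IsLog x y = expSum y ⟶ x

-- z = x / y
IsQuotient : ℝ → ℝ → ℝ → Set
IsQuotient x y z = y ≄ 0ℝ × z * y ≃ x

-- y = x ^ (-1/2)
IsInverseSqrt : ℝ → ℝ → Set
IsInverseSqrt x y = 0ℝ < y × (y * y) * x ≃ 1ℝ

-- k is ⌊ x ⌋ or ⌈ x ⌉, expressed as ∣ x - k ∣ < 1.  For integral x this
-- forces k = x.  Unlike k ≤ x < k + 1, it has a solution k for every x ≥ 0
-- without deciding any comparison of reals.
IsRounding : ℝ → ℕ → Set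
IsRounding x k = (x < fromℕ k + 1ℝ) × (fromℕ k < x + 1ℝ)

-- p solves C = log p / log (1 - p) in the interval (0 , 1/2).
record IsSolution (C p : ℝ) : Set where
  field
    0<p      : 0ℝ < p
    p<½      : p < ½ℝ
    a b      : ℝ
    a-log    : IsLog p a
    b-log    : IsLog (1ℝ - p) b
    equation : IsQuotient a b C

data Colour : Set where
  red blue : Colour

-- Colourings of pairs, as a matrix; the edge colourings of Kₙ are the
-- symmetric ones, with diagonal entries carrying no information.
Matrix : ℕ → Set
Matrix n = Vec (Vec Colour n) n

colour : ∀ {n} → Matrix n → Fin n → Fin n → Colour
colour c i j = lookup (lookup c i) j

Symmetric : ∀ {n} → Matrix n → Set
Symmetric c = ∀ i j → colour c i j ≡ colour c j i

Monochromatic : ∀ {n} → Matrix n → Colour → Subset n → Set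
Monochromatic c x S = ∀ i j → i ∈ S → j ∈ S → i ≢ j → colour c i j ≡ x

HasClique : ∀ {n} → Matrix n → Colour → ℕ → Set
HasClique c x m = ∃[ S ] (∣ S ∣ ≡ m × Monochromatic c x S)

Arrows : ℕ → ℕ → ℕ → Set
Arrows ℓ k n = (c : Matrix n) → Symmetric c →
  HasClique c red ℓ ⊎ HasClique c blue k

private
  _≟ᶜ_ : (x y : Colour) → Dec (x ≡ y)
  red  ≟ᶜ red  = yes refl
  red  ≟ᶜ blue = no λ ()
  blue ≟ᶜ red  = no λ ()
  blue ≟ᶜ blue = yes refl

  Searchable : Set → Set₁
  Searchable A = ∀ {P : A → Set} → Decidable P → Dec (∀ a → P a)

  colour-searchable : Searchable Colour
  colour-searchable P? = map′
    (λ { (r , b) red → r ; (r , b) blue → b }) (λ f → f red , f blue)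
    (P? red ×-dec P? blue)

  vec-searchable : ∀ {A} → Searchable A → ∀ n → Searchable (Vec A n)
  vec-searchable all? zero    P? = map′ (λ { p [] → p }) (λ f → f []) (P? [])
  vec-searchable all? (suc n) P? = map′
    (λ { f (a ∷ v) → f a v }) (λ f a v → f (a ∷ v))
    (all? λ a → vec-searchable all? n λ v → P? (a ∷ v))

  monochromatic? : ∀ {n} (c : Matrix n) x → Decidable (Monochromatic c x)
  monochromatic? c x S = Fin.all? λ i → Fin.all? λ j →
    (i ∈? S) →-dec ((j ∈? S) →-dec (¬? (i Fin.≟ j) →-dec (colour c i j ≟ᶜ x)))

  hasClique? : ∀ {n} (c : Matrix n) x m → Dec (HasClique c x m)
  hasClique? c x m =
    anySubset? λ S → (∣ S ∣ ℕ.≟ m) ×-dec monochromatic? c x S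

  arrows? : ∀ ℓ k → Decidable (Arrows ℓ k)
  arrows? ℓ k n = vec-searchable (vec-searchable colour-searchable n) n λ c →
    Fin.all? (λ i → Fin.all? λ j → colour c i j ≟ᶜ colour c j i)
    →-dec (hasClique? c red ℓ ⊎-dec hasClique? c blue k)

  ∣p∣-split : ∀ {n} (p q : Subset n) → ∣ p ∣ ≡ ∣ p ∩ q ∣ ℕ.+ ∣ p ∩ ∁ q ∣
  ∣p∣-split []            []            = refl
  ∣p∣-split (outside ∷ p) (y ∷ q)       = ∣p∣-split p q
  ∣p∣-split (inside ∷ p)  (inside ∷ q)  = cong suc (∣p∣-split p q)
  ∣p∣-split (inside ∷ p)  (outside ∷ q) =
    trans (cong suc (∣p∣-split p q)) (sym (ℕ.+-suc ∣ p ∩ q ∣ ∣ p ∩ ∁ q ∣))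

  ∣p∪x∣ : ∀ {n} (p : Subset n) x → x ∉ p → ∣ p ∪ ⁅ x ⁆ ∣ ≡ suc ∣ p ∣
  ∣p∪x∣ (inside ∷ p)  zero    x∉p = contradiction here x∉p
  ∣p∪x∣ (outside ∷ p) zero    x∉p = cong (λ q → suc ∣ q ∣) (∪-identityʳ p)
  ∣p∪x∣ (inside ∷ p)  (suc x) x∉p = cong suc (∣p∪x∣ p x λ h → x∉p (there h))
  ∣p∪x∣ (outside ∷ p) (suc x) x∉p = ∣p∪x∣ p x λ h → x∉p (there h)

  ∣p∖x∣ : ∀ {n} (p : Subset n) x → ∣ p ∣ ℕ.≤ suc ∣ p ∖ x ∣
  ∣p∖x∣ (inside ∷ p)  zero    = s≤s (ℕ.≤-reflexive (cong ∣_∣ (sym (p─⊥≡p p))))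
  ∣p∖x∣ (outside ∷ p) zero    = ℕ.m≤n⇒m≤1+n (ℕ.≤-reflexive (cong ∣_∣ (sym (p─⊥≡p p))))
  ∣p∖x∣ (inside ∷ p)  (suc x) = s≤s (∣p∖x∣ p x)
  ∣p∖x∣ (outside ∷ p) (suc x) = ∣p∖x∣ p x

  nonempty : ∀ {n} (p : Subset n) → 1 ℕ.≤ ∣ p ∣ → ∃[ x ] x ∈ p
  nonempty (inside ∷ p)  _ = zero , here
  nonempty (outside ∷ p) h = let x , x∈p = nonempty p h in suc x , there x∈p

  x∉p∖x : ∀ {n} (p : Subset n) x → x ∉ p ∖ x
  x∉p∖x (_ ∷ p) (suc x) (there h) = x∉p∖x p x h

  ∖⊆ : ∀ {n} (p : Subset n) x → p ∖ x ⊆ p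
  ∖⊆ p x = p─q⊆p p ⁅ x ⁆

  redNbrs : ∀ {n} → Matrix n → Fin n → Subset n
  redNbrs c v = map side (lookup c v)
    where
    side : Colour → Side
    side red  = inside
    side blue = outside

  ∈redNbrs : ∀ {n} (w : Vec Colour n) {i} {f : Colour → Side} →
    f blue ≡ outside → i ∈ map f w → lookup w i ≡ red
  ∈redNbrs (red ∷ w)  {zero}  e h         = refl
  ∈redNbrs (blue ∷ w) {zero}  e h with trans (sym e) (Vec.[]=⇒lookup h)
  ... | ()
  ∈redNbrs (_ ∷ w)    {suc i} e (there h) = ∈redNbrs w e h

  ∉redNbrs : ∀ {n} (w : Vec Colour n) {i} {f : Colour → Side} →
    f red ≡ inside → i ∉ map f w → lookup w i ≡ blue
  ∉redNbrs (blue ∷ w) {zero}  e h = refl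
  ∉redNbrs (red ∷ w)  {zero}  {f} e h =
    contradiction (subst (λ s → zero ∈ (s ∷ map f w)) (sym e) here) h
  ∉redNbrs (_ ∷ w)    {suc i} e h = ∉redNbrs w e λ h′ → h (there h′)

  data CliqueIn {n} (c : Matrix n) (X : Subset n) (x : Colour) (m : ℕ) : Set where
    clique : ∀ S → S ⊆ X → ∣ S ∣ ≡ m → Monochromatic c x S → CliqueIn c X x m

  widen : ∀ {n} {c : Matrix n} {X Y x m} → X ⊆ Y → CliqueIn c X x m → CliqueIn c Y x m
  widen X⊆Y (clique S S⊆X size mono) = clique S (λ h → X⊆Y (S⊆X h)) size mono

  extend : ∀ {n} {c : Matrix n} {X Y x m} v → Symmetric c → v ∈ X → v ∉ Y → Y ⊆ X →
    (∀ {i} → i ∈ Y → colour c v i ≡ x) → CliqueIn c Y x m → CliqueIn c X x (suc m)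
  extend {c = c} {X} {Y} {x} v sym-c v∈X v∉Y Y⊆X vY (clique S S⊆Y size mono) =
    clique (S ∪ ⁅ v ⁆) sub
      (trans (∣p∪x∣ S v λ h → v∉Y (S⊆Y h)) (cong suc size)) mono′
    where
    sub : S ∪ ⁅ v ⁆ ⊆ X
    sub h with x∈p∪q⁻ S ⁅ v ⁆ h
    ... | inj₁ h₁ = Y⊆X (S⊆Y h₁)
    ... | inj₂ h₂ rewrite x∈⁅y⁆⇒x≡y v h₂ = v∈X
    mono′ : Monochromatic c x (S ∪ ⁅ v ⁆)
    mono′ i j hi hj i≢j with x∈p∪q⁻ S ⁅ v ⁆ hi | x∈p∪q⁻ S ⁅ v ⁆ hj
    ... | inj₁ hi | inj₁ hj = mono i j hi hj i≢j
    ... | inj₁ hi | inj₂ hj rewrite x∈⁅y⁆⇒x≡y v hj =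
      trans (sym-c i v) (vY (S⊆Y hi))
    ... | inj₂ hi | inj₁ hj rewrite x∈⁅y⁆⇒x≡y v hi = vY (S⊆Y hj)
    ... | inj₂ hi | inj₂ hj =
      contradiction (trans (x∈⁅y⁆⇒x≡y v hi) (sym (x∈⁅y⁆⇒x≡y v hj))) i≢j

  emptyClique : ∀ {n} {c : Matrix n} {X x} → CliqueIn c X x 0
  emptyClique {n} = clique ⊥ (λ h → contradiction h ∉⊥) (∣⊥∣≡0 n)
    λ _ _ h → contradiction h ∉⊥

  pigeonhole : ∀ {a b} A B → suc (A ℕ.+ B) ℕ.≤ suc (a ℕ.+ b) → A ℕ.≤ a ⊎ B ℕ.≤ b
  pigeonhole {a} {b} A B (s≤s h) with A ℕ.≤? a | B ℕ.≤? b
  ... | yes p | _     = inj₁ p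
  ... | no _  | yes q = inj₂ q
  ... | no p  | no q  =
    contradiction h (ℕ.<⇒≱ (ℕ.+-mono-< (ℕ.≰⇒> p) (ℕ.≰⇒> q)))

  ramsey-in : ∀ ℓ k → ∃[ N ] (∀ {n} (c : Matrix n) → Symmetric c → ∀ X → N ℕ.≤ ∣ X ∣ →
    CliqueIn c X red ℓ ⊎ CliqueIn c X blue k)
  ramsey-in zero    k    = 0 , λ _ _ _ _ → inj₁ emptyClique
  ramsey-in (suc ℓ) zero = 0 , λ _ _ _ _ → inj₂ emptyClique
  ramsey-in (suc ℓ) (suc k) with ramsey-in ℓ (suc k) | ramsey-in (suc ℓ) k
  ... | A , hA | B , hB = suc (A ℕ.+ B) , step
    where
    step : ∀ {n} (c : Matrix n) → Symmetric c → ∀ X → suc (A ℕ.+ B) ℕ.≤ ∣ X ∣ →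
      CliqueIn c X red (suc ℓ) ⊎ CliqueIn c X blue (suc k)
    step c sym-c X big with nonempty X (ℕ.≤-trans (s≤s z≤n) big)
    ... | v , v∈X = split
      where
      X′ = X ∖ v
      Q = redNbrs c v
      Y = X′ ∩ Q
      Z = X′ ∩ ∁ Q
      Y⊆X : Y ⊆ X
      Y⊆X h = ∖⊆ X v (p∩q⊆p X′ Q h)
      Z⊆X : Z ⊆ X
      Z⊆X h = ∖⊆ X v (p∩q⊆p X′ (∁ Q) h)
      v∉Y : v ∉ Y
      v∉Y h = x∉p∖x X v (p∩q⊆p X′ Q h)
      v∉Z : v ∉ Z
      v∉Z h = x∉p∖x X v (p∩q⊆p X′ (∁ Q) h)
      split : CliqueIn c X red (suc ℓ) ⊎ CliqueIn c X blue (suc k)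
      split with pigeonhole A B (ℕ.≤-trans big
        (ℕ.≤-trans (∣p∖x∣ X v) (s≤s (ℕ.≤-reflexive (∣p∣-split X′ Q)))))
      ... | inj₁ A≤ with hA c sym-c Y A≤
      ...   | inj₁ r = inj₁ (extend v sym-c v∈X v∉Y Y⊆X
                (λ h → ∈redNbrs (lookup c v) refl (p∩q⊆q X′ Q h)) r)
      ...   | inj₂ b = inj₂ (widen Y⊆X b)
      split | inj₂ B≤ with hB c sym-c Z B≤
      ...   | inj₁ r = inj₁ (widen Z⊆X r)
      ...   | inj₂ b = inj₂ (extend v sym-c v∈X v∉Z Z⊆X
                (λ h → ∉redNbrs (lookup c v) refl
                  (x∈∁p⇒x∉p (p∩q⊆q X′ (∁ Q) h))) b)

  least : ∀ {P : ℕ → Set} → Decidable P → ∃ P →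
    ∃[ n ] (P n × (∀ m → P m → n ℕ.≤ m))
  least {P} P? (n , pn) = go n 0 P? (subst P (sym (ℕ.+-identityʳ n)) pn) λ _ _ → z≤n
    where
    go : ∀ {P : ℕ → Set} fuel n → Decidable P → P (fuel ℕ.+ n) →
      (∀ m → P m → n ℕ.≤ m) → ∃[ n ] (P n × (∀ m → P m → n ℕ.≤ m))
    go zero n P? pn low = n , pn , low
    go {P} (suc fuel) n P? pn low with P? n
    ... | yes p = n , p , low
    ... | no ¬p = go fuel (suc n) P? (subst P (sym (ℕ.+-suc fuel n)) pn)
      λ m pm → ℕ.≤∧≢⇒< (low m pm) λ { refl → ¬p pm }

ramsey : ∀ ℓ k → ∃[ n ] Arrows ℓ k n
ramsey ℓ k = let N , h = ramsey-in ℓ k in N , λ c sym-c →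
  forget (h c sym-c ⊤ (ℕ.≤-reflexive (sym (∣⊤∣≡n N))))
  where
  forget : ∀ {n} {c : Matrix n} → CliqueIn c ⊤ red ℓ ⊎ CliqueIn c ⊤ blue k →
    HasClique c red ℓ ⊎ HasClique c blue k
  forget (inj₁ (clique S _ size mono)) = inj₁ (S , size , mono)
  forget (inj₂ (clique S _ size mono)) = inj₂ (S , size , mono)

R : ℕ → ℕ → ℕ
R ℓ k = proj₁ (least (arrows? ℓ k) (ramsey ℓ k))

R-arrows : ∀ ℓ k → Arrows ℓ k (R ℓ k)
R-arrows ℓ k = proj₁ (proj₂ (least (arrows? ℓ k) (ramsey ℓ k)))

R-least : ∀ ℓ k n → Arrows ℓ k n → R ℓ k ℕ.≤ n
R-least ℓ k = proj₂ (proj₂ (least (arrows? ℓ k) (ramsey ℓ k)))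

{-# OPTIONS --safe #-}
module Submission where

-- Give every vertex u a vector x_u of d = ℓ² random signs and colour uv red with probability p′ ∏ᵢ (1 - τ x_uᵢ x_vᵢ), truncated at 1,
-- where τ = β/ℓ for a small constant β.  Given ℓ vertices, they span a red clique with probability at most p′^(ℓ choose 2) Z^d, where
-- Z = 𝔼 ∏ (1 - τ x_u x_v) ≤ 1 - β³/6 + O(β⁴): the terms of first and second order vanish, and triangles contribute -β³/6.
-- Write q = 1 - p.  The blue weight is dominated, Fourier coefficient by Fourier coefficient, by a mixture of products ∏ᵢ (1 + t x_uᵢ x_vᵢ);
-- replacing the mixture on one edge at a time by t = σ ≈ (p/q) τ shows that k ≈ C ℓ vertices span a blue clique with probability at most about
-- q′^(k choose 2) (1 + (σ k)³/6)^d.  With p′ = p (1 + ξ β³) the red gain survives if 3 ξ < 1, and the blue loss is compensated if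
-- C p² < 3 ξ q².  Such a ξ exists because p = exp (C b) and q = exp b, where b < 0 solves exp (C b) + exp b = 1, satisfy C p² < q².

import Data.Nat.Base as ℕ
open import Data.Nat.Base using (ℕ; zero; suc)
import Data.Nat.Properties as ℕ
open import Data.Product using (Σ; Σ-syntax; ∃; ∃-syntax; _×_; _,_; proj₁; proj₂)
open import Data.Sum.Base using (_⊎_; inj₁; inj₂)
open import Relation.Binary.PropositionalEquality
open import Relation.Nullary using (contradiction; ¬_)
open import Relation.Nullary.Decidable using (from-yes; from-no)
open import Tactic.RingSolver using (solve-∀)

-- With τ = β/ℓ and d = ℓ² the triangle term, about ℓ² β³/6, is proportional to the number of edges;
-- the neglected terms are smaller by a factor β, up to powers of m. The conditions on ξ compare
-- exponents of order β³ ℓ². For red, the cost ξ/2 of raising p must stay below the gain 1/6. For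
-- blue, q drops by the factor 1 - (p/q) ξ β³, which counts k²/2 times, while the triangles cost
-- (p/q)³ β³ (k/ℓ)³/6 in each of ℓ² coordinates; hence C (p/q)² < 3 ξ. The obstacle is that 1 - p ∏
-- (...) is no product over coordinates, so the blue mean does not factorise. Mixtures restore
-- products, but the coupling t of an edge is shared by all d coordinates, and the mean of a d-th
-- power exceeds the d-th power at the mean. This excess is tolerable only one edge at a time,
-- because a single edge shifts the bound for one coordinate by at most order t τ² k, up to powers
-- of m. The probabilistic part stays in ℚ: C, p and p^(-1/2) are replaced by rational upper bounds,
-- which the strict inequalities permit.

-- Rational arithmetic, powers and Bernoulli inequalities

module Rationals where
  open import Data.Integer.Base using (+_)
  import Data.Integer.Base as ℤ
  import Data.Integer.Properties as ℤ
  open import Data.Rational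
  open import Data.Rational.Properties
  open import Data.Rational.Unnormalised.Base using (mkℚᵘ; *≡*)
  import Data.Rational.Unnormalised.Base as ℚᵘ
  import Data.Rational.Unnormalised.Properties as ℚᵘ
  open import Relation.Nullary
  open import Relation.Nullary.Decidable using (dec⇒maybe)
  open import Tactic.RingSolver.Core.AlmostCommutativeRing using (AlmostCommutativeRing; fromCommutativeRing)

  ℚ-ring : AlmostCommutativeRing _ _
  ℚ-ring = fromCommutativeRing +-*-commutativeRing λ x → dec⇒maybe (0ℚ ≟ x)

  open import Relation.Binary.Reasoning.Setoid ℚᵘ.≃-setoid as ≃ using ()

  -- Opaque, so that `ι n` stays an atom for conversion and for the ring solver instead of unfolding
  -- to a normalised fraction.
  opaque
    ι : ℕ → ℚ
    ι n = + n / 1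

    ι-def : ∀ n → ι n ≡ + n / 1
    ι-def n = refl

    ι-0 : ι 0 ≡ 0ℚ
    ι-0 = refl

    ι-1 : ι 1 ≡ 1ℚ
    ι-1 = refl

    0≤ι : ∀ n → 0ℚ ≤ ι n
    0≤ι n = nonNegative⁻¹ (ι n) {{normalize-nonNeg n 1}}

    0<ι : ∀ n → 0ℚ < ι (suc n)
    0<ι n = positive⁻¹ (ι (suc n)) {{normalize-pos (suc n) 1}}

    ι-+ : ∀ m n → ι (m ℕ.+ n) ≡ ι m + ι n
    ι-+ m n = toℚᵘ-injective (≃.begin
      toℚᵘ (ι (m ℕ.+ n))               ≃.≈⟨ toℚᵘ-fromℚᵘ (mkℚᵘ (+ (m ℕ.+ n)) 0) ⟩
      mkℚᵘ (+ (m ℕ.+ n)) 0             ≃.≈⟨ *≡* (cong₂ ℤ._*_ (cong₂ ℤ._+_ (sym (ℤ.*-identityʳ (+ m))) (sym (ℤ.*-identityʳ (+ n)))) refl) ⟩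
      mkℚᵘ (+ m) 0 ℚᵘ.+ mkℚᵘ (+ n) 0   ≃.≈⟨ ℚᵘ.+-cong (toℚᵘ-fromℚᵘ (mkℚᵘ (+ m) 0)) (toℚᵘ-fromℚᵘ (mkℚᵘ (+ n) 0)) ⟨
      toℚᵘ (ι m) ℚᵘ.+ toℚᵘ (ι n)       ≃.≈⟨ toℚᵘ-homo-+ (ι m) (ι n) ⟨
      toℚᵘ (ι m + ι n)                 ≃.∎)

    ι-* : ∀ m n → ι (m ℕ.* n) ≡ ι m * ι n
    ι-* m n = toℚᵘ-injective (≃.begin
      toℚᵘ (ι (m ℕ.* n))               ≃.≈⟨ toℚᵘ-fromℚᵘ (mkℚᵘ (+ (m ℕ.* n)) 0) ⟩
      mkℚᵘ (+ (m ℕ.* n)) 0             ≃.≈⟨ *≡* (cong (ℤ._* + 1) (ℤ.pos-* m n)) ⟩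
      mkℚᵘ (+ m) 0 ℚᵘ.* mkℚᵘ (+ n) 0   ≃.≈⟨ ℚᵘ.*-cong (toℚᵘ-fromℚᵘ (mkℚᵘ (+ m) 0)) (toℚᵘ-fromℚᵘ (mkℚᵘ (+ n) 0)) ⟨
      toℚᵘ (ι m) ℚᵘ.* toℚᵘ (ι n)       ≃.≈⟨ toℚᵘ-homo-* (ι m) (ι n) ⟨
      toℚᵘ (ι m * ι n)                 ≃.∎)

    ι-suc : ∀ n → ι (suc n) ≡ 1ℚ + ι n
    ι-suc n = ι-+ 1 n

  sub⁻ : ∀ {a b} → 0ℚ ≤ b - a → a ≤ b
  sub⁻ {a} {b} h = subst₂ _≤_ (+-identityˡ a) (e a b) (+-monoˡ-≤ a h)
    where e : ∀ a b → b - a + a ≡ b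
          e = solve-∀ ℚ-ring

  sub⁺ : ∀ {a b} → a ≤ b → 0ℚ ≤ b - a
  sub⁺ {a} {b} h = subst (_≤ b - a) (+-inverseʳ a) (+-monoˡ-≤ (- a) h)

  sub⁻< : ∀ {a b} → 0ℚ < b - a → a < b
  sub⁻< {a} {b} h = subst₂ _<_ (+-identityˡ a) (e a b) (+-monoˡ-< a h)
    where e : ∀ a b → b - a + a ≡ b
          e = solve-∀ ℚ-ring

  sub⁺< : ∀ {a b} → a < b → 0ℚ < b - a
  sub⁺< {a} {b} h = subst (_< b - a) (+-inverseʳ a) (+-monoˡ-< (- a) h)

  -- The standard way to prove polynomial inequalities below: the difference is rewritten as an
  -- expression `d` that is visibly nonnegative, and the ring solver checks the rewriting.
  by-diff : ∀ {a b} d → 0ℚ ≤ d → b - a ≡ d → a ≤ b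
  by-diff d h e = sub⁻ (subst (0ℚ ≤_) (sym e) h)

  by-diff< : ∀ {a b} d → 0ℚ < d → b - a ≡ d → a < b
  by-diff< d h e = sub⁻< (subst (0ℚ <_) (sym e) h)

  infixl 6 _⊕_
  infixl 7 _⊛_
  _⊕_ : ∀ {a b} → 0ℚ ≤ a → 0ℚ ≤ b → 0ℚ ≤ a + b
  _⊕_ = +-mono-≤

  _⊛_ : ∀ {a b} → 0ℚ ≤ a → 0ℚ ≤ b → 0ℚ ≤ a * b
  _⊛_ {a} {b} p q = nonNegative⁻¹ (a * b) {{nonNeg*nonNeg⇒nonNeg a {{nonNegative p}} b {{nonNegative q}}}}

  infixl 7 _⊛<_
  _⊛<_ : ∀ {a b} → 0ℚ < a → 0ℚ < b → 0ℚ < a * b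
  _⊛<_ {a} {b} p q = positive⁻¹ (a * b) {{pos*pos⇒pos a {{positive p}} b {{positive q}}}}

  _⊕<_ : ∀ {a b} → 0ℚ < a → 0ℚ ≤ b → 0ℚ < a + b
  _⊕<_ = +-mono-<-≤

  *-mono : ∀ {a b c d} → 0ℚ ≤ a → 0ℚ ≤ c → a ≤ b → c ≤ d → a * c ≤ b * d
  *-mono {a} {b} {c} {d} 0≤a 0≤c a≤b c≤d = ≤-trans
    (*-monoˡ-≤-nonNeg a {{nonNegative 0≤a}} c≤d)
    (*-monoʳ-≤-nonNeg d {{nonNegative (≤-trans 0≤c c≤d)}} a≤b)

  *-monoˡ : ∀ {a c d} → 0ℚ ≤ a → c ≤ d → a * c ≤ a * d
  *-monoˡ {a} h = *-monoˡ-≤-nonNeg a {{nonNegative h}}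

  *-monoʳ : ∀ {a b c} → 0ℚ ≤ c → a ≤ b → a * c ≤ b * c
  *-monoʳ {c = c} h = *-monoʳ-≤-nonNeg c {{nonNegative h}}

  *-cancel : ∀ {a b c} → 0ℚ < c → a * c ≤ b * c → a ≤ b
  *-cancel {c = c} h = *-cancelʳ-≤-pos c {{positive h}}

  0≤1 : 0ℚ ≤ 1ℚ
  0≤1 = nonNegative⁻¹ 1ℚ

  0<1 : 0ℚ < 1ℚ
  0<1 = positive⁻¹ 1ℚ

  ι-mono : ∀ {m n} → m ℕ.≤ n → ι m ≤ ι n
  ι-mono {m} {n} h = by-diff (ι (n ℕ.∸ m)) (0≤ι _)
    (trans (cong (λ k → ι k - ι m) (sym (ℕ.m+[n∸m]≡n h)))
    (trans (cong (_- ι m) (ι-+ m (n ℕ.∸ m))) (e (ι m) (ι (n ℕ.∸ m)))))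
    where e : ∀ a b → a + b - a ≡ b
          e = solve-∀ ℚ-ring

  infixr 8 _^_
  _^_ : ℚ → ℕ → ℚ
  x ^ zero  = 1ℚ
  x ^ suc n = x * x ^ n

  0≤^ : ∀ {x} n → 0ℚ ≤ x → 0ℚ ≤ x ^ n
  0≤^ zero    h = 0≤1
  0≤^ (suc n) h = h ⊛ 0≤^ n h

  0<^ : ∀ {x} n → 0ℚ < x → 0ℚ < x ^ n
  0<^ zero    h = 0<1
  0<^ (suc n) h = h ⊛< 0<^ n h

  ^-mono : ∀ {x y} n → 0ℚ ≤ x → x ≤ y → x ^ n ≤ y ^ n
  ^-mono zero    h l = ≤-refl
  ^-mono (suc n) h l = *-mono h (0≤^ n h) l (^-mono n h l)

  ^-+ : ∀ x m n → x ^ (m ℕ.+ n) ≡ x ^ m * x ^ n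
  ^-+ x zero    n = sym (*-identityˡ _)
  ^-+ x (suc m) n = trans (cong (x *_) (^-+ x m n)) (sym (*-assoc x _ _))

  1^ : ∀ n → 1ℚ ^ n ≡ 1ℚ
  1^ zero    = refl
  1^ (suc n) = trans (*-identityˡ _) (1^ n)

  *-^ : ∀ x y n → (x * y) ^ n ≡ x ^ n * y ^ n
  *-^ x y zero    = refl
  *-^ x y (suc n) = trans (cong (x * y *_) (*-^ x y n)) (e x y (x ^ n) (y ^ n))
    where e : ∀ a b c d → a * b * (c * d) ≡ a * c * (b * d)
          e = solve-∀ ℚ-ring

  ^-* : ∀ x m n → x ^ (m ℕ.* n) ≡ (x ^ n) ^ m
  ^-* x zero    n = refl
  ^-* x (suc m) n = trans (^-+ x n (m ℕ.* n)) (cong (x ^ n *_) (^-* x m n))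

  ^≤1 : ∀ {x} n → 0ℚ ≤ x → x ≤ 1ℚ → x ^ n ≤ 1ℚ
  ^≤1 {x} n h l = subst (x ^ n ≤_) (1^ n) (^-mono n h l)

  1≤^ : ∀ {x} n → 1ℚ ≤ x → 1ℚ ≤ x ^ n
  1≤^ {x} n l = subst (_≤ x ^ n) (1^ n) (^-mono n 0≤1 l)

  ^-antitone : ∀ {x m n} → 0ℚ ≤ x → x ≤ 1ℚ → m ℕ.≤ n → x ^ n ≤ x ^ m
  ^-antitone {x} {m} {n} h l m≤n = subst₂ _≤_
    (trans (sym (^-+ x m (n ℕ.∸ m))) (cong (x ^_) (ℕ.m+[n∸m]≡n m≤n))) (*-identityʳ _)
    (*-monoˡ (0≤^ m h) (^≤1 (n ℕ.∸ m) h l))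

  ^-monotone : ∀ {x m n} → 1ℚ ≤ x → m ℕ.≤ n → x ^ m ≤ x ^ n
  ^-monotone {x} {m} {n} l m≤n = subst₂ _≤_ (*-identityʳ _)
    (trans (sym (^-+ x m (n ℕ.∸ m))) (cong (x ^_) (ℕ.m+[n∸m]≡n m≤n)))
    (*-monoˡ (0≤^ m (≤-trans 0≤1 l)) (1≤^ (n ℕ.∸ m) l))

  bernoulli : ∀ n {x} → 0ℚ ≤ x → 1ℚ + ι n * x ≤ (1ℚ + x) ^ n
  bernoulli zero {x} h = ≤-reflexive (trans (cong (λ z → 1ℚ + z * x) ι-0) (trans (cong (λ z → 1ℚ + z) (*-zeroˡ x)) (+-identityʳ 1ℚ)))
  bernoulli (suc n) {x} h = begin
    1ℚ + ι (suc n) * x           ≡⟨ cong (λ z → 1ℚ + z * x) (ι-suc n) ⟩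
    1ℚ + (1ℚ + ι n) * x          ≤⟨ by-diff (ι n * (x * x)) (0≤ι n ⊛ (h ⊛ h)) (e (ι n) x) ⟩
    (1ℚ + x) * (1ℚ + ι n * x)    ≤⟨ *-monoˡ (0≤1 ⊕ h) (bernoulli n h) ⟩
    (1ℚ + x) * (1ℚ + x) ^ n      ∎
    where
    open ≤-Reasoning
    e : ∀ n x → (1ℚ + x) * (1ℚ + n * x) - (1ℚ + (1ℚ + n) * x) ≡ n * (x * x)
    e = solve-∀ ℚ-ring

  -- The division-free form of (1 + x)^n ≤ 1/(1 - n x). Each step uses (1 + x)(1 - (n + 1) x) = 1 -
  -- n x - (n + 1) x².
  bernoulli-inv : ∀ n {x} → 0ℚ ≤ x → (1ℚ + x) ^ n * (1ℚ - ι n * x) ≤ 1ℚ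
  bernoulli-inv zero {x} h = ≤-reflexive (trans (cong (λ z → 1ℚ * (1ℚ - z * x)) ι-0) (cong (λ z → 1ℚ * (1ℚ - z)) (*-zeroˡ x)))
  bernoulli-inv (suc n) {x} h = begin
    (1ℚ + x) * (1ℚ + x) ^ n * (1ℚ - ι (suc n) * x)  ≡⟨ cong (λ z → (1ℚ + x) * (1ℚ + x) ^ n * (1ℚ - z * x)) (ι-suc n) ⟩
    (1ℚ + x) * (1ℚ + x) ^ n * (1ℚ - (1ℚ + ι n) * x)
      ≤⟨ by-diff ((1ℚ + x) ^ n * ((1ℚ + ι n) * (x * x))) (0≤^ n (0≤1 ⊕ h) ⊛ ((0≤1 ⊕ 0≤ι n) ⊛ (h ⊛ h))) (e ((1ℚ + x) ^ n) (ι n) x) ⟩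
    (1ℚ + x) ^ n * (1ℚ - ι n * x)                   ≤⟨ bernoulli-inv n h ⟩
    1ℚ                                              ∎
    where
    open ≤-Reasoning
    e : ∀ p n x → p * (1ℚ - n * x) - (1ℚ + x) * p * (1ℚ - (1ℚ + n) * x) ≡ p * ((1ℚ + n) * (x * x))
    e = solve-∀ ℚ-ring

-- Finite means and the cone of nonnegative Fourier coefficients

module Fourier where
  open Rationals
  open import Data.Bool.Base using (Bool; true; false; not)
  open import Data.Fin.Base using (Fin; zero; suc)
  open import Data.List.Base using ([]; _∷_)
  open import Data.Rational
  open import Data.Rational.Properties
  open import Data.Unit.Base using (⊤; tt)
  open import Data.Vec.Base using (Vec; []; _∷_; lookup)

  -- A mean 𝔼 on functions together with a cone Pos playing the role of the functions
  -- with nonnegative Fourier coefficients.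
  record Space (X : Set) : Set₁ where
    field
      𝔼        : (X → ℚ) → ℚ
      𝔼-cong   : ∀ {f g} → (∀ x → f x ≡ g x) → 𝔼 f ≡ 𝔼 g
      𝔼-+      : ∀ f g → 𝔼 (λ x → f x + g x) ≡ 𝔼 f + 𝔼 g
      𝔼-*      : ∀ c f → 𝔼 (λ x → c * f x) ≡ c * 𝔼 f
      𝔼-one    : 𝔼 (λ _ → 1ℚ) ≡ 1ℚ
      𝔼-nonneg : ∀ {f} → (∀ x → 0ℚ ≤ f x) → 0ℚ ≤ 𝔼 f
      Pos      : (X → ℚ) → Set
      Pos-cong : ∀ {f g} → (∀ x → f x ≡ g x) → Pos f → Pos g
      Pos-+    : ∀ {f g} → Pos f → Pos g → Pos (λ x → f x + g x)
      Pos-*    : ∀ {f g} → Pos f → Pos g → Pos (λ x → f x * g x)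
      Pos-const : ∀ {c} → 0ℚ ≤ c → Pos (λ _ → c)
      Pos⇒0≤𝔼  : ∀ {f} → Pos f → 0ℚ ≤ 𝔼 f

  module Ops {X : Set} (S : Space X) where
    open Space S public

    𝔼-const : ∀ c → 𝔼 (λ _ → c) ≡ c
    𝔼-const c = trans (𝔼-cong λ _ → sym (*-identityʳ c))
      (trans (𝔼-* c (λ _ → 1ℚ)) (trans (cong (c *_) 𝔼-one) (*-identityʳ c)))

    𝔼-neg : ∀ f → 𝔼 (λ x → - f x) ≡ - 𝔼 f
    𝔼-neg f = trans (𝔼-cong λ x → e (f x)) (trans (𝔼-* (- 1ℚ) f) (sym (e (𝔼 f))))
      where e : ∀ a → - a ≡ - 1ℚ * a
            e = solve-∀ ℚ-ring

    𝔼-- : ∀ f g → 𝔼 (λ x → f x - g x) ≡ 𝔼 f - 𝔼 g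
    𝔼-- f g = trans (𝔼-+ f (λ x → - g x)) (cong (𝔼 f +_) (𝔼-neg g))

    𝔼-mono : ∀ {f g} → (∀ x → f x ≤ g x) → 𝔼 f ≤ 𝔼 g
    𝔼-mono {f} {g} h = sub⁻ (subst (0ℚ ≤_) (𝔼-- g f) (𝔼-nonneg λ x → sub⁺ (h x)))

    infix 4 _≼_ _◁_
    -- The order coefficient by coefficient, not value by value. It bounds means because the mean is
    -- the constant coefficient, and products of elements of the cone respect it.
    record _≼_ (f g : X → ℚ) : Set where
      constructor mk≼
      field diff : Pos (λ x → g x - f x)
    open _≼_ public

    -- Encodes |f| ≤ g for each Fourier coefficient without naming coefficients. It is needed for
    -- factors such as 1 - τ ζ, which lie outside the cone.
    record _◁_ (f g : X → ℚ) : Set where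
      constructor mk◁
      field below : Pos (λ x → g x - f x)
            above : Pos (λ x → g x + f x)
    open _◁_ public

    Pos-scale : ∀ {c f} → 0ℚ ≤ c → Pos f → Pos (λ x → c * f x)
    Pos-scale h = Pos-* (Pos-const h)

    Pos-zero : Pos (λ _ → 0ℚ)
    Pos-zero = Pos-const ≤-refl

    Pos-mono : ∀ {f g} → Pos f → f ≼ g → Pos g
    Pos-mono {f} {g} p q = Pos-cong (λ x → e (f x) (g x)) (Pos-+ p (diff q))
      where e : ∀ a b → a + (b - a) ≡ b
            e = solve-∀ ℚ-ring

    ≼⇒𝔼≤ : ∀ {f g} → f ≼ g → 𝔼 f ≤ 𝔼 g
    ≼⇒𝔼≤ {f} {g} h = sub⁻ (subst (0ℚ ≤_) (𝔼-- g f) (Pos⇒0≤𝔼 (diff h)))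

    ≼-reflexive : ∀ {f g} → (∀ x → f x ≡ g x) → f ≼ g
    ≼-reflexive {f} {g} h = mk≼ (Pos-cong (λ x → sym (trans (cong (λ z → z - f x) (sym (h x))) (+-inverseʳ (f x)))) Pos-zero)

    ≼-refl : ∀ {f} → f ≼ f
    ≼-refl = ≼-reflexive λ _ → refl

    ≼-cong : ∀ {f f′ g g′} → (∀ x → f x ≡ f′ x) → (∀ x → g x ≡ g′ x) → f ≼ g → f′ ≼ g′
    ≼-cong p q h = mk≼ (Pos-cong (λ x → cong₂ _-_ (q x) (p x)) (diff h))

    ≼-trans : ∀ {f g h} → f ≼ g → g ≼ h → f ≼ h
    ≼-trans {f} {g} {h} p q = mk≼ (Pos-cong (λ x → e (f x) (g x) (h x)) (Pos-+ (diff p) (diff q)))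
      where e : ∀ a b c → b - a + (c - b) ≡ c - a
            e = solve-∀ ℚ-ring

    ≼-+ : ∀ {f g f′ g′} → f ≼ g → f′ ≼ g′ → (λ x → f x + f′ x) ≼ (λ x → g x + g′ x)
    ≼-+ {f} {g} {f′} {g′} p q = mk≼ (Pos-cong (λ x → e (f x) (g x) (f′ x) (g′ x)) (Pos-+ (diff p) (diff q)))
      where e : ∀ a b c d → b - a + (d - c) ≡ b + d - (a + c)
            e = solve-∀ ℚ-ring

    ≼-* : ∀ {f g f′ g′} → Pos f → Pos f′ → f ≼ g → f′ ≼ g′ → (λ x → f x * f′ x) ≼ (λ x → g x * g′ x)
    ≼-* {f} {g} {f′} {g′} p p′ q q′ = mk≼ (Pos-cong (λ x → e (f x) (g x) (f′ x) (g′ x))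
      (Pos-+ (Pos-* (diff q) (Pos-mono p′ q′)) (Pos-* p (diff q′))))
      where e : ∀ a b c d → (b - a) * d + a * (d - c) ≡ b * d - a * c
            e = solve-∀ ℚ-ring

    ◁⇒≼ : ∀ {f g} → f ◁ g → f ≼ g
    ◁⇒≼ h = mk≼ (below h)

    ◁⇒𝔼≤ : ∀ {f g} → f ◁ g → 𝔼 f ≤ 𝔼 g
    ◁⇒𝔼≤ h = ≼⇒𝔼≤ (◁⇒≼ h)

    ≼⇒◁ : ∀ {f g} → Pos f → f ≼ g → f ◁ g
    ≼⇒◁ p q = mk◁ (diff q) (Pos-+ (Pos-mono p q) p)

    Pos⇒◁ : ∀ {f} → Pos f → f ◁ f
    Pos⇒◁ p = ≼⇒◁ p ≼-refl

    ◁-cong : ∀ {f f′ g g′} → (∀ x → f x ≡ f′ x) → (∀ x → g x ≡ g′ x) → f ◁ g → f′ ◁ g′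
    ◁-cong p q h = mk◁ (Pos-cong (λ x → cong₂ _-_ (q x) (p x)) (below h)) (Pos-cong (λ x → cong₂ _+_ (q x) (p x)) (above h))

    ◁-one : (λ _ → 1ℚ) ◁ (λ _ → 1ℚ)
    ◁-one = Pos⇒◁ (Pos-const 0≤1)

    ◁-neg : ∀ {f g} → f ◁ g → (λ x → - f x) ◁ g
    ◁-neg {f} {g} h = mk◁ (Pos-cong (λ x → e (f x) (g x)) (above h)) (below h)
      where e : ∀ a b → b + a ≡ b - (- a)
            e = solve-∀ ℚ-ring

    ◁-+ : ∀ {f g f′ g′} → f ◁ g → f′ ◁ g′ → (λ x → f x + f′ x) ◁ (λ x → g x + g′ x)
    ◁-+ {f} {g} {f′} {g′} p q = mk◁ (diff (≼-+ (◁⇒≼ p) (◁⇒≼ q)))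
      (Pos-cong (λ x → e (f x) (g x) (f′ x) (g′ x)) (Pos-+ (above p) (above q)))
      where e : ∀ a b c d → b + a + (d + c) ≡ b + d + (a + c)
            e = solve-∀ ℚ-ring

    -- The two polarisation identities write g g′ - f f′ and g g′ + f f′ as half sums of products of
    -- the four cone elements g ± f and g′ ± f′.
    ◁-* : ∀ {f g f′ g′} → f ◁ g → f′ ◁ g′ → (λ x → f x * f′ x) ◁ (λ x → g x * g′ x)
    ◁-* {f} {g} {f′} {g′} p q = mk◁
      (Pos-cong (λ x → e₁ (f x) (g x) (f′ x) (g′ x)) (Pos-scale (nonNegative⁻¹ ½) (Pos-+ (Pos-* (below p) (above q)) (Pos-* (above p) (below q)))))
      (Pos-cong (λ x → e₂ (f x) (g x) (f′ x) (g′ x)) (Pos-scale (nonNegative⁻¹ ½) (Pos-+ (Pos-* (below p) (below q)) (Pos-* (above p) (above q)))))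
      where e₁ : ∀ a b c d → ½ * ((b - a) * (d + c) + (b + a) * (d - c)) ≡ b * d - a * c
            e₁ = solve-∀ ℚ-ring
            e₂ : ∀ a b c d → ½ * ((b - a) * (d - c) + (b + a) * (d + c)) ≡ b * d + a * c
            e₂ = solve-∀ ℚ-ring

    ◁-≼ : ∀ {f g h} → f ◁ g → g ≼ h → f ◁ h
    ◁-≼ {f} {g} {h} p r = mk◁ (diff (≼-trans (◁⇒≼ p) r)) (Pos-cong (λ x → e (f x) (g x) (h x)) (Pos-+ (above p) (diff r)))
      where e : ∀ a b c → b + a + (c - b) ≡ c + a
            e = solve-∀ ℚ-ring

  open Ops

  unit : Space ⊤
  unit = record
    { 𝔼        = λ f → f tt
    ; 𝔼-cong   = λ h → h tt
    ; 𝔼-+      = λ f g → refl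
    ; 𝔼-*      = λ c f → refl
    ; 𝔼-one    = refl
    ; 𝔼-nonneg = λ h → h tt
    ; Pos      = λ f → 0ℚ ≤ f tt
    ; Pos-cong = λ h → subst (0ℚ ≤_) (h tt)
    ; Pos-+    = _⊕_
    ; Pos-*    = _⊛_
    ; Pos-const = λ h → h
    ; Pos⇒0≤𝔼  = λ h → h
    }

  -- The two conditions of `Pos` say that the two Fourier coefficients of a function of one sign,
  -- each doubled, are nonnegative; closure under products is the convolution rule for them.
  sign : Space Bool
  sign = record
    { 𝔼        = λ f → ½ * (f true + f false)
    ; 𝔼-cong   = λ h → cong (½ *_) (cong₂ _+_ (h true) (h false))
    ; 𝔼-+      = λ f g → e₁ (f true) (g true) (f false) (g false)
    ; 𝔼-*      = λ c f → e₂ c (f true) (f false)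
    ; 𝔼-one    = refl
    ; 𝔼-nonneg = λ h → nonNegative⁻¹ ½ ⊛ (h true ⊕ h false)
    ; Pos      = λ f → 0ℚ ≤ f true + f false × 0ℚ ≤ f true - f false
    ; Pos-cong = λ h (p , q) → subst (0ℚ ≤_) (cong₂ _+_ (h true) (h false)) p , subst (0ℚ ≤_) (cong₂ _-_ (h true) (h false)) q
    ; Pos-+    = λ {f} {g} (p , q) (p′ , q′) → subst (0ℚ ≤_) (e₃ (f true) (f false) (g true) (g false)) (p ⊕ p′) , subst (0ℚ ≤_) (e₄ (f true) (f false) (g true) (g false)) (q ⊕ q′)
    ; Pos-*    = λ {f} {g} (p , q) (p′ , q′) → subst (0ℚ ≤_) (e₅ (f true) (f false) (g true) (g false)) (nonNegative⁻¹ ½ ⊛ (p ⊛ p′ ⊕ q ⊛ q′)) , subst (0ℚ ≤_) (e₆ (f true) (f false) (g true) (g false)) (nonNegative⁻¹ ½ ⊛ (p ⊛ q′ ⊕ q ⊛ p′))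
    ; Pos-const = λ {c} h → h ⊕ h , ≤-reflexive (sym (+-inverseʳ c))
    ; Pos⇒0≤𝔼  = λ (p , q) → nonNegative⁻¹ ½ ⊛ p
    }
    where
    e₁ : ∀ a b c d → ½ * (a + b + (c + d)) ≡ ½ * (a + c) + ½ * (b + d)
    e₁ = solve-∀ ℚ-ring
    e₂ : ∀ c a b → ½ * (c * a + c * b) ≡ c * (½ * (a + b))
    e₂ = solve-∀ ℚ-ring
    e₃ : ∀ a b c d → a + b + (c + d) ≡ a + c + (b + d)
    e₃ = solve-∀ ℚ-ring
    e₄ : ∀ a b c d → a - b + (c - d) ≡ a + c - (b + d)
    e₄ = solve-∀ ℚ-ring
    e₅ : ∀ a b c d → ½ * ((a + b) * (c + d) + (a - b) * (c - d)) ≡ a * c + b * d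
    e₅ = solve-∀ ℚ-ring
    e₆ : ∀ a b c d → ½ * ((a + b) * (c - d) + (a - b) * (c + d)) ≡ a * c - b * d
    e₆ = solve-∀ ℚ-ring

  module _ {X Y : Set} (S : Space X) (T : Space Y) where
    -- The cone on a product is generated by products of cone elements. As an inductive type it is
    -- closed under products by recursion on the derivations, with no expansion into characters.
    data Tensor : (X × Y → ℚ) → Set where
      tensor : ∀ {f g h} → Pos S f → Pos T g → (∀ x y → h (x , y) ≡ f x * g y) → Tensor h
      plus   : ∀ {f g h} → Tensor f → Tensor g → (∀ z → h z ≡ f z + g z) → Tensor h

    private
      mult : ∀ {f g} → Tensor f → Tensor g → Tensor (λ z → f z * g z)
      mult (tensor {a} {b} p q e) (tensor {a′} {b′} p′ q′ e′) =
        tensor (Pos-* S p p′) (Pos-* T q q′) λ x y → trans (cong₂ _*_ (e x y) (e′ x y)) (r (a x) (b y) (a′ x) (b′ y))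
        where r : ∀ a b c d → a * b * (c * d) ≡ a * c * (b * d)
              r = solve-∀ ℚ-ring
      mult {f} {g} (plus {a} {b} u v e) w = plus (mult u w) (mult v w) λ z → trans (cong (_* g z) (e z)) (*-distribʳ-+ (g z) (a z) (b z))
      mult {f} {g} u@(tensor _ _ _) (plus {a} {b} v w e) = plus (mult u v) (mult u w) λ z → trans (cong (f z *_) (e z)) (*-distribˡ-+ (f z) (a z) (b z))

      E : (X × Y → ℚ) → ℚ
      E f = 𝔼 S λ x → 𝔼 T λ y → f (x , y)

      E-+ : ∀ f g → E (λ x → f x + g x) ≡ E f + E g
      E-+ f g = trans (𝔼-cong S λ x → 𝔼-+ T _ _) (𝔼-+ S _ _)

    E-⊗ : ∀ f g → E (λ z → f (proj₁ z) * g (proj₂ z)) ≡ 𝔼 S f * 𝔼 T g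
    E-⊗ f g = trans (𝔼-cong S λ x → trans (𝔼-* T (f x) g) (*-comm (f x) (𝔼 T g))) (trans (𝔼-* S (𝔼 T g) f) (*-comm (𝔼 T g) (𝔼 S f)))

    private
      nonneg : ∀ {f} → Tensor f → 0ℚ ≤ E f
      nonneg (tensor {f} {g} {h} p q e) = subst (0ℚ ≤_)
        (sym (trans (𝔼-cong S λ x → 𝔼-cong T λ y → e x y) (E-⊗ f g))) (Pos⇒0≤𝔼 S p ⊛ Pos⇒0≤𝔼 T q)
      nonneg (plus {f} {g} u v e) = subst (0ℚ ≤_)
        (sym (trans (𝔼-cong S λ x → 𝔼-cong T λ y → e (x , y)) (E-+ f g))) (nonneg u ⊕ nonneg v)

      respects : ∀ {f g} → (∀ x → f x ≡ g x) → Tensor f → Tensor g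
      respects h (tensor p q e) = tensor p q λ x y → trans (sym (h (x , y))) (e x y)
      respects h (plus u v e)   = plus u v λ z → trans (sym (h z)) (e z)

    infixr 6 _⊗_
    _⊗_ : Space (X × Y)
    _⊗_ = record
      { 𝔼        = E
      ; 𝔼-cong   = λ h → 𝔼-cong S λ x → 𝔼-cong T λ y → h (x , y)
      ; 𝔼-+      = E-+
      ; 𝔼-*      = λ c f → trans (𝔼-cong S λ x → 𝔼-* T c _) (𝔼-* S c _)
      ; 𝔼-one    = trans (𝔼-cong S λ x → 𝔼-one T) (𝔼-one S)
      ; 𝔼-nonneg = λ h → 𝔼-nonneg S λ x → 𝔼-nonneg T λ y → h (x , y)
      ; Pos      = Tensor
      ; Pos-cong = respects
      ; Pos-+    = λ u v → plus u v λ _ → refl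
      ; Pos-*    = mult
      ; Pos-const = λ {c} h → tensor (Pos-const S h) (Pos-const T 0≤1) λ _ _ → sym (*-identityʳ c)
      ; Pos⇒0≤𝔼  = nonneg
      }

  push : ∀ {X Y} → (Y → X) → Space Y → Space X
  push k S = record
    { 𝔼        = λ f → 𝔼 S λ y → f (k y)
    ; 𝔼-cong   = λ h → 𝔼-cong S λ y → h (k y)
    ; 𝔼-+      = λ f g → 𝔼-+ S _ _
    ; 𝔼-*      = λ c f → 𝔼-* S c _
    ; 𝔼-one    = 𝔼-one S
    ; 𝔼-nonneg = λ h → 𝔼-nonneg S λ y → h (k y)
    ; Pos      = λ f → Pos S λ y → f (k y)
    ; Pos-cong = λ h → Pos-cong S λ y → h (k y)
    ; Pos-+    = Pos-+ S
    ; Pos-*    = Pos-* S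
    ; Pos-const = Pos-const S
    ; Pos⇒0≤𝔼  = Pos⇒0≤𝔼 S
    }

  cons : ∀ {X : Set} {n} → X × Vec X n → Vec X (suc n)
  cons (x , xs) = x ∷ xs

  power : ∀ {X} → Space X → ∀ n → Space (Vec X n)
  power S zero    = push (λ _ → []) unit
  power S (suc n) = push cons (S ⊗ power S n)

  ∏ : ∀ {X : Set} {n} → (X → ℚ) → Vec X n → ℚ
  ∏ f []       = 1ℚ
  ∏ f (x ∷ xs) = f x * ∏ f xs

  ∏-* : ∀ {X : Set} {n} f g (xs : Vec X n) → ∏ (λ x → f x * g x) xs ≡ ∏ f xs * ∏ g xs
  ∏-* f g []       = refl
  ∏-* f g (x ∷ xs) = trans (cong (f x * g x *_) (∏-* f g xs)) (e (f x) (g x) (∏ f xs) (∏ g xs))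
    where e : ∀ a b c d → a * b * (c * d) ≡ a * c * (b * d)
          e = solve-∀ ℚ-ring

  𝔼-∏ : ∀ {X} (S : Space X) n f → 𝔼 (power S n) (∏ f) ≡ 𝔼 S f ^ n
  𝔼-∏ S zero    f = refl
  𝔼-∏ S (suc n) f = trans (E-⊗ S (power S n) f (∏ f)) (cong (𝔼 S f *_) (𝔼-∏ S n f))

  Pos-∏ : ∀ {X} (S : Space X) n {f} → Pos S f → Pos (power S n) (∏ f)
  Pos-∏ S zero    p = 0≤1
  Pos-∏ S (suc n) p = tensor p (Pos-∏ S n p) λ _ _ → refl

  module _ {X Y : Set} (S : Space X) (T : Space Y) where
    open Ops

    Pos-left : ∀ {f} → Pos S f → Pos (S ⊗ T) (λ z → f (proj₁ z))
    Pos-left {f} p = tensor {f = f} {g = λ _ → 1ℚ} p (Pos-const T 0≤1) λ x y → sym (*-identityʳ (f x))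

    Pos-right : ∀ {f} → Pos T f → Pos (S ⊗ T) (λ z → f (proj₂ z))
    Pos-right {f} p = tensor {f = λ _ → 1ℚ} {g = f} (Pos-const S 0≤1) p λ x y → sym (*-identityˡ (f y))

    ◁-left : ∀ {f g} → _◁_ S f g → _◁_ (S ⊗ T) (λ z → f (proj₁ z)) (λ z → g (proj₁ z))
    ◁-left h = mk◁ (Pos-left (below h)) (Pos-left (above h))

    ◁-right : ∀ {f g} → _◁_ T f g → _◁_ (S ⊗ T) (λ z → f (proj₂ z)) (λ z → g (proj₂ z))
    ◁-right h = mk◁ (Pos-right (below h)) (Pos-right (above h))

  ◁-∏ : ∀ {X} (S : Space X) n {f g} → Ops._◁_ S f g → Ops._◁_ (power S n) (∏ f) (∏ g)
  ◁-∏ S zero    h = Ops.mk◁ ≤-refl (0≤1 ⊕ 0≤1)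
  ◁-∏ S (suc n) {f} {g} h = Ops.mk◁ (Ops.below p) (Ops.above p)
    where
    p : Ops._◁_ (S ⊗ power S n) (λ z → f (proj₁ z) * ∏ f (proj₂ z)) (λ z → g (proj₁ z) * ∏ g (proj₂ z))
    p = Ops.◁-* (S ⊗ power S n) (◁-left S (power S n) h) (◁-right S (power S n) (◁-∏ S n h))

  -- Stronger than domination of the two products, since the constant 2 is taken off. Passing to one
  -- more coordinate adds g ∏ (1 + g) + f ∏ (1 + f), and the second summand is dominated by the
  -- first. With f = - τ ζ this compares 1 - p D with its bound in `Blue-dominated`, where p times
  -- this function is exactly the difference.
  Pos-∏-2 : ∀ {X} (S : Space X) n {f g} → Ops._◁_ S f g →
    Ops.Pos (power S n) (λ x → ∏ (λ v → 1ℚ + g v) x + ∏ (λ v → 1ℚ + f v) x - (1ℚ + 1ℚ))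
  Pos-∏-2 S zero h = ≤-refl
  Pos-∏-2 S (suc n) {f} {g} h = Pos-cong (S ⊗ power S n) (λ z → e (f (proj₁ z)) (g (proj₁ z)) (∏ f′ (proj₂ z)) (∏ g′ (proj₂ z)))
    (Pos-+ (S ⊗ power S n) (Pos-right S (power S n) (Pos-∏-2 S n h))
      (above (◁-* (S ⊗ power S n) (◁-left S (power S n) h) (◁-right S (power S n)
        (◁-∏ S n (◁-+ S (◁-one S) h))))))
    where
    open Ops
    f′ = λ v → 1ℚ + f v
    g′ = λ v → 1ℚ + g v
    e : ∀ f g a b → b + a - (1ℚ + 1ℚ) + (g * b + f * a) ≡ (1ℚ + g) * b + (1ℚ + f) * a - (1ℚ + 1ℚ)
    e = solve-∀ ℚ-ring

  Pos-lookup : ∀ {X} (S : Space X) {n f} → Pos S f → ∀ i → Pos (power S n) (λ v → f (lookup v i))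
  Pos-lookup S {suc n} {f} p zero    = tensor {f = f} {g = λ _ → 1ℚ} p (Pos-const (power S n) 0≤1) λ x y → sym (*-identityʳ (f x))
  Pos-lookup S {suc n} {f} p (suc i) = tensor {f = λ _ → 1ℚ} {g = λ v → f (lookup v i)} (Pos-const S 0≤1) (Pos-lookup S p i) λ x v → sym (*-identityˡ (f (lookup v i)))

  cube : ∀ n → Space (Vec Bool n)
  cube = power sign

  sgn : Bool → ℚ
  sgn true  = 1ℚ
  sgn false = - 1ℚ

  sgn² : ∀ b → sgn b * sgn b ≡ 1ℚ
  sgn² true  = refl
  sgn² false = refl

  χ : ∀ {n} → Fin n → Vec Bool n → ℚ
  χ i v = sgn (lookup v i)

  Pos-χ : ∀ {n} (i : Fin n) → Pos (cube n) (χ i)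
  Pos-χ i = Pos-lookup sign {f = sgn} (≤-refl , nonNegative⁻¹ (+ 2 / 1)) i
    where open import Data.Integer.Base using (+_)

  flip : ∀ {n} → Fin n → Vec Bool n → Vec Bool n
  flip zero    (b ∷ v) = not b ∷ v
  flip (suc i) (b ∷ v) = b ∷ flip i v

  𝔼-flip : ∀ {n} (i : Fin n) f → 𝔼 (cube n) (λ v → f (flip i v)) ≡ 𝔼 (cube n) f
  𝔼-flip {suc n} zero    f = cong (½ *_) (+-comm (𝔼 (cube n) (λ v → f (false ∷ v))) (𝔼 (cube n) (λ v → f (true ∷ v))))
  𝔼-flip (suc i) f = cong (½ *_) (cong₂ _+_ (𝔼-flip i (λ v → f (true ∷ v))) (𝔼-flip i (λ v → f (false ∷ v))))

  χ-flip : ∀ {n} (i : Fin n) v → χ i (flip i v) ≡ - χ i v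
  χ-flip zero    (true ∷ v)  = refl
  χ-flip zero    (false ∷ v) = refl
  χ-flip (suc i) (b ∷ v)     = χ-flip i v

  χ-flip-≢ : ∀ {n} {i j : Fin n} → i ≢ j → ∀ v → χ j (flip i v) ≡ χ j v
  χ-flip-≢ {i = zero}  {zero}  h v = contradiction refl h
    where open import Relation.Nullary
  χ-flip-≢ {i = zero}  {suc j} h (b ∷ v) = refl
  χ-flip-≢ {i = suc i} {zero}  h (b ∷ v) = refl
  χ-flip-≢ {i = suc i} {suc j} h (b ∷ v) = χ-flip-≢ (λ e → h (cong suc e)) v

  -- Flipping sign `i` preserves the mean and negates the integrand, so the mean is its own
  -- negative. This takes the place of orthogonality of characters.
  𝔼-odd : ∀ {n} (i : Fin n) {f : Vec Bool n → ℚ} → (∀ v → f (flip i v) ≡ f v) → 𝔼 (cube n) (λ v → χ i v * f v) ≡ 0ℚ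
  𝔼-odd {n} i {f} h = x≡-x⇒x≡0 (𝔼 (cube n) λ v → χ i v * f v) (trans (sym (𝔼-flip i (λ v → χ i v * f v)))
    (trans (𝔼-cong (cube n) λ v → trans (cong₂ _*_ (χ-flip i v) (h v)) (sym (neg-distribˡ-* (χ i v) (f v))))
           (𝔼-neg (cube n) (λ v → χ i v * f v))))
    where
    e : ∀ x → x ≡ ½ * (x + x)
    e = solve-∀ ℚ-ring
    x≡-x⇒x≡0 : ∀ x → x ≡ - x → x ≡ 0ℚ
    x≡-x⇒x≡0 x p = trans (e x) (trans (cong (λ y → ½ * (x + y)) p) (trans (cong (½ *_) (+-inverseʳ x)) refl))

-- Expansion of edge products and moments of the quadratic form y

module Spins where
  open Rationals
  open Fourier
  open import Data.Bool.Base using (Bool)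
  open import Data.Fin.Base using (Fin; suc)
  open import Data.Integer.Base using (+_)
  open import Data.List.Base using (List; []; _∷_; map; length; _++_)
  open import Data.List.Properties using (length-++; length-map)
  open import Data.List.Relation.Unary.All using (All; []; _∷_)
  open import Data.List.Relation.Unary.AllPairs.Core using ([]; _∷_)
  open import Data.List.Relation.Unary.Unique.Propositional using (Unique)
  open import Data.List.Relation.Binary.Pointwise.Base using (Pointwise; []; _∷_)
  open import Data.Rational
  open import Data.Rational.Properties
  open import Data.Vec.Base using (Vec; lookup)

  module _ {X : Set} where

    scale : ℚ → (X → ℚ) → X → ℚ
    scale c f x = c * f x

    -- Π is the product of the factors 1 + f; σ₁, σ₂, σ₃ are its terms of degree 1, 2, 3
    -- in the f's, and ρ collects the terms of degree at least 4.
    Π σ₁ σ₂ σ₃ ρ : List (X → ℚ) → X → ℚ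
    Π []       x = 1ℚ
    Π (f ∷ fs) x = (1ℚ + f x) * Π fs x
    σ₁ []       x = 0ℚ
    σ₁ (f ∷ fs) x = f x + σ₁ fs x
    σ₂ []       x = 0ℚ
    σ₂ (f ∷ fs) x = f x * σ₁ fs x + σ₂ fs x
    σ₃ []       x = 0ℚ
    σ₃ (f ∷ fs) x = f x * σ₂ fs x + σ₃ fs x
    ρ []       x = 0ℚ
    ρ (f ∷ fs) x = f x * (σ₃ fs x + ρ fs x) + ρ fs x

    Π-expand : ∀ fs x → Π fs x ≡ 1ℚ + σ₁ fs x + σ₂ fs x + σ₃ fs x + ρ fs x
    Π-expand []       x = refl
    Π-expand (f ∷ fs) x = trans (cong ((1ℚ + f x) *_) (Π-expand fs x)) (e (f x) (σ₁ fs x) (σ₂ fs x) (σ₃ fs x) (ρ fs x))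
      where
      e : ∀ f a b c r → (1ℚ + f) * (1ℚ + a + b + c + r) ≡ 1ℚ + (f + a) + (f * a + b) + (f * b + c) + (f * (c + r) + r)
      e = solve-∀ ℚ-ring

    Π-++ : ∀ fs gs x → Π (fs ++ gs) x ≡ Π fs x * Π gs x
    Π-++ []       gs x = sym (*-identityˡ _)
    Π-++ (f ∷ fs) gs x = trans (cong ((1ℚ + f x) *_) (Π-++ fs gs x)) (sym (*-assoc (1ℚ + f x) (Π fs x) (Π gs x)))

    σ₁-++ : ∀ fs gs x → σ₁ (fs ++ gs) x ≡ σ₁ fs x + σ₁ gs x
    σ₁-++ []       gs x = sym (+-identityˡ _)
    σ₁-++ (f ∷ fs) gs x = trans (cong (_+_ (f x)) (σ₁-++ fs gs x)) (sym (+-assoc (f x) (σ₁ fs x) (σ₁ gs x)))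

    σ₁-scale : ∀ c fs x → σ₁ (map (scale c) fs) x ≡ c * σ₁ fs x
    σ₁-scale c []       x = sym (*-zeroʳ c)
    σ₁-scale c (f ∷ fs) x = trans (cong (_+_ (c * f x)) (σ₁-scale c fs x)) (sym (*-distribˡ-+ c (f x) (σ₁ fs x)))

    σ₂-scale : ∀ c fs x → σ₂ (map (scale c) fs) x ≡ c * c * σ₂ fs x
    σ₂-scale c []       x = sym (*-zeroʳ (c * c))
    σ₂-scale c (f ∷ fs) x = trans (cong₂ (λ a b → c * f x * a + b) (σ₁-scale c fs x) (σ₂-scale c fs x)) (e c (f x) (σ₁ fs x) (σ₂ fs x))
      where
      e : ∀ c f a b → c * f * (c * a) + c * c * b ≡ c * c * (f * a + b)
      e = solve-∀ ℚ-ring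

    σ₃-scale : ∀ c fs x → σ₃ (map (scale c) fs) x ≡ c * c * c * σ₃ fs x
    σ₃-scale c []       x = sym (*-zeroʳ (c * c * c))
    σ₃-scale c (f ∷ fs) x = trans (cong₂ (λ a b → c * f x * a + b) (σ₂-scale c fs x) (σ₃-scale c fs x)) (e c (f x) (σ₂ fs x) (σ₃ fs x))
      where
      e : ∀ c f a b → c * f * (c * c * a) + c * c * c * b ≡ c * c * c * (f * a + b)
      e = solve-∀ ℚ-ring

    -- Newton's identities for values ±1, whose even power sums are all equal to their number.
    newton₂ : ∀ fs x → All (λ f → f x * f x ≡ 1ℚ) fs → (+ 2 / 1) * σ₂ fs x ≡ σ₁ fs x * σ₁ fs x - ι (length fs)
    newton₂ [] x [] = sym (trans (cong (λ z → 0ℚ * 0ℚ - z) ι-0) refl)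
    newton₂ (f ∷ fs) x (h ∷ hs) = trans (e₁ (f x) (σ₁ fs x) (σ₂ fs x)) (trans (cong (λ z → (+ 2 / 1) * (f x * σ₁ fs x) + z) (newton₂ fs x hs))
      (trans (e₂ (f x) (σ₁ fs x) (ι (length fs))) (trans (cong₂ (λ p q → (f x + σ₁ fs x) * (f x + σ₁ fs x) + (1ℚ - p) - q) h (sym (ι-suc (length fs)))) (e₃ (f x + σ₁ fs x) (ι (suc (length fs)))))))
      where
      e₃ : ∀ a c → a * a + (1ℚ - 1ℚ) - c ≡ a * a - c
      e₃ = solve-∀ ℚ-ring
      e₁ : ∀ f a b → (+ 2 / 1) * (f * a + b) ≡ (+ 2 / 1) * (f * a) + (+ 2 / 1) * b
      e₁ = solve-∀ ℚ-ring
      e₂ : ∀ f a c → (+ 2 / 1) * (f * a) + (a * a - c) ≡ (f + a) * (f + a) + (1ℚ - f * f) - (1ℚ + c)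
      e₂ = solve-∀ ℚ-ring

    newton₃ : ∀ fs x → All (λ f → f x * f x ≡ 1ℚ) fs →
      (+ 6 / 1) * σ₃ fs x ≡ σ₁ fs x * σ₁ fs x * σ₁ fs x - (+ 3 / 1) * ι (length fs) * σ₁ fs x + (+ 2 / 1) * σ₁ fs x
    newton₃ [] x [] = sym (trans (cong (λ z → 0ℚ * 0ℚ * 0ℚ - (+ 3 / 1) * z * 0ℚ + (+ 2 / 1) * 0ℚ) ι-0) refl)
    newton₃ (f ∷ fs) x (h ∷ hs) = begin
      (+ 6 / 1) * (f x * b + c)  ≡⟨ e₁ (f x) b c ⟩
      (+ 3 / 1) * f x * ((+ 2 / 1) * b) + (+ 6 / 1) * c
        ≡⟨ cong₂ (λ p q → (+ 3 / 1) * f x * p + q) (newton₂ fs x hs) (newton₃ fs x hs) ⟩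
      (+ 3 / 1) * f x * (a * a - N) + (a * a * a - (+ 3 / 1) * N * a + (+ 2 / 1) * a)
        ≡⟨ e₂ (f x) a N ⟩
      g (f x * f x) (1ℚ + N)  ≡⟨ cong₂ g h (sym (ι-suc (length fs))) ⟩
      g 1ℚ (ι (length (f ∷ fs)))  ≡⟨ e₃ (f x) a (ι (length (f ∷ fs))) ⟩
      (f x + a) * (f x + a) * (f x + a) - (+ 3 / 1) * ι (length (f ∷ fs)) * (f x + a) + (+ 2 / 1) * (f x + a) ∎
      where
      open ≡-Reasoning
      a b c N : ℚ
      a = σ₁ fs x
      b = σ₂ fs x
      c = σ₃ fs x
      N = ι (length fs)
      g : ℚ → ℚ → ℚ
      g p M = (f x + a) * (f x + a) * (f x + a) + (1ℚ - p) * (f x + (+ 3 / 1) * a) - (+ 3 / 1) * M * (f x + a) + (+ 2 / 1) * (f x + a)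
      e₁ : ∀ f b c → (+ 6 / 1) * (f * b + c) ≡ (+ 3 / 1) * f * ((+ 2 / 1) * b) + (+ 6 / 1) * c
      e₁ = solve-∀ ℚ-ring
      e₂ : ∀ f a N → (+ 3 / 1) * f * (a * a - N) + (a * a * a - (+ 3 / 1) * N * a + (+ 2 / 1) * a)
        ≡ (f + a) * (f + a) * (f + a) + (1ℚ - f * f) * (f + (+ 3 / 1) * a) - (+ 3 / 1) * (1ℚ + N) * (f + a) + (+ 2 / 1) * (f + a)
      e₂ = solve-∀ ℚ-ring
      e₃ : ∀ f a M → (f + a) * (f + a) * (f + a) + (1ℚ - 1ℚ) * (f + (+ 3 / 1) * a) - (+ 3 / 1) * M * (f + a) + (+ 2 / 1) * (f + a)
        ≡ (f + a) * (f + a) * (f + a) - (+ 3 / 1) * M * (f + a) + (+ 2 / 1) * (f + a)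
      e₃ = solve-∀ ℚ-ring

  module _ {X : Set} (S : Space X) where
    open Ops S

    Pos-Π : ∀ {fs} → All Pos fs → Pos (Π fs)
    Pos-Π []       = Pos-const 0≤1
    Pos-Π (p ∷ ps) = Pos-* (Pos-+ (Pos-const 0≤1) p) (Pos-Π ps)

    Pos-σ₁ : ∀ {fs} → All Pos fs → Pos (σ₁ fs)
    Pos-σ₁ []       = Pos-zero
    Pos-σ₁ (p ∷ ps) = Pos-+ p (Pos-σ₁ ps)

    Pos-σ₂ : ∀ {fs} → All Pos fs → Pos (σ₂ fs)
    Pos-σ₂ []       = Pos-zero
    Pos-σ₂ (p ∷ ps) = Pos-+ (Pos-* p (Pos-σ₁ ps)) (Pos-σ₂ ps)

    Pos-σ₃ : ∀ {fs} → All Pos fs → Pos (σ₃ fs)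
    Pos-σ₃ []       = Pos-zero
    Pos-σ₃ (p ∷ ps) = Pos-+ (Pos-* p (Pos-σ₂ ps)) (Pos-σ₃ ps)

    Pos-ρ : ∀ {fs} → All Pos fs → Pos (ρ fs)
    Pos-ρ []       = Pos-zero
    Pos-ρ (p ∷ ps) = Pos-+ (Pos-* p (Pos-+ (Pos-σ₃ ps) (Pos-ρ ps))) (Pos-ρ ps)

    module _ {c : ℚ} (0≤c : 0ℚ ≤ c) where
      private
        zero◁ : ∀ b → (λ _ → 0ℚ) ◁ (λ (x : X) → b * 0ℚ)
        zero◁ b = ◁-cong (λ _ → refl) (λ _ → sym (*-zeroʳ b)) (Pos⇒◁ Pos-zero)

      _◁*_ : (X → ℚ) → (X → ℚ) → Set
      f ◁* g = f ◁ scale c g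

      σ₁-◁ : ∀ {fs gs} → Pointwise _◁*_ fs gs → σ₁ fs ◁ scale c (σ₁ gs)
      σ₁-◁ [] = zero◁ c
      σ₁-◁ {f ∷ fs} {g ∷ gs} (p ∷ ps) = ◁-cong (λ _ → refl) (λ x → sym (*-distribˡ-+ c (g x) (σ₁ gs x))) (◁-+ p (σ₁-◁ ps))

      σ₂-◁ : ∀ {fs gs} → Pointwise _◁*_ fs gs → σ₂ fs ◁ scale (c * c) (σ₂ gs)
      σ₂-◁ [] = zero◁ (c * c)
      σ₂-◁ {f ∷ fs} {g ∷ gs} (p ∷ ps) = ◁-cong (λ _ → refl) (λ x → e c (g x) (σ₁ gs x) (σ₂ gs x)) (◁-+ (◁-* p (σ₁-◁ ps)) (σ₂-◁ ps))
        where e : ∀ c g a b → c * g * (c * a) + c * c * b ≡ c * c * (g * a + b)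
              e = solve-∀ ℚ-ring

      σ₃-◁ : ∀ {fs gs} → Pointwise _◁*_ fs gs → σ₃ fs ◁ scale (c * c * c) (σ₃ gs)
      σ₃-◁ [] = zero◁ (c * c * c)
      σ₃-◁ {f ∷ fs} {g ∷ gs} (p ∷ ps) = ◁-cong (λ _ → refl) (λ x → e c (g x) (σ₂ gs x) (σ₃ gs x)) (◁-+ (◁-* p (σ₂-◁ ps)) (σ₃-◁ ps))
        where e : ∀ c g a b → c * g * (c * c * a) + c * c * c * b ≡ c * c * c * (g * a + b)
              e = solve-∀ ℚ-ring

      -- Every monomial of `ρ` has degree at least 4, so scaling its factors by c gains at least c⁴;
      -- the surplus powers are discarded by c ≤ 1.
      ρ-◁ : c ≤ 1ℚ → ∀ {fs gs} → All Pos gs → Pointwise _◁*_ fs gs → ρ fs ◁ scale (c * c * c * c) (ρ gs)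
      ρ-◁ c≤1 [] [] = zero◁ (c * c * c * c)
      ρ-◁ c≤1 {f ∷ fs} {g ∷ gs} (q ∷ qs) (p ∷ ps) =
        ◁-≼ (◁-+ (◁-* p (◁-+ (σ₃-◁ ps) (ρ-◁ c≤1 qs ps))) (ρ-◁ c≤1 qs ps))
          (mk≼ (Pos-cong (λ x → e c (g x) (σ₃ gs x) (ρ gs x))
            (Pos-scale ((0≤c ⊛ 0≤c ⊛ 0≤c ⊛ 0≤c) ⊛ sub⁺ c≤1) (Pos-* q (Pos-ρ qs)))))
        where e : ∀ c g a r → c * c * c * c * (1ℚ - c) * (g * r)
                    ≡ c * c * c * c * (g * (a + r) + r) - (c * g * (c * c * c * a + c * c * c * c * r) + c * c * c * c * r)
              e = solve-∀ ℚ-ring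

      -- Only the cubic term is kept exactly. The terms of degree 1 and 2 are dominated by multiples
      -- of terms with mean zero. The tail is compared with the tail at the fixed, larger couplings
      -- `gs`, where the whole partition function bounds it; the price is c⁴.
      𝔼-Π≤ : c ≤ 1ℚ → ∀ {fs gs} → All Pos gs → Pointwise _◁*_ fs gs → 𝔼 (σ₁ gs) ≡ 0ℚ → 𝔼 (σ₂ gs) ≡ 0ℚ →
        𝔼 (Π fs) ≤ 1ℚ + 𝔼 (σ₃ fs) + c * c * c * c * 𝔼 (Π gs)
      𝔼-Π≤ c≤1 {fs} {gs} qs ps h₁ h₂ = begin
        𝔼 (Π fs)  ≡⟨ 𝔼-expand fs ⟩
        1ℚ + 𝔼 (σ₁ fs) + 𝔼 (σ₂ fs) + 𝔼 (σ₃ fs) + 𝔼 (ρ fs)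
          ≤⟨ +-mono-≤ (+-monoˡ-≤ (𝔼 (σ₃ fs)) (+-mono-≤ (+-monoʳ-≤ 1ℚ b₁) b₂)) b₃ ⟩
        1ℚ + 0ℚ + 0ℚ + 𝔼 (σ₃ fs) + c * c * c * c * 𝔼 (Π gs)
          ≡⟨ e (𝔼 (σ₃ fs)) (c * c * c * c * 𝔼 (Π gs)) ⟩
        1ℚ + 𝔼 (σ₃ fs) + c * c * c * c * 𝔼 (Π gs) ∎
        where
        open ≤-Reasoning
        𝔼-expand : ∀ fs → 𝔼 (Π fs) ≡ 1ℚ + 𝔼 (σ₁ fs) + 𝔼 (σ₂ fs) + 𝔼 (σ₃ fs) + 𝔼 (ρ fs)
        𝔼-expand fs = trans (𝔼-cong (Π-expand fs)) (trans (𝔼-+ (λ x → 1ℚ + σ₁ fs x + σ₂ fs x + σ₃ fs x) (ρ fs)) (cong (_+ 𝔼 (ρ fs))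
          (trans (𝔼-+ (λ x → 1ℚ + σ₁ fs x + σ₂ fs x) (σ₃ fs)) (cong (_+ 𝔼 (σ₃ fs))
          (trans (𝔼-+ (λ x → 1ℚ + σ₁ fs x) (σ₂ fs)) (cong (_+ 𝔼 (σ₂ fs))
          (trans (𝔼-+ (λ x → 1ℚ) (σ₁ fs)) (cong (_+ 𝔼 (σ₁ fs)) 𝔼-one))))))))
        b₁ : 𝔼 (σ₁ fs) ≤ 0ℚ
        b₁ = subst (𝔼 (σ₁ fs) ≤_) (trans (𝔼-* c (σ₁ gs)) (trans (cong (c *_) h₁) (*-zeroʳ c))) (◁⇒𝔼≤ (σ₁-◁ ps))
        b₂ : 𝔼 (σ₂ fs) ≤ 0ℚ
        b₂ = subst (𝔼 (σ₂ fs) ≤_) (trans (𝔼-* (c * c) (σ₂ gs)) (trans (cong (c * c *_) h₂) (*-zeroʳ (c * c)))) (◁⇒𝔼≤ (σ₂-◁ ps))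
        ρ≼Π : ρ gs ≼ Π gs
        ρ≼Π = mk≼ (Pos-cong (λ x → trans (e′ (σ₁ gs x) (σ₂ gs x) (σ₃ gs x) (ρ gs x)) (cong (_- ρ gs x) (sym (Π-expand gs x))))
          (Pos-+ (Pos-+ (Pos-+ (Pos-const 0≤1) (Pos-σ₁ qs)) (Pos-σ₂ qs)) (Pos-σ₃ qs)))
          where e′ : ∀ a b c r → 1ℚ + a + b + c ≡ 1ℚ + a + b + c + r - r
                e′ = solve-∀ ℚ-ring
        b₃ : 𝔼 (ρ fs) ≤ c * c * c * c * 𝔼 (Π gs)
        b₃ = ≤-trans (subst (𝔼 (ρ fs) ≤_) (𝔼-* (c * c * c * c) (ρ gs)) (◁⇒𝔼≤ (ρ-◁ c≤1 qs ps)))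
          (*-monoˡ (0≤c ⊛ 0≤c ⊛ 0≤c ⊛ 0≤c) (≼⇒𝔼≤ ρ≼Π))
        e : ∀ a b → 1ℚ + 0ℚ + 0ℚ + a + b ≡ 1ℚ + a + b
        e = solve-∀ ℚ-ring

    σ₂≼ : ∀ {fs} → All Pos fs → scale (+ 2 / 1) (σ₂ fs) ≼ (λ x → σ₁ fs x * σ₁ fs x)
    σ₂≼ []                 = ≼-reflexive λ _ → refl
    σ₂≼ {f ∷ fs} (p ∷ ps) = mk≼ (Pos-cong (λ x → e (f x) (σ₁ fs x) (σ₂ fs x)) (Pos-+ (diff (σ₂≼ ps)) (Pos-* p p)))
      where e : ∀ f a b → a * a - (+ 2 / 1) * b + f * f ≡ (f + a) * (f + a) - (+ 2 / 1) * (f * a + b)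
            e = solve-∀ ℚ-ring

    -- Expanding the cube of `σ₁` gives 6 `σ₃` plus monomials with a repeated factor, all of them in
    -- the cone. This serves where the couplings vary from edge to edge and `newton₃` does not
    -- apply.
    σ₃≼ : ∀ {fs} → All Pos fs → scale (+ 6 / 1) (σ₃ fs) ≼ (λ x → σ₁ fs x * σ₁ fs x * σ₁ fs x)
    σ₃≼ []                 = ≼-reflexive λ _ → refl
    σ₃≼ {f ∷ fs} (p ∷ ps) = mk≼ (Pos-cong (λ x → e (f x) (σ₁ fs x) (σ₂ fs x) (σ₃ fs x))
      (Pos-+ (Pos-+ (diff (σ₃≼ ps)) (Pos-scale (nonNegative⁻¹ (+ 3 / 1)) (Pos-* p (diff (σ₂≼ ps)))))
        (Pos-+ (Pos-scale (nonNegative⁻¹ (+ 3 / 1)) (Pos-* (Pos-* p p) (Pos-σ₁ ps))) (Pos-* (Pos-* p p) p))))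
      where e : ∀ f a b c → a * a * a - (+ 6 / 1) * c + (+ 3 / 1) * (f * (a * a - (+ 2 / 1) * b)) + ((+ 3 / 1) * (f * f * a) + f * f * f)
                  ≡ (f + a) * (f + a) * (f + a) - (+ 6 / 1) * (f * b + c)
            e = solve-∀ ℚ-ring

  pairs : ∀ {A : Set} → List A → List (A × A)
  pairs []       = []
  pairs (i ∷ is) = map (i ,_) is ++ pairs is

  length-pairs : ∀ {A : Set} (is : List A) → (+ 2 / 1) * ι (length (pairs is)) ≡ ι (length is) * (ι (length is) - 1ℚ)
  length-pairs []       = trans (cong ((+ 2 / 1) *_) ι-0) (sym (trans (cong (λ z → z * (z - 1ℚ)) ι-0) refl))
  length-pairs (i ∷ is) = trans (cong (λ n → (+ 2 / 1) * ι n) (trans (length-++ (map (i ,_) is)) (cong (ℕ._+ length (pairs is)) (length-map (i ,_) is))))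
    (trans (cong ((+ 2 / 1) *_) (ι-+ (length is) (length (pairs is)))) (trans (*-distribˡ-+ (+ 2 / 1) (ι (length is)) _)
    (trans (cong (λ z → (+ 2 / 1) * ι (length is) + z) (length-pairs is)) (trans (e (ι (length is))) (cong (λ z → z * (z - 1ℚ)) (sym (ι-suc (length is))))))))
    where e : ∀ k → (+ 2 / 1) * k + k * (k - 1ℚ) ≡ (1ℚ + k) * (1ℚ + k - 1ℚ)
          e = solve-∀ ℚ-ring

  map-pairs : ∀ {A B : Set} (f : A → B) is → pairs (map f is) ≡ map (λ e → f (proj₁ e) , f (proj₂ e)) (pairs is)
  map-pairs f []       = refl
  map-pairs f (i ∷ is) = trans (cong₂ _++_ (trans (sym (map-∘ is)) (map-∘ is)) (map-pairs f is)) (sym (map-++ _ (map (i ,_) is) (pairs is)))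
    where open import Data.List.Properties using (map-∘; map-++)

  module _ {n : ℕ} where
    open Ops (cube n)

    ζ : Fin n × Fin n → Vec Bool n → ℚ
    ζ (i , j) v = χ i v * χ j v

    ζs : List (Fin n) → List (Vec Bool n → ℚ)
    ζs is = map ζ (pairs is)

    s : List (Fin n) → Vec Bool n → ℚ
    s is = σ₁ (map χ is)

    -- The energy of the Curie-Weiss model on the vertices `is`; `s` is its magnetisation.
    y : List (Fin n) → Vec Bool n → ℚ
    y is = σ₁ (ζs is)

    ζ² : ∀ e v → ζ e v * ζ e v ≡ 1ℚ
    ζ² (i , j) v = trans (r (χ i v) (χ j v)) (cong₂ _*_ (sgn² (lookup v i)) (sgn² (lookup v j)))
      where r : ∀ a b → a * b * (a * b) ≡ a * a * (b * b)
            r = solve-∀ ℚ-ring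

    ζs² : ∀ es v → All (λ f → f v * f v ≡ 1ℚ) (map ζ es)
    ζs² []       v = []
    ζs² (e ∷ es) v = ζ² e v ∷ ζs² es v

    Pos-ζ : ∀ e → Pos (ζ e)
    Pos-ζ (i , j) = Pos-* (Pos-χ i) (Pos-χ j)

    Pos-ζs : ∀ es → All Pos (map ζ es)
    Pos-ζs []       = []
    Pos-ζs (e ∷ es) = Pos-ζ e ∷ Pos-ζs es

    Pos-χs : ∀ is → All Pos (map χ is)
    Pos-χs []       = []
    Pos-χs (i ∷ is) = Pos-χ i ∷ Pos-χs is

    y-∷ : ∀ i is v → y (i ∷ is) v ≡ χ i v * s is v + y is v
    y-∷ i is v = trans (cong (λ fs → σ₁ fs v) (trans (map-++ ζ (map (i ,_) is) (pairs is)) (cong (_++ ζs is) (sym (map-∘ is)))))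
      (trans (σ₁-++ (map (λ j → ζ (i , j)) is) (ζs is) v) (cong (_+ y is v) (row is)))
      where
      open import Data.List.Properties using (map-++; map-∘)
      row : ∀ is → σ₁ (map (λ j → ζ (i , j)) is) v ≡ χ i v * s is v
      row []       = sym (*-zeroʳ (χ i v))
      row (j ∷ js) = trans (cong (_+_ (χ i v * χ j v)) (row js)) (sym (*-distribˡ-+ (χ i v) (χ j v) (s js v)))

    s² : ∀ is v → s is v * s is v ≡ (+ 2 / 1) * y is v + ι (length is)
    s² []       v = sym (trans (cong (_+_ ((+ 2 / 1) * 0ℚ)) ι-0) refl)
    s² (i ∷ is) v = trans (e₁ (χ i v) (s is v)) (trans (cong₂ (λ p q → p + (+ 2 / 1) * (χ i v * s is v) + q) (sgn² (lookup v i)) (s² is v))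
      (trans (e₂ (χ i v * s is v) (y is v) (ι (length is))) (cong₂ (λ p q → (+ 2 / 1) * p + q) (sym (y-∷ i is v)) (sym (ι-suc (length is))))))
      where
      e₁ : ∀ a b → (a + b) * (a + b) ≡ a * a + (+ 2 / 1) * (a * b) + b * b
      e₁ = solve-∀ ℚ-ring
      e₂ : ∀ a b c → 1ℚ + (+ 2 / 1) * a + ((+ 2 / 1) * b + c) ≡ (+ 2 / 1) * (a + b) + (1ℚ + c)
      e₂ = solve-∀ ℚ-ring

    s-flip : ∀ {i is} → All (i ≢_) is → ∀ v → s is (flip i v) ≡ s is v
    s-flip []       v = refl
    s-flip (h ∷ hs) v = cong₂ _+_ (χ-flip-≢ h v) (s-flip hs v)

    -- By `s²`, y is a function of the magnetisation, whose invariance is known.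
    y-flip : ∀ {i is} → All (i ≢_) is → ∀ v → y is (flip i v) ≡ y is v
    y-flip {i} {is} h v = trans (e (s² is (flip i v))) (trans (cong (λ z → ½ * (z * z - ι (length is))) (s-flip h v)) (sym (e (s² is v))))
      where
      r : ∀ a c → ½ * ((+ 2 / 1) * a + c - c) ≡ a
      r = solve-∀ ℚ-ring
      e : ∀ {a b} → b ≡ (+ 2 / 1) * a + ι (length is) → a ≡ ½ * (b - ι (length is))
      e {a} p = trans (sym (r a (ι (length is)))) (cong (λ z → ½ * (z - ι (length is))) (sym p))

    𝔼-y : ∀ {is} → Unique is → 𝔼 (y is) ≡ 0ℚ
    𝔼-y []       = 𝔼-const 0ℚ
    𝔼-y {i ∷ is} (h ∷ u) = trans (𝔼-cong (y-∷ i is)) (trans (𝔼-+ (λ v → χ i v * s is v) (y is))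
      (trans (cong₂ _+_ (𝔼-odd i {s is} (s-flip h)) (𝔼-y u)) refl))

    𝔼-s² : ∀ {is} → Unique is → 𝔼 (λ v → s is v * s is v) ≡ ι (length is)
    𝔼-s² {is} u = trans (𝔼-cong (s² is)) (trans (𝔼-+ (scale (+ 2 / 1) (y is)) (λ _ → ι (length is)))
      (trans (cong₂ _+_ (trans (𝔼-* (+ 2 / 1) (y is)) (cong ((+ 2 / 1) *_) (𝔼-y u))) (𝔼-const (ι (length is)))) (+-identityˡ _)))

    𝔼-y² : ∀ {is} → Unique is → 𝔼 (λ v → y is v * y is v) ≡ ½ * (ι (length is) * (ι (length is) - 1ℚ))
    𝔼-y² [] = trans (𝔼-const 0ℚ) (sym (trans (cong (λ z → ½ * (z * (z - 1ℚ))) ι-0) refl))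
    𝔼-y² {i ∷ is} (h ∷ u) = begin
      𝔼 (λ v → y (i ∷ is) v * y (i ∷ is) v)
        ≡⟨ 𝔼-cong (λ v → trans (cong (λ z → z * z) (y-∷ i is v)) (trans (e₁ (χ i v) (s is v) (y is v)) (cong (λ z → χ i v * f v + (z * g v + h′ v)) (sgn² (lookup v i))))) ⟩
      𝔼 (λ v → χ i v * f v + (1ℚ * g v + h′ v))
        ≡⟨ trans (𝔼-+ (λ v → χ i v * f v) (λ v → 1ℚ * g v + h′ v)) (cong₂ _+_ (𝔼-odd i {f} f-flip) (trans (𝔼-+ (scale 1ℚ g) h′) (cong₂ _+_ (trans (𝔼-* 1ℚ g) (cong (1ℚ *_) (𝔼-s² u))) (𝔼-y² u)))) ⟩
      0ℚ + (1ℚ * k + ½ * (k * (k - 1ℚ)))  ≡⟨ e₂ k ⟩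
      ½ * ((1ℚ + k) * (1ℚ + k - 1ℚ))      ≡⟨ cong (λ z → ½ * (z * (z - 1ℚ))) (sym (ι-suc (length is))) ⟩
      ½ * (ι (length (i ∷ is)) * (ι (length (i ∷ is)) - 1ℚ)) ∎
      where
      open ≡-Reasoning
      f g h′ : Vec Bool n → ℚ
      f v = (+ 2 / 1) * s is v * y is v
      g v = s is v * s is v
      h′ v = y is v * y is v
      k = ι (length is)
      f-flip : ∀ v → f (flip i v) ≡ f v
      f-flip v = cong₂ (λ p q → (+ 2 / 1) * p * q) (s-flip h v) (y-flip h v)
      e₁ : ∀ a b c → (a * b + c) * (a * b + c) ≡ a * ((+ 2 / 1) * b * c) + (a * a * (b * b) + c * c)
      e₁ = solve-∀ ℚ-ring
      e₂ : ∀ k → 0ℚ + (1ℚ * k + ½ * (k * (k - 1ℚ))) ≡ ½ * ((1ℚ + k) * (1ℚ + k - 1ℚ))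
      e₂ = solve-∀ ℚ-ring

    -- Counts ordered triples of edges whose product is constantly 1, that is, the three edges of a
    -- triangle in any order. The recursion writes y of the larger set as χᵢ s + y, drops what is
    -- odd in χᵢ, and replaces s² in the surviving term 3 s² y by `s²`.
    𝔼-y³ : ∀ {is} → Unique is → 𝔼 (λ v → y is v * y is v * y is v) ≡ ι (length is) * (ι (length is) - 1ℚ) * (ι (length is) - (+ 2 / 1))
    𝔼-y³ [] = trans (𝔼-const 0ℚ) (sym (trans (cong (λ z → z * (z - 1ℚ) * (z - (+ 2 / 1))) ι-0) refl))
    𝔼-y³ {i ∷ is} (h ∷ u) = begin
      𝔼 (λ v → y (i ∷ is) v * y (i ∷ is) v * y (i ∷ is) v)
        ≡⟨ 𝔼-cong (λ v → trans (cong (λ z → z * z * z) (y-∷ i is v)) (trans (e₁ (χ i v) (s is v) (y is v))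
             (trans (cong₂ (λ p q → χ i v * (p * (s is v * s is v * s is v) + (+ 3 / 1) * (s is v * (y is v * y is v))) + (p * ((+ 3 / 1) * (q * y is v)) + y is v * y is v * y is v)) (sgn² (lookup v i)) (s² is v))
               (cong (_+_ (χ i v * f v)) (e₂ (y is v) k))))) ⟩
      𝔼 (λ v → χ i v * f v + ((+ 6 / 1) * g v + ((+ 3 / 1) * k * y is v + h′ v)))
        ≡⟨ trans (𝔼-+ (λ v → χ i v * f v) _) (cong₂ _+_ (𝔼-odd i {f} f-flip)
             (trans (𝔼-+ (scale (+ 6 / 1) g) _) (cong₂ _+_ (trans (𝔼-* (+ 6 / 1) g) (cong ((+ 6 / 1) *_) (𝔼-y² u)))
               (trans (𝔼-+ (scale ((+ 3 / 1) * k) (y is)) h′) (cong₂ _+_ (trans (𝔼-* ((+ 3 / 1) * k) (y is)) (cong ((+ 3 / 1) * k *_) (𝔼-y u))) (𝔼-y³ u)))))) ⟩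
      0ℚ + ((+ 6 / 1) * (½ * (k * (k - 1ℚ))) + ((+ 3 / 1) * k * 0ℚ + k * (k - 1ℚ) * (k - (+ 2 / 1))))  ≡⟨ e₃ k ⟩
      (1ℚ + k) * (1ℚ + k - 1ℚ) * (1ℚ + k - (+ 2 / 1))      ≡⟨ cong (λ z → z * (z - 1ℚ) * (z - (+ 2 / 1))) (sym (ι-suc (length is))) ⟩
      ι (length (i ∷ is)) * (ι (length (i ∷ is)) - 1ℚ) * (ι (length (i ∷ is)) - (+ 2 / 1)) ∎
      where
      open ≡-Reasoning
      f g h′ : Vec Bool n → ℚ
      f v = 1ℚ * (s is v * s is v * s is v) + (+ 3 / 1) * (s is v * (y is v * y is v))
      g v = y is v * y is v
      h′ v = y is v * y is v * y is v
      k = ι (length is)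
      f-flip : ∀ v → f (flip i v) ≡ f v
      f-flip v = cong₂ (λ p q → 1ℚ * (p * p * p) + (+ 3 / 1) * (p * (q * q))) (s-flip h v) (y-flip h v)
      e₁ : ∀ a b c → (a * b + c) * (a * b + c) * (a * b + c) ≡ a * (a * a * (b * b * b) + (+ 3 / 1) * (b * (c * c))) + (a * a * ((+ 3 / 1) * (b * b * c)) + c * c * c)
      e₁ = solve-∀ ℚ-ring
      e₂ : ∀ y k → 1ℚ * ((+ 3 / 1) * (((+ 2 / 1) * y + k) * y)) + y * y * y ≡ (+ 6 / 1) * (y * y) + ((+ 3 / 1) * k * y + y * y * y)
      e₂ = solve-∀ ℚ-ring
      e₃ : ∀ k → 0ℚ + ((+ 6 / 1) * (½ * (k * (k - 1ℚ))) + ((+ 3 / 1) * k * 0ℚ + k * (k - 1ℚ) * (k - (+ 2 / 1)))) ≡ (1ℚ + k) * (1ℚ + k - 1ℚ) * (1ℚ + k - (+ 2 / 1))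
      e₃ = solve-∀ ℚ-ring

-- Boundedness of the ferromagnetic partition function at high temperature

module PartitionFunction where
  open Rationals
  open Fourier
  open Spins
  open import Data.Bool.Base using (Bool)
  open import Data.Fin.Base using (Fin; suc)
  open import Data.Integer.Base using (+_)
  open import Data.List.Base using (List; []; _∷_; map; length; _++_)
  open import Data.List.Properties using (length-++; length-map; map-++; map-∘)
  open import Data.List.Relation.Unary.All as All using (All; []; _∷_)
  import Data.List.Relation.Unary.All.Properties as All
  open import Data.List.Relation.Unary.AllPairs.Core using ([]; _∷_)
  open import Data.List.Relation.Unary.Unique.Propositional using (Unique)
  open import Data.Rational
  open import Data.Rational.Properties
  open import Data.Vec.Base using (Vec; lookup)
  open import Relation.Binary.Definitions using (tri<; tri≈; tri>)

  module _ {X : Set} (S : Space X) where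
    open Ops S

    1+σ₁≼Π : ∀ {fs} → All Pos fs → (λ x → 1ℚ + σ₁ fs x) ≼ Π fs
    1+σ₁≼Π {fs} ps = mk≼ (Pos-cong (λ x → trans (e (σ₁ fs x) (σ₂ fs x) (σ₃ fs x) (ρ fs x)) (cong (_- (1ℚ + σ₁ fs x)) (sym (Π-expand fs x))))
      (Pos-+ (Pos-+ (Pos-σ₂ S ps) (Pos-σ₃ S ps)) (Pos-ρ S ps)))
      where e : ∀ a b c r → b + c + r ≡ 1ℚ + a + b + c + r - (1ℚ + a)
            e = solve-∀ ℚ-ring

    Pos-scales : ∀ {c fs} → 0ℚ ≤ c → All Pos fs → All Pos (map (scale c) fs)
    Pos-scales h []       = []
    Pos-scales h (p ∷ ps) = Pos-scale h p ∷ Pos-scales h ps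

    -- For each edge, f² = 1 gives (1 + a² f)(1 + a f) = 1 + a³ + (a + a²) f, which is dominated by
    -- (1 + a³)(1 + b f). Two couplings on one edge thus become one.
    merge : ∀ {a b} → 0ℚ ≤ a → a + a * a ≤ b → ∀ {fs} → All Pos fs → (∀ x → All (λ f → f x * f x ≡ 1ℚ) fs) →
      (λ x → Π (map (scale (a * a)) fs) x * Π (map (scale a) fs) x) ≼ (λ x → (1ℚ + a * a * a) ^ length fs * Π (map (scale b) fs) x)
    merge {a} {b} 0≤a h [] sq = ≼-reflexive λ _ → refl
    merge {a} {b} 0≤a h {f ∷ fs} (p ∷ ps) sq =
      ≼-cong (λ x → trans (cong (_* (P x * P′ x)) (sym (trans (e₁ a (f x)) (cong (λ z → 1ℚ + a * a * a * z + (a + a * a) * f x) (All.head (sq x))))))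
                      (e₂ (1ℚ + a * a * f x) (1ℚ + a * f x) (P x) (P′ x)))
             (λ x → e₂ (1ℚ + a * a * a) (1ℚ + b * f x) ((1ℚ + a * a * a) ^ length fs) (Π (map (scale b) fs) x))
        (≼-* {g = λ x → (1ℚ + a * a * a) * (1ℚ + b * f x)} (Pos-+ (Pos-const (0≤1 ⊕ 0≤a ⊛ 0≤a ⊛ 0≤a ⊛ 0≤1)) (Pos-scale (0≤a ⊕ 0≤a ⊛ 0≤a) p))
             (Pos-* (Pos-Π S (Pos-scales (0≤a ⊛ 0≤a) ps)) (Pos-Π S (Pos-scales 0≤a ps)))
             (mk≼ (Pos-cong (λ x → e₃ a b (f x)) (Pos-scale (sub⁺ h ⊕ 0≤a ⊛ 0≤a ⊛ 0≤a ⊛ ≤-trans (0≤a ⊕ 0≤a ⊛ 0≤a) h) p)))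
             (merge 0≤a h ps (λ x → All.tail (sq x))))
      where
      P P′ : X → ℚ
      P  = Π (map (scale (a * a)) fs)
      P′ = Π (map (scale a) fs)
      e₁ : ∀ a f → (1ℚ + a * a * f) * (1ℚ + a * f) ≡ 1ℚ + a * a * a * (f * f) + (a + a * a) * f
      e₁ = solve-∀ ℚ-ring
      e₂ : ∀ a b c d → a * b * (c * d) ≡ a * c * (b * d)
      e₂ = solve-∀ ℚ-ring
      e₃ : ∀ a b f → (b - (a + a * a) + a * a * a * b) * f ≡ (1ℚ + a * a * a) * (1ℚ + b * f) - (1ℚ + a * a * a * 1ℚ + (a + a * a) * f)
      e₃ = solve-∀ ℚ-ring

  scaled-ζs : ∀ {n} c (i : Fin n) is → map (scale c) (ζs (i ∷ is)) ≡ map (λ j → scale c (ζ (i , j))) is ++ map (scale c) (ζs is)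
  scaled-ζs c i is = trans (cong (map (scale c)) (map-++ ζ (map (i ,_) is) (pairs is)))
    (trans (map-++ (scale c) (map ζ (map (i ,_) is)) (ζs is)) (cong (_++ map (scale c) (ζs is)) (sym (trans (map-∘ is) (cong (map (scale c)) (map-∘ is))))))

  module _ {n : ℕ} where
    open Ops (cube n)

    private module Row (a : ℚ) (0≤a : 0ℚ ≤ a) where
      -- The sums of a^|A| χ_A over the subsets A of the list of even and of odd size: the expansion
      -- of the edges at one vertex, separated by parity as in `split`.
      even odd : List (Fin n) → Vec Bool n → ℚ
      even []       v = 1ℚ
      even (j ∷ js) v = even js v + a * χ j v * odd js v
      odd []       v = 0ℚ
      odd (j ∷ js) v = odd js v + a * χ j v * even js v

      row : Fin n → List (Fin n) → Vec Bool n → ℚ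
      row i js = Π (map (λ j → scale a (ζ (i , j))) js)

      split : ∀ i js v → row i js v ≡ even js v + χ i v * odd js v
      split i []       v = sym (trans (cong (_+_ 1ℚ) (*-zeroʳ (χ i v))) (+-identityʳ 1ℚ))
      split i (j ∷ js) v = trans (cong ((1ℚ + a * (χ i v * χ j v)) *_) (split i js v))
        (trans (e (χ i v) (χ j v) (even js v) (odd js v) a)
          (cong (λ z → even js v + a * χ j v * z * odd js v + χ i v * (odd js v + a * χ j v * even js v)) (sgn² (lookup v i)))
        ) ⟨trans⟩ cong (λ z → even js v + z * odd js v + χ i v * (odd js v + a * χ j v * even js v)) (*-identityʳ (a * χ j v))
        where
        infixl 5 _⟨trans⟩_
        _⟨trans⟩_ : ∀ {x y z : ℚ} → x ≡ y → y ≡ z → x ≡ z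
        _⟨trans⟩_ = trans
        e : ∀ x z c o a → (1ℚ + a * (x * z)) * (c + x * o) ≡ c + a * z * (x * x) * o + x * (o + a * z * c)
        e = solve-∀ ℚ-ring

      flips : ∀ {i js} → All (i ≢_) js → ∀ v → even js (flip i v) ≡ even js v × odd js (flip i v) ≡ odd js v
      flips []       v = refl , refl
      flips (h ∷ hs) v = cong₂ _+_ (proj₁ (flips hs v)) (cong₂ (λ p q → a * p * q) (χ-flip-≢ h v) (proj₂ (flips hs v))) ,
                         cong₂ _+_ (proj₂ (flips hs v)) (cong₂ (λ p q → a * p * q) (χ-flip-≢ h v) (proj₁ (flips hs v)))

      G : List (Fin n) → Vec Bool n → ℚ
      G js = Π (map (scale (a * a)) (ζs js))

      0≤a² : 0ℚ ≤ a * a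
      0≤a² = 0≤a ⊛ 0≤a

      Pos-even-odd : ∀ js → Pos (even js) × Pos (odd js)
      Pos-even-odd [] = Pos-const 0≤1 , Pos-zero
      Pos-even-odd (j ∷ js) = let p , q = Pos-even-odd js in
        Pos-+ p (Pos-* (Pos-scale 0≤a (Pos-χ j)) q) , Pos-+ q (Pos-* (Pos-scale 0≤a (Pos-χ j)) p)

      Pos-G : ∀ js → Pos (G js)
      Pos-G js = Pos-Π (cube n) (Pos-scales (cube n) 0≤a² (Pos-ζs (pairs js)))

      Pos-s : ∀ js → Pos (s js)
      Pos-s js = Pos-σ₁ (cube n) (Pos-χs js)

      G-∷ : ∀ j js → (λ v → (1ℚ + a * a * (χ j v * s js v)) * G js v) ≼ G (j ∷ js)
      G-∷ j js = ≼-cong (λ v → cong (λ z → (1ℚ + z) * G js v) (lin js v))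
        (λ v → trans (sym (Π-++ (map f js) (map (scale (a * a)) (ζs js)) v)) (cong (λ l → Π l v) (sym (scaled-ζs (a * a) j js))))
        (≼-* (Pos-+ (Pos-const 0≤1) (Pos-σ₁ (cube n) (Pos-f {js}))) (Pos-G js) (1+σ₁≼Π (cube n) (Pos-f {js})) ≼-refl)
        where
        f : Fin n → Vec Bool n → ℚ
        f i = scale (a * a) (ζ (j , i))
        Pos-f : ∀ {js} → All Pos (map f js)
        Pos-f {[]}     = []
        Pos-f {i ∷ is} = Pos-scale 0≤a² (Pos-ζ (j , i)) ∷ Pos-f
        lin : ∀ js v → σ₁ (map f js) v ≡ a * a * (χ j v * s js v)
        lin []       v = sym (trans (cong (a * a *_) (*-zeroʳ (χ j v))) (*-zeroʳ (a * a)))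
        lin (i ∷ is) v = trans (cong (_+_ (a * a * (χ j v * χ i v))) (lin is v)) (e (a * a) (χ j v) (χ i v) (s is v))
          where e : ∀ c x z t → c * (x * z) + c * (x * t) ≡ c * (x * (z + t))
                e = solve-∀ ℚ-ring

      -- Every even set of vertices is a union of edges, so the even part is dominated by G.
      dominated : ∀ js → even js ≼ G js × odd js ≼ (λ v → a * s js v * G js v)
      dominated [] = ≼-reflexive (λ v → refl) , ≼-reflexive (λ v → sym (trans (cong (_* 1ℚ) (*-zeroʳ a)) refl))
      dominated (j ∷ js) = let p , q = dominated js in
        ≼-trans (≼-cong (λ _ → refl) (λ v → e₁ a (χ j v) (s js v) (G js v))
          (≼-+ p (≼-* (Pos-scale 0≤a (Pos-χ j)) (proj₂ (Pos-even-odd js)) ≼-refl q))) (G-∷ j js) ,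
        ≼-trans (≼-cong (λ _ → refl) (λ v → e₂ a (χ j v) (s js v) (G js v))
          (≼-+ q (≼-* (Pos-scale 0≤a (Pos-χ j)) (proj₁ (Pos-even-odd js)) ≼-refl p)))
          (≼-* (Pos-scale 0≤a (Pos-s (j ∷ js))) (Pos-G js) ≼-refl
            (≼-trans (mk≼ (Pos-cong (λ v → e₃ a (χ j v) (s js v) (G js v)) (Pos-* (Pos-scale 0≤a² (Pos-* (Pos-χ j) (Pos-s js))) (Pos-G js)))) (G-∷ j js)))
        where
        e₁ : ∀ a x t g → g + a * x * (a * t * g) ≡ (1ℚ + a * a * (x * t)) * g
        e₁ = solve-∀ ℚ-ring
        e₂ : ∀ a x t g → a * t * g + a * x * g ≡ a * (x + t) * g
        e₂ = solve-∀ ℚ-ring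
        e₃ : ∀ a x t g → a * a * (x * t) * g ≡ (1ℚ + a * a * (x * t)) * g - g
        e₃ = solve-∀ ℚ-ring

    Z : ℚ → List (Fin n) → ℚ
    Z a is = 𝔼 (Π (map (scale a) (ζs is)))

    0≤Z : ∀ {a} is → 0ℚ ≤ a → 0ℚ ≤ Z a is
    0≤Z is h = Pos⇒0≤𝔼 (Pos-Π (cube n) (Pos-scales (cube n) h (Pos-ζs (pairs is))))

    flip-Π : ∀ c {i is} → All (i ≢_) is → ∀ v → Π (map (scale c) (ζs is)) (flip i v) ≡ Π (map (scale c) (ζs is)) v
    flip-Π c {i} {[]} [] v = refl
    flip-Π c {i} {j ∷ js} (h ∷ hs) v = begin
      Π (map (scale c) (ζs (j ∷ js))) (flip i v)  ≡⟨ cong (λ l → Π l (flip i v)) (scaled-ζs c j js) ⟩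
      Π (r js ++ map (scale c) (ζs js)) (flip i v) ≡⟨ Π-++ (r js) _ (flip i v) ⟩
      Π (r js) (flip i v) * Π (map (scale c) (ζs js)) (flip i v) ≡⟨ cong₂ _*_ (go hs) (flip-Π c hs v) ⟩
      Π (r js) v * Π (map (scale c) (ζs js)) v ≡⟨ sym (Π-++ (r js) _ v) ⟩
      Π (r js ++ map (scale c) (ζs js)) v ≡⟨ cong (λ l → Π l v) (sym (scaled-ζs c j js)) ⟩
      Π (map (scale c) (ζs (j ∷ js))) v ∎
      where
      open ≡-Reasoning
      r : List (Fin n) → List (Vec Bool n → ℚ)
      r = map (λ k → scale c (ζ (j , k)))
      go : ∀ {ks} → All (i ≢_) ks → Π (r ks) (flip i v) ≡ Π (r ks) v
      go []       = refl
      go (g ∷ gs) = cong₂ (λ p q → (1ℚ + c * p) * q) (cong₂ _*_ (χ-flip-≢ h v) (χ-flip-≢ g v)) (go gs)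

    -- Averaging over the spin at `i` removes the odd part of its edges. The even part is dominated
    -- by couplings a² among the remaining vertices, and `merge` joins these with the couplings a
    -- already there.
    remove-vertex : ∀ {a b i is} → 0ℚ ≤ a → a + a * a ≤ b → All (i ≢_) is →
      Z a (i ∷ is) ≤ (1ℚ + a * a * a) ^ length (pairs is) * Z b is
    remove-vertex {a} {b} {i} {is} 0≤a h u = begin
      Z a (i ∷ is)
        ≡⟨ 𝔼-cong (λ v → trans (cong (λ l → Π l v) (scaled-ζs a i is)) (trans (Π-++ (map (λ j → scale a (ζ (i , j))) is) _ v)
             (trans (cong (_* P v) (split i is v)) (e (even is v) (χ i v) (odd is v) (P v))))) ⟩
      𝔼 (λ v → even is v * P v + χ i v * (odd is v * P v))
        ≡⟨ trans (𝔼-+ _ (λ v → χ i v * (odd is v * P v))) (trans (cong (_+_ (𝔼 (λ v → even is v * P v)))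
             (𝔼-odd i {λ v → odd is v * P v} (λ v → cong₂ _*_ (proj₂ (flips u v)) (flip-Π a u v)))) (+-identityʳ _)) ⟩
      𝔼 (λ v → even is v * P v)
        ≤⟨ ≼⇒𝔼≤ (≼-* (proj₁ (Pos-even-odd is)) Pos-P (proj₁ (dominated is)) ≼-refl) ⟩
      𝔼 (λ v → G is v * P v)
        ≤⟨ ≼⇒𝔼≤ (merge (cube n) 0≤a h (Pos-ζs (pairs is)) (ζs² (pairs is))) ⟩
      𝔼 (λ v → (1ℚ + a * a * a) ^ length (ζs is) * Π (map (scale b) (ζs is)) v)
        ≡⟨ trans (𝔼-* ((1ℚ + a * a * a) ^ length (ζs is)) _) (cong (λ m → (1ℚ + a * a * a) ^ m * Z b is) (length-map ζ (pairs is))) ⟩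
      (1ℚ + a * a * a) ^ length (pairs is) * Z b is ∎
      where
      open ≤-Reasoning
      open Row a 0≤a
      P : Vec Bool n → ℚ
      P = Π (map (scale a) (ζs is))
      Pos-P : Pos P
      Pos-P = Pos-Π (cube n) (Pos-scales (cube n) 0≤a (Pos-ζs (pairs is)))
      e : ∀ c x o p → (c + x * o) * p ≡ c * p + x * (o * p)
      e = solve-∀ ℚ-ring

    -- Removing a vertex replaces a by a + a², which lowers 1/a by at most 1.
    Z-crude : ∀ {κ K} M is {a} → Unique is → 0ℚ ≤ a → 1ℚ ≤ κ * K → 0ℚ < K → 0ℚ ≤ κ → a * (K + ι (length is)) ≤ 1ℚ →
      length is ℕ.* length is ℕ.≤ M → Z a is ≤ (1ℚ + κ * κ * κ) ^ (length is ℕ.* M)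
    Z-crude M [] u 0≤a κK 0<K 0≤κ h m = ≤-reflexive 𝔼-one
    Z-crude {κ} {K} M (i ∷ is) {a} (d ∷ u) 0≤a κK 0<K 0≤κ h m = begin
      Z a (i ∷ is)  ≤⟨ remove-vertex 0≤a ≤-refl d ⟩
      (1ℚ + a * a * a) ^ length (pairs is) * Z (a + a * a) is
        ≤⟨ *-mono (0≤^ (length (pairs is)) (0≤1 ⊕ 0≤a ⊛ 0≤a ⊛ 0≤a)) (0≤Z is (0≤a ⊕ 0≤a ⊛ 0≤a)) fac
             (Z-crude {κ} {K} M is u (0≤a ⊕ 0≤a ⊛ 0≤a) κK 0<K 0≤κ next (ℕ.≤-trans (ℕ.*-mono-≤ (ℕ.n≤1+n k) (ℕ.n≤1+n k)) m)) ⟩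
      (1ℚ + κ * κ * κ) ^ M * (1ℚ + κ * κ * κ) ^ (k ℕ.* M)  ≡⟨ sym (^-+ _ M (k ℕ.* M)) ⟩
      (1ℚ + κ * κ * κ) ^ (suc k ℕ.* M) ∎
      where
      open ≤-Reasoning
      k = length is
      T = K + ι k
      h′ : a * (1ℚ + T) ≤ 1ℚ
      h′ = subst (λ z → a * z ≤ 1ℚ) (trans (cong (_+_ K) (ι-suc k)) (e K (ι k))) h
        where e : ∀ K k → K + (1ℚ + k) ≡ 1ℚ + (K + k)
              e = solve-∀ ℚ-ring
      a≤κ : a ≤ κ
      a≤κ = *-cancel 0<K (≤-trans (≤-trans (*-monoˡ 0≤a (by-diff (1ℚ + ι k) (0≤1 ⊕ 0≤ι k) (e K (ι k)))) h′) κK)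
        where e : ∀ K k → 1ℚ + (K + k) - K ≡ 1ℚ + k
              e = solve-∀ ℚ-ring
      next : (a + a * a) * T ≤ 1ℚ
      next = begin
        (a + a * a) * T  ≤⟨ by-diff ((1ℚ + a) * (1ℚ - a * (1ℚ + T)) + a * a) ((0≤1 ⊕ 0≤a) ⊛ sub⁺ h′ ⊕ 0≤a ⊛ 0≤a) (e a T) ⟩
        1ℚ ∎
        where e : ∀ a T → 1ℚ - (a + a * a) * T ≡ (1ℚ + a) * (1ℚ - a * (1ℚ + T)) + a * a
              e = solve-∀ ℚ-ring
      pairs≤ : ∀ (is : List (Fin n)) → length (pairs is) ℕ.≤ length is ℕ.* length is
      pairs≤ []       = ℕ.z≤n
      pairs≤ (i ∷ is) = subst (ℕ._≤ suc (length is) ℕ.* suc (length is)) (sym (trans (length-++ (map (i ,_) is)) (cong (ℕ._+ length (pairs is)) (length-map (i ,_) is))))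
        (ℕ.+-mono-≤ (ℕ.n≤1+n (length is)) (ℕ.≤-trans (pairs≤ is) (ℕ.*-monoʳ-≤ (length is) (ℕ.n≤1+n (length is)))))
      fac : (1ℚ + a * a * a) ^ length (pairs is) ≤ (1ℚ + κ * κ * κ) ^ M
      fac = ≤-trans (^-mono (length (pairs is)) (0≤1 ⊕ 0≤a ⊛ 0≤a ⊛ 0≤a) (+-monoʳ-≤ 1ℚ (*-mono (0≤a ⊛ 0≤a) 0≤a (*-mono 0≤a 0≤a a≤κ a≤κ) a≤κ)))
        (^-monotone (≤-trans (≤-reflexive (sym (+-identityʳ 1ℚ))) (+-monoʳ-≤ 1ℚ (0≤κ ⊛ 0≤κ ⊛ 0≤κ)))
          (ℕ.≤-trans (pairs≤ is) (ℕ.≤-trans (ℕ.*-mono-≤ (ℕ.n≤1+n k) (ℕ.n≤1+n k)) m)))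

    -- For k vertices the coupling is 1/(3 k). `Z-crude` with K = 2 k and κ = 1/(2 k) bounds `Z` by
    -- (1 + κ³)^(k³); since k³ κ³ = 1/8, `bernoulli-inv` leaves at most 8/7.
    Z-bounded : ∀ {q} is → Unique is → 0ℚ ≤ q → q * ι (length is) ≡ 1ℚ → Z ((+ 1 / 3) * q) is ≤ + 2 / 1
    Z-bounded {q} is u 0≤q qk = *-cancel {c = + 7 / 8} (positive⁻¹ (+ 7 / 8)) (begin
      Z ((+ 1 / 3) * q) is * (+ 7 / 8)
        ≤⟨ *-monoʳ (nonNegative⁻¹ (+ 7 / 8)) (Z-crude {½ * q} {(+ 2 / 1) * K} (k ℕ.* k) is u (nonNegative⁻¹ (+ 1 / 3) ⊛ 0≤q)
             (≤-reflexive (sym (trans (e₁ q K) qk))) (positive⁻¹ (+ 2 / 1) ⊛< 0<K) (nonNegative⁻¹ ½ ⊛ 0≤q) (≤-reflexive (trans (e₂ q K) qk)) ℕ.≤-refl) ⟩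
      (1ℚ + x) ^ N * (+ 7 / 8)  ≡⟨ cong ((1ℚ + x) ^ N *_) (sym Nx) ⟩
      (1ℚ + x) ^ N * (1ℚ - ι N * x)  ≤⟨ bernoulli-inv N (nonNegative⁻¹ ½ ⊛ 0≤q ⊛ (nonNegative⁻¹ ½ ⊛ 0≤q) ⊛ (nonNegative⁻¹ ½ ⊛ 0≤q)) ⟩
      1ℚ  ≤⟨ p ⟩
      (+ 2 / 1) * (+ 7 / 8) ∎)
      where
      open ≤-Reasoning
      open import Data.Integer.Base using (+≤+)
      open import Relation.Nullary.Decidable using (from-yes)
      p : 1ℚ ≤ (+ 2 / 1) * (+ 7 / 8)
      p = from-yes (1ℚ ≤? (+ 2 / 1) * (+ 7 / 8))
      k N : ℕ
      k = length is
      N = k ℕ.* (k ℕ.* k)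
      K x : ℚ
      K = ι k
      x = ½ * q * (½ * q) * (½ * q)
      0<K : 0ℚ < K
      0<K with <-cmp 0ℚ K
      ... | tri< h _ _ = h
      ... | tri≈ _ h _ = contradiction (trans (sym qk) (trans (cong (q *_) (sym h)) (*-zeroʳ q))) λ ()
      ... | tri> _ _ h = contradiction (<-≤-trans h (0≤ι k)) (<-irrefl refl)
      e₁ : ∀ q k → ½ * q * ((+ 2 / 1) * k) ≡ q * k
      e₁ = solve-∀ ℚ-ring
      e₂ : ∀ q k → (+ 1 / 3) * q * ((+ 2 / 1) * k + k) ≡ q * k
      e₂ = solve-∀ ℚ-ring
      e₃ : ∀ q k → 1ℚ - k * (k * k) * (½ * q * (½ * q) * (½ * q)) ≡ 1ℚ - (+ 1 / 8) * (q * k * (q * k) * (q * k))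
      e₃ = solve-∀ ℚ-ring
      Nx : 1ℚ - ι N * x ≡ + 7 / 8
      Nx = trans (cong (λ z → 1ℚ - z * x) (trans (ι-* k (k ℕ.* k)) (cong (K *_) (ι-* k k)))) (trans (e₃ q K) (trans (cong (λ z → 1ℚ - (+ 1 / 8) * (z * z * z)) qk) refl))

-- Negative and positive small couplings: the triangle term

module Antiferromagnet where
  open Rationals
  open Fourier
  open Spins
  open PartitionFunction
  open import Data.Bool.Base using (Bool)
  open import Data.Fin.Base using (Fin)
  open import Data.Integer.Base using (+_)
  open import Data.List.Base using (List; []; _∷_; map; length)
  open import Data.List.Properties using (length-map)
  open import Data.List.Relation.Unary.All as All using (All; []; _∷_)
  import Data.List.Relation.Unary.All.Properties as All
  open import Data.List.Relation.Unary.AllPairs.Core using ([]; _∷_)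
  open import Data.List.Relation.Unary.Unique.Propositional using (Unique)
  open import Data.List.Relation.Binary.Pointwise.Base using (Pointwise; []; _∷_)
  open import Data.Rational
  open import Data.Rational.Properties
  open import Data.Vec.Base using (Vec; lookup)

  module _ {n : ℕ} where
    open Ops (cube n)

    -- Two distinct edges never multiply to a constant. In moments: `newton₂` turns the mean into
    -- half of 𝔼 y² minus the number of edges, and these agree.
    𝔼-σ₂ζs : ∀ {is : List (Fin n)} → Unique is → 𝔼 (σ₂ (ζs is)) ≡ 0ℚ
    𝔼-σ₂ζs {is} u = begin
      𝔼 (σ₂ (ζs is))   ≡⟨ 𝔼-cong (λ v → trans (e₁ (σ₂ (ζs is) v)) (cong (½ *_) (newton₂ (ζs is) v (ζs² (pairs is) v)))) ⟩
      𝔼 (λ v → ½ * (y is v * y is v - N))  ≡⟨ trans (𝔼-* ½ _) (cong (½ *_) (trans (𝔼-- (λ v → y is v * y is v) (λ _ → N)) (cong₂ _-_ (𝔼-y² u) (trans (𝔼-const N) N≡)))) ⟩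
      ½ * (½ * (ι k * (ι k - 1ℚ)) - ½ * (ι k * (ι k - 1ℚ)))  ≡⟨ e₂ (½ * (ι k * (ι k - 1ℚ))) ⟩
      0ℚ ∎
      where
      open ≡-Reasoning
      k = length is
      N = ι (length (ζs is))
      e₁ : ∀ a → a ≡ ½ * ((+ 2 / 1) * a)
      e₁ = solve-∀ ℚ-ring
      e₂ : ∀ a → ½ * (a - a) ≡ 0ℚ
      e₂ = solve-∀ ℚ-ring
      N≡ : N ≡ ½ * (ι k * (ι k - 1ℚ))
      N≡ = trans (cong ι (length-map ζ (pairs is))) (trans (e₁ (ι (length (pairs is)))) (cong (½ *_) (length-pairs is)))

    𝔼-σ₃ζs : ∀ {is : List (Fin n)} → Unique is → (+ 6 / 1) * 𝔼 (σ₃ (ζs is)) ≡ ι (length is) * (ι (length is) - 1ℚ) * (ι (length is) - (+ 2 / 1))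
    𝔼-σ₃ζs {is} u = begin
      (+ 6 / 1) * 𝔼 (σ₃ (ζs is))           ≡⟨ sym (𝔼-* (+ 6 / 1) (σ₃ (ζs is))) ⟩
      𝔼 (λ v → (+ 6 / 1) * σ₃ (ζs is) v)   ≡⟨ 𝔼-cong (λ v → newton₃ (ζs is) v (ζs² (pairs is) v)) ⟩
      𝔼 (λ v → y is v * y is v * y is v - (+ 3 / 1) * N * y is v + (+ 2 / 1) * y is v)
        ≡⟨ trans (𝔼-+ (λ v → y is v * y is v * y is v - (+ 3 / 1) * N * y is v) (scale (+ 2 / 1) (y is)))
             (cong₂ _+_ (trans (𝔼-- (λ v → y is v * y is v * y is v) (scale ((+ 3 / 1) * N) (y is)))
                (cong₂ _-_ (𝔼-y³ u) (trans (𝔼-* ((+ 3 / 1) * N) (y is)) (cong ((+ 3 / 1) * N *_) (𝔼-y u)))))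
                (trans (𝔼-* (+ 2 / 1) (y is)) (cong ((+ 2 / 1) *_) (𝔼-y u)))) ⟩
      K - (+ 3 / 1) * N * 0ℚ + (+ 2 / 1) * 0ℚ  ≡⟨ e K N ⟩
      K ∎
      where
      open ≡-Reasoning
      k = length is
      K = ι k * (ι k - 1ℚ) * (ι k - (+ 2 / 1))
      N = ι (length (ζs is))
      e : ∀ a N → a - (+ 3 / 1) * N * 0ℚ + (+ 2 / 1) * 0ℚ ≡ a
      e = solve-∀ ℚ-ring

    module _ {is : List (Fin n)} (u : Unique is) {q : ℚ} (0≤q : 0ℚ ≤ q) (qk : q * ι (length is) ≡ 1ℚ) where
      private
        b : ℚ
        b = (+ 1 / 3) * q
        gs : List (Vec Bool n → ℚ)
        gs = map (scale b) (ζs is)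
        0≤b : 0ℚ ≤ b
        0≤b = nonNegative⁻¹ (+ 1 / 3) ⊛ 0≤q
        σ₁gs : 𝔼 (σ₁ gs) ≡ 0ℚ
        σ₁gs = trans (𝔼-cong (σ₁-scale b (ζs is))) (trans (𝔼-* b (y is)) (trans (cong (b *_) (𝔼-y u)) (*-zeroʳ b)))
        σ₂gs : 𝔼 (σ₂ gs) ≡ 0ℚ
        σ₂gs = trans (𝔼-cong (σ₂-scale b (ζs is))) (trans (𝔼-* (b * b) (σ₂ (ζs is))) (trans (cong (b * b *_) (𝔼-σ₂ζs u)) (*-zeroʳ (b * b))))

      𝔼-Π-bound : ∀ {c fs} → 0ℚ ≤ c → c ≤ 1ℚ → Pointwise (λ f e → f ◁ scale (c * b) (ζ e)) fs (pairs is) →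
        𝔼 (Π fs) ≤ 1ℚ + 𝔼 (σ₃ fs) + c * c * c * c * (+ 2 / 1)
      𝔼-Π-bound {c} {fs} 0≤c c≤1 h = ≤-trans
        (𝔼-Π≤ (cube n) 0≤c c≤1 (Pos-scales (cube n) 0≤b (Pos-ζs (pairs is))) (go h) σ₁gs σ₂gs)
        (+-monoʳ-≤ (1ℚ + 𝔼 (σ₃ fs)) (*-monoˡ (0≤c ⊛ 0≤c ⊛ 0≤c ⊛ 0≤c) (Z-bounded is u 0≤q qk)))
        where
        go : ∀ {fs es} → Pointwise (λ f e → f ◁ scale (c * b) (ζ e)) fs es → Pointwise (λ f g → f ◁ scale c g) fs (map (scale b) (map ζ es))
        go []       = []
        go {es = e ∷ _} (p ∷ ps) = ◁-cong (λ _ → refl) (λ v → *-assoc c b (ζ e v)) p ∷ go ps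

      -- The couplings are those of `Z-bounded` scaled by - c with c = 3 β, so the tail is at most 2
      -- (3 β)⁴ = 162 β⁴. The cubic term is exact, minus one τ³ for every triangle.
      antiferromagnetic : ∀ {β} → 0ℚ ≤ β → (+ 3 / 1) * β ≤ 1ℚ →
        Z (- (β * q)) is ≤ 1ℚ - (+ 1 / 6) * (β * q * (β * q) * (β * q)) * (ι (length is) * (ι (length is) - 1ℚ) * (ι (length is) - (+ 2 / 1))) + (+ 162 / 1) * (β * β * β * β)
      antiferromagnetic {β} 0≤β c≤1 = ≤-trans (𝔼-Π-bound (nonNegative⁻¹ (+ 3 / 1) ⊛ 0≤β) c≤1 (go (pairs is))) (≤-reflexive (cong₂ (λ a b → 1ℚ + a + b) third (e₃ β)))
        where
        τ = β * q
        e₁ : ∀ β q z → β * q * z ≡ (+ 3 / 1) * β * ((+ 1 / 3) * q) * z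
        e₁ = solve-∀ ℚ-ring
        e₂ : ∀ a z → - (a * z) ≡ - a * z
        e₂ = solve-∀ ℚ-ring
        e₃ : ∀ β → (+ 3 / 1) * β * ((+ 3 / 1) * β) * ((+ 3 / 1) * β) * ((+ 3 / 1) * β) * (+ 2 / 1) ≡ (+ 162 / 1) * (β * β * β * β)
        e₃ = solve-∀ ℚ-ring
        e₄ : ∀ t s → - t * - t * - t * s ≡ - ((+ 1 / 6) * (t * t * t) * ((+ 6 / 1) * s))
        e₄ = solve-∀ ℚ-ring
        go : ∀ es → Pointwise (λ f e → f ◁ scale ((+ 3 / 1) * β * b) (ζ e)) (map (scale (- τ)) (map ζ es)) es
        go []       = []
        go (e ∷ es) = ◁-cong (λ v → e₂ τ (ζ e v)) (λ v → e₁ β q (ζ e v)) (◁-neg (Pos⇒◁ (Pos-scale (0≤β ⊛ 0≤q) (Pos-ζ e)))) ∷ go es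
        third : 𝔼 (σ₃ (map (scale (- τ)) (ζs is))) ≡ - ((+ 1 / 6) * (τ * τ * τ) * (ι (length is) * (ι (length is) - 1ℚ) * (ι (length is) - (+ 2 / 1))))
        third = trans (𝔼-cong (σ₃-scale (- τ) (ζs is))) (trans (𝔼-* (- τ * - τ * - τ) (σ₃ (ζs is)))
          (trans (e₄ τ (𝔼 (σ₃ (ζs is)))) (cong (λ z → - ((+ 1 / 6) * (τ * τ * τ) * z)) (𝔼-σ₃ζs u))))

      -- Each edge has its own coupling, at most `t`. The cubic term is therefore only bounded, but
      -- by the third moment of the actual total: in this form the couplings can later be changed
      -- one edge at a time.
      ferromagnetic : ∀ {t fs} → 0ℚ ≤ t → (+ 3 / 1) * (t * ι (length is)) ≤ 1ℚ → Pointwise (λ f e → Pos f × f ≼ scale t (ζ e)) fs (pairs is) →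
        𝔼 (Π fs) ≤ 1ℚ + (+ 162 / 1) * (t * ι (length is)) ^ 4 + (+ 1 / 6) * 𝔼 (λ v → σ₁ fs v * σ₁ fs v * σ₁ fs v)
      ferromagnetic {t} {fs} 0≤t c≤1 h = begin
        𝔼 (Π fs)  ≤⟨ 𝔼-Π-bound (nonNegative⁻¹ (+ 3 / 1) ⊛ (0≤t ⊛ 0≤ι k)) c≤1 (go h) ⟩
        1ℚ + 𝔼 (σ₃ fs) + c * c * c * c * (+ 2 / 1)
          ≤⟨ +-monoˡ-≤ _ (+-monoʳ-≤ 1ℚ (≤-trans (≤-reflexive (e₅ (𝔼 (σ₃ fs)))) (*-monoˡ (nonNegative⁻¹ (+ 1 / 6))
               (≤-trans (≤-reflexive (sym (𝔼-* (+ 6 / 1) (σ₃ fs)))) (≼⇒𝔼≤ (σ₃≼ (cube n) (all-pos h))))))) ⟩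
        1ℚ + (+ 1 / 6) * 𝔼 (λ v → σ₁ fs v * σ₁ fs v * σ₁ fs v) + c * c * c * c * (+ 2 / 1)
          ≡⟨ e₆ (t * ι k) (𝔼 (λ v → σ₁ fs v * σ₁ fs v * σ₁ fs v)) ⟩
        1ℚ + (+ 162 / 1) * (t * ι k) ^ 4 + (+ 1 / 6) * 𝔼 (λ v → σ₁ fs v * σ₁ fs v * σ₁ fs v) ∎
        where
        open ≤-Reasoning
        k = length is
        c = (+ 3 / 1) * (t * ι k)
        e₄ : ∀ t q k z → t * (q * k) * z ≡ (+ 3 / 1) * (t * k) * ((+ 1 / 3) * q) * z
        e₄ = solve-∀ ℚ-ring
        e₅ : ∀ a → a ≡ (+ 1 / 6) * ((+ 6 / 1) * a)
        e₅ = solve-∀ ℚ-ring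
        e₆ : ∀ x a → 1ℚ + (+ 1 / 6) * a + (+ 3 / 1) * x * ((+ 3 / 1) * x) * ((+ 3 / 1) * x) * ((+ 3 / 1) * x) * (+ 2 / 1) ≡ 1ℚ + (+ 162 / 1) * (x * (x * (x * (x * 1ℚ)))) + (+ 1 / 6) * a
        e₆ = solve-∀ ℚ-ring
        all-pos : ∀ {fs es} → Pointwise (λ f e → Pos f × f ≼ scale t (ζ e)) fs es → All Pos fs
        all-pos []             = []
        all-pos ((p , _) ∷ ps) = p ∷ all-pos ps
        go : ∀ {fs es} → Pointwise (λ f e → Pos f × f ≼ scale t (ζ e)) fs es → Pointwise (λ f e → f ◁ scale (c * b) (ζ e)) fs es
        go []                           = []
        go {es = e ∷ _} ((p , l) ∷ ps) = ◁-cong (λ _ → refl) (λ v → trans (cong (_* ζ e v) (sym (trans (cong (t *_) qk) (*-identityʳ t)))) (e₄ t q (ι k) (ζ e v))) (≼⇒◁ p l) ∷ go ps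

    𝔼-ζ : ∀ {is : List (Fin n)} → Unique is → All (λ e → 𝔼 (ζ e) ≡ 0ℚ) (pairs is)
    𝔼-ζ []      = []
    𝔼-ζ {i ∷ is} (h ∷ u) = All.++⁺ (All.map⁺ (All.map (λ {j} i≢j → 𝔼-odd i {χ j} (χ-flip-≢ i≢j)) h)) (𝔼-ζ u)

    𝔼-χs : ∀ {is : List (Fin n)} → Unique is → All (λ j → 𝔼 (λ v → χ j v * s is v) ≡ 1ℚ) is
    𝔼-χs [] = []
    𝔼-χs {i ∷ is} (h ∷ u) = here ∷ All.zipWith there (h , 𝔼-χs u)
      where
      e : ∀ a b c → a * (b + c) ≡ b * a + a * c
      e = solve-∀ ℚ-ring
      here : 𝔼 (λ v → χ i v * s (i ∷ is) v) ≡ 1ℚ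
      here = trans (𝔼-cong λ v → trans (e (χ i v) (χ i v) (s is v)) (cong (_+ χ i v * s is v) (sgn² (lookup v i))))
        (trans (𝔼-+ (λ _ → 1ℚ) (λ v → χ i v * s is v)) (cong₂ _+_ 𝔼-one (𝔼-odd i {s is} (s-flip h))))
      there : ∀ {j} → i ≢ j × 𝔼 (λ v → χ j v * s is v) ≡ 1ℚ → 𝔼 (λ v → χ j v * s (i ∷ is) v) ≡ 1ℚ
      there {j} (i≢j , p) = trans (𝔼-cong λ v → e (χ j v) (χ i v) (s is v))
        (trans (𝔼-+ (λ v → χ i v * χ j v) (λ v → χ j v * s is v)) (cong₂ _+_ (𝔼-odd i {χ j} (χ-flip-≢ i≢j)) p))

    ζ-flip : ∀ {i : Fin n} {js} → All (i ≢_) js → All (λ e → ∀ v → ζ e (flip i v) ≡ ζ e v) (pairs js)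
    ζ-flip []       = []
    ζ-flip (g ∷ gs) = All.++⁺ (All.map⁺ (All.map (λ g′ v → cong₂ _*_ (χ-flip-≢ g v) (χ-flip-≢ g′ v)) gs)) (ζ-flip gs)

    𝔼-ζy : ∀ {is : List (Fin n)} → Unique is → All (λ e → 𝔼 (λ v → ζ e v * y is v) ≡ 1ℚ) (pairs is)
    𝔼-ζy [] = []
    𝔼-ζy {i ∷ is} (h ∷ u) = All.++⁺ (All.map⁺ (All.zipWith here (h , 𝔼-χs u))) (All.zipWith there (𝔼-ζy u , ζ-flip h))
      where
      e₁ : ∀ a b c d → a * b * (a * c + d) ≡ a * a * (b * c) + a * (b * d)
      e₁ = solve-∀ ℚ-ring
      e₂ : ∀ a b c d → b * (a * c + d) ≡ a * (b * c) + b * d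
      e₂ = solve-∀ ℚ-ring
      here : ∀ {j} → i ≢ j × 𝔼 (λ v → χ j v * s is v) ≡ 1ℚ → 𝔼 (λ v → ζ (i , j) v * y (i ∷ is) v) ≡ 1ℚ
      here {j} (i≢j , p) = trans (𝔼-cong λ v → trans (cong (ζ (i , j) v *_) (y-∷ i is v)) (trans (e₁ (χ i v) (χ j v) (s is v) (y is v)) (cong (λ z → z * (χ j v * s is v) + χ i v * (χ j v * y is v)) (sgn² (lookup v i)))))
        (trans (𝔼-+ (scale 1ℚ (λ v → χ j v * s is v)) (λ v → χ i v * (χ j v * y is v)))
          (cong₂ _+_ (trans (𝔼-* 1ℚ (λ v → χ j v * s is v)) (cong (1ℚ *_) p)) (𝔼-odd i {λ v → χ j v * y is v} λ v → cong₂ _*_ (χ-flip-≢ i≢j v) (y-flip h v))))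
      there : ∀ {e} → 𝔼 (λ v → ζ e v * y is v) ≡ 1ℚ × (∀ v → ζ e (flip i v) ≡ ζ e v) → 𝔼 (λ v → ζ e v * y (i ∷ is) v) ≡ 1ℚ
      there {e} (p , f) = trans (𝔼-cong λ v → trans (cong (ζ e v *_) (y-∷ i is v)) (e₂ (χ i v) (ζ e v) (s is v) (y is v)))
        (trans (𝔼-+ (λ v → χ i v * (ζ e v * s is v)) (λ v → ζ e v * y is v)) (cong₂ _+_ (𝔼-odd i {λ v → ζ e v * s is v} λ v → cong₂ _*_ (f v) (s-flip h v)) p))

    -- Counts the vertices i and edges e with χⱼ χᵢ ζₑ constant, which forces e to join i and j.
    -- Used for the edges at the new vertex in `𝔼-ζy²`.
    𝔼-χsy : ∀ {is : List (Fin n)} → Unique is → All (λ j → 𝔼 (λ v → χ j v * (s is v * y is v)) ≡ ι (length is) - 1ℚ) is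
    𝔼-χsy [] = []
    𝔼-χsy {i ∷ is} (h ∷ u) = here ∷ All.zipWith there (h , All.zip (𝔼-χs u , 𝔼-χsy u))
      where
      k = ι (length is)
      e₁ : ∀ a b c → a * ((a + b) * (a * b + c)) ≡ a * (a * a * b + b * c) + a * a * (b * b + c)
      e₁ = solve-∀ ℚ-ring
      e₂ : ∀ a b c d → b * ((a + c) * (a * c + d)) ≡ a * (b * (d + c * c)) + (a * a * (b * c) + b * (c * d))
      e₂ = solve-∀ ℚ-ring
      e₃ : ∀ k → 0ℚ + 1ℚ * (k + 0ℚ) ≡ 1ℚ + k - 1ℚ
      e₃ = solve-∀ ℚ-ring
      e₄ : ∀ k → 0ℚ + (1ℚ * 1ℚ + (k - 1ℚ)) ≡ 1ℚ + k - 1ℚ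
      e₄ = solve-∀ ℚ-ring
      f g : Vec Bool n → ℚ
      f v = 1ℚ * s is v + s is v * y is v
      g v = s is v * s is v + y is v
      here : 𝔼 (λ v → χ i v * (s (i ∷ is) v * y (i ∷ is) v)) ≡ ι (length (i ∷ is)) - 1ℚ
      here = trans (𝔼-cong λ v → trans (cong (λ z → χ i v * (s (i ∷ is) v * z)) (y-∷ i is v)) (trans (e₁ (χ i v) (s is v) (y is v)) (cong (λ z → χ i v * (z * s is v + s is v * y is v) + z * g v) (sgn² (lookup v i)))))
        (trans (𝔼-+ (λ v → χ i v * f v) (scale 1ℚ g))
        (trans (cong₂ _+_ (𝔼-odd i {f} (λ v → cong₂ (λ a b → 1ℚ * a + a * b) (s-flip h v) (y-flip h v))) (trans (𝔼-* 1ℚ g) (cong (1ℚ *_) (trans (𝔼-+ (λ v → s is v * s is v) (y is)) (cong₂ _+_ (𝔼-s² u) (𝔼-y u))))))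
        (trans (e₃ k) (cong (_- 1ℚ) (sym (ι-suc (length is)))))))
      there : ∀ {j} → i ≢ j × 𝔼 (λ v → χ j v * s is v) ≡ 1ℚ × 𝔼 (λ v → χ j v * (s is v * y is v)) ≡ k - 1ℚ →
        𝔼 (λ v → χ j v * (s (i ∷ is) v * y (i ∷ is) v)) ≡ ι (length (i ∷ is)) - 1ℚ
      there {j} (i≢j , p , q) = trans (𝔼-cong λ v → trans (cong (λ z → χ j v * (s (i ∷ is) v * z)) (y-∷ i is v)) (trans (e₂ (χ i v) (χ j v) (s is v) (y is v)) (cong (λ z → χ i v * (χ j v * (y is v + s is v * s is v)) + (z * (χ j v * s is v) + χ j v * (s is v * y is v))) (sgn² (lookup v i)))))
        (trans (𝔼-+ (λ v → χ i v * (χ j v * (y is v + s is v * s is v))) (λ v → 1ℚ * (χ j v * s is v) + χ j v * (s is v * y is v)))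
        (trans (cong₂ _+_ (𝔼-odd i {λ v → χ j v * (y is v + s is v * s is v)} (λ v → cong₂ _*_ (χ-flip-≢ i≢j v) (cong₂ (λ a b → b + a * a) (s-flip h v) (y-flip h v))))
           (trans (𝔼-+ (scale 1ℚ (λ v → χ j v * s is v)) (λ v → χ j v * (s is v * y is v))) (cong₂ _+_ (trans (𝔼-* 1ℚ (λ v → χ j v * s is v)) (cong (1ℚ *_) p)) q)))
        (trans (e₄ k) (cong (_- 1ℚ) (sym (ι-suc (length is)))))))

    -- Counts ordered pairs of edges that complete e to a triangle, two for each of the other k - 2
    -- vertices. It measures how strongly the third moment depends on one edge.
    𝔼-ζy² : ∀ {is : List (Fin n)} → Unique is → All (λ e → 𝔼 (λ v → ζ e v * (y is v * y is v)) ≡ (+ 2 / 1) * (ι (length is) - (+ 2 / 1))) (pairs is)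
    𝔼-ζy² [] = []
    𝔼-ζy² {i ∷ is} (h ∷ u) = All.++⁺ (All.map⁺ (All.zipWith here (h , 𝔼-χsy u))) (All.zipWith (λ (a , z) → there a z) (All.zip (ζ-flip h , All.zip (𝔼-ζy u , 𝔼-ζy² u)) , 𝔼-ζ u))
      where
      k = ι (length is)
      e₁ : ∀ a b c d → a * b * ((a * c + d) * (a * c + d)) ≡ a * (a * a * (b * (c * c)) + b * (d * d)) + a * a * ((+ 2 / 1) * (b * (c * d)))
      e₁ = solve-∀ ℚ-ring
      e₂ : ∀ a z c d → z * ((a * c + d) * (a * c + d)) ≡ a * (z * ((+ 2 / 1) * (c * d))) + (a * a * (z * (c * c)) + z * (d * d))
      e₂ = solve-∀ ℚ-ring
      e₃ : ∀ k → 0ℚ + 1ℚ * ((+ 2 / 1) * (k - 1ℚ)) ≡ (+ 2 / 1) * (1ℚ + k - (+ 2 / 1))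
      e₃ = solve-∀ ℚ-ring
      e₄ : ∀ k → 0ℚ + (1ℚ * ((+ 2 / 1) * 1ℚ + k * 0ℚ) + (+ 2 / 1) * (k - (+ 2 / 1))) ≡ (+ 2 / 1) * (1ℚ + k - (+ 2 / 1))
      e₄ = solve-∀ ℚ-ring
      here : ∀ {j} → i ≢ j × 𝔼 (λ v → χ j v * (s is v * y is v)) ≡ k - 1ℚ →
        𝔼 (λ v → ζ (i , j) v * (y (i ∷ is) v * y (i ∷ is) v)) ≡ (+ 2 / 1) * (ι (length (i ∷ is)) - (+ 2 / 1))
      here {j} (i≢j , p) = trans (𝔼-cong λ v → trans (cong (λ z → ζ (i , j) v * (z * z)) (y-∷ i is v)) (trans (e₁ (χ i v) (χ j v) (s is v) (y is v)) (cong (λ z → χ i v * (z * (χ j v * (s is v * s is v)) + χ j v * (y is v * y is v)) + z * ((+ 2 / 1) * g v)) (sgn² (lookup v i)))))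
        (trans (𝔼-+ (λ v → χ i v * f v) (scale 1ℚ (scale (+ 2 / 1) g)))
        (trans (cong₂ _+_ (𝔼-odd i {f} (λ v → cong₂ (λ c w → 1ℚ * (c * (proj₁ w * proj₁ w)) + c * (proj₂ w * proj₂ w)) (χ-flip-≢ i≢j v) (cong₂ _,_ (s-flip h v) (y-flip h v))))
           (trans (𝔼-* 1ℚ (scale (+ 2 / 1) g)) (cong (1ℚ *_) (trans (𝔼-* (+ 2 / 1) g) (cong ((+ 2 / 1) *_) p)))))
        (trans (e₃ k) (cong (λ z → (+ 2 / 1) * (z - (+ 2 / 1))) (sym (ι-suc (length is)))))))
        where
        f g : Vec Bool n → ℚ
        f v = 1ℚ * (χ j v * (s is v * s is v)) + χ j v * (y is v * y is v)
        g v = χ j v * (s is v * y is v)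
      there : ∀ {e} → (∀ v → ζ e (flip i v) ≡ ζ e v) × 𝔼 (λ v → ζ e v * y is v) ≡ 1ℚ × 𝔼 (λ v → ζ e v * (y is v * y is v)) ≡ (+ 2 / 1) * (k - (+ 2 / 1)) →
        𝔼 (ζ e) ≡ 0ℚ → 𝔼 (λ v → ζ e v * (y (i ∷ is) v * y (i ∷ is) v)) ≡ (+ 2 / 1) * (ι (length (i ∷ is)) - (+ 2 / 1))
      there {e} (f , p , q) z = trans (𝔼-cong λ v → trans (cong (λ z → ζ e v * (z * z)) (y-∷ i is v)) (trans (e₂ (χ i v) (ζ e v) (s is v) (y is v)) (cong₂ (λ a b → χ i v * (ζ e v * ((+ 2 / 1) * (s is v * y is v))) + (a * (ζ e v * b) + ζ e v * (y is v * y is v))) (sgn² (lookup v i)) (s² is v))))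
        (trans (𝔼-+ (λ v → χ i v * (ζ e v * ((+ 2 / 1) * (s is v * y is v)))) _)
        (trans (cong₂ _+_ (𝔼-odd i {λ v → ζ e v * ((+ 2 / 1) * (s is v * y is v))} (λ v → cong₂ _*_ (f v) (cong₂ (λ a b → (+ 2 / 1) * (a * b)) (s-flip h v) (y-flip h v))))
           (trans (𝔼-+ (scale 1ℚ (λ v → ζ e v * ((+ 2 / 1) * y is v + k))) (λ v → ζ e v * (y is v * y is v))) (cong₂ _+_ (trans (𝔼-* 1ℚ _) (cong (1ℚ *_) lin)) q)))
        (trans (e₄ k) (cong (λ z → (+ 2 / 1) * (z - (+ 2 / 1))) (sym (ι-suc (length is)))))))
        where
        e₅ : ∀ a b k → a * ((+ 2 / 1) * b + k) ≡ (+ 2 / 1) * (a * b) + k * a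
        e₅ = solve-∀ ℚ-ring
        lin : 𝔼 (λ v → ζ e v * ((+ 2 / 1) * y is v + k)) ≡ (+ 2 / 1) * 1ℚ + k * 0ℚ
        lin = trans (𝔼-cong λ v → e₅ (ζ e v) (y is v) k) (trans (𝔼-+ (scale (+ 2 / 1) (λ v → ζ e v * y is v)) (scale k (ζ e)))
          (cong₂ _+_ (trans (𝔼-* (+ 2 / 1) (λ v → ζ e v * y is v)) (cong ((+ 2 / 1) *_) p)) (trans (𝔼-* k (ζ e)) (cong (k *_) z))))

-- Mixtures of couplings and their replacement edge by edge

module Mixtures where
  open Rationals
  open Fourier
  open Spins
  open import Data.Bool.Base using (Bool)
  open import Data.Fin.Base using (Fin)
  open import Data.Integer.Base using (+_)
  open import Data.List.Base using (List; []; _∷_; map; length)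
  open import Data.List.Relation.Unary.All using (All; []; _∷_)
  open import Data.List.Relation.Binary.Pointwise.Base using (Pointwise; []; _∷_)
  open import Data.Rational
  open import Data.Rational.Properties
  open import Data.Vec.Base using (Vec)

  -- The integral against the finite measure with mass w at t. The total mass need not be 1; it
  -- becomes the blue weight ω of an edge.
  mixture : List (ℚ × ℚ) → (ℚ → ℚ) → ℚ
  mixture []             F = 0ℚ
  mixture ((w , t) ∷ ws) F = w * F t + mixture ws F

  Weights : ℚ → List (ℚ × ℚ) → Set
  Weights b = All (λ wt → 0ℚ ≤ proj₁ wt × 0ℚ ≤ proj₂ wt × proj₂ wt ≤ b)

  mixture-cong : ∀ ws {F G} → (∀ t → F t ≡ G t) → mixture ws F ≡ mixture ws G
  mixture-cong []             h = refl
  mixture-cong ((w , t) ∷ ws) h = cong₂ _+_ (cong (w *_) (h t)) (mixture-cong ws h)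

  mixture-mono : ∀ {b ws F G} → Weights b ws → (∀ t → 0ℚ ≤ t → t ≤ b → F t ≤ G t) → mixture ws F ≤ mixture ws G
  mixture-mono []                   h = ≤-refl
  mixture-mono ((p , q , r) ∷ ps) h = +-mono-≤ (*-monoˡ p (h _ q r)) (mixture-mono ps h)

  mixture-* : ∀ ws c F → mixture ws (λ t → c * F t) ≡ c * mixture ws F
  mixture-* []             c F = sym (*-zeroʳ c)
  mixture-* ((w , t) ∷ ws) c F = trans (cong (_+_ (w * (c * F t))) (mixture-* ws c F)) (e w c (F t) (mixture ws F))
    where e : ∀ w c f m → w * (c * f) + c * m ≡ c * (w * f + m)
          e = solve-∀ ℚ-ring

  𝔼-mixture : ∀ {X} (S : Space X) ws (F : ℚ → X → ℚ) → Ops.𝔼 S (λ x → mixture ws (λ t → F t x)) ≡ mixture ws (λ t → Ops.𝔼 S (F t))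
  𝔼-mixture S []             F = Ops.𝔼-const S 0ℚ
  𝔼-mixture S ((w , t) ∷ ws) F = trans (𝔼-+ (scale w (F t)) (λ x → mixture ws (λ t → F t x))) (cong₂ _+_ (𝔼-* w (F t)) (𝔼-mixture S ws F))
    where open Ops S

  ∏L : ∀ {A : Set} → (A → ℚ) → List A → ℚ
  ∏L f []       = 1ℚ
  ∏L f (e ∷ es) = f e * ∏L f es

  module _ {n : ℕ} (ws : List (ℚ × ℚ)) where
    open Ops (cube n)
    Fun = Vec Bool n → ℚ

    -- The coupling t is chosen once for the edge and shared by all d coordinates; the mixture
    -- stands outside the product.
    edge-factor : ∀ {d} → Vec (Vec Bool n) d → Fin n × Fin n → ℚ
    edge-factor x e = mixture ws λ t → ∏ (λ v → 1ℚ + scale t (ζ e) v) x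

    Mix : List (Fin n × Fin n) → (List Fun → ℚ) → ℚ
    Mix []       Ψ = Ψ []
    Mix (e ∷ es) Ψ = mixture ws λ t → Mix es λ l → Ψ (scale t (ζ e) ∷ l)

    Mix-cong : ∀ es {Ψ Φ} → (∀ l → Ψ l ≡ Φ l) → Mix es Ψ ≡ Mix es Φ
    Mix-cong []       h = h []
    Mix-cong (e ∷ es) h = mixture-cong ws λ t → Mix-cong es λ l → h (scale t (ζ e) ∷ l)

    Mix-mono : ∀ {b} → Weights b ws → ∀ es {Ψ Φ} → (∀ l → Pointwise (λ f e → Pos f × f ≼ scale b (ζ e)) l es → Ψ l ≤ Φ l) → Mix es Ψ ≤ Mix es Φ
    Mix-mono W []       h = h [] []
    Mix-mono {b} W (e ∷ es) h = mixture-mono W λ t 0≤t t≤b → Mix-mono W es λ l v →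
      h (scale t (ζ e) ∷ l) ((Pos-scale 0≤t (Pos-ζ e) , mk≼ (Pos-cong (λ x → r b t (ζ e x)) (Pos-scale (sub⁺ t≤b) (Pos-ζ e)))) ∷ v)
      where r : ∀ b t z → (b - t) * z ≡ b * z - t * z
            r = solve-∀ ℚ-ring

    -- Once all couplings are fixed the coordinates are independent and identically distributed,
    -- whence a d-th power. `P` accumulates the factors of the edges whose couplings are already
    -- fixed.
    𝔼-edge-factors : ∀ d es (P : Fun) → Ops.𝔼 (power (cube n) d) (λ x → ∏ P x * ∏L (edge-factor x) es) ≡ Mix es (λ l → 𝔼 (λ v → P v * Π l v) ^ d)
    𝔼-edge-factors d [] P = trans (Ω.𝔼-cong λ x → *-identityʳ (∏ P x)) (trans (𝔼-∏ (cube n) d P) (cong (_^ d) (𝔼-cong λ v → sym (*-identityʳ (P v)))))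
      where module Ω = Ops (power (cube n) d)
    𝔼-edge-factors d (e ∷ es) P = begin
      Ω.𝔼 (λ x → ∏ P x * (edge-factor x e * ∏L (edge-factor x) es))
        ≡⟨ Ω.𝔼-cong (λ x → trans (r₁ (∏ P x) (edge-factor x e) (∏L (edge-factor x) es)) (trans (sym (mixture-* ws (∏ P x * ∏L (edge-factor x) es) _))
             (mixture-cong ws λ t → trans (r₂ (∏ P x) (∏L (edge-factor x) es) (∏ (f t) x)) (cong (_* ∏L (edge-factor x) es) (sym (∏-* P (f t) x)))))) ⟩
      Ω.𝔼 (λ x → mixture ws λ t → ∏ (λ v → P v * f t v) x * ∏L (edge-factor x) es)
        ≡⟨ 𝔼-mixture (power (cube n) d) ws _ ⟩
      (mixture ws λ t → Ω.𝔼 (λ x → ∏ (λ v → P v * f t v) x * ∏L (edge-factor x) es))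
        ≡⟨ mixture-cong ws (λ t → trans (𝔼-edge-factors d es (λ v → P v * f t v))
             (Mix-cong es λ l → cong (_^ d) (𝔼-cong λ v → *-assoc (P v) (f t v) (Π l v)))) ⟩
      Mix (e ∷ es) (λ l → 𝔼 (λ v → P v * Π l v) ^ d) ∎
      where
      open ≡-Reasoning
      module Ω = Ops (power (cube n) d)
      f : ℚ → Fun
      f t v = 1ℚ + scale t (ζ e) v
      r₁ : ∀ a b c → a * (b * c) ≡ a * c * b
      r₁ = solve-∀ ℚ-ring
      r₂ : ∀ a b c → a * b * c ≡ a * c * b
      r₂ = solve-∀ ℚ-ring

    module Replace (d : ℕ) (T ω σ b β : ℚ) (W : Weights b ws) (0≤b : 0ℚ ≤ b) (0≤ω : 0ℚ ≤ ω) (0≤σ : 0ℚ ≤ σ) (σ≤b : σ ≤ b) (1≤T : 1ℚ ≤ T)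
      (one-edge : ∀ A B → 1ℚ ≤ A → 0ℚ ≤ B → B ≤ β → mixture ws (λ t → (A + t * B) ^ d) ≤ ω * (A + σ * B) ^ d)
      (yT : Fun) (𝔼yT : 𝔼 yT ≡ 0ℚ) where

      Good : Fin n × Fin n → Set
      Good e = 𝔼 (ζ e) ≡ 0ℚ × ½ * (b * b * 𝔼 (λ v → ζ e v * (yT v * yT v))) ≤ β

      cubed : ℚ → ℚ
      cubed a = a * a * a

      -- The shape of the bound from `ferromagnetic` for one coordinate with total `Y`; `T` holds
      -- the constant and the quartic error.
      value : Fun → ℚ
      value Y = T + (+ 1 / 6) * 𝔼 (λ v → cubed (Y v))

      -- `value` is affine in t: after ζ² = 1 the coefficients of t² and t³ in the cube are
      -- multiples of 𝔼 Q and 𝔼 ζ, both zero. Here 𝔼 Q = 0 because it lies between 0 and b 𝔼 yT. The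
      -- slope is controlled by Q ≼ b yT together with `Good`, so `one-edge` applies.
      step : ∀ {e Q} → Good e → Pos Q → Q ≼ scale b yT →
        mixture ws (λ t → value (λ v → Q v + t * ζ e v) ^ d) ≤ ω * value (λ v → Q v + σ * ζ e v) ^ d
      step {e} {Q} (z , g) p h = subst₂ _≤_ (mixture-cong ws λ t → cong (_^ d) (sym (expand t))) (cong (λ a → ω * a ^ d) (sym (expand σ)))
        (one-edge (value Q) B
          (≤-trans 1≤T (subst (_≤ value Q) (+-identityʳ T) (+-monoʳ-≤ T (nonNegative⁻¹ (+ 1 / 6) ⊛ Pos⇒0≤𝔼 (Pos-* (Pos-* p p) p)))))
          (nonNegative⁻¹ ½ ⊛ Pos⇒0≤𝔼 (Pos-* (Pos-ζ e) (Pos-* p p)))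
          (≤-trans (*-monoˡ (nonNegative⁻¹ ½) (≤-trans (≼⇒𝔼≤ (≼-cong (λ _ → refl) (λ v → r₁ b (ζ e v) (yT v)) (≼-* (Pos-ζ e) (Pos-* p p) ≼-refl (≼-* p p h h))))
            (≤-reflexive (𝔼-* (b * b) _)))) g))
        where
        B : ℚ
        B = ½ * 𝔼 (λ v → ζ e v * (Q v * Q v))
        𝔼Q : 𝔼 Q ≡ 0ℚ
        𝔼Q = ≤-antisym (≤-trans (≼⇒𝔼≤ h) (≤-reflexive (trans (𝔼-* b yT) (trans (cong (b *_) 𝔼yT) (*-zeroʳ b))))) (Pos⇒0≤𝔼 p)
        r₁ : ∀ b z y → z * (b * y * (b * y)) ≡ b * b * (z * (y * y))
        r₁ = solve-∀ ℚ-ring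
        r₂ : ∀ q t z → (q + t * z) * (q + t * z) * (q + t * z) ≡ q * q * q + ((+ 3 / 1) * t * (z * (q * q)) + ((+ 3 / 1) * (t * t) * (z * z) * q + t * t * t * (z * z) * z))
        r₂ = solve-∀ ℚ-ring
        r₃ : ∀ T a t b → T + (+ 1 / 6) * (a + ((+ 3 / 1) * t * b + ((+ 3 / 1) * (t * t) * 1ℚ * 0ℚ + t * t * t * 1ℚ * 0ℚ))) ≡ T + (+ 1 / 6) * a + t * (½ * b)
        r₃ = solve-∀ ℚ-ring
        expand : ∀ t → value (λ v → Q v + t * ζ e v) ≡ value Q + t * B
        expand t = trans (cong (λ a → T + (+ 1 / 6) * a) (trans (𝔼-cong λ v → trans (r₂ (Q v) t (ζ e v))
            (cong (λ a → cubed (Q v) + (f v + ((+ 3 / 1) * (t * t) * a * Q v + t * t * t * a * ζ e v))) (ζ² e v)))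
          (trans (𝔼-+ (λ v → cubed (Q v)) (λ v → f v + (g′ v + h′ v))) (cong (_+_ (𝔼 (λ v → cubed (Q v))))
            (trans (𝔼-+ f (λ v → g′ v + h′ v)) (cong₂ _+_ (𝔼-* ((+ 3 / 1) * t) _)
              (trans (𝔼-+ g′ h′) (cong₂ _+_ (trans (𝔼-* ((+ 3 / 1) * (t * t) * 1ℚ) Q) (cong ((+ 3 / 1) * (t * t) * 1ℚ *_) 𝔼Q)) (trans (𝔼-* (t * t * t * 1ℚ) (ζ e)) (cong (t * t * t * 1ℚ *_) z))))))))))
          (r₃ T (𝔼 (λ v → cubed (Q v))) t (𝔼 (λ v → ζ e v * (Q v * Q v))))
          where
          f g′ h′ : Fun
          f v = (+ 3 / 1) * t * (ζ e v * (Q v * Q v))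
          g′ v = (+ 3 / 1) * (t * t) * 1ℚ * Q v
          h′ v = t * t * t * 1ℚ * ζ e v

      -- `Y` is the total of the edges whose couplings are held fixed and `U` their unweighted sum.
      -- For each coupling of the head edge the tail is replaced first, then the head itself. The
      -- two domination hypotheses keep every intermediate total below b yT, as `step` requires.
      replace-edges : ∀ es {Y U} → All Good es → Pos Y → Y ≼ scale b U → (λ v → U v + σ₁ (map ζ es) v) ≼ yT →
        Mix es (λ l → value (λ v → Y v + σ₁ l v) ^ d) ≤ ω ^ length es * value (λ v → Y v + σ * σ₁ (map ζ es) v) ^ d
      replace-edges [] {Y} [] p h k = ≤-reflexive (trans (cong (λ a → (T + (+ 1 / 6) * a) ^ d) (𝔼-cong λ v → cong (λ a → cubed (Y v + a)) (sym (*-zeroʳ σ)))) (sym (*-identityˡ _)))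
      replace-edges (e ∷ es) {Y} {U} (g ∷ gs) p h k = begin
        (mixture ws λ t → Mix es λ l → value (λ v → Y v + (t * ζ e v + σ₁ l v)) ^ d)
          ≡⟨ mixture-cong ws (λ t → Mix-cong es λ l → cong (λ a → (T + (+ 1 / 6) * a) ^ d) (𝔼-cong λ v → cong cubed (sym (+-assoc (Y v) (t * ζ e v) (σ₁ l v))))) ⟩
        (mixture ws λ t → Mix es λ l → value (λ v → Y v + t * ζ e v + σ₁ l v) ^ d)
          ≤⟨ mixture-mono W (λ t 0≤t t≤b → replace-edges es gs (Pos-+ p (Pos-scale 0≤t (Pos-ζ e)))
               (mk≼ (Pos-cong (λ v → r₁ b t (U v) (Y v) (ζ e v)) (Pos-+ (diff h) (Pos-scale (sub⁺ t≤b) (Pos-ζ e)))))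
               (≼-cong (λ v → sym (+-assoc (U v) (ζ e v) (σ₁ (map ζ es) v))) (λ _ → refl) k)) ⟩
        (mixture ws λ t → ω ^ m * value (λ v → Y v + t * ζ e v + σ * σ₁ (map ζ es) v) ^ d)
          ≡⟨ trans (mixture-* ws (ω ^ m) _) (cong (ω ^ m *_) (mixture-cong ws λ t → cong (λ a → (T + (+ 1 / 6) * a) ^ d) (𝔼-cong λ v → cong cubed (r₂ (Y v) (t * ζ e v) (σ * σ₁ (map ζ es) v))))) ⟩
        ω ^ m * mixture ws (λ t → value (λ v → Q v + t * ζ e v) ^ d)
          ≤⟨ *-monoˡ (0≤^ m 0≤ω) (step g Pos-Q (mk≼ (Pos-cong (λ v → r₄ b σ (yT v) (U v) (Y v) (ζ e v) (σ₁ (map ζ es) v))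
               (Pos-+ (Pos-+ (Pos-scale 0≤b (diff k)) (diff h)) (Pos-+ (Pos-scale 0≤b (Pos-ζ e)) (Pos-scale (sub⁺ σ≤b) (Pos-σ₁ (cube n) (Pos-ζs es)))))))) ⟩
        ω ^ m * (ω * value (λ v → Q v + σ * ζ e v) ^ d)
          ≡⟨ trans (r₃ (ω ^ m) ω _) (cong (λ a → ω * ω ^ m * (T + (+ 1 / 6) * a) ^ d) (𝔼-cong λ v → cong cubed (r₅ (Y v) σ (σ₁ (map ζ es) v) (ζ e v)))) ⟩
        ω * ω ^ m * value (λ v → Y v + σ * (ζ e v + σ₁ (map ζ es) v)) ^ d ∎
        where
        open ≤-Reasoning
        m = length es
        Q : Fun
        Q v = Y v + σ * σ₁ (map ζ es) v
        Pos-Q : Pos Q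
        Pos-Q = Pos-+ p (Pos-scale 0≤σ (Pos-σ₁ (cube n) (Pos-ζs es)))
        r₁ : ∀ b t u y z → b * u - y + (b - t) * z ≡ b * (u + z) - (y + t * z)
        r₁ = solve-∀ ℚ-ring
        r₂ : ∀ a b c → a + b + c ≡ a + c + b
        r₂ = solve-∀ ℚ-ring
        r₃ : ∀ a b c → a * (b * c) ≡ b * a * c
        r₃ = solve-∀ ℚ-ring
        r₄ : ∀ b s t u y z c → b * (t - (u + (z + c))) + (b * u - y) + (b * z + (b - s) * c) ≡ b * t - (y + s * c)
        r₄ = solve-∀ ℚ-ring
        r₅ : ∀ y s c z → y + s * c + s * z ≡ y + s * (z + c)
        r₅ = solve-∀ ℚ-ring

-- Replacing the mixture on a single edge by one coupling

module EdgeReplacement where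
  open Rationals
  open Mixtures
  open import Data.Integer.Base using (+_)
  open import Data.List.Base using (List; []; _∷_)
  open import Data.List.Relation.Unary.All using ([]; _∷_)
  open import Data.Rational
  open import Data.Rational.Properties

  -- With u = n x, `bernoulli-inv` bounds the power by 1/(1 - u), and (1 + u + 2 u²)(1 - u) = 1 + u²
  -- (1 - 2 u) ≥ 1.
  1+x≤ : ∀ n {x} → 0ℚ ≤ x → ι n * x ≤ ½ → (1ℚ + x) ^ n ≤ 1ℚ + ι n * x + (+ 2 / 1) * (ι n * x * (ι n * x))
  1+x≤ n {x} 0≤x h = *-cancel {c = 1ℚ - u} (<-≤-trans (positive⁻¹ ½) (by-diff (½ - u) (sub⁺ h) (e₁ u)))
    (≤-trans (bernoulli-inv n 0≤x) (by-diff (u * u * ((+ 2 / 1) * (½ - u))) (0≤u ⊛ 0≤u ⊛ (nonNegative⁻¹ (+ 2 / 1) ⊛ sub⁺ h)) (e₂ u)))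
    where
    u = ι n * x
    0≤u = 0≤ι n ⊛ 0≤x
    e₁ : ∀ u → 1ℚ - u - ½ ≡ ½ - u
    e₁ = solve-∀ ℚ-ring
    e₂ : ∀ u → (1ℚ + u + (+ 2 / 1) * (u * u)) * (1ℚ - u) - 1ℚ ≡ u * u * ((+ 2 / 1) * (½ - u))
    e₂ = solve-∀ ℚ-ring

  inverse : ∀ {a} → 0ℚ < a → ∃[ b ] (0ℚ < b × a * b ≡ 1ℚ)
  inverse {a} h = 1/ a , positive⁻¹ (1/ a) {{1/pos⇒pos a}} , *-inverseʳ a
    where instance
      a-pos = positive h
      a-nz  = pos⇒nonZero a

  module Parameters (p q δ τ τm σ β : ℚ) (d : ℕ)
    (0≤p : 0ℚ ≤ p) (p≤q : p ≤ q) (0≤δ : 0ℚ ≤ δ) (0≤τ : 0ℚ ≤ τ) (τ≤τm : τ ≤ τm) (0≤σ : 0ℚ ≤ σ) (0≤β : 0ℚ ≤ β)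
    (small : ι d * (τm * β) ≤ ½)
    (σ-large : p * τ + δ * τm + (+ 2 / 1) * (ι d * β) * (p * (τ * τ) + δ * (τm * τm)) ≤ (q + δ) * σ) where

    -- In `Blue-dominated` the masses q - p and p dominate 1 - p D, while δ at the larger coupling
    -- `τm` dominates the added power (p D)^m.
    ws : List (ℚ × ℚ)
    ws = (q - p , 0ℚ) ∷ (p , τ) ∷ (δ , τm) ∷ []

    0≤τm : 0ℚ ≤ τm
    0≤τm = ≤-trans 0≤τ τ≤τm

    weights : Weights τm ws
    weights = (sub⁺ p≤q , ≤-refl , 0≤τm) ∷ (0≤p , 0≤τ , τ≤τm) ∷ (0≤δ , 0≤τm , ≤-refl) ∷ []

    -- Division by A^d reduces to r = B/A ≤ β. Each power on the left is at most its second-order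
    -- expansion by `1+x≤`, and Bernoulli bounds the right from below to first order. As r ≤ β, the
    -- quadratic terms are at most linear in r, and `σ-large` is precisely the resulting condition
    -- on σ.
    one-edge : ∀ A B → 1ℚ ≤ A → 0ℚ ≤ B → B ≤ β → mixture ws (λ t → (A + t * B) ^ d) ≤ (q + δ) * (A + σ * B) ^ d
    one-edge A B 1≤A 0≤B B≤β = begin
      (q - p) * (A + 0ℚ * B) ^ d + (p * (A + τ * B) ^ d + (δ * (A + τm * B) ^ d + 0ℚ))
        ≡⟨ cong₂ _+_ (cong ((q - p) *_) (factor 0ℚ)) (cong₂ _+_ (cong (p *_) (factor τ)) (cong (_+ 0ℚ) (cong (δ *_) (factor τm)))) ⟩
      (q - p) * (A ^ d * (1ℚ + 0ℚ * r) ^ d) + (p * (A ^ d * (1ℚ + τ * r) ^ d) + (δ * (A ^ d * (1ℚ + τm * r) ^ d) + 0ℚ))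
        ≡⟨ e₁ (q - p) p δ (A ^ d) ((1ℚ + 0ℚ * r) ^ d) ((1ℚ + τ * r) ^ d) ((1ℚ + τm * r) ^ d) ⟩
      A ^ d * ((q - p) * (1ℚ + 0ℚ * r) ^ d + p * (1ℚ + τ * r) ^ d + δ * (1ℚ + τm * r) ^ d)
        ≤⟨ *-monoˡ 0≤Aᵈ (+-mono-≤ (+-mono-≤ (≤-reflexive (cong ((q - p) *_) (trans (cong (_^ d) (trans (cong (_+_ 1ℚ) (*-zeroˡ r)) (+-identityʳ 1ℚ))) (1^ d))))
             (*-monoˡ 0≤p (bound 0≤τ τ≤τm))) (*-monoˡ 0≤δ (bound 0≤τm ≤-refl))) ⟩
      A ^ d * ((q - p) * 1ℚ + p * (1ℚ + N * (τ * r) + (+ 2 / 1) * (N * (τ * r) * (N * (τ * r)))) + δ * (1ℚ + N * (τm * r) + (+ 2 / 1) * (N * (τm * r) * (N * (τm * r)))))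
        ≤⟨ *-monoˡ 0≤Aᵈ (by-diff (N * r * ((q + δ) * σ - (p * τ + δ * τm + (+ 2 / 1) * (N * β) * (p * (τ * τ) + δ * (τm * τm)))) + N * r * (N * (β - r) * ((+ 2 / 1) * (p * (τ * τ) + δ * (τm * τm)))))
             ((0≤N ⊛ 0≤r) ⊛ sub⁺ σ-large ⊕ (0≤N ⊛ 0≤r) ⊛ (0≤N ⊛ sub⁺ r≤β ⊛ (nonNegative⁻¹ (+ 2 / 1) ⊛ (0≤p ⊛ (0≤τ ⊛ 0≤τ) ⊕ 0≤δ ⊛ (0≤τm ⊛ 0≤τm)))))
             (e₂ p q δ τ τm σ β N r)) ⟩
      A ^ d * ((q + δ) * (1ℚ + N * (σ * r)))  ≤⟨ *-monoˡ 0≤Aᵈ (*-monoˡ 0≤ω (bernoulli d (0≤σ ⊛ 0≤r))) ⟩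
      A ^ d * ((q + δ) * (1ℚ + σ * r) ^ d)    ≡⟨ e₃ (A ^ d) (q + δ) ((1ℚ + σ * r) ^ d) ⟩
      (q + δ) * (A ^ d * (1ℚ + σ * r) ^ d)    ≡⟨ cong ((q + δ) *_) (sym (factor σ)) ⟩
      (q + δ) * (A + σ * B) ^ d ∎
      where
      open ≤-Reasoning
      N = ι d
      0≤N = 0≤ι d
      0≤ω : 0ℚ ≤ q + δ
      0≤ω = ≤-trans 0≤p p≤q ⊕ 0≤δ
      0<A : 0ℚ < A
      0<A = <-≤-trans 0<1 1≤A
      a = proj₁ (inverse 0<A)
      0<a = proj₁ (proj₂ (inverse 0<A))
      Aa : A * a ≡ 1ℚ
      Aa = proj₂ (proj₂ (inverse 0<A))
      r : ℚ
      r = B * a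
      0≤r : 0ℚ ≤ r
      0≤r = 0≤B ⊛ <⇒≤ 0<a
      a≤1 : a ≤ 1ℚ
      a≤1 = subst₂ _≤_ (*-identityˡ a) Aa (*-monoʳ (<⇒≤ 0<a) 1≤A)
      r≤β : r ≤ β
      r≤β = ≤-trans (subst (r ≤_) (*-identityʳ B) (*-monoˡ 0≤B a≤1)) B≤β
      0≤Aᵈ : 0ℚ ≤ A ^ d
      0≤Aᵈ = 0≤^ d (<⇒≤ 0<A)
      factor : ∀ t → (A + t * B) ^ d ≡ A ^ d * (1ℚ + t * r) ^ d
      factor t = trans (cong (_^ d) (trans (cong (λ z → A + t * z) (sym (trans (cong (B *_) Aa) (*-identityʳ B)))) (e A t B a))) (*-^ A (1ℚ + t * r) d)
        where e : ∀ A t B a → A + t * (B * (A * a)) ≡ A * (1ℚ + t * (B * a))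
              e = solve-∀ ℚ-ring
      bound : ∀ {t} → 0ℚ ≤ t → t ≤ τm → (1ℚ + t * r) ^ d ≤ 1ℚ + N * (t * r) + (+ 2 / 1) * (N * (t * r) * (N * (t * r)))
      bound 0≤t t≤ = 1+x≤ d (0≤t ⊛ 0≤r) (≤-trans (*-monoˡ 0≤N (*-mono 0≤t 0≤r t≤ r≤β)) small)
      e₁ : ∀ w p δ A a b c → w * (A * a) + (p * (A * b) + (δ * (A * c) + 0ℚ)) ≡ A * (w * a + p * b + δ * c)
      e₁ = solve-∀ ℚ-ring
      e₂ : ∀ p q δ t s σ β N y →
        (q + δ) * (1ℚ + N * (σ * y)) - ((q - p) * 1ℚ + p * (1ℚ + N * (t * y) + (+ 2 / 1) * (N * (t * y) * (N * (t * y)))) + δ * (1ℚ + N * (s * y) + (+ 2 / 1) * (N * (s * y) * (N * (s * y)))))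
        ≡ N * y * ((q + δ) * σ - (p * t + δ * s + (+ 2 / 1) * (N * β) * (p * (t * t) + δ * (s * s)))) + N * y * (N * (β - y) * ((+ 2 / 1) * (p * (t * t) + δ * (s * s))))
      e₂ = solve-∀ ℚ-ring
      e₃ : ∀ a b c → a * (b * c) ≡ b * (a * c)
      e₃ = solve-∀ ℚ-ring

-- Random edge weights and the expected weight of a clique

module RandomWeights where
  open Rationals
  open Fourier
  open Spins
  open PartitionFunction
  open Antiferromagnet
  open Mixtures
  open EdgeReplacement
  open import Data.Bool.Base using (Bool)
  open import Data.Fin.Base using (Fin; zero; suc)
  open import Data.Integer.Base using (+_)
  open import Data.List.Base using (List; []; _∷_; map; length)
  open import Data.List.Relation.Unary.All using (All; []; _∷_)
  open import Data.List.Relation.Unary.Unique.Propositional using (Unique)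
  open import Data.List.Relation.Binary.Pointwise.Base using (Pointwise; []; _∷_)
  open import Data.Rational
  open import Data.Rational.Properties
  open import Data.Vec.Base using (Vec; []; _∷_)

  module _ {X : Set} (S : Space X) where
    open Ops S

    ◁-∏L : ∀ {A : Set} {f g : A → X → ℚ} (es : List A) → (∀ e → f e ◁ g e) → (λ x → ∏L (λ e → f e x) es) ◁ (λ x → ∏L (λ e → g e x) es)
    ◁-∏L []       h = ◁-one
    ◁-∏L (e ∷ es) h = ◁-* (h e) (◁-∏L es h)

    ◁-^ : ∀ {f g} → f ◁ g → ∀ m → (λ x → f x ^ m) ◁ (λ x → g x ^ m)
    ◁-^ h zero    = ◁-one
    ◁-^ h (suc m) = ◁-* h (◁-^ h m)

    -- Since z² = 1 the power is affine in z, so two coefficients have to be compared. In the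
    -- induction step the constant coefficient has the surplus τ² (1 - 2 m³ τ²). `M` bounds all
    -- exponents at once, so that the smallness condition is unchanged along the induction.
    power≼ : ∀ {z τ M} → Pos z → (∀ x → z x * z x ≡ 1ℚ) → 0ℚ ≤ τ → ∀ m → ι m ≤ M → (+ 2 / 1) * (M * M * M) * (τ * τ) ≤ 1ℚ →
      (λ x → (1ℚ + τ * z x) ^ m) ≼ (λ x → (1ℚ + ι m * ι m * (τ * τ)) * (1ℚ + (+ 2 / 1) * ι m * τ * z x))
    power≼ {z} {τ} p z² 0≤τ zero m≤M h = ≼-reflexive λ x → sym (trans (cong (λ i → (1ℚ + i * i * (τ * τ)) * (1ℚ + (+ 2 / 1) * i * τ * z x)) ι-0) (e (τ * τ) τ (z x)))
      where e : ∀ s t z → (1ℚ + 0ℚ * 0ℚ * s) * (1ℚ + (+ 2 / 1) * 0ℚ * t * z) ≡ 1ℚ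
            e = solve-∀ ℚ-ring
    power≼ {z} {τ} {M} p z² 0≤τ (suc m) m≤M h = ≼-trans
      (≼-* (Pos-+ (Pos-const 0≤1) (Pos-scale 0≤τ p)) (Pos-pow m) ≼-refl (power≼ {M = M} p z² 0≤τ m i≤M h))
      (≼-cong (λ x → trans (cong (λ w → (1ℚ + K) * (1ℚ + (+ 2 / 1) * (i * t * τ) * w + ((+ 2 / 1) * i + 1ℚ) * τ * z x)) (sym (z² x))) (e₁ K i τ (z x)))
              (λ x → cong (λ j → (1ℚ + j * j * (τ * τ)) * (1ℚ + (+ 2 / 1) * j * τ * z x)) (sym (ι-suc m)))
        (mk≼ (Pos-cong (λ x → e₂ i τ (z x)) (Pos-+
          (Pos-const (0≤τ ⊛ 0≤τ ⊛ sub⁺ cond))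
          (Pos-scale (0≤τ ⊛ (0≤1 ⊕ 0≤i ⊛ 0≤i ⊛ (0≤τ ⊛ 0≤τ) ⊕ (nonNegative⁻¹ (+ 2 / 1) ⊛ 0≤i ⊕ 0≤1) ⊛ ((nonNegative⁻¹ (+ 2 / 1)) ⊛ 0≤i ⊕ nonNegative⁻¹ (+ 2 / 1)) ⊛ (0≤τ ⊛ 0≤τ))) p)))))
      where
      i = ι m
      t = τ
      K = i * i * (τ * τ)
      0≤i = 0≤ι m
      i≤M : i ≤ M
      i≤M = ≤-trans (ι-mono (ℕ.n≤1+n m)) m≤M
      0≤M = ≤-trans 0≤i i≤M
      cond : (+ 2 / 1) * (i * i * i) * (τ * τ) ≤ 1ℚ
      cond = ≤-trans (*-monoʳ (0≤τ ⊛ 0≤τ) (*-monoˡ (nonNegative⁻¹ (+ 2 / 1)) (*-mono (0≤i ⊛ 0≤i) 0≤i (*-mono 0≤i 0≤i i≤M i≤M) i≤M))) h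
      Pos-pow : ∀ m → Pos (λ x → (1ℚ + τ * z x) ^ m)
      Pos-pow zero    = Pos-const 0≤1
      Pos-pow (suc m) = Pos-* (Pos-+ (Pos-const 0≤1) (Pos-scale 0≤τ p)) (Pos-pow m)
      e₁ : ∀ K i t z → (1ℚ + K) * (1ℚ + (+ 2 / 1) * (i * t * t) * (z * z) + ((+ 2 / 1) * i + 1ℚ) * t * z) ≡ (1ℚ + t * z) * ((1ℚ + K) * (1ℚ + (+ 2 / 1) * i * t * z))
      e₁ = solve-∀ ℚ-ring
      e₂ : ∀ i t z → t * t * (1ℚ - (+ 2 / 1) * (i * i * i) * (t * t)) + t * (1ℚ + i * i * (t * t) + ((+ 2 / 1) * i + 1ℚ) * ((+ 2 / 1) * i + (+ 2 / 1)) * (t * t)) * z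
        ≡ (1ℚ + (1ℚ + i) * (1ℚ + i) * (t * t)) * (1ℚ + (+ 2 / 1) * (1ℚ + i) * t * z) - (1ℚ + i * i * (t * t)) * (1ℚ + (+ 2 / 1) * (i * t * t) * 1ℚ + ((+ 2 / 1) * i + 1ℚ) * t * z)
      e₂ = solve-∀ ℚ-ring

  ∏-const-* : ∀ {X : Set} {n} c (f : X → ℚ) (xs : Vec X n) → ∏ (λ v → c * f v) xs ≡ c ^ n * ∏ f xs
  ∏-const-* c f []       = refl
  ∏-const-* c f (x ∷ xs) = trans (cong (c * f x *_) (∏-const-* c f xs)) (e c (f x) _ (∏ f xs))
    where e : ∀ a b c d → a * b * (c * d) ≡ a * c * (b * d)
          e = solve-∀ ℚ-ring

  ∏-^ : ∀ {X : Set} {n} (f : X → ℚ) m (xs : Vec X n) → ∏ (λ v → f v ^ m) xs ≡ ∏ f xs ^ m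
  ∏-^ f m []       = sym (1^ m)
  ∏-^ f m (x ∷ xs) = trans (cong (f x ^ m *_) (∏-^ f m xs)) (sym (*-^ (f x) (∏ f xs) m))

  ∏-one : ∀ {X : Set} {n} {f : X → ℚ} → (∀ v → f v ≡ 1ℚ) → (xs : Vec X n) → ∏ f xs ≡ 1ℚ
  ∏-one h []       = refl
  ∏-one h (x ∷ xs) = trans (cong₂ _*_ (h x) (∏-one h xs)) refl

  ∏-cong : ∀ {X : Set} {n} {f g : X → ℚ} → (∀ v → f v ≡ g v) → (xs : Vec X n) → ∏ f xs ≡ ∏ g xs
  ∏-cong h []       = refl
  ∏-cong h (x ∷ xs) = cong₂ _*_ (h x) (∏-cong h xs)

  module Weighting {n : ℕ} (d : ℕ) (p τ : ℚ) (m : ℕ) where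
    Ω : Space (Vec (Vec Bool n) d)
    Ω = power (cube n) d

    D : Fin n × Fin n → Vec (Vec Bool n) d → ℚ
    D e = ∏ λ v → 1ℚ - τ * ζ e v

    -- p * D e x may exceed 1, so 1 - Red can be negative; the added power restores nonnegativity and keeps Blue polynomial in D e x.
    Red Blue : Fin n × Fin n → Vec (Vec Bool n) d → ℚ
    Red e x  = p * D e x
    Blue e x = 1ℚ - p * D e x + (p * D e x) ^ m

    private module O = Ops Ω
    private module C = Ops (cube n)

    𝔼-red : ∀ is → O.𝔼 (λ x → ∏L (λ e → Red e x) (pairs is)) ≡ p ^ length (pairs is) * Z (- τ) is ^ d
    𝔼-red is = trans (O.𝔼-cong (λ x → lemma x (pairs is))) (trans (O.𝔼-* (p ^ length (pairs is)) _) (cong (p ^ length (pairs is) *_) (𝔼-∏ (cube n) d (Π (map (scale (- τ)) (ζs is))))))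
      where
      e : ∀ p a b c → p * a * (b * c) ≡ p * b * (a * c)
      e = solve-∀ ℚ-ring
      e′ : ∀ t z → 1ℚ - t * z ≡ 1ℚ + - t * z
      e′ = solve-∀ ℚ-ring
      lemma : ∀ x es → ∏L (λ e → Red e x) es ≡ p ^ length es * ∏ (Π (map (scale (- τ)) (map ζ es))) x
      lemma x [] = sym (trans (*-identityˡ _) (∏-one (λ _ → refl) x))
      lemma x (f ∷ es) = trans (cong (p * D f x *_) (lemma x es)) (trans (e p (D f x) (p ^ length es) _)
        (cong (p * p ^ length es *_) (trans (cong (_* ∏ (Π (map (scale (- τ)) (map ζ es))) x) (∏-cong (λ v → e′ τ (ζ f v)) x))
          (sym (∏-* (λ v → 1ℚ + - τ * ζ f v) (Π (map (scale (- τ)) (map ζ es))) x)))))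

    module _ (0≤p : 0ℚ ≤ p) (p≤q : p ≤ 1ℚ - p) (0≤τ : 0ℚ ≤ τ) (1≤m : 1 ℕ.≤ m) (mτ : (+ 2 / 1) * (ι m * ι m * ι m) * (τ * τ) ≤ 1ℚ)
      (δ : ℚ) (Kδ : (1ℚ + ι m * ι m * (τ * τ)) ^ d * p ^ m ≤ δ) where
      private
        q τm K : ℚ
        q = 1ℚ - p
        τm = (+ 2 / 1) * ι m * τ
        K = 1ℚ + ι m * ι m * (τ * τ)
        0≤K : 0ℚ ≤ K
        0≤K = 0≤1 ⊕ 0≤ι m ⊛ 0≤ι m ⊛ (0≤τ ⊛ 0≤τ)
        0≤δ : 0ℚ ≤ δ
        0≤δ = ≤-trans (0≤^ d 0≤K ⊛ 0≤^ m 0≤p) Kδ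
        0≤τm : 0ℚ ≤ τm
        0≤τm = nonNegative⁻¹ (+ 2 / 1) ⊛ 0≤ι m ⊛ 0≤τ
        τ≤τm : τ ≤ τm
        τ≤τm = subst (_≤ τm) (*-identityˡ τ) (*-monoʳ {b = (+ 2 / 1) * ι m} 0≤τ (≤-trans (subst (_≤ ι m) ι-1 (ι-mono 1≤m)) (by-diff (ι m) (0≤ι m) (e (ι m)))))
          where e : ∀ i → (+ 2 / 1) * i - i ≡ i
                e = solve-∀ ℚ-ring
        W : List (ℚ × ℚ)
        W = (q - p , 0ℚ) ∷ (p , τ) ∷ (δ , τm) ∷ []

      -- The two parts of `Blue` are dominated separately: 1 - p D by q - p + p D⁺, through
      -- `Pos-∏-2`, and (p D)^m by δ `Dₘ`, through `power≼` in each coordinate and `Kδ` for the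
      -- d-fold constant. The sum of the bounds is the edge factor of the mixture.
      Blue-dominated : ∀ e → Blue e O.◁ (λ x → edge-factor W x e)
      Blue-dominated e = O.◁-cong (λ _ → refl) (λ x → sym (trans (cong (λ a → (q - p) * a + (p * D⁺ x + (δ * Dₘ x + 0ℚ))) (∏-one (λ v → trans (cong (_+_ 1ℚ) (*-zeroˡ (ζ e v))) (+-identityʳ 1ℚ)) x)) (r₁ (q - p) (p * D⁺ x) (δ * Dₘ x))))
        (O.◁-+ first second)
        where
        D⁺ Dₘ : Vec (Vec Bool n) d → ℚ
        D⁺ = ∏ λ v → 1ℚ + scale τ (ζ e) v
        Dₘ = ∏ λ v → 1ℚ + scale τm (ζ e) v
        τζ : (λ v → - (τ * ζ e v)) C.◁ scale τ (ζ e)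
        τζ = C.◁-neg (C.Pos⇒◁ (C.Pos-scale 0≤τ (Pos-ζ e)))
        D◁D⁺ : D e O.◁ D⁺
        D◁D⁺ = ◁-∏ (cube n) d (C.◁-+ C.◁-one τζ)
        r₁ : ∀ a b c → a * 1ℚ + (b + (c + 0ℚ)) ≡ a + b + c
        r₁ = solve-∀ ℚ-ring
        r₂ : ∀ p a b → p * (b + a - (1ℚ + 1ℚ)) ≡ 1ℚ - p - p + p * b - (1ℚ - p * a)
        r₂ = solve-∀ ℚ-ring
        r₃ : ∀ p a b → (1ℚ - p + (1ℚ - p)) + p * (b - a) ≡ 1ℚ - p - p + p * b + (1ℚ - p * a)
        r₃ = solve-∀ ℚ-ring
        0≤q : 0ℚ ≤ q
        0≤q = ≤-trans 0≤p p≤q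
        first : (λ x → 1ℚ - p * D e x) O.◁ (λ x → q - p + p * D⁺ x)
        first = O.mk◁ (O.Pos-cong (λ x → r₂ p (D e x) (D⁺ x)) (O.Pos-scale 0≤p (Pos-∏-2 (cube n) d τζ)))
                      (O.Pos-cong (λ x → r₃ p (D e x) (D⁺ x)) (O.Pos-+ (O.Pos-const (0≤q ⊕ 0≤q)) (O.Pos-scale 0≤p (O.below D◁D⁺))))
        bound : (λ v → (1ℚ + - (τ * ζ e v)) ^ m) C.◁ (λ v → K * (1ℚ + τm * ζ e v))
        bound = C.◁-≼ (◁-^ (cube n) (C.◁-+ C.◁-one τζ) m) (power≼ (cube n) {M = ι m} (Pos-ζ e) (ζ² e) 0≤τ m ≤-refl mτ)
        second : (λ x → (p * D e x) ^ m) O.◁ (λ x → δ * Dₘ x)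
        second = O.◁-≼
          (O.◁-cong (λ x → trans (cong (p ^ m *_) (∏-^ (λ v → 1ℚ + - (τ * ζ e v)) m x)) (sym (*-^ p (D e x) m)))
                    (λ x → cong (p ^ m *_) (∏-const-* K (λ v → 1ℚ + τm * ζ e v) x))
            (O.◁-* (O.Pos⇒◁ (O.Pos-const (0≤^ m 0≤p))) (◁-∏ (cube n) d bound)))
          (O.mk≼ (O.Pos-cong (λ x → r₄ δ (K ^ d) (p ^ m) (Dₘ x)) (O.Pos-scale (sub⁺ Kδ) (Pos-∏ (cube n) d (C.Pos-+ (C.Pos-const 0≤1) (C.Pos-scale 0≤τm (Pos-ζ e)))))))
          where r₄ : ∀ a k p x → (a - k * p) * x ≡ a * x - p * (k * x)
                r₄ = solve-∀ ℚ-ring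

      module _ {is : List (Fin n)} (u : Unique is) {r : ℚ} (0≤r : 0ℚ ≤ r) (rk : r * ι (length is) ≡ 1ℚ) (σ : ℚ) (0≤σ : 0ℚ ≤ σ) (σ≤τm : σ ≤ τm)
        (3τk : (+ 3 / 1) * (τm * ι (length is)) ≤ 1ℚ)
        (small : ι d * (τm * (τm * τm * ι (length is))) ≤ ½)
        (σ-large : p * τ + δ * τm + (+ 2 / 1) * (ι d * (τm * τm * ι (length is))) * (p * (τ * τ) + δ * (τm * τm)) ≤ (q + δ) * σ) where

        -- The mixture is dominated, its couplings are fixed, `ferromagnetic` bounds each
        -- coordinate, and only then are the couplings replaced by σ. With equal couplings the third
        -- moment is `𝔼-y³`.
        𝔼-blue : O.𝔼 (λ x → ∏L (λ e → Blue e x) (pairs is)) ≤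
          (q + δ) ^ length (pairs is) * (1ℚ + (+ 162 / 1) * (τm * ι (length is)) ^ 4 + (+ 1 / 6) * (σ * σ * σ * (ι (length is) * (ι (length is) - 1ℚ) * (ι (length is) - (+ 2 / 1))))) ^ d
        𝔼-blue = begin
          O.𝔼 (λ x → ∏L (λ e → Blue e x) (pairs is))  ≤⟨ O.◁⇒𝔼≤ (◁-∏L Ω (pairs is) Blue-dominated) ⟩
          O.𝔼 (λ x → ∏L (edge-factor W x) (pairs is))
            ≡⟨ O.𝔼-cong (λ x → sym (trans (cong (_* ∏L (edge-factor W x) (pairs is)) (∏-one (λ _ → refl) x)) (*-identityˡ _))) ⟩
          O.𝔼 (λ x → ∏ (λ _ → 1ℚ) x * ∏L (edge-factor W x) (pairs is))
            ≡⟨ 𝔼-edge-factors W d (pairs is) (λ _ → 1ℚ) ⟩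
          Mix W (pairs is) (λ l → C.𝔼 (λ v → 1ℚ * Π l v) ^ d)
            ≤⟨ Mix-mono W weights (pairs is) (λ l h → subst₂ _≤_ (cong (_^ d) (C.𝔼-cong λ v → sym (*-identityˡ (Π l v))))
                 (cong (λ a → (T + (+ 1 / 6) * a) ^ d) (C.𝔼-cong λ v → cong (λ a → a * a * a) (sym (+-identityˡ (σ₁ l v)))))
                 (^-mono d (C.Pos⇒0≤𝔼 (Pos-Π (cube n) (all-pos h))) (ferromagnetic u 0≤r rk 0≤τm 3τk h))) ⟩
          Mix W (pairs is) (λ l → value (λ v → 0ℚ + σ₁ l v) ^ d)
            ≤⟨ replace-edges (pairs is) {λ _ → 0ℚ} {λ _ → 0ℚ} (good (pairs is) (𝔼-ζ u) (𝔼-ζy² u)) C.Pos-zero (C.≼-reflexive λ _ → sym (*-zeroʳ τm)) (C.≼-reflexive λ v → +-identityˡ _) ⟩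
          (q + δ) ^ length (pairs is) * value (λ v → 0ℚ + σ * σ₁ (map ζ (pairs is)) v) ^ d
            ≡⟨ cong (λ a → (q + δ) ^ length (pairs is) * (T + (+ 1 / 6) * a) ^ d) (trans (C.𝔼-cong λ v → e₁ σ (y is v)) (trans (C.𝔼-* (σ * σ * σ) _) (cong (σ * σ * σ *_) (𝔼-y³ u)))) ⟩
          (q + δ) ^ length (pairs is) * (T + (+ 1 / 6) * (σ * σ * σ * (k * (k - 1ℚ) * (k - (+ 2 / 1))))) ^ d ∎
          where
          open ≤-Reasoning
          k T β : ℚ
          k = ι (length is)
          T = 1ℚ + (+ 162 / 1) * (τm * k) ^ 4
          -- Half of τm² 𝔼 (ζ y²) is τm² (k - 2) by `𝔼-ζy²`, so this bounds the slope for every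
          -- edge.
          β = τm * τm * k
          0≤β : 0ℚ ≤ β
          0≤β = 0≤τm ⊛ 0≤τm ⊛ 0≤ι (length is)
          open Parameters p q δ τ τm σ β d 0≤p p≤q 0≤δ 0≤τ τ≤τm 0≤σ 0≤β small σ-large using (weights; one-edge)
          open Replace W d T (q + δ) σ τm β weights 0≤τm (≤-trans 0≤p p≤q ⊕ 0≤δ) 0≤σ σ≤τm
            (subst (_≤ T) (+-identityʳ 1ℚ) (+-monoʳ-≤ 1ℚ (nonNegative⁻¹ (+ 162 / 1) ⊛ 0≤^ 4 (0≤τm ⊛ 0≤ι (length is)))))
            one-edge (y is) (𝔼-y u)
          e₁ : ∀ s y → (0ℚ + s * y) * (0ℚ + s * y) * (0ℚ + s * y) ≡ s * s * s * (y * y * y)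
          e₁ = solve-∀ ℚ-ring
          e₂ : ∀ b k → b * k - ½ * (b * ((+ 2 / 1) * (k - (+ 2 / 1)))) ≡ (+ 2 / 1) * b
          e₂ = solve-∀ ℚ-ring
          all-pos : ∀ {l es} → Pointwise (λ f e → C.Pos f × f C.≼ scale τm (ζ e)) l es → All C.Pos l
          all-pos []             = []
          all-pos ((h , _) ∷ hs) = h ∷ all-pos hs
          good : ∀ es → All (λ e → C.𝔼 (ζ e) ≡ 0ℚ) es → All (λ e → C.𝔼 (λ v → ζ e v * (y is v * y is v)) ≡ (+ 2 / 1) * (k - (+ 2 / 1))) es → All Good es
          good []       []       []       = []
          good (e ∷ es) (h ∷ hs) (g ∷ gs) = (h , ≤-trans (≤-reflexive (cong (λ a → ½ * (τm * τm * a)) g)) (by-diff ((+ 2 / 1) * (τm * τm)) (nonNegative⁻¹ (+ 2 / 1) ⊛ (0≤τm ⊛ 0≤τm)) (e₂ (τm * τm) k))) ∷ good es hs gs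

-- First moment method for independent edge colours

module FirstMoment where
  open Rationals
  open Fourier
  open Spins
  open Mixtures
  open import Defs using (Colour; red; blue; Matrix; colour; Symmetric; HasClique; Arrows)
  open import Data.Bool.Base using (true; false)
  open import Data.Fin.Base using (Fin; zero; suc)
  import Data.Fin.Properties as Fin
  open import Data.Fin.Subset using (Subset; ∣_∣; _∈_)
  open import Data.Integer.Base using (+_)
  open import Data.List.Base using (List; []; _∷_; map; length; _++_)
  open import Data.List.Properties using (length-++; length-map)
  open import Data.List.Membership.Propositional using () renaming (_∈_ to _∈L_)
  open import Data.List.Membership.Propositional.Properties using (∈-map⁺; ∈-++⁺ˡ; ∈-++⁺ʳ)
  open import Data.List.Relation.Unary.Any using (here; there)
  open import Data.List.Relation.Unary.All as All using (All; []; _∷_)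
  import Data.List.Relation.Unary.All.Properties as All
  open import Data.List.Relation.Unary.AllPairs.Core using ([]; _∷_)
  open import Data.List.Relation.Unary.Unique.Propositional using (Unique)
  import Data.List.Relation.Unary.Unique.Propositional.Properties as Unique
  open import Data.Rational hiding (∣_∣)
  open import Data.Rational.Properties
  open import Data.Unit.Base using (⊤)
  open import Data.Vec.Base using (Vec; []; _∷_; lookup; tabulate)
  import Data.Vec.Base as V
  open import Data.Vec.Properties using (lookup∘tabulate)
  open import Function.Base using (_∘_)

  elems : ∀ {n} → Subset n → List (Fin n)
  elems []          = []
  elems (true ∷ S)  = zero ∷ map suc (elems S)
  elems (false ∷ S) = map suc (elems S)

  elems-unique : ∀ {n} (S : Subset n) → Unique (elems S)
  elems-unique []          = []
  elems-unique (true ∷ S)  = All.map⁺ (All.universal (λ _ ()) (elems S)) ∷ Unique.map⁺ Fin.suc-injective (elems-unique S)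
  elems-unique (false ∷ S) = Unique.map⁺ Fin.suc-injective (elems-unique S)

  length-elems : ∀ {n} (S : Subset n) → length (elems S) ≡ ∣ S ∣
  length-elems []          = refl
  length-elems (true ∷ S)  = cong suc (trans (length-map suc (elems S)) (length-elems S))
  length-elems (false ∷ S) = trans (length-map suc (elems S)) (length-elems S)

  elems-∈ : ∀ {n} (S : Subset n) → All (_∈ S) (elems S)
  elems-∈ []          = []
  elems-∈ (true ∷ S)  = V.here ∷ All.map⁺ (All.map V.there (elems-∈ S))
  elems-∈ (false ∷ S) = All.map⁺ (All.map V.there (elems-∈ S))

  subsets : ∀ n → ℕ → List (Subset n)
  subsets zero    zero    = [] ∷ []
  subsets zero    (suc m) = []
  subsets (suc n) zero    = map (false ∷_) (subsets n zero)
  subsets (suc n) (suc m) = map (true ∷_) (subsets n m) ++ map (false ∷_) (subsets n (suc m))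

  ∈-subsets : ∀ {n} (S : Subset n) → S ∈L subsets n ∣ S ∣
  ∈-subsets []          = here refl
  ∈-subsets {suc n} (true ∷ S) = ∈-++⁺ˡ (∈-map⁺ (true ∷_) (∈-subsets S))
  ∈-subsets {suc n} (false ∷ S) with ∣ S ∣ | ∈-subsets S
  ... | zero  | h = ∈-map⁺ (false ∷_) h
  ... | suc m | h = ∈-++⁺ʳ (map (true ∷_) (subsets n m)) (∈-map⁺ (false ∷_) h)

  subsets-size : ∀ n m → All (λ S → ∣ S ∣ ≡ m) (subsets n m)
  subsets-size zero    zero    = refl ∷ []
  subsets-size zero    (suc m) = []
  subsets-size (suc n) zero    = All.map⁺ (subsets-size n zero)
  subsets-size (suc n) (suc m) = All.++⁺ (All.map⁺ (All.map (cong suc) (subsets-size n m))) (All.map⁺ (subsets-size n (suc m)))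

  -- The crude count suffices: gaining the factorial of m would change the admissible n only by a
  -- factor polynomial in m.
  length-subsets : ∀ n m → length (subsets n m) ℕ.≤ n ℕ.^ m
  length-subsets zero    zero    = ℕ.≤-refl
  length-subsets zero    (suc m) = ℕ.z≤n
  length-subsets (suc n) zero    = ℕ.≤-trans (ℕ.≤-reflexive (length-map (false ∷_) (subsets n zero))) (length-subsets n zero)
  length-subsets (suc n) (suc m) = begin
    length (subsets (suc n) (suc m))
      ≡⟨ trans (length-++ (map (true ∷_) (subsets n m))) (cong₂ ℕ._+_ (length-map _ (subsets n m)) (length-map _ (subsets n (suc m)))) ⟩
    length (subsets n m) ℕ.+ length (subsets n (suc m))  ≤⟨ ℕ.+-mono-≤ (length-subsets n m) (length-subsets n (suc m)) ⟩
    n ℕ.^ m ℕ.+ n ℕ.* n ℕ.^ m  ≤⟨ ℕ.*-monoʳ-≤ (suc n) (ℕ.^-monoˡ-≤ m (ℕ.n≤1+n n)) ⟩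
    suc n ℕ.* suc n ℕ.^ m ∎
    where open ℕ.≤-Reasoning

  ∑L : ∀ {A : Set} → (A → ℚ) → List A → ℚ
  ∑L f []       = 0ℚ
  ∑L f (x ∷ xs) = f x + ∑L f xs

  ∑L-nonneg : ∀ {A : Set} {f : A → ℚ} → (∀ x → 0ℚ ≤ f x) → ∀ xs → 0ℚ ≤ ∑L f xs
  ∑L-nonneg h []       = ≤-refl
  ∑L-nonneg h (x ∷ xs) = h x ⊕ ∑L-nonneg h xs

  ∑L-member : ∀ {A : Set} {f : A → ℚ} → (∀ x → 0ℚ ≤ f x) → ∀ {x xs} → x ∈L xs → f x ≤ ∑L f xs
  ∑L-member {f = f} h {x} {_ ∷ xs} (here refl) = subst (_≤ f x + ∑L f xs) (+-identityʳ (f x)) (+-monoʳ-≤ (f x) (∑L-nonneg h xs))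
  ∑L-member {f = f} h {x} {y ∷ xs} (there p)   = subst (_≤ f y + ∑L f xs) (+-identityˡ (f x)) (+-mono-≤ (h y) (∑L-member h p))

  ∑L-mono : ∀ {A : Set} {f g : A → ℚ} → (∀ x → f x ≤ g x) → ∀ xs → ∑L f xs ≤ ∑L g xs
  ∑L-mono h []       = ≤-refl
  ∑L-mono h (x ∷ xs) = +-mono-≤ (h x) (∑L-mono h xs)

  ∑L-cong : ∀ {A : Set} {f g : A → ℚ} → (∀ x → f x ≡ g x) → ∀ xs → ∑L f xs ≡ ∑L g xs
  ∑L-cong h []       = refl
  ∑L-cong h (x ∷ xs) = cong₂ _+_ (h x) (∑L-cong h xs)

  ∑L-≤-length : ∀ {A : Set} {f : A → ℚ} {c} xs → All (λ x → f x ≤ c) xs → ∑L f xs ≤ ι (length xs) * c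
  ∑L-≤-length {c = c} []       []       = ≤-reflexive (sym (trans (cong (_* c) ι-0) (*-zeroˡ c)))
  ∑L-≤-length {c = c} (x ∷ xs) (h ∷ hs) = ≤-trans (+-mono-≤ h (∑L-≤-length xs hs))
    (≤-reflexive (trans (e c (ι (length xs))) (cong (_* c) (sym (ι-suc (length xs))))))
    where e : ∀ c k → c + k * c ≡ (1ℚ + k) * c
          e = solve-∀ ℚ-ring

  𝔼-∑L : ∀ {X A : Set} (S : Space X) (f : A → X → ℚ) xs → Ops.𝔼 S (λ x → ∑L (λ a → f a x) xs) ≡ ∑L (λ a → Ops.𝔼 S (f a)) xs
  𝔼-∑L S f []       = Ops.𝔼-const S 0ℚ
  𝔼-∑L S f (a ∷ as) = trans (Ops.𝔼-+ S (f a) _) (cong (_+_ (Ops.𝔼 S (f a))) (𝔼-∑L S f as))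

  ∏L-++ : ∀ {A : Set} (f : A → ℚ) xs ys → ∏L f (xs ++ ys) ≡ ∏L f xs * ∏L f ys
  ∏L-++ f []       ys = sym (*-identityˡ _)
  ∏L-++ f (x ∷ xs) ys = trans (cong (f x *_) (∏L-++ f xs ys)) (sym (*-assoc (f x) _ _))

  ∏L-map : ∀ {A B : Set} (f : B → ℚ) (g : A → B) xs → ∏L f (map g xs) ≡ ∏L (f ∘ g) xs
  ∏L-map f g []       = refl
  ∏L-map f g (x ∷ xs) = cong (f (g x) *_) (∏L-map f g xs)

  ∏L-nonneg : ∀ {A : Set} {f : A → ℚ} → (∀ x → 0ℚ ≤ f x) → ∀ xs → 0ℚ ≤ ∏L f xs
  ∏L-nonneg h []       = 0≤1
  ∏L-nonneg h (x ∷ xs) = h x ⊛ ∏L-nonneg h xs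

  ∏L-mono : ∀ {A : Set} {f g : A → ℚ} → (∀ x → 0ℚ ≤ f x) → (∀ x → f x ≤ g x) → ∀ xs → ∏L f xs ≤ ∏L g xs
  ∏L-mono p h []       = ≤-refl
  ∏L-mono p h (x ∷ xs) = *-mono (p x) (∏L-nonneg p xs) (h x) (∏L-mono p h xs)

  ∏L-one : ∀ {A : Set} {f : A → ℚ} {xs} → All (λ x → f x ≡ 1ℚ) xs → ∏L f xs ≡ 1ℚ
  ∏L-one []       = refl
  ∏L-one (h ∷ hs) = trans (cong₂ _*_ h (∏L-one hs)) refl

  is : Colour → Colour → ℚ
  is red  red  = 1ℚ
  is red  blue = 0ℚ
  is blue red  = 0ℚ
  is blue blue = 1ℚ

  is-refl : ∀ c → is c c ≡ 1ℚ
  is-refl red  = refl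
  is-refl blue = refl

  0≤is : ∀ c d → 0ℚ ≤ is c d
  0≤is red  red  = 0≤1
  0≤is red  blue = ≤-refl
  0≤is blue red  = ≤-refl
  0≤is blue blue = 0≤1

  weight : Colour → ℚ → ℚ
  weight red  w = w
  weight blue w = 1ℚ - w

  In01 : ℚ → Set
  In01 w = 0ℚ ≤ w × w ≤ 1ℚ

  -- The pointwise nonnegative functions serve as the cone here; the space is used for its mean and
  -- for the independence that comes with `_⊗_`.
  bernoulli-space : ∀ w → In01 w → Space Colour
  bernoulli-space w (p , q) = record
    { 𝔼        = λ f → w * f red + (1ℚ - w) * f blue
    ; 𝔼-cong   = λ h → cong₂ (λ a b → w * a + (1ℚ - w) * b) (h red) (h blue)
    ; 𝔼-+      = λ f g → e₁ w (f red) (g red) (f blue) (g blue)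
    ; 𝔼-*      = λ c f → e₂ w c (f red) (f blue)
    ; 𝔼-one    = e₃ w
    ; 𝔼-nonneg = λ h → p ⊛ h red ⊕ sub⁺ q ⊛ h blue
    ; Pos      = λ f → ∀ x → 0ℚ ≤ f x
    ; Pos-cong = λ h f x → subst (0ℚ ≤_) (h x) (f x)
    ; Pos-+    = λ f g x → f x ⊕ g x
    ; Pos-*    = λ f g x → f x ⊛ g x
    ; Pos-const = λ h _ → h
    ; Pos⇒0≤𝔼  = λ h → p ⊛ h red ⊕ sub⁺ q ⊛ h blue
    }
    where
    e₁ : ∀ w a b c d → w * (a + b) + (1ℚ - w) * (c + d) ≡ w * a + (1ℚ - w) * c + (w * b + (1ℚ - w) * d)
    e₁ = solve-∀ ℚ-ring
    e₂ : ∀ w c a b → w * (c * a) + (1ℚ - w) * (c * b) ≡ c * (w * a + (1ℚ - w) * b)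
    e₂ = solve-∀ ℚ-ring
    e₃ : ∀ w → w * 1ℚ + (1ℚ - w) * 1ℚ ≡ 1ℚ
    e₃ = solve-∀ ℚ-ring

  𝔼-is : ∀ w h c → Ops.𝔼 (bernoulli-space w h) (is c) ≡ weight c w
  𝔼-is w h red  = e w
    where e : ∀ w → w * 1ℚ + (1ℚ - w) * 0ℚ ≡ w
          e = solve-∀ ℚ-ring
  𝔼-is w h blue = e w
    where e : ∀ w → w * 0ℚ + (1ℚ - w) * 1ℚ ≡ 1ℚ - w
          e = solve-∀ ℚ-ring

  row-space : ∀ n (w : Fin n → ℚ) → (∀ i → In01 (w i)) → Space (Vec Colour n)
  row-space zero    w h = push (λ _ → []) unit
  row-space (suc n) w h = push cons (bernoulli-space (w zero) (h zero) ⊗ row-space n (w ∘ suc) (h ∘ suc))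

  -- The edge colourings of a complete graph, as the rows of a strictly triangular matrix.
  Triangle : ℕ → Set
  Triangle zero    = ⊤
  Triangle (suc n) = Vec Colour n × Triangle n

  entry : ∀ {n} → Triangle n → Fin n → Fin n → Colour
  -- A dummy value on the diagonal; pairs of distinct vertices never read it.
  entry {suc n} (r , t) zero    zero    = red
  entry {suc n} (r , t) zero    (suc j) = lookup r j
  entry {suc n} (r , t) (suc i) zero    = lookup r i
  entry {suc n} (r , t) (suc i) (suc j) = entry t i j

  entry-sym : ∀ {n} (t : Triangle n) i j → entry t i j ≡ entry t j i
  entry-sym {suc n} (r , t) zero    zero    = refl
  entry-sym {suc n} (r , t) zero    (suc j) = refl
  entry-sym {suc n} (r , t) (suc i) zero    = refl
  entry-sym {suc n} (r , t) (suc i) (suc j) = entry-sym t i j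

  matrix : ∀ {n} → Triangle n → Matrix n
  matrix t = tabulate λ i → tabulate (entry t i)

  colour-matrix : ∀ {n} (t : Triangle n) i j → colour (matrix t) i j ≡ entry t i j
  colour-matrix t i j = trans (cong (λ r → lookup r j) (lookup∘tabulate (λ i → tabulate (entry t i)) i)) (lookup∘tabulate (entry t i) j)

  triangle-space : ∀ n (w : Fin n → Fin n → ℚ) → (∀ i j → In01 (w i j)) → Space (Triangle n)
  triangle-space zero    w h = unit
  triangle-space (suc n) w h = row-space n (w zero ∘ suc) (h zero ∘ suc) ⊗ triangle-space n (λ i j → w (suc i) (suc j)) (λ i j → h (suc i) (suc j))

  clique : ∀ {n} → Colour → Triangle n → Subset n → ℚ
  clique c t S = ∏L (λ (i , j) → is c (entry t i j)) (pairs (elems S))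

  pairs-map-suc : ∀ {n} (f : Fin (suc n) × Fin (suc n) → ℚ) is → ∏L f (pairs (map suc is)) ≡ ∏L (λ (i , j) → f (suc i , suc j)) (pairs is)
  pairs-map-suc f is = trans (cong (∏L f) (map-pairs suc is)) (∏L-map f _ (pairs is))

  pairs-∷ : ∀ {n} (f : Fin (suc n) × Fin (suc n) → ℚ) is →
    ∏L f (pairs (zero ∷ map suc is)) ≡ ∏L (λ j → f (zero , suc j)) is * ∏L (λ (i , j) → f (suc i , suc j)) (pairs is)
  pairs-∷ f is = trans (∏L-++ f (map (zero ,_) (map suc is)) _)
    (cong₂ _*_ (trans (∏L-map f (zero ,_) (map suc is)) (∏L-map (λ j → f (zero , j)) suc is)) (pairs-map-suc f is))

  𝔼-row : ∀ {n} c w h (S : Subset n) → Ops.𝔼 (row-space n w h) (λ r → ∏L (λ j → is c (lookup r j)) (elems S)) ≡ ∏L (λ j → weight c (w j)) (elems S)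
  𝔼-row c w h [] = refl
  𝔼-row {suc n} c w h (true ∷ S) = trans (Ops.𝔼-cong (bernoulli-space (w zero) (h zero) ⊗ row-space n (w ∘ suc) (h ∘ suc)) λ { (b , r) → cong (is c b *_) (∏L-map (λ j → is c (lookup (b ∷ r) j)) suc (elems S)) })
    (trans (E-⊗ (bernoulli-space (w zero) (h zero)) (row-space n (w ∘ suc) (h ∘ suc)) (is c) (λ r → ∏L (λ j → is c (lookup r j)) (elems S)))
    (cong₂ _*_ (𝔼-is (w zero) (h zero) c) (trans (𝔼-row c (w ∘ suc) (h ∘ suc) S) (sym (∏L-map (λ j → weight c (w j)) suc (elems S))))))
  𝔼-row {suc n} c w h (false ∷ S) = trans (Ops.𝔼-cong (bernoulli-space (w zero) (h zero) ⊗ row-space n (w ∘ suc) (h ∘ suc)) λ { (b , r) → trans (∏L-map (λ j → is c (lookup (b ∷ r) j)) suc (elems S)) (sym (*-identityˡ _)) })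
    (trans (E-⊗ (bernoulli-space (w zero) (h zero)) (row-space n (w ∘ suc) (h ∘ suc)) (λ _ → 1ℚ) (λ r → ∏L (λ j → is c (lookup r j)) (elems S)))
    (trans (cong₂ _*_ (Ops.𝔼-one (bernoulli-space (w zero) (h zero))) (trans (𝔼-row c (w ∘ suc) (h ∘ suc) S) (sym (∏L-map (λ j → weight c (w j)) suc (elems S))))) (*-identityˡ _)))

  -- Independence: if vertex zero belongs to `S`, its edges form a row that is independent of the
  -- remaining triangle, and the mean splits along `pairs`.
  𝔼-clique : ∀ {n} c w h (S : Subset n) → Ops.𝔼 (triangle-space n w h) (λ t → clique c t S) ≡ ∏L (λ (i , j) → weight c (w i j)) (pairs (elems S))
  𝔼-clique c w h [] = refl
  𝔼-clique {suc n} c w h (true ∷ S) = trans (Ops.𝔼-cong (triangle-space (suc n) w h) λ { (r , t) → pairs-∷ (λ (i , j) → is c (entry (r , t) i j)) (elems S) })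
    (trans (E-⊗ (row-space n (w zero ∘ suc) (h zero ∘ suc)) (triangle-space n _ (λ i j → h (suc i) (suc j))) (λ r → ∏L (λ j → is c (lookup r j)) (elems S)) (λ t → clique c t S))
    (trans (cong₂ _*_ (𝔼-row c (w zero ∘ suc) (h zero ∘ suc) S) (𝔼-clique c _ (λ i j → h (suc i) (suc j)) S)) (sym (pairs-∷ (λ (i , j) → weight c (w i j)) (elems S)))))
  𝔼-clique {suc n} c w h (false ∷ S) = trans (Ops.𝔼-cong (triangle-space (suc n) w h) λ { (r , t) → trans (pairs-map-suc (λ (i , j) → is c (entry (r , t) i j)) (elems S)) (sym (*-identityˡ _)) })
    (trans (E-⊗ (row-space n (w zero ∘ suc) (h zero ∘ suc)) (triangle-space n _ (λ i j → h (suc i) (suc j))) (λ _ → 1ℚ) (λ t → clique c t S))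
    (trans (cong₂ _*_ (Ops.𝔼-one (row-space n (w zero ∘ suc) (h zero ∘ suc))) (𝔼-clique c _ (λ i j → h (suc i) (suc j)) S)) (trans (*-identityˡ _) (sym (pairs-map-suc (λ (i , j) → weight c (w i j)) (elems S))))))

  0≤clique : ∀ {n} c (t : Triangle n) S → 0ℚ ≤ clique c t S
  0≤clique c t S = ∏L-nonneg (λ (i , j) → 0≤is c (entry t i j)) (pairs (elems S))

  All-pairs : ∀ {A : Set} {P : A → Set} {Q : A × A → Set} → (∀ {i j} → P i → P j → i ≢ j → Q (i , j)) → ∀ {xs} → All P xs → Unique xs → All Q (pairs xs)
  All-pairs h []       []       = []
  All-pairs h (p ∷ ps) (u ∷ us) = All.++⁺ (All.map⁺ (All.zipWith (λ (q , n) → h p q n) (ps , u))) (All-pairs h ps us)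

  HasClique⇒1≤ : ∀ {n} c (t : Triangle n) m → HasClique (matrix t) c m → 1ℚ ≤ ∑L (clique c t) (subsets n m)
  HasClique⇒1≤ c t m (S , refl , mono) = subst (_≤ ∑L (clique c t) (subsets _ ∣ S ∣))
    (∏L-one (All-pairs (λ {i} {j} p q i≢j → trans (cong (is c) (trans (sym (colour-matrix t i j)) (mono i j p q i≢j))) (is-refl c)) (elems-∈ S) (elems-unique S)))
    (∑L-member (0≤clique c t) (∈-subsets S))

  -- Arrowing puts a red or a blue clique into every colouring, so the number of these cliques is at
  -- least 1 pointwise, and so is its mean under independent colours.
  first-moment : ∀ {ℓ k n} → Arrows ℓ k n → (w : Fin n → Fin n → ℚ) → (∀ i j → In01 (w i j)) →
    1ℚ ≤ ∑L (λ S → ∏L (λ (i , j) → w i j) (pairs (elems S))) (subsets n ℓ) + ∑L (λ S → ∏L (λ (i , j) → 1ℚ - w i j) (pairs (elems S))) (subsets n k)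
  first-moment {ℓ} {k} {n} arr w h = begin
    1ℚ  ≡⟨ sym 𝔼-one ⟩
    𝔼 (λ _ → 1ℚ)  ≤⟨ 𝔼-mono pointwise ⟩
    𝔼 (λ t → ∑L (clique red t) (subsets n ℓ) + ∑L (clique blue t) (subsets n k))
      ≡⟨ trans (𝔼-+ _ _) (cong₂ _+_ (trans (𝔼-∑L T (λ S t → clique red t S) (subsets n ℓ)) (∑L-cong (𝔼-clique red w h) (subsets n ℓ)))
                                    (trans (𝔼-∑L T (λ S t → clique blue t S) (subsets n k)) (∑L-cong (𝔼-clique blue w h) (subsets n k)))) ⟩
    _ ∎
    where
    open ≤-Reasoning
    T = triangle-space n w h
    open Ops T
    sym-matrix : ∀ t → Symmetric (matrix t)
    sym-matrix t i j = trans (colour-matrix t i j) (trans (entry-sym t i j) (sym (colour-matrix t j i)))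
    pointwise : ∀ t → 1ℚ ≤ ∑L (clique red t) (subsets n ℓ) + ∑L (clique blue t) (subsets n k)
    pointwise t with arr (matrix t) (sym-matrix t)
    ... | inj₁ r = subst (_≤ ∑L (clique red t) (subsets n ℓ) + ∑L (clique blue t) (subsets n k)) (+-identityʳ 1ℚ) (+-mono-≤ (HasClique⇒1≤ red t ℓ r) (∑L-nonneg (0≤clique blue t) (subsets n k)))
    ... | inj₂ b = subst (_≤ ∑L (clique red t) (subsets n ℓ) + ∑L (clique blue t) (subsets n k)) (+-identityˡ 1ℚ) (+-mono-≤ (∑L-nonneg (0≤clique red t) (subsets n ℓ)) (HasClique⇒1≤ blue t k b))

-- Union bound over the vertex sets of both sizes

module UnionBound where
  open Rationals
  open Fourier
  open Spins
  open Mixtures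
  open PartitionFunction
  open RandomWeights
  open FirstMoment
  open import Defs using (Arrows)
  open import Data.Bool.Base using (true; false)
  open import Data.Fin.Base using (Fin; zero; suc)
  import Data.Fin.Subset
  open import Data.Fin.Subset using (Subset; ∣_∣)
  open import Data.List.Base using (List; []; _∷_; map; length)
  open import Data.List.Properties using (length-++; length-map)
  open import Data.List.Relation.Unary.All as All using (All)
  import Data.List.Relation.Unary.All.Properties as All
  open import Data.List.Relation.Unary.Unique.Propositional using (Unique)
  open import Data.Rational hiding (∣_∣)
  open import Data.Rational.Properties
  open import Data.Vec.Base using (Vec; []; _∷_; lookup)

  -- The binomial coefficient m choose 2, in a recursion that follows `pairs`.
  ∑↓ : ℕ → ℕ
  ∑↓ zero    = 0
  ∑↓ (suc m) = m ℕ.+ ∑↓ m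

  length-pairs-∑↓ : ∀ {A : Set} (xs : List A) → length (pairs xs) ≡ ∑↓ (length xs)
  length-pairs-∑↓ []       = refl
  length-pairs-∑↓ (x ∷ xs) = trans (length-++ (map (x ,_) xs)) (cong₂ ℕ._+_ (length-map (x ,_) xs) (length-pairs-∑↓ xs))

  -- Avoids halves and subtraction. It is the reason why the final estimates square the totals and
  -- multiply them by one more power of the edge weight.
  ∑↓-square : ∀ m → 2 ℕ.* ∑↓ m ℕ.+ m ≡ m ℕ.* m
  ∑↓-square zero    = refl
  ∑↓-square (suc m) = trans (e₁ m (∑↓ m)) (trans (cong (λ z → z ℕ.+ (m ℕ.+ suc m)) (∑↓-square m)) (e₂ m))
    where
    open import Data.Nat.Tactic.RingSolver using () renaming (solve-∀ to solve-ℕ)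
    e₁ : ∀ m x → 2 ℕ.* (m ℕ.+ x) ℕ.+ suc m ≡ 2 ℕ.* x ℕ.+ m ℕ.+ (m ℕ.+ suc m)
    e₁ = solve-ℕ
    e₂ : ∀ m → m ℕ.* m ℕ.+ (m ℕ.+ suc m) ≡ suc m ℕ.* suc m
    e₂ = solve-ℕ

  ζ≤1 : ∀ {n} (e : Fin n × Fin n) v → ζ e v ≤ 1ℚ
  ζ≤1 (i , j) v = sgn≤ (lookup v i) (lookup v j)
    where
    sgn≤ : ∀ a b → sgn a * sgn b ≤ 1ℚ
    sgn≤ true  true  = ≤-refl
    sgn≤ true  false = <⇒≤ (neg<pos (- 1ℚ) 1ℚ)
    sgn≤ false true  = <⇒≤ (neg<pos (- 1ℚ) 1ℚ)
    sgn≤ false false = ≤-refl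

  module _ {n : ℕ} {τ : ℚ} (0≤τ : 0ℚ ≤ τ) (τ≤1 : τ ≤ 1ℚ) where
    0≤1-τζ : ∀ (e : Fin n × Fin n) v → 0ℚ ≤ 1ℚ - τ * ζ e v
    0≤1-τζ e v = sub⁺ (≤-trans (≤-trans (*-monoˡ 0≤τ (ζ≤1 e v)) (≤-reflexive (*-identityʳ τ))) τ≤1)

    -- Negative couplings leave the cone, so the sign is read off pointwise: for τ ≤ 1 every factor
    -- is nonnegative.
    0≤Z- : ∀ is → 0ℚ ≤ Z {n} (- τ) is
    0≤Z- is = Ops.𝔼-nonneg (cube n) (go (pairs is))
      where
      e′ : ∀ t z → 1ℚ - t * z ≡ 1ℚ + - t * z
      e′ = solve-∀ ℚ-ring
      go : ∀ es v → 0ℚ ≤ Π (map (scale (- τ)) (map ζ es)) v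
      go []       v = 0≤1
      go (e ∷ es) v = subst (0ℚ ≤_) (e′ τ (ζ e v)) (0≤1-τζ e v) ⊛ go es v

  ∏-nonneg : ∀ {X : Set} {n} {f : X → ℚ} → (∀ v → 0ℚ ≤ f v) → (xs : Vec X n) → 0ℚ ≤ ∏ f xs
  ∏-nonneg h []       = 0≤1
  ∏-nonneg h (x ∷ xs) = h x ⊛ ∏-nonneg h xs

  -- The witness is a cut off at 1. Where the cut takes effect, 1 - w vanishes while 1 - a + a · a^m
  -- is at least 1; otherwise the added power is mere slack.
  truncated : ∀ {a} m → 0ℚ ≤ a → ∃[ w ] (In01 w × w ≤ a × 1ℚ - w ≤ 1ℚ - a + a ^ suc m)
  truncated {a} m 0≤a with ≤-total a 1ℚ
  ... | inj₁ a≤1 = a , (0≤a , a≤1) , ≤-refl , by-diff (a ^ suc m) (0≤^ (suc m) 0≤a) (e a (a ^ suc m))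
    where e : ∀ a b → 1ℚ - a + b - (1ℚ - a) ≡ b
          e = solve-∀ ℚ-ring
  ... | inj₂ 1≤a = 1ℚ , (0≤1 , ≤-refl) , 1≤a , by-diff (1ℚ + a * (a ^ m - 1ℚ)) (0≤1 ⊕ 0≤a ⊛ sub⁺ (1≤^ m 1≤a)) (e a (a ^ m))
    where e : ∀ a b → 1ℚ - a + a * b - (1ℚ - 1ℚ) ≡ 1ℚ + a * (b - 1ℚ)
          e = solve-∀ ℚ-ring

  ι-^ : ∀ n m → ι (n ℕ.^ m) ≡ ι n ^ m
  ι-^ n zero    = ι-1
  ι-^ n (suc m) = trans (ι-* n (n ℕ.^ m)) (cong (ι n *_) (ι-^ n m))

  -- ρ bounds the red partition function per coordinate, φ the blue one, and ω is the blue weight of an edge.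
  union-bound : ∀ {ℓ k n} d (p τ : ℚ) m {ρ ω φ} → 0ℚ ≤ p → 0ℚ ≤ τ → τ ≤ 1ℚ → Arrows ℓ k n →
    (∀ {is : List (Fin n)} → Unique is → length is ≡ ℓ → Z (- τ) is ≤ ρ) →
    (∀ {is : List (Fin n)} → Unique is → length is ≡ k →
      Ops.𝔼 (Weighting.Ω {n} d p τ (suc m)) (λ x → ∏L (λ e → Weighting.Blue d p τ (suc m) e x) (pairs is)) ≤ ω ^ ∑↓ k * φ ^ d) →
    0ℚ ≤ ρ → 0ℚ ≤ ω ^ ∑↓ k * φ ^ d →
    1ℚ ≤ ι n ^ ℓ * (p ^ ∑↓ ℓ * ρ ^ d) + ι n ^ k * (ω ^ ∑↓ k * φ ^ d)
  union-bound {ℓ} {k} {n} d p τ m {ρ} {ω} {φ} 0≤p 0≤τ τ≤1 arr hρ hφ 0≤ρ 0≤φ = begin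
    1ℚ ≡⟨ sym (O.𝔼-one) ⟩
    O.𝔼 (λ _ → 1ℚ) ≤⟨ O.𝔼-mono pointwise ⟩
    O.𝔼 (λ x → ∑L (λ S → ∏L (λ e → Red e x) (pairs (elems S))) (subsets n ℓ) + ∑L (λ S → ∏L (λ e → Blue e x) (pairs (elems S))) (subsets n k))
      ≡⟨ trans (O.𝔼-+ _ _) (cong₂ _+_ (𝔼-∑L Ω (λ S x → ∏L (λ e → Red e x) (pairs (elems S))) (subsets n ℓ)) (𝔼-∑L Ω (λ S x → ∏L (λ e → Blue e x) (pairs (elems S))) (subsets n k))) ⟩
    ∑L (λ S → O.𝔼 (λ x → ∏L (λ e → Red e x) (pairs (elems S)))) (subsets n ℓ) + ∑L (λ S → O.𝔼 (λ x → ∏L (λ e → Blue e x) (pairs (elems S)))) (subsets n k)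
      ≤⟨ +-mono-≤ (∑L-≤-length (subsets n ℓ) (All.map (λ {S} → red-term S) (subsets-size n ℓ))) (∑L-≤-length (subsets n k) (All.map (λ {S} h → hφ (elems-unique S) (trans (length-elems S) h)) (subsets-size n k))) ⟩
    ι (length (subsets n ℓ)) * (p ^ ∑↓ ℓ * ρ ^ d) + ι (length (subsets n k)) * (ω ^ ∑↓ k * φ ^ d)
      ≤⟨ +-mono-≤ (*-monoʳ (0≤^ (∑↓ ℓ) 0≤p ⊛ 0≤^ d 0≤ρ) (count ℓ)) (*-monoʳ 0≤φ (count k)) ⟩
    ι n ^ ℓ * (p ^ ∑↓ ℓ * ρ ^ d) + ι n ^ k * (ω ^ ∑↓ k * φ ^ d) ∎
    where
    open ≤-Reasoning
    open Weighting {n} d p τ (suc m)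
    module O = Ops Ω
    0≤Red : ∀ e x → 0ℚ ≤ Red e x
    0≤Red e x = 0≤p ⊛ ∏-nonneg (0≤1-τζ 0≤τ τ≤1 e) x
    count : ∀ m → ι (length (subsets n m)) ≤ ι n ^ m
    count m = ≤-trans (ι-mono (length-subsets n m)) (≤-reflexive (ι-^ n m))
    red-term : ∀ S → Data.Fin.Subset.∣ S ∣ ≡ ℓ → O.𝔼 (λ x → ∏L (λ e → Red e x) (pairs (elems S))) ≤ p ^ ∑↓ ℓ * ρ ^ d
    red-term S h = begin
      O.𝔼 (λ x → ∏L (λ e → Red e x) (pairs (elems S)))  ≡⟨ 𝔼-red (elems S) ⟩
      p ^ length (pairs (elems S)) * Z (- τ) (elems S) ^ d
        ≡⟨ cong (λ j → p ^ j * Z (- τ) (elems S) ^ d) (trans (length-pairs-∑↓ (elems S)) (cong ∑↓ (trans (length-elems S) h))) ⟩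
      p ^ ∑↓ ℓ * Z (- τ) (elems S) ^ d  ≤⟨ *-monoˡ (0≤^ (∑↓ ℓ) 0≤p) (^-mono d (0≤Z- 0≤τ τ≤1 (elems S)) (hρ (elems-unique S) (trans (length-elems S) h))) ⟩
      p ^ ∑↓ ℓ * ρ ^ d ∎
    -- For fixed signs x the edges are coloured independently with the truncated probabilities; the
    -- mean over x is taken afterwards.
    pointwise : ∀ x → 1ℚ ≤ ∑L (λ S → ∏L (λ e → Red e x) (pairs (elems S))) (subsets n ℓ) + ∑L (λ S → ∏L (λ e → Blue e x) (pairs (elems S))) (subsets n k)
    pointwise x = ≤-trans (first-moment {ℓ} {k} {n} arr w (λ i j → proj₁ (proj₂ (t (i , j)))))
      (+-mono-≤ (∑L-mono (λ S → ∏L-mono (λ e → proj₁ (proj₁ (proj₂ (t e)))) (λ e → proj₁ (proj₂ (proj₂ (t e)))) (pairs (elems S))) (subsets n ℓ))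
                (∑L-mono (λ S → ∏L-mono (λ e → sub⁺ (proj₂ (proj₁ (proj₂ (t e))))) (λ e → proj₂ (proj₂ (proj₂ (t e)))) (pairs (elems S))) (subsets n k)))
      where
      t : ∀ e → ∃[ w ] (In01 w × w ≤ Red e x × 1ℚ - w ≤ Blue e x)
      t e = truncated m (0≤Red e x)
      w : Fin n → Fin n → ℚ
      w i j = proj₁ (t (i , j))

-- Convexity, decay of powers and the Archimedean property

module Inequalities where
  open Rationals
  open EdgeReplacement using (inverse)
  open import Data.Integer.Base using (+_; -[1+_])
  import Data.Integer.Base as ℤ
  import Data.Integer.Properties as ℤ
  open import Data.Rational
  open import Data.Rational.Properties

  0≤sq : ∀ x → 0ℚ ≤ x * x
  0≤sq x with ≤-total 0ℚ x
  ... | inj₁ h = h ⊛ h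
  ... | inj₂ h = subst (0ℚ ≤_) (e x) (neg-antimono-≤ h ⊛ neg-antimono-≤ h)
    where e : ∀ x → - x * - x ≡ x * x
          e = solve-∀ ℚ-ring

  -- Convexity: the left side is the tangent line of b^(n + 1) at the point a.
  tangent : ∀ n {a b} → 0ℚ ≤ a → 0ℚ ≤ b → a ^ n * ((1ℚ + ι n) * b - ι n * a) ≤ b ^ suc n
  tangent zero {a} {b} 0≤a 0≤b = ≤-reflexive (trans (cong (λ z → 1ℚ * ((1ℚ + z) * b - z * a)) ι-0) (e a b))
    where e : ∀ a b → 1ℚ * ((1ℚ + 0ℚ) * b - 0ℚ * a) ≡ b * 1ℚ
          e = solve-∀ ℚ-ring
  tangent (suc n) {a} {b} 0≤a 0≤b = begin
    a * a ^ n * ((1ℚ + ι (suc n)) * b - ι (suc n) * a)  ≡⟨ cong (λ z → a * a ^ n * ((1ℚ + z) * b - z * a)) (ι-suc n) ⟩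
    a * a ^ n * ((1ℚ + (1ℚ + ι n)) * b - (1ℚ + ι n) * a)
      ≤⟨ by-diff (a ^ n * ((1ℚ + ι n) * ((a - b) * (a - b)))) (0≤^ n 0≤a ⊛ ((0≤1 ⊕ 0≤ι n) ⊛ 0≤sq (a - b))) (e a (a ^ n) b (ι n)) ⟩
    b * (a ^ n * ((1ℚ + ι n) * b - ι n * a))            ≤⟨ *-monoˡ 0≤b (tangent n 0≤a 0≤b) ⟩
    b * b ^ suc n ∎
    where
    open ≤-Reasoning
    e : ∀ a p b n → b * (p * ((1ℚ + n) * b - n * a)) - a * p * ((1ℚ + (1ℚ + n)) * b - (1ℚ + n) * a) ≡ p * ((1ℚ + n) * ((a - b) * (a - b)))
    e = solve-∀ ℚ-ring

  -- (1 + x/n)ⁿ increases with n.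
  spread₁ : ∀ n {y z} → 0ℚ ≤ y → 0ℚ ≤ z → ι (suc n) * z ≡ ι n * y → (1ℚ + y) ^ n ≤ (1ℚ + z) ^ suc n
  spread₁ n {y} {z} 0≤y 0≤z h = ≤-trans (≤-reflexive (trans (sym (*-identityʳ _)) (cong ((1ℚ + y) ^ n *_) one)))
    (tangent n (0≤1 ⊕ 0≤y) (0≤1 ⊕ 0≤z))
    where
    e₁ : ∀ n y z → (1ℚ + n) * (1ℚ + z) - n * (1ℚ + y) ≡ 1ℚ + ((1ℚ + n) * z - n * y)
    e₁ = solve-∀ ℚ-ring
    e₂ : ∀ a → 1ℚ + (a - a) ≡ 1ℚ
    e₂ = solve-∀ ℚ-ring
    one : 1ℚ ≡ (1ℚ + ι n) * (1ℚ + z) - ι n * (1ℚ + y)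
    one = sym (trans (e₁ (ι n) y z) (trans (cong (λ w → 1ℚ + (w - ι n * y)) (trans (cong (_* z) (sym (ι-suc n))) h)) (e₂ (ι n * y))))

  spread : ∀ e n {y z} → 0ℚ ≤ y → 0ℚ ≤ z → ι (e ℕ.+ suc n) * z ≡ ι (suc n) * y → (1ℚ + y) ^ suc n ≤ (1ℚ + z) ^ (e ℕ.+ suc n)
  spread zero    n {y} {z} 0≤y 0≤z h = ≤-reflexive (cong (λ w → (1ℚ + w) ^ suc n) y≡z)
    where
    iv = inverse (0<ι n)
    y≡z : y ≡ z
    y≡z = trans (e (ι (suc n)) y (proj₁ iv)) (trans (cong (_* proj₁ iv) (sym h)) (sym (e (ι (suc n)) z (proj₁ iv))))
      where
      e : ∀ a y b → {{a * b ≡ 1ℚ}} → y ≡ a * y * b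
      e a y b {{p}} = trans (sym (*-identityʳ y)) (trans (cong (y *_) (sym p)) (r a y b))
        where r : ∀ a y b → y * (a * b) ≡ a * y * b
              r = solve-∀ ℚ-ring
      instance
        inst : ι (suc n) * proj₁ iv ≡ 1ℚ
        inst = proj₂ (proj₂ iv)
  spread (suc e) n {y} {z} 0≤y 0≤z h = ≤-trans (spread e n 0≤y 0≤w hw) (spread₁ (e ℕ.+ suc n) 0≤w 0≤z (trans h (sym hw)))
    where
    N = e ℕ.+ suc n
    0<N : 0ℚ < ι N
    0<N = <-≤-trans (0<ι n) (ι-mono (ℕ.m≤n+m (suc n) e))
    iv = inverse 0<N
    w = ι (suc n) * y * proj₁ iv
    0≤w : 0ℚ ≤ w
    0≤w = 0≤ι (suc n) ⊛ 0≤y ⊛ <⇒≤ (proj₁ (proj₂ iv))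
    hw : ι N * w ≡ ι (suc n) * y
    hw = trans (r (ι N) (ι (suc n) * y) (proj₁ iv)) (trans (cong (ι (suc n) * y *_) (proj₂ (proj₂ iv))) (*-identityʳ _))
      where r : ∀ a b c → a * (b * c) ≡ b * (a * c)
            r = solve-∀ ℚ-ring

  -- Bernoulli bounds the second factor by (1 + x)^n, and (1 - x)(1 + x) ≤ 1. This yields an
  -- explicit rate for `vanishing` without logarithms.
  decay : ∀ n {x} → 0ℚ ≤ x → x ≤ 1ℚ → (1ℚ - x) ^ n * (1ℚ + ι n * x) ≤ 1ℚ
  decay n {x} 0≤x x≤1 = begin
    (1ℚ - x) ^ n * (1ℚ + ι n * x)   ≤⟨ *-monoˡ (0≤^ n (sub⁺ x≤1)) (bernoulli n 0≤x) ⟩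
    (1ℚ - x) ^ n * (1ℚ + x) ^ n     ≡⟨ sym (*-^ (1ℚ - x) (1ℚ + x) n) ⟩
    ((1ℚ - x) * (1ℚ + x)) ^ n       ≤⟨ ^≤1 n (sub⁺ x≤1 ⊛ (0≤1 ⊕ 0≤x)) (by-diff (x * x) (0≤x ⊛ 0≤x) (e x)) ⟩
    1ℚ ∎
    where
    open ≤-Reasoning
    e : ∀ x → 1ℚ - (1ℚ - x) * (1ℚ + x) ≡ x * x
    e = solve-∀ ℚ-ring

  archimedean : ∀ q → ∃[ n ] q ≤ ι n
  archimedean q@(mkℚ (+ n) d c) = n , subst (q ≤_) (sym (ι-def n)) (≤-trans le (≤-reflexive (sym (↥p/↧p≡p (mkℚ (+ n) 0 (cop n))))))
    where
    open import Data.Nat.Coprimality using (Coprime; 1-coprimeTo)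
    import Data.Nat.Coprimality as Cop
    cop : ∀ n → Coprime n 1
    cop n = Cop.sym (1-coprimeTo n)
    le : q ≤ mkℚ (+ n) 0 (cop n)
    le = *≤* (ℤ.*-monoˡ-≤-nonNeg (+ n) (ℤ.+≤+ (ℕ.s≤s ℕ.z≤n)))
  archimedean q@(mkℚ -[1+ n ] d c) = 0 , ≤-trans (nonPositive⁻¹ q) (0≤ι 0)

  archimedean* : ∀ {x} → 0ℚ < x → ∀ y → ∃[ n ] y ≤ ι n * x
  archimedean* {x} 0<x y = let z , 0<z , xz = inverse 0<x ; n , h = archimedean (y * z) in
    n , subst (_≤ ι n * x) (trans (e y z x) (trans (cong (y *_) xz) (*-identityʳ y))) (*-monoʳ (<⇒≤ 0<x) h)
    where e : ∀ y z x → y * z * x ≡ y * (x * z)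
          e = solve-∀ ℚ-ring

  vanishing : ∀ {x} → 0ℚ < x → x ≤ 1ℚ → ∀ {y} → 0ℚ < y → ∃[ L ] (∀ n → L ℕ.≤ n → (1ℚ - x) ^ n ≤ y)
  vanishing {x} 0<x x≤1 {y} 0<y = let z , 0<z , yz = inverse 0<y ; L , h = archimedean* 0<x z in
    L , λ n L≤n → *-cancel (<-≤-trans 0<1 (subst (_≤ 1ℚ + ι n * x) (+-identityʳ 1ℚ) (+-monoʳ-≤ 1ℚ (0≤ι n ⊛ <⇒≤ 0<x))))
      (≤-trans (decay n (<⇒≤ 0<x) x≤1) (subst (_≤ y * (1ℚ + ι n * x)) yz
        (*-monoˡ (<⇒≤ 0<y) (≤-trans h (≤-trans (*-monoʳ (<⇒≤ 0<x) (ι-mono L≤n)) (subst (_≤ 1ℚ + ι n * x) (+-identityˡ _) (+-monoˡ-≤ (ι n * x) 0≤1)))))))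

  least-positive : ∀ {a b} → 0ℚ < a → 0ℚ < b → ∃[ c ] (0ℚ < c × c ≤ a × c ≤ b)
  least-positive {a} {b} 0<a 0<b = a ⊓ b , 0<⊓ (⊓-sel a b) , p⊓q≤p a b , p⊓q≤q a b
    where
    0<⊓ : a ⊓ b ≡ a ⊎ a ⊓ b ≡ b → 0ℚ < a ⊓ b
    0<⊓ (inj₁ e) = subst (0ℚ <_) (sym e) 0<a
    0<⊓ (inj₂ e) = subst (0ℚ <_) (sym e) 0<b

-- Exponential against polynomial growth

module Growth where
  open import Data.Nat.Base using (ℕ; zero; suc; _≤_; _*_; _+_; _^_)
  open import Data.Nat.Tactic.RingSolver using () renaming (solve-∀ to solve-ℕ)

  open ℕ.≤-Reasoning

  n<2^n : ∀ n → suc n ≤ 2 ^ n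
  n<2^n zero    = ℕ.≤-refl
  n<2^n (suc n) = begin
    suc (suc n)     ≤⟨ ℕ.s≤s (n<2^n n) ⟩
    1 + 2 ^ n       ≤⟨ ℕ.+-mono-≤ (ℕ.m^n>0 2 n) (ℕ.m≤m+n (2 ^ n) 0) ⟩
    2 ^ suc n       ∎

  -- With j = 16 i and i = X + 3 the left side is X i⁴ 2^24. Each of the five factors X, i, i, i, i
  -- is at most 2^i, and 24 ≤ 11 i; the exponents add up to 16 i.
  exponential-beats-quartic : ∀ X → ∃[ j ] (1 ≤ j × X * ((4 * j) * (4 * j) * (4 * j) * (4 * j)) ≤ 2 ^ j)
  exponential-beats-quartic X = 16 * i , ℕ.s≤s ℕ.z≤n , (begin
    X * ((4 * (16 * i)) * (4 * (16 * i)) * (4 * (16 * i)) * (4 * (16 * i)))  ≡⟨ e X i ⟩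
    X * (i * i * i * i) * 2 ^ 24
      ≤⟨ ℕ.*-mono-≤ (ℕ.*-mono-≤ (ℕ.m≤n+m X 3) (ℕ.≤-refl {i * i * i * i})) (ℕ.^-monoʳ-≤ 2 24≤11i) ⟩
    i * (i * i * i * i) * 2 ^ (11 * i)
      ≤⟨ ℕ.*-monoˡ-≤ (2 ^ (11 * i)) (ℕ.*-mono-≤ b (ℕ.*-mono-≤ (ℕ.*-mono-≤ (ℕ.*-mono-≤ b b) b) b)) ⟩
    2 ^ i * (2 ^ i * 2 ^ i * 2 ^ i * 2 ^ i) * 2 ^ (11 * i)
      ≡⟨ sym (trans (cong (2 ^_) (e′ i)) (trans (d (i + (i + i + i + i)) (11 * i)) (cong (_* 2 ^ (11 * i)) (trans (d i (i + i + i + i))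
           (cong (2 ^ i *_) (trans (d (i + i + i) i) (cong (_* 2 ^ i) (trans (d (i + i) i) (cong (_* 2 ^ i) (d i i)))))))))) ⟩
    2 ^ (16 * i) ∎)
    where
    i = 3 + X
    b : i ≤ 2 ^ i
    b = ℕ.≤-trans (ℕ.n≤1+n i) (n<2^n i)
    24≤11i : 24 ≤ 11 * i
    24≤11i = ℕ.≤-trans (from-yes (24 ℕ.≤? 33)) (ℕ.*-monoʳ-≤ 11 (ℕ.m≤m+n 3 X))
    e : ∀ X i → X * ((4 * (16 * i)) * (4 * (16 * i)) * (4 * (16 * i)) * (4 * (16 * i))) ≡ X * (i * i * i * i) * 16777216
    e = solve-ℕ
    e′ : ∀ i → 16 * i ≡ i + (i + i + i + i) + 11 * i
    e′ = solve-ℕ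
    d : ∀ m n → 2 ^ (m + n) ≡ 2 ^ m * 2 ^ n
    d = ℕ.^-distribˡ-+-* 2

-- Per-edge bases of the two totals, to first order in η

module Bases where
  open Rationals
  open import Data.Integer.Base using (+_)
  open import Data.Rational
  open import Data.Rational.Properties
  open import Relation.Binary.Definitions using (tri<; tri≈; tri>)

  sq-cancel : ∀ {x y} → 0ℚ ≤ y → x * x ≤ y * y → x ≤ y
  sq-cancel {x} {y} 0≤y h with <-cmp x y
  ... | tri< p _ _ = <⇒≤ p
  ... | tri≈ _ p _ = ≤-reflexive p
  ... | tri> _ _ p = contradiction (≤-<-trans h (≤-<-trans (*-monoˡ 0≤y (<⇒≤ p)) (*-monoˡ-<-pos x {{positive (≤-<-trans 0≤y p)}} p))) (<-irrefl refl)

  module Base (g χ η : ℚ) (0≤g : 0ℚ ≤ g) (g≤1 : g ≤ 1ℚ) (0≤χ : 0ℚ ≤ χ) (48χ≤g : (+ 48 / 1) * χ ≤ g) (0≤η : 0ℚ ≤ η) (5η≤χ : (+ 5 / 1) * η ≤ χ) where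
    -- 3 ξ = 1 - g/2 is the midpoint between 1 - g, which bounds C p²/q², and 1.
    ξ : ℚ
    ξ = (+ 1 / 3) - (+ 1 / 6) * g

    χ≤1 : χ ≤ 1ℚ
    χ≤1 = ≤-trans (by-diff ((+ 47 / 1) * χ) (nonNegative⁻¹ (+ 47 / 1) ⊛ 0≤χ) (e χ)) (≤-trans 48χ≤g g≤1)
      where e : ∀ x → (+ 48 / 1) * x - x ≡ (+ 47 / 1) * x
            e = solve-∀ ℚ-ring

    48χ≤1 : (+ 48 / 1) * χ ≤ 1ℚ
    48χ≤1 = ≤-trans 48χ≤g g≤1

    η≤1 : η ≤ 1ℚ
    η≤1 = ≤-trans (by-diff ((+ 4 / 1) * η) (nonNegative⁻¹ (+ 4 / 1) ⊛ 0≤η) (e η)) (≤-trans 5η≤χ χ≤1)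
      where e : ∀ x → (+ 5 / 1) * x - x ≡ (+ 4 / 1) * x
            e = solve-∀ ℚ-ring

    0≤ξ : 0ℚ ≤ ξ
    0≤ξ = subst (0ℚ ≤_) (e g) (nonNegative⁻¹ (+ 1 / 6) ⊕ nonNegative⁻¹ (+ 1 / 6) ⊛ sub⁺ g≤1)
      where e : ∀ g → (+ 1 / 6) + (+ 1 / 6) * (1ℚ - g) ≡ (+ 1 / 3) - (+ 1 / 6) * g
            e = solve-∀ ℚ-ring

    ξ≤1 : ξ ≤ 1ℚ
    ξ≤1 = by-diff ((+ 2 / 3) + (+ 1 / 6) * g) (nonNegative⁻¹ (+ 2 / 3) ⊕ nonNegative⁻¹ (+ 1 / 6) ⊛ 0≤g) (e g)
      where e : ∀ g → 1ℚ - ((+ 1 / 3) - (+ 1 / 6) * g) ≡ (+ 2 / 3) + (+ 1 / 6) * g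
            e = solve-∀ ℚ-ring

    a : ℚ
    a = (+ 1 / 6) - χ

    ρ : ℚ
    ρ = 1ℚ - a * η

    0≤a : 0ℚ ≤ a
    0≤a = subst (0ℚ ≤_) (e χ) (nonNegative⁻¹ (+ 1 / 48) ⊛ (sub⁺ 48χ≤1 ⊕ nonNegative⁻¹ (+ 7 / 1)))
      where e : ∀ x → (+ 1 / 48) * (1ℚ - (+ 48 / 1) * x + (+ 7 / 1)) ≡ (+ 1 / 6) - x
            e = solve-∀ ℚ-ring

    a≤1 : a ≤ 1ℚ
    a≤1 = by-diff ((+ 5 / 6) + χ) (nonNegative⁻¹ (+ 5 / 6) ⊕ 0≤χ) (e χ)
      where e : ∀ x → 1ℚ - ((+ 1 / 6) - x) ≡ (+ 5 / 6) + x
            e = solve-∀ ℚ-ring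

    0≤ρ : 0ℚ ≤ ρ
    0≤ρ = sub⁺ (≤-trans (*-mono 0≤a 0≤η a≤1 η≤1) ≤-refl)

    -- The coefficient of η is χ + ξ - 2 a = 3 χ - g/6, at most - 5 χ because 48 χ ≤ g; the higher
    -- terms are at most 5 η² ≤ χ η. The factor `1 + χ * η` is the slack in S² P, and ρ is squared
    -- because the totals are.
    red-base : (1ℚ + χ * η) * (1ℚ + ξ * η) * (ρ * ρ) ≤ 1ℚ - χ * η
    red-base = begin
      (1ℚ + χ * η) * (1ℚ + ξ * η) * (ρ * ρ)
        ≤⟨ *-mono {b = 1ℚ + U} {d = 1ℚ - (+ 2 / 1) * (a * η) + η * η} ((0≤1 ⊕ 0≤χ ⊛ 0≤η) ⊛ (0≤1 ⊕ 0≤ξ ⊛ 0≤η)) (0≤ρ ⊛ 0≤ρ)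
             (by-diff (η * η * (1ℚ - χ * ξ)) (0≤η ⊛ 0≤η ⊛ sub⁺ (*-mono 0≤χ 0≤ξ χ≤1 ξ≤1)) (e₁ χ ξ η))
             (by-diff (η * η * (1ℚ - a * a)) (0≤η ⊛ 0≤η ⊛ sub⁺ (*-mono 0≤a 0≤a a≤1 a≤1)) (e₂ a η)) ⟩
      (1ℚ + U) * (1ℚ - (+ 2 / 1) * (a * η) + η * η)
        ≤⟨ by-diff (η * η * ((+ 3 / 1) - U) + (+ 2 / 1) * (a * η) * U) (0≤η ⊛ 0≤η ⊛ sub⁺ U≤3 ⊕ nonNegative⁻¹ (+ 2 / 1) ⊛ (0≤a ⊛ 0≤η) ⊛ 0≤U) (e₃ a η U) ⟩
      1ℚ + U - (+ 2 / 1) * (a * η) + (+ 4 / 1) * (η * η)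
        ≤⟨ by-diff (η * ((+ 1 / 6) * (g - (+ 48 / 1) * χ) + (+ 3 / 1) * χ + (χ - (+ 5 / 1) * η)))
             (0≤η ⊛ (nonNegative⁻¹ (+ 1 / 6) ⊛ sub⁺ 48χ≤g ⊕ nonNegative⁻¹ (+ 3 / 1) ⊛ 0≤χ ⊕ sub⁺ 5η≤χ)) (e₄ g χ η) ⟩
      1ℚ - χ * η ∎
      where
      open ≤-Reasoning
      U : ℚ
      U = (χ + ξ) * η + η * η
      0≤U : 0ℚ ≤ U
      0≤U = (0≤χ ⊕ 0≤ξ) ⊛ 0≤η ⊕ 0≤η ⊛ 0≤η
      U≤3 : U ≤ + 3 / 1
      U≤3 = ≤-trans (+-mono-≤ (*-mono (0≤χ ⊕ 0≤ξ) 0≤η (+-mono-≤ χ≤1 ξ≤1) η≤1) (*-mono 0≤η 0≤η η≤1 η≤1)) ≤-refl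
      e₁ : ∀ x y η → 1ℚ + ((x + y) * η + η * η) - (1ℚ + x * η) * (1ℚ + y * η) ≡ η * η * (1ℚ - x * y)
      e₁ = solve-∀ ℚ-ring
      e₂ : ∀ a η → 1ℚ - (+ 2 / 1) * (a * η) + η * η - (1ℚ - a * η) * (1ℚ - a * η) ≡ η * η * (1ℚ - a * a)
      e₂ = solve-∀ ℚ-ring
      e₃ : ∀ a η U → 1ℚ + U - (+ 2 / 1) * (a * η) + (+ 4 / 1) * (η * η) - (1ℚ + U) * (1ℚ - (+ 2 / 1) * (a * η) + η * η) ≡ η * η * ((+ 3 / 1) - U) + (+ 2 / 1) * (a * η) * U
      e₃ = solve-∀ ℚ-ring
      e₄ : ∀ g χ η → 1ℚ - χ * η - (1ℚ + ((χ + ((+ 1 / 3) - (+ 1 / 6) * g)) * η + η * η) - (+ 2 / 1) * (((+ 1 / 6) - χ) * η) + (+ 4 / 1) * (η * η))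
        ≡ η * ((+ 1 / 6) * (g - (+ 48 / 1) * χ) + (+ 3 / 1) * χ + (χ - (+ 5 / 1) * η))
      e₄ = solve-∀ ℚ-ring

    -- By the last hypothesis the coefficient χ - s + 2 b of η is at most - χ - 4 η, and 4 η² bounds
    -- the remaining terms. Here s is the rate gained from the smaller blue density and b the rate
    -- lost to triangles.
    blue-base : ∀ {s b} → 0ℚ ≤ s → s ≤ 1ℚ → 0ℚ ≤ b → b ≤ 1ℚ → (+ 2 / 1) * χ + (+ 2 / 1) * b + (+ 4 / 1) * η ≤ s →
      (1ℚ + χ * η) * (1ℚ - s * η) * ((1ℚ + b * η) * (1ℚ + b * η)) ≤ 1ℚ - χ * η
    blue-base {s} {b} 0≤s s≤1 0≤b b≤1 h = begin
      (1ℚ + χ * η) * (1ℚ - s * η) * ((1ℚ + b * η) * (1ℚ + b * η))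
        ≤⟨ *-monoˡ ((0≤1 ⊕ 0≤χ ⊛ 0≤η) ⊛ 0≤1-sη) (by-diff (η * η * (1ℚ - b * b)) (0≤η ⊛ 0≤η ⊛ sub⁺ (*-mono 0≤b 0≤b b≤1 b≤1)) (e₁ b η)) ⟩
      (1ℚ + χ * η) * (1ℚ - s * η) * (1ℚ + U)
        ≤⟨ by-diff ((1ℚ - s * η) * (η * (η * ((1ℚ - η) + (+ 2 / 1) * (1ℚ - b)) + U * (1ℚ - χ))))
             (0≤1-sη ⊛ (0≤η ⊛ (0≤η ⊛ (sub⁺ η≤1 ⊕ nonNegative⁻¹ (+ 2 / 1) ⊛ sub⁺ b≤1) ⊕ 0≤U ⊛ sub⁺ χ≤1))) (e₂ χ s b η) ⟩
      (1ℚ - s * η) * (1ℚ + V)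
        ≤⟨ by-diff (s * η * V) (0≤s ⊛ 0≤η ⊛ 0≤V) (e₃ (s * η) V) ⟩
      1ℚ + V - s * η
        ≤⟨ by-diff (η * (s - ((+ 2 / 1) * χ + (+ 2 / 1) * b + (+ 4 / 1) * η))) (0≤η ⊛ sub⁺ h) (e₄ χ s b η) ⟩
      1ℚ - χ * η ∎
      where
      open ≤-Reasoning
      U V : ℚ
      U = (+ 2 / 1) * b * η + η * η
      V = χ * η + U + (+ 3 / 1) * (η * η)
      0≤U : 0ℚ ≤ U
      0≤U = nonNegative⁻¹ (+ 2 / 1) ⊛ 0≤b ⊛ 0≤η ⊕ 0≤η ⊛ 0≤η
      0≤V : 0ℚ ≤ V
      0≤V = 0≤χ ⊛ 0≤η ⊕ 0≤U ⊕ nonNegative⁻¹ (+ 3 / 1) ⊛ (0≤η ⊛ 0≤η)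
      0≤1-sη : 0ℚ ≤ 1ℚ - s * η
      0≤1-sη = sub⁺ (≤-trans (*-mono 0≤s 0≤η s≤1 η≤1) ≤-refl)
      e₁ : ∀ b η → 1ℚ + ((+ 2 / 1) * b * η + η * η) - (1ℚ + b * η) * (1ℚ + b * η) ≡ η * η * (1ℚ - b * b)
      e₁ = solve-∀ ℚ-ring
      e₂ : ∀ χ s b η → (1ℚ - s * η) * (1ℚ + (χ * η + ((+ 2 / 1) * b * η + η * η) + (+ 3 / 1) * (η * η))) - (1ℚ + χ * η) * (1ℚ - s * η) * (1ℚ + ((+ 2 / 1) * b * η + η * η))
        ≡ (1ℚ - s * η) * (η * (η * ((1ℚ - η) + (+ 2 / 1) * (1ℚ - b)) + ((+ 2 / 1) * b * η + η * η) * (1ℚ - χ)))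
      e₂ = solve-∀ ℚ-ring
      e₃ : ∀ s V → 1ℚ + V - s - (1ℚ - s) * (1ℚ + V) ≡ s * V
      e₃ = solve-∀ ℚ-ring
      e₄ : ∀ χ s b η → 1ℚ - χ * η - (1ℚ + (χ * η + ((+ 2 / 1) * b * η + η * η) + (+ 3 / 1) * (η * η)) - s * η) ≡ η * (s - ((+ 2 / 1) * χ + (+ 2 / 1) * b + (+ 4 / 1) * η))
      e₄ = solve-∀ ℚ-ring

-- Choice of scales and the exclusion of arrows

module Scales where
  open Rationals
  open Fourier using (module Ops)
  open Spins using (pairs)
  open Mixtures using (∏L)
  open PartitionFunction
  open Antiferromagnet using (antiferromagnetic)
  open EdgeReplacement using (inverse; 1+x≤)
  open RandomWeights
  open UnionBound
  open Inequalities
  open Bases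
  open import Defs using (Arrows)
  open import Data.Fin.Base using (Fin)
  open import Data.Integer.Base using (+_)
  open import Data.List.Base using (List; length)
  open import Data.List.Relation.Unary.Unique.Propositional using (Unique)
  open import Data.Rational
  open import Data.Rational.Properties
  open import Relation.Binary.Definitions using (tri<; tri≈; tri>)

  ι1≤ : ∀ {n} → 1 ℕ.≤ n → 1ℚ ≤ ι n
  ι1≤ {n} h = subst (_≤ ι n) ι-1 (ι-mono h)

  x≤x*y : ∀ {x y} → 0ℚ ≤ x → 1ℚ ≤ y → x ≤ x * y
  x≤x*y {x} {y} h l = subst (_≤ x * y) (*-identityʳ x) (*-monoˡ h l)

  x≤y*x : ∀ {x y} → 0ℚ ≤ x → 1ℚ ≤ y → x ≤ y * x
  x≤y*x {x} {y} h l = subst (_≤ y * x) (*-identityˡ x) (*-monoʳ h l)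

  x*y≤x : ∀ {x y} → 0ℚ ≤ x → y ≤ 1ℚ → x * y ≤ x
  x*y≤x {x} {y} h l = subst (x * y ≤_) (*-identityʳ x) (*-monoˡ h l)

  0≤falling : ∀ k → 0ℚ ≤ ι k * (ι k - 1ℚ) * (ι k - (+ 2 / 1))
  0≤falling zero = ≤-reflexive (sym (trans (cong (λ z → z * (z - 1ℚ) * (z - (+ 2 / 1))) ι-0) refl))
  0≤falling (suc zero) = ≤-reflexive (sym (trans (cong (λ z → z * (z - 1ℚ) * (z - (+ 2 / 1))) ι-1) refl))
  0≤falling (suc (suc k)) = 0≤ι (suc (suc k)) ⊛ subst (0ℚ ≤_) (trans (e₁ (ι (suc k))) (cong (_- 1ℚ) (sym (ι-suc (suc k))))) (0≤ι (suc k))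
    ⊛ subst (0ℚ ≤_) (trans (e₂ (ι k)) (cong (_- (+ 2 / 1)) (sym (trans (ι-suc (suc k)) (cong (_+_ 1ℚ) (ι-suc k)))))) (0≤ι k)
    where
    e₁ : ∀ x → x ≡ 1ℚ + x - 1ℚ
    e₁ = solve-∀ ℚ-ring
    e₂ : ∀ x → x ≡ 1ℚ + (1ℚ + x) - (+ 2 / 1)
    e₂ = solve-∀ ℚ-ring

  <½ : ∀ {x} → x * x ≤ + 1 / 8 → x < ½
  <½ {x} h with <-cmp x ½
  ... | tri< p _ _ = p
  ... | tri≈ _ refl _ = contradiction h λ p → from-no (½ * ½ ≤? + 1 / 8) p
  ... | tri> _ _ p = contradiction (≤-trans (*-mono (nonNegative⁻¹ ½) (nonNegative⁻¹ ½) (<⇒≤ p) (<⇒≤ p)) h) (from-no (½ * ½ ≤? + 1 / 8))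

  -- A single integer j fixes all scales. β = 2^(-j) beats every needed power of m, and m = 4 j is
  -- chosen so that p ≤ ½ gives p^m ≤ β⁴. χ is the unit of slack; the factor lo in it secures 48 χ ≤
  -- g γ for every admissible ratio γ = P/Q.
  module Scale (c g lo : ℚ) (1≤c : 1ℚ ≤ c) (0≤g : 0ℚ ≤ g) (g≤1 : g ≤ 1ℚ) (0≤lo : 0ℚ ≤ lo) (lo≤1 : lo ≤ 1ℚ) (j′ : ℕ) where
    j m : ℕ
    j = suc j′
    m = 4 ℕ.* j
    M β a χ t η : ℚ
    M = ι m
    β = ½ ^ j
    a = M * c
    χ = (+ 1 / 48) * (g * lo)
    t = a * a * a * a * β
    η = β * β * β

    0<β : 0ℚ < β
    0<β = 0<^ j (positive⁻¹ ½)
    0≤β : 0ℚ ≤ β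
    0≤β = <⇒≤ 0<β
    β≤1 : β ≤ 1ℚ
    β≤1 = ^≤1 j (nonNegative⁻¹ ½) (from-yes (½ ≤? 1ℚ))
    1≤M : 1ℚ ≤ M
    1≤M = ι1≤ (ℕ.s≤s ℕ.z≤n)
    0≤M : 0ℚ ≤ M
    0≤M = ≤-trans 0≤1 1≤M
    0≤c : 0ℚ ≤ c
    0≤c = ≤-trans 0≤1 1≤c
    M≤a : M ≤ a
    M≤a = x≤x*y 0≤M 1≤c
    1≤a : 1ℚ ≤ a
    1≤a = ≤-trans 1≤M M≤a
    0≤a : 0ℚ ≤ a
    0≤a = ≤-trans 0≤1 1≤a
    0≤χ : 0ℚ ≤ χ
    0≤χ = nonNegative⁻¹ (+ 1 / 48) ⊛ (0≤g ⊛ 0≤lo)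
    48χ≤g : (+ 48 / 1) * χ ≤ g
    48χ≤g = ≤-trans (≤-reflexive (e (g * lo))) (x*y≤x 0≤g lo≤1)
      where e : ∀ x → (+ 48 / 1) * ((+ 1 / 48) * x) ≡ x
            e = solve-∀ ℚ-ring
    a³β≤t : a * a * a * β ≤ t
    a³β≤t = *-monoʳ 0≤β (x≤x*y (0≤a ⊛ 0≤a ⊛ 0≤a) 1≤a)
    a²β≤t : a * a * β ≤ t
    a²β≤t = ≤-trans (*-monoʳ 0≤β (x≤x*y (0≤a ⊛ 0≤a) 1≤a)) a³β≤t
    aβ≤t : a * β ≤ t
    aβ≤t = ≤-trans (*-monoʳ 0≤β (x≤x*y 0≤a 1≤a)) a²β≤t
    β≤t : β ≤ t
    β≤t = ≤-trans (x≤y*x 0≤β 1≤a) aβ≤t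
    0≤η : 0ℚ ≤ η
    0≤η = 0≤β ⊛ 0≤β ⊛ 0≤β
    ββ≤β : β * β ≤ β
    ββ≤β = x*y≤x 0≤β β≤1
    η≤β : η ≤ β
    η≤β = ≤-trans (x*y≤x (0≤β ⊛ 0≤β) β≤1) ββ≤β

    -- 2592 = 162 · 2⁴ is dictated by `quartic`; all other smallness conditions follow from the same
    -- hypothesis with smaller constants.
    module Small (big : (+ 2592 / 1) * t ≤ χ) where
      small : ∀ {x} y → 0ℚ ≤ y → y ≤ + 2592 / 1 → 0ℚ ≤ x → x ≤ t → y * x ≤ χ
      small y 0≤y y≤ 0≤x h = ≤-trans (*-mono 0≤y 0≤x y≤ h) big
      scaled : ∀ {x} → 0ℚ ≤ x → x * β ≤ t → x * η ≤ t
      scaled 0≤x h = ≤-trans (*-monoˡ 0≤x η≤β) h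

      163β≤χ : (+ 163 / 1) * β ≤ χ
      163β≤χ = small (+ 163 / 1) (nonNegative⁻¹ _) (from-yes ((+ 163 / 1) ≤? (+ 2592 / 1))) 0≤β β≤t
      5η≤χ : (+ 5 / 1) * η ≤ χ
      5η≤χ = small (+ 5 / 1) (nonNegative⁻¹ _) (from-yes ((+ 5 / 1) ≤? (+ 2592 / 1))) 0≤η (≤-trans η≤β β≤t)
      4β≤χ : (+ 4 / 1) * β ≤ χ
      4β≤χ = small (+ 4 / 1) (nonNegative⁻¹ _) (from-yes ((+ 4 / 1) ≤? (+ 2592 / 1))) 0≤β β≤t

      open Base g χ η 0≤g g≤1 0≤χ 48χ≤g 0≤η 5η≤χ public hiding (a; 0≤a; a≤1)

      -- 54 · 48 = 2592, so `big` and χ ≤ 1/48 leave at most 1/48², which is below 1/1000.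
      small₁ : ∀ {x} y → 0ℚ ≤ y → y ≤ + 54 / 1 → 0ℚ ≤ x → x ≤ t → y * x ≤ + 1 / 1000
      small₁ {x} y 0≤y y≤ 0≤x h = *-cancel {c = + 48 / 1} (positive⁻¹ (+ 48 / 1)) (begin
        y * x * (+ 48 / 1)    ≤⟨ *-monoʳ (nonNegative⁻¹ (+ 48 / 1)) (*-mono 0≤y 0≤x y≤ h) ⟩
        (+ 54 / 1) * t * (+ 48 / 1)  ≡⟨ e t ⟩
        (+ 2592 / 1) * t      ≤⟨ big ⟩
        χ                     ≤⟨ χ≤ ⟩
        (+ 1 / 48)            ≤⟨ from-yes ((+ 1 / 48) ≤? (+ 1 / 1000) * (+ 48 / 1)) ⟩
        (+ 1 / 1000) * (+ 48 / 1) ∎)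
        where
        open ≤-Reasoning
        e : ∀ t → (+ 54 / 1) * t * (+ 48 / 1) ≡ (+ 2592 / 1) * t
        e = solve-∀ ℚ-ring
        χ≤ : χ ≤ + 1 / 48
        χ≤ = *-cancel {c = + 48 / 1} (positive⁻¹ (+ 48 / 1)) (≤-trans (≤-reflexive (*-comm χ (+ 48 / 1))) (≤-trans 48χ≤1 ≤-refl))

      aβ≤ : (+ 24 / 1) * (a * β) ≤ + 1 / 1000
      aβ≤ = small₁ (+ 24 / 1) (nonNegative⁻¹ _) (from-yes ((+ 24 / 1) ≤? (+ 54 / 1))) (0≤a ⊛ 0≤β) aβ≤t
      a²β≤ : (+ 24 / 1) * (a * a * β) ≤ + 1 / 1000
      a²β≤ = small₁ (+ 24 / 1) (nonNegative⁻¹ _) (from-yes ((+ 24 / 1) ≤? (+ 54 / 1))) (0≤a ⊛ 0≤a ⊛ 0≤β) a²β≤t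
      a³β≤ : (+ 24 / 1) * (a * a * a * β) ≤ + 1 / 1000
      a³β≤ = small₁ (+ 24 / 1) (nonNegative⁻¹ _) (from-yes ((+ 24 / 1) ≤? (+ 54 / 1))) (0≤a ⊛ 0≤a ⊛ 0≤a ⊛ 0≤β) a³β≤t

      -- The excess of the replacing coupling over γ τ, in units of τ. As Q ≥ ½, it contributes at
      -- least 32 a² η to `σ-large`, where the errors amount to 8 a² η plus a few η.
      κ : ℚ
      κ = (+ 64 / 1) * (a * a * η)
      0≤κ : 0ℚ ≤ κ
      0≤κ = nonNegative⁻¹ (+ 64 / 1) ⊛ (0≤a ⊛ 0≤a ⊛ 0≤η)
      κ≤1 : κ ≤ 1ℚ
      κ≤1 = ≤-trans (small (+ 64 / 1) (nonNegative⁻¹ _) (from-yes ((+ 64 / 1) ≤? (+ 2592 / 1))) (0≤a ⊛ 0≤a ⊛ 0≤η) (scaled (0≤a ⊛ 0≤a) a²β≤t)) χ≤1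
      c7κ≤χ : c * ((+ 7 / 1) * κ) ≤ χ
      c7κ≤χ = begin
        c * ((+ 7 / 1) * κ)  ≡⟨ e c (a * a) η ⟩
        (+ 448 / 1) * (a * a * c * η)  ≤⟨ *-monoˡ (nonNegative⁻¹ (+ 448 / 1)) (*-monoʳ 0≤η (*-monoˡ (0≤a ⊛ 0≤a) (x≤y*x 0≤c 1≤M))) ⟩
        (+ 448 / 1) * (a * a * a * η)
          ≤⟨ small (+ 448 / 1) (nonNegative⁻¹ _) (from-yes ((+ 448 / 1) ≤? (+ 2592 / 1))) (0≤a ⊛ 0≤a ⊛ 0≤a ⊛ 0≤η) (scaled (0≤a ⊛ 0≤a ⊛ 0≤a) a³β≤t) ⟩
        χ ∎
        where
        open ≤-Reasoning
        e : ∀ c a η → c * ((+ 7 / 1) * ((+ 64 / 1) * (a * η))) ≡ (+ 448 / 1) * (a * c * η)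
        e = solve-∀ ℚ-ring
      -- In `Kδ`, 2 bounds the d-fold constant and β⁴ bounds p^m.
      δ : ℚ
      δ = (+ 2 / 1) * (β * β * β * β)
      0≤δ : 0ℚ ≤ δ
      0≤δ = nonNegative⁻¹ (+ 2 / 1) ⊛ (0≤β ⊛ 0≤β ⊛ 0≤β ⊛ 0≤β)

      module AtP (P : ℚ) (lo≤P : lo ≤ P) (P≤1 : P ≤ 1ℚ) (hP : c * (P * P) ≤ (1ℚ - g) * ((1ℚ - P) * (1ℚ - P))) where
        Q : ℚ
        Q = 1ℚ - P
        0≤P : 0ℚ ≤ P
        0≤P = ≤-trans 0≤lo lo≤P
        0≤Q : 0ℚ ≤ Q
        0≤Q = sub⁺ P≤1
        0≤1-½g : 0ℚ ≤ 1ℚ - ½ * g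
        0≤1-½g = sub⁺ (≤-trans (*-mono (nonNegative⁻¹ ½) 0≤g (from-yes (½ ≤? 1ℚ)) g≤1) ≤-refl)
        -- From c ≥ 1 and `hP`, P² ≤ (1 - g) Q² ≤ ((1 - g/2) Q)². The factor 1 - g/2 leaves the room
        -- in which P may be raised to `p` without passing ½.
        P≤′ : P ≤ (1ℚ - ½ * g) * Q
        P≤′ = sq-cancel (0≤1-½g ⊛ 0≤Q) (begin
          P * P                      ≤⟨ x≤y*x (0≤P ⊛ 0≤P) 1≤c ⟩
          c * (P * P)                ≤⟨ hP ⟩
          (1ℚ - g) * (Q * Q)         ≤⟨ by-diff ((+ 1 / 4) * (g * g) * (Q * Q)) (nonNegative⁻¹ (+ 1 / 4) ⊛ (0≤g ⊛ 0≤g) ⊛ (0≤Q ⊛ 0≤Q)) (e g Q) ⟩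
          (1ℚ - ½ * g) * Q * ((1ℚ - ½ * g) * Q) ∎)
          where
          open ≤-Reasoning
          e : ∀ g Q → (1ℚ - ½ * g) * Q * ((1ℚ - ½ * g) * Q) - (1ℚ - g) * (Q * Q) ≡ (+ 1 / 4) * (g * g) * (Q * Q)
          e = solve-∀ ℚ-ring
        P≤Q : P ≤ Q
        P≤Q = ≤-trans P≤′ (≤-trans (*-monoʳ {a = 1ℚ - ½ * g} {b = 1ℚ} 0≤Q (by-diff (½ * g) (nonNegative⁻¹ ½ ⊛ 0≤g) (e (½ * g)))) (≤-reflexive (*-identityˡ Q)))
          where e : ∀ x → 1ℚ - (1ℚ - x) ≡ x
                e = solve-∀ ℚ-ring
        ½≤Q : ½ ≤ Q
        ½≤Q = by-diff (½ * (Q - P)) (nonNegative⁻¹ ½ ⊛ sub⁺ P≤Q) (e P)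
          where e : ∀ P → 1ℚ - P - ½ ≡ ½ * (1ℚ - P - P)
                e = solve-∀ ℚ-ring
        Q≤1 : Q ≤ 1ℚ
        Q≤1 = by-diff P 0≤P (e P)
          where e : ∀ P → 1ℚ - (1ℚ - P) ≡ P
                e = solve-∀ ℚ-ring
        0<Q : 0ℚ < Q
        0<Q = <-≤-trans (positive⁻¹ ½) ½≤Q
        Q⁻¹ : ℚ
        Q⁻¹ = proj₁ (inverse 0<Q)
        0≤Q⁻¹ : 0ℚ ≤ Q⁻¹
        0≤Q⁻¹ = <⇒≤ (proj₁ (proj₂ (inverse 0<Q)))
        QQ⁻¹ : Q * Q⁻¹ ≡ 1ℚ
        QQ⁻¹ = proj₂ (proj₂ (inverse 0<Q))
        1≤Q⁻¹ : 1ℚ ≤ Q⁻¹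
        1≤Q⁻¹ = subst₂ _≤_ QQ⁻¹ (*-identityˡ Q⁻¹) (*-monoʳ 0≤Q⁻¹ Q≤1)
        γ : ℚ
        γ = P * Q⁻¹
        0≤γ : 0ℚ ≤ γ
        0≤γ = 0≤P ⊛ 0≤Q⁻¹
        γ≤1 : γ ≤ 1ℚ
        γ≤1 = subst (γ ≤_) QQ⁻¹ (*-monoʳ 0≤Q⁻¹ P≤Q)
        lo≤γ : lo ≤ γ
        lo≤γ = ≤-trans lo≤P (x≤x*y 0≤P 1≤Q⁻¹)
        Qγ : Q * γ ≡ P
        Qγ = trans (e Q P Q⁻¹) (trans (cong (P *_) QQ⁻¹) (*-identityʳ P))
          where e : ∀ Q P q → Q * (P * q) ≡ P * (Q * q)
                e = solve-∀ ℚ-ring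
        cγ² : c * (γ * γ) ≤ 1ℚ - g
        cγ² = begin
          c * (γ * γ)                        ≡⟨ e₁ c P Q⁻¹ ⟩
          c * (P * P) * (Q⁻¹ * Q⁻¹)          ≤⟨ *-monoʳ (0≤Q⁻¹ ⊛ 0≤Q⁻¹) hP ⟩
          (1ℚ - g) * (Q * Q) * (Q⁻¹ * Q⁻¹)   ≡⟨ e₂ (1ℚ - g) Q Q⁻¹ ⟩
          (1ℚ - g) * (Q * Q⁻¹ * (Q * Q⁻¹))   ≡⟨ trans (cong (λ z → (1ℚ - g) * (z * z)) QQ⁻¹) (*-identityʳ (1ℚ - g)) ⟩
          1ℚ - g ∎
          where
          open ≤-Reasoning
          e₁ : ∀ c P q → c * (P * q * (P * q)) ≡ c * (P * P) * (q * q)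
          e₁ = solve-∀ ℚ-ring
          e₂ : ∀ g Q q → g * (Q * Q) * (q * q) ≡ g * (Q * q * (Q * q))
          e₂ = solve-∀ ℚ-ring

        p : ℚ
        p = P * (1ℚ + ξ * η)
        0≤p : 0ℚ ≤ p
        0≤p = 0≤P ⊛ (0≤1 ⊕ 0≤ξ ⊛ 0≤η)
        P≤p : P ≤ p
        P≤p = x≤x*y 0≤P (subst (_≤ 1ℚ + ξ * η) (+-identityʳ 1ℚ) (+-monoʳ-≤ 1ℚ (0≤ξ ⊛ 0≤η)))
        -- By `P≤′`, ½ - P = ½ (Q - P) is at least g Q/4, which exceeds the increase P ξ η.
        p≤½ : p ≤ ½
        p≤½ = by-diff (½ * (½ * g * Q - (+ 6 / 1) * η + ((1ℚ - ½ * g) * Q - P)) + (η * (1ℚ - P * ξ) + (+ 2 / 1) * η))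
          (nonNegative⁻¹ ½ ⊛ (sub⁺ 6η≤ ⊕ sub⁺ P≤′) ⊕ (0≤η ⊛ sub⁺ (*-mono 0≤P 0≤ξ P≤1 ξ≤1) ⊕ nonNegative⁻¹ (+ 2 / 1) ⊛ 0≤η)) (e P ξ η g)
          where
          e : ∀ P ξ η g → ½ - P * (1ℚ + ξ * η) ≡ ½ * (½ * g * (1ℚ - P) - (+ 6 / 1) * η + ((1ℚ - ½ * g) * (1ℚ - P) - P)) + (η * (1ℚ - P * ξ) + (+ 2 / 1) * η)
          e = solve-∀ ℚ-ring
          6η≤ : (+ 6 / 1) * η ≤ ½ * g * Q
          6η≤ = begin
            (+ 6 / 1) * η                   ≡⟨ e₁ η ⟩
            (+ 6 / 5) * ((+ 5 / 1) * η)     ≤⟨ *-monoˡ (nonNegative⁻¹ (+ 6 / 5)) 5η≤χ ⟩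
            (+ 6 / 5) * χ                   ≤⟨ by-diff ((+ 54 / 5) * χ) (nonNegative⁻¹ (+ 54 / 5) ⊛ 0≤χ) (e₂ χ) ⟩
            (+ 1 / 4) * ((+ 48 / 1) * χ)    ≤⟨ *-monoˡ (nonNegative⁻¹ (+ 1 / 4)) 48χ≤g ⟩
            (+ 1 / 4) * g                   ≡⟨ e₃ g ⟩
            ½ * g * ½                       ≤⟨ *-monoˡ (nonNegative⁻¹ ½ ⊛ 0≤g) ½≤Q ⟩
            ½ * g * Q ∎
            where
            open ≤-Reasoning
            e₁ : ∀ x → (+ 6 / 1) * x ≡ (+ 6 / 5) * ((+ 5 / 1) * x)
            e₁ = solve-∀ ℚ-ring
            e₂ : ∀ x → (+ 1 / 4) * ((+ 48 / 1) * x) - (+ 6 / 5) * x ≡ (+ 54 / 5) * x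
            e₂ = solve-∀ ℚ-ring
            e₃ : ∀ x → (+ 1 / 4) * x ≡ ½ * x * ½
            e₃ = solve-∀ ℚ-ring
        ½≤1-p : ½ ≤ 1ℚ - p
        ½≤1-p = by-diff (½ - p) (sub⁺ p≤½) (e p)
          where e : ∀ p → 1ℚ - p - ½ ≡ ½ - p
                e = solve-∀ ℚ-ring
        p≤q : p ≤ 1ℚ - p
        p≤q = ≤-trans p≤½ ½≤1-p

        -- b and s are rates per η: b for the growth of the blue partition function through
        -- triangles, s for the drop of the blue density, so that ω is at most Q v.
        γ′ b s ω v : ℚ
        γ′ = γ + κ
        b = (+ 1 / 6) * ((1ℚ - g) * γ) + (+ 2 / 1) * χ
        s = γ * ξ - χ
        ω = 1ℚ - p + δ
        v = 1ℚ - s * η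
        0≤γ′ : 0ℚ ≤ γ′
        0≤γ′ = 0≤γ ⊕ 0≤κ
        γ′≤2 : γ′ ≤ + 2 / 1
        γ′≤2 = ≤-trans (+-mono-≤ γ≤1 κ≤1) ≤-refl
        0≤1-g : 0ℚ ≤ 1ℚ - g
        0≤1-g = sub⁺ g≤1
        1-g≤1 : 1ℚ - g ≤ 1ℚ
        1-g≤1 = by-diff g 0≤g (e g)
          where e : ∀ P → 1ℚ - (1ℚ - P) ≡ P
                e = solve-∀ ℚ-ring
        48χ≤gγ : (+ 48 / 1) * χ ≤ g * γ
        48χ≤gγ = ≤-trans (≤-reflexive (e (g * lo))) (*-monoˡ 0≤g lo≤γ)
          where e : ∀ x → (+ 48 / 1) * ((+ 1 / 48) * x) ≡ x
                e = solve-∀ ℚ-ring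
        0≤b : 0ℚ ≤ b
        0≤b = nonNegative⁻¹ (+ 1 / 6) ⊛ (0≤1-g ⊛ 0≤γ) ⊕ nonNegative⁻¹ (+ 2 / 1) ⊛ 0≤χ
        b≤1 : b ≤ 1ℚ
        b≤1 = ≤-trans (+-mono-≤ (*-monoˡ (nonNegative⁻¹ (+ 1 / 6)) (*-mono 0≤1-g 0≤γ 1-g≤1 γ≤1)) (≤-reflexive (e χ)))
          (≤-trans (+-monoʳ-≤ ((+ 1 / 6) * (1ℚ * 1ℚ)) (*-monoˡ (nonNegative⁻¹ (+ 1 / 24)) 48χ≤1)) (from-yes ((+ 1 / 6) * (1ℚ * 1ℚ) + (+ 1 / 24) * 1ℚ ≤? 1ℚ)))
          where e : ∀ x → (+ 2 / 1) * x ≡ (+ 1 / 24) * ((+ 48 / 1) * x)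
                e = solve-∀ ℚ-ring
        -- The main terms of s - 2 b are γ (ξ - (1 - g)/3) = g γ/6 ≥ 8 χ. This is the point of
        -- choosing 3 ξ strictly above 1 - g.
        s-large : (+ 2 / 1) * χ + (+ 2 / 1) * b + (+ 4 / 1) * η ≤ s
        s-large = by-diff ((+ 1 / 6) * (g * γ - (+ 48 / 1) * χ) + (χ - (+ 5 / 1) * η + η)) (nonNegative⁻¹ (+ 1 / 6) ⊛ sub⁺ 48χ≤gγ ⊕ (sub⁺ 5η≤χ ⊕ 0≤η)) (e g γ χ η)
          where e : ∀ g γ χ η → γ * ((+ 1 / 3) - (+ 1 / 6) * g) - χ - ((+ 2 / 1) * χ + (+ 2 / 1) * ((+ 1 / 6) * ((1ℚ - g) * γ) + (+ 2 / 1) * χ) + (+ 4 / 1) * η)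
                      ≡ (+ 1 / 6) * (g * γ - (+ 48 / 1) * χ) + (χ - (+ 5 / 1) * η + η)
                e = solve-∀ ℚ-ring
        0≤s : 0ℚ ≤ s
        0≤s = ≤-trans (nonNegative⁻¹ (+ 2 / 1) ⊛ 0≤χ ⊕ nonNegative⁻¹ (+ 2 / 1) ⊛ 0≤b ⊕ nonNegative⁻¹ (+ 4 / 1) ⊛ 0≤η) s-large
        s≤1 : s ≤ 1ℚ
        s≤1 = ≤-trans (by-diff χ 0≤χ (e (γ * ξ) χ)) (*-mono 0≤γ 0≤ξ γ≤1 ξ≤1)
          where e : ∀ a χ → a - (a - χ) ≡ χ
                e = solve-∀ ℚ-ring
        0≤v : 0ℚ ≤ v
        0≤v = sub⁺ (*-mono 0≤s 0≤η s≤1 η≤1)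
        -- Because Q γ = P, the raise P ξ η of p cancels against Q γ ξ η. The χ in `s` then leaves χ
        -- η Q, which pays for δ = 2 β η.
        ω≤Qv : ω ≤ Q * v
        ω≤Qv = by-diff (η * (½ * (χ - (+ 4 / 1) * β) + (Q - ½) * χ)) (0≤η ⊛ (nonNegative⁻¹ ½ ⊛ sub⁺ 4β≤χ ⊕ sub⁺ ½≤Q ⊛ 0≤χ))
          (trans (cong (_- ω) (e₁ Q γ ξ χ η)) (trans (e₂ (Q * γ) Q ξ χ η P β) (trans (e₃ (Q - (1ℚ - P) + (P - Q * γ) * (ξ * η)) χ Q β)
            (trans (cong (λ z → Q - (1ℚ - P) + (P - z) * (ξ * η) + η * (½ * (χ - (+ 4 / 1) * β) + (Q - ½) * χ)) Qγ) (e₄ P (ξ * η) _)))))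
          where
          e₁ : ∀ Q γ ξ χ η → Q * (1ℚ - (γ * ξ - χ) * η) ≡ Q - (Q * γ) * (ξ * η) + χ * η * Q
          e₁ = solve-∀ ℚ-ring
          e₂ : ∀ y Q ξ χ η P β → Q - y * (ξ * η) + χ * η * Q - (1ℚ - P * (1ℚ + ξ * η) + (+ 2 / 1) * (β * β * β * β))
             ≡ Q - (1ℚ - P) + (P - y) * (ξ * η) + (η * (½ * χ + (Q - ½) * χ) - (+ 2 / 1) * (β * β * β * β))
          e₂ = solve-∀ ℚ-ring
          e₃ : ∀ x χ Q β → x + (β * β * β * (½ * χ + (Q - ½) * χ) - (+ 2 / 1) * (β * β * β * β)) ≡ x + β * β * β * (½ * (χ - (+ 4 / 1) * β) + (Q - ½) * χ)
          e₃ = solve-∀ ℚ-ring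
          e₄ : ∀ P x y → (1ℚ - P) - (1ℚ - P) + (P - P) * x + y ≡ y
          e₄ = solve-∀ ℚ-ring

        module AtSize (ℓ′ k : ℕ) (ℓ≤k : suc ℓ′ ℕ.≤ k) (k≤cℓ : ι k ≤ c * ι (suc ℓ′)) (large : 1ℚ ≤ β * ι (suc ℓ′)) where
          ℓ d : ℕ
          ℓ = suc ℓ′
          d = ℓ ℕ.* ℓ
          L K r τ τm σ h : ℚ
          L = ι ℓ
          K = ι k
          r = proj₁ (inverse (0<ι ℓ′))
          τ = β * r
          τm = (+ 2 / 1) * M * τ
          σ = γ′ * τ
          h = K * r
          0≤r : 0ℚ ≤ r
          0≤r = <⇒≤ (proj₁ (proj₂ (inverse (0<ι ℓ′))))
          Lr : L * r ≡ 1ℚ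
          Lr = proj₂ (proj₂ (inverse (0<ι ℓ′)))
          rL : r * L ≡ 1ℚ
          rL = trans (*-comm r L) Lr
          1≤K : 1ℚ ≤ K
          1≤K = ι1≤ (ℕ.≤-trans (ℕ.s≤s ℕ.z≤n) ℓ≤k)
          0≤K : 0ℚ ≤ K
          0≤K = ≤-trans 0≤1 1≤K
          r≤β : r ≤ β
          r≤β = begin
            r              ≡⟨ sym (*-identityʳ r) ⟩
            r * 1ℚ         ≤⟨ *-monoˡ 0≤r large ⟩
            r * (β * L)    ≡⟨ e r β L ⟩
            β * (r * L)    ≡⟨ trans (cong (β *_) rL) (*-identityʳ β) ⟩
            β ∎
            where
            open ≤-Reasoning
            e : ∀ r b l → r * (b * l) ≡ b * (r * l)
            e = solve-∀ ℚ-ring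
          r≤1 : r ≤ 1ℚ
          r≤1 = ≤-trans r≤β β≤1
          0≤h : 0ℚ ≤ h
          0≤h = 0≤K ⊛ 0≤r
          h≤c : h ≤ c
          h≤c = ≤-trans (*-monoʳ 0≤r k≤cℓ) (≤-reflexive (trans (*-assoc c L r) (trans (cong (c *_) Lr) (*-identityʳ c))))
          0≤τ : 0ℚ ≤ τ
          0≤τ = 0≤β ⊛ 0≤r
          τ≤β : τ ≤ β
          τ≤β = x*y≤x 0≤β r≤1
          0≤τm : 0ℚ ≤ τm
          0≤τm = nonNegative⁻¹ (+ 2 / 1) ⊛ 0≤M ⊛ 0≤τ
          0≤σ : 0ℚ ≤ σ
          0≤σ = 0≤γ′ ⊛ 0≤τ
          σ≤τm : σ ≤ τm
          σ≤τm = *-monoʳ 0≤τ (≤-trans γ′≤2 (x≤x*y (nonNegative⁻¹ (+ 2 / 1)) 1≤M))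
          τK : τ * K ≡ β * h
          τK = e β r K
            where e : ∀ β r K → β * r * K ≡ β * (K * r)
                  e = solve-∀ ℚ-ring
          -- The choice d = ℓ² makes this total independent of ℓ; all conditions on d τ² become
          -- conditions on β alone.
          dττ : ι d * (τ * τ) ≡ β * β
          dττ = trans (cong (_* (τ * τ)) (ι-* ℓ ℓ)) (trans (e L β r) (trans (cong (λ z → β * β * (z * z)) Lr) (*-identityʳ (β * β))))
            where e : ∀ L β r → L * L * (β * r * (β * r)) ≡ β * β * (L * r * (L * r))
                  e = solve-∀ ℚ-ring

          -- τ³ ℓ (ℓ - 1)(ℓ - 2) = η (1 - r)(1 - 2 r). A sixth of its shortfall from η is at most ½
          -- r η ≤ β η; together with the quartic error 162 β η this is at most χ η.
          red-bound : ∀ {n} {is : List (Fin n)} → Unique is → length is ≡ ℓ → Z (- τ) is ≤ ρ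
          red-bound {is = is} u len = ≤-trans
            (antiferromagnetic u 0≤r (subst (λ l → r * ι l ≡ 1ℚ) (sym len) rL) 0≤β (≤-trans 3β≤ (from-yes ((+ 1 / 1000) ≤? 1ℚ))))
            (≤-trans (≤-reflexive (cong (λ l → 1ℚ - (+ 1 / 6) * (τ * τ * τ) * (ι l * (ι l - 1ℚ) * (ι l - (+ 2 / 1))) + (+ 162 / 1) * (β * β * β * β)) len))
              (by-diff (η * ((χ - (+ 163 / 1) * β) + (β - ½ * r) + (+ 1 / 3) * (r * r)))
                (0≤η ⊛ (sub⁺ 163β≤χ ⊕ sub⁺ ½r≤β ⊕ nonNegative⁻¹ (+ 1 / 3) ⊛ (0≤r ⊛ 0≤r)))
                (trans (e₁ χ β r L) (trans (cong (λ z → ρ - (1ℚ - (+ 1 / 6) * η * (z * (z - r) * (z - (+ 2 / 1) * r)) + (+ 162 / 1) * (β * β * β * β))) rL) (e₂ χ β r)))))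
            where
            3β≤ : (+ 3 / 1) * β ≤ + 1 / 1000
            3β≤ = small₁ (+ 3 / 1) (nonNegative⁻¹ _) (from-yes ((+ 3 / 1) ≤? (+ 54 / 1))) 0≤β β≤t
            ½r≤β : ½ * r ≤ β
            ½r≤β = ≤-trans (*-monoʳ 0≤r (from-yes (½ ≤? 1ℚ))) (≤-trans (≤-reflexive (*-identityˡ r)) r≤β)
            e₁ : ∀ χ β r L → 1ℚ - ((+ 1 / 6) - χ) * (β * β * β) - (1ℚ - (+ 1 / 6) * (β * r * (β * r) * (β * r)) * (L * (L - 1ℚ) * (L - (+ 2 / 1))) + (+ 162 / 1) * (β * β * β * β))
              ≡ 1ℚ - ((+ 1 / 6) - χ) * (β * β * β) - (1ℚ - (+ 1 / 6) * (β * β * β) * (r * L * (r * L - r) * (r * L - (+ 2 / 1) * r)) + (+ 162 / 1) * (β * β * β * β))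
            e₁ = solve-∀ ℚ-ring
            e₂ : ∀ χ β r → 1ℚ - ((+ 1 / 6) - χ) * (β * β * β) - (1ℚ - (+ 1 / 6) * (β * β * β) * (1ℚ * (1ℚ - r) * (1ℚ - (+ 2 / 1) * r)) + (+ 162 / 1) * (β * β * β * β))
              ≡ β * β * β * ((χ - (+ 163 / 1) * β) + (β - ½ * r) + (+ 1 / 3) * (r * r))
            e₂ = solve-∀ ℚ-ring

          -- d M² τ² = M² β² is at most ½, so `1+x≤` bounds the first factor by 1 + ½ + 2/4 = 2.
          Kδ : (1ℚ + M * M * (τ * τ)) ^ d * p ^ m ≤ δ
          Kδ = *-mono (0≤^ d (0≤1 ⊕ 0≤x)) (0≤^ m 0≤p) two power
            where
            x : ℚ
            x = M * M * (τ * τ)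
            0≤x : 0ℚ ≤ x
            0≤x = 0≤M ⊛ 0≤M ⊛ (0≤τ ⊛ 0≤τ)
            dx : ι d * x ≤ ½
            dx = begin
              ι d * (M * M * (τ * τ))     ≡⟨ e (ι d) (M * M) (τ * τ) ⟩
              M * M * (ι d * (τ * τ))     ≡⟨ cong (M * M *_) dττ ⟩
              M * M * (β * β)             ≤⟨ *-mono (0≤M ⊛ 0≤M) (0≤β ⊛ 0≤β) (*-mono 0≤M 0≤M M≤a M≤a) ββ≤β ⟩
              a * a * β                   ≤⟨ x≤y*x (0≤a ⊛ 0≤a ⊛ 0≤β) (from-yes (1ℚ ≤? (+ 24 / 1))) ⟩
              (+ 24 / 1) * (a * a * β)    ≤⟨ a²β≤ ⟩
              (+ 1 / 1000)                ≤⟨ from-yes ((+ 1 / 1000) ≤? ½) ⟩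
              ½ ∎
              where
              open ≤-Reasoning
              e : ∀ d m t → d * (m * t) ≡ m * (d * t)
              e = solve-∀ ℚ-ring
            two : (1ℚ + x) ^ d ≤ + 2 / 1
            two = ≤-trans (1+x≤ d 0≤x dx) (≤-trans (+-mono-≤ (+-monoʳ-≤ 1ℚ dx) (*-monoˡ (nonNegative⁻¹ (+ 2 / 1)) (*-mono (0≤ι d ⊛ 0≤x) (0≤ι d ⊛ 0≤x) dx dx))) (from-yes (1ℚ + ½ + (+ 2 / 1) * (½ * ½) ≤? (+ 2 / 1))))
            power : p ^ m ≤ β * β * β * β
            power = ≤-trans (^-mono m 0≤p p≤½) (≤-reflexive (trans (^-* ½ 4 j) (e β)))
              where e : ∀ b → b * (b * (b * (b * 1ℚ))) ≡ b * b * b * b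
                    e = solve-∀ ℚ-ring

          mτ : (+ 2 / 1) * (M * M * M) * (τ * τ) ≤ 1ℚ
          mτ = begin
            (+ 2 / 1) * (M * M * M) * (τ * τ)
              ≤⟨ *-mono (nonNegative⁻¹ (+ 2 / 1) ⊛ (0≤M ⊛ 0≤M ⊛ 0≤M)) (0≤τ ⊛ 0≤τ)
                   (*-mono (nonNegative⁻¹ (+ 2 / 1)) (0≤M ⊛ 0≤M ⊛ 0≤M) (from-yes ((+ 2 / 1) ≤? (+ 24 / 1))) (*-mono (0≤M ⊛ 0≤M) 0≤M (*-mono 0≤M 0≤M M≤a M≤a) M≤a))
                   (≤-trans (*-mono 0≤τ 0≤τ τ≤β τ≤β) ββ≤β) ⟩
            (+ 24 / 1) * (a * a * a) * β    ≡⟨ *-assoc (+ 24 / 1) (a * a * a) β ⟩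
            (+ 24 / 1) * (a * a * a * β)    ≤⟨ a³β≤ ⟩
            (+ 1 / 1000)                    ≤⟨ from-yes ((+ 1 / 1000) ≤? 1ℚ) ⟩
            1ℚ ∎
            where open ≤-Reasoning

          τmK : τm * K ≡ (+ 2 / 1) * (M * h * β)
          τmK = trans (*-assoc ((+ 2 / 1) * M) τ K) (trans (cong ((+ 2 / 1) * M *_) τK) (e M β h))
            where e : ∀ M β h → (+ 2 / 1) * M * (β * h) ≡ (+ 2 / 1) * (M * h * β)
                  e = solve-∀ ℚ-ring
          Mh≤a : M * h ≤ a
          Mh≤a = *-monoˡ 0≤M h≤c
          τmK≤ : τm * K ≤ (+ 2 / 1) * (a * β)
          τmK≤ = ≤-trans (≤-reflexive τmK) (*-monoˡ (nonNegative⁻¹ (+ 2 / 1)) (*-monoʳ 0≤β Mh≤a))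

          3τmK≤1 : (+ 3 / 1) * (τm * K) ≤ 1ℚ
          3τmK≤1 = begin
            (+ 3 / 1) * (τm * K)                    ≤⟨ *-monoˡ (nonNegative⁻¹ (+ 3 / 1)) τmK≤ ⟩
            (+ 3 / 1) * ((+ 2 / 1) * (a * β))       ≤⟨ by-diff ((+ 18 / 1) * (a * β)) (nonNegative⁻¹ (+ 18 / 1) ⊛ (0≤a ⊛ 0≤β)) (e (a * β)) ⟩
            (+ 24 / 1) * (a * β)                    ≤⟨ aβ≤ ⟩
            (+ 1 / 1000)                            ≤⟨ from-yes ((+ 1 / 1000) ≤? 1ℚ) ⟩
            1ℚ ∎
            where
            open ≤-Reasoning
            e : ∀ x → (+ 24 / 1) * x - (+ 3 / 1) * ((+ 2 / 1) * x) ≡ (+ 18 / 1) * x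
            e = solve-∀ ℚ-ring

          dτmτmτmK : ι d * (τm * (τm * τm * K)) ≡ (+ 8 / 1) * (M * M * (M * h) * (β * β * β))
          dτmτmτmK = trans (e₁ (ι d) M τ K) (trans (cong₂ (λ x y → (+ 8 / 1) * (M * M * M) * (x * y)) dττ τK) (e₂ M β h))
            where
            e₁ : ∀ d M t K → d * ((+ 2 / 1) * M * t * ((+ 2 / 1) * M * t * ((+ 2 / 1) * M * t) * K)) ≡ (+ 8 / 1) * (M * M * M) * (d * (t * t) * (t * K))
            e₁ = solve-∀ ℚ-ring
            e₂ : ∀ M β h → (+ 8 / 1) * (M * M * M) * (β * β * (β * h)) ≡ (+ 8 / 1) * (M * M * (M * h) * (β * β * β))
            e₂ = solve-∀ ℚ-ring
          dτm≤ : ι d * (τm * (τm * τm * K)) ≤ ½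
          dτm≤ = begin
            ι d * (τm * (τm * τm * K))              ≡⟨ dτmτmτmK ⟩
            (+ 8 / 1) * (M * M * (M * h) * η)
              ≤⟨ *-mono (nonNegative⁻¹ (+ 8 / 1)) (0≤M ⊛ 0≤M ⊛ (0≤M ⊛ 0≤h) ⊛ 0≤η) (from-yes ((+ 8 / 1) ≤? (+ 24 / 1)))
                   (*-mono (0≤M ⊛ 0≤M ⊛ (0≤M ⊛ 0≤h)) 0≤η (*-mono (0≤M ⊛ 0≤M) (0≤M ⊛ 0≤h) (*-mono 0≤M 0≤M M≤a M≤a) Mh≤a) η≤β) ⟩
            (+ 24 / 1) * (a * a * a * β)            ≤⟨ a³β≤ ⟩
            (+ 1 / 1000)                            ≤⟨ from-yes ((+ 1 / 1000) ≤? ½) ⟩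
            ½ ∎
            where open ≤-Reasoning

          -- After division by τ the left side is at most P + 2 η + 8 a² η. On the right Q γ = P,
          -- and the surplus Q κ covers the errors and the loss from p > P.
          σ-large : p * τ + δ * τm + (+ 2 / 1) * (ι d * (τm * τm * K)) * (p * (τ * τ) + δ * (τm * τm)) ≤ (1ℚ - p + δ) * σ
          σ-large = begin
            p * τ + δ * τm + (+ 2 / 1) * (ι d * (τm * τm * K)) * (p * (τ * τ) + δ * (τm * τm))
              ≡⟨ trans (e₁ p τ δ M (ι d) K) (cong₂ (λ x y → τ * (p + (+ 2 / 1) * M * δ + (+ 8 / 1) * (M * M * (x * y)) * (p + (+ 4 / 1) * (M * M) * δ))) dττ τK) ⟩
            τ * (p + (+ 2 / 1) * M * δ + (+ 8 / 1) * (M * M * (β * β * (β * h))) * (p + (+ 4 / 1) * (M * M) * δ))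
              ≤⟨ *-monoˡ 0≤τ (+-mono-≤ (+-mono-≤ p≤ 2Mδ≤) (*-mono (nonNegative⁻¹ (+ 8 / 1) ⊛ (0≤M ⊛ 0≤M ⊛ (0≤β ⊛ 0≤β ⊛ (0≤β ⊛ 0≤h))))
                   (0≤p ⊕ nonNegative⁻¹ (+ 4 / 1) ⊛ (0≤M ⊛ 0≤M) ⊛ 0≤δ) MMh≤ (≤-trans (+-mono-≤ p≤½ 4MMδ≤) ≤-refl))) ⟩
            τ * (P + η + η + (+ 8 / 1) * (a * a * η) * 1ℚ)
              ≤⟨ *-monoˡ 0≤τ (by-diff ((Q - ½) * κ + η * ((+ 24 / 1) * (a * a - 1ℚ) + (+ 20 / 1) + ((+ 2 / 1) - P * ξ * γ′)))
                   (sub⁺ ½≤Q ⊛ 0≤κ ⊕ 0≤η ⊛ (nonNegative⁻¹ (+ 24 / 1) ⊛ sub⁺ (≤-trans 1≤a (x≤x*y 0≤a 1≤a)) ⊕ nonNegative⁻¹ (+ 20 / 1) ⊕ sub⁺ (*-mono (0≤P ⊛ 0≤ξ) 0≤γ′ (*-mono 0≤P 0≤ξ P≤1 ξ≤1) γ′≤2)))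
                   (trans (e₂ P ξ η γ a) (trans (cong (λ z → z - P + W) Qγ) (e₄ P W)))) ⟩
            τ * ((1ℚ - p) * γ′)
              ≤⟨ by-diff (δ * σ) (0≤δ ⊛ 0≤σ) (e₃ p γ′ τ δ) ⟩
            (1ℚ - p + δ) * σ ∎
            where
            open ≤-Reasoning
            W : ℚ
            W = (Q - ½) * κ + η * ((+ 24 / 1) * (a * a - 1ℚ) + (+ 20 / 1) + ((+ 2 / 1) - P * ξ * γ′))
            p≤ : p ≤ P + η
            p≤ = by-diff (η * (1ℚ - P * ξ)) (0≤η ⊛ sub⁺ (*-mono 0≤P 0≤ξ P≤1 ξ≤1)) (e P ξ η)
              where e : ∀ P ξ η → P + η - P * (1ℚ + ξ * η) ≡ η * (1ℚ - P * ξ)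
                    e = solve-∀ ℚ-ring
            2Mδ≤ : (+ 2 / 1) * M * δ ≤ η
            2Mδ≤ = begin
              (+ 2 / 1) * M * δ                 ≡⟨ e M β ⟩
              (+ 4 / 1) * (M * β) * η           ≤⟨ *-monoʳ 0≤η (*-mono (nonNegative⁻¹ (+ 4 / 1)) (0≤M ⊛ 0≤β) (from-yes ((+ 4 / 1) ≤? (+ 24 / 1))) (*-monoʳ 0≤β M≤a)) ⟩
              (+ 24 / 1) * (a * β) * η          ≤⟨ *-monoʳ 0≤η (≤-trans aβ≤ (from-yes ((+ 1 / 1000) ≤? 1ℚ))) ⟩
              1ℚ * η                            ≡⟨ *-identityˡ η ⟩
              η ∎
              where e : ∀ M β → (+ 2 / 1) * M * ((+ 2 / 1) * (β * β * β * β)) ≡ (+ 4 / 1) * (M * β) * (β * β * β)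
                    e = solve-∀ ℚ-ring
            4MMδ≤ : (+ 4 / 1) * (M * M) * δ ≤ ½
            4MMδ≤ = begin
              (+ 4 / 1) * (M * M) * δ           ≡⟨ e M β ⟩
              (+ 8 / 1) * (M * M * (β * η))
                ≤⟨ *-mono (nonNegative⁻¹ (+ 8 / 1)) (0≤M ⊛ 0≤M ⊛ (0≤β ⊛ 0≤η)) (from-yes ((+ 8 / 1) ≤? (+ 24 / 1))) (*-mono (0≤M ⊛ 0≤M) (0≤β ⊛ 0≤η) (*-mono 0≤M 0≤M M≤a M≤a) (x*y≤x 0≤β η≤1)) ⟩
              (+ 24 / 1) * (a * a * β)          ≤⟨ a²β≤ ⟩
              (+ 1 / 1000)                      ≤⟨ from-yes ((+ 1 / 1000) ≤? ½) ⟩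
              ½ ∎
              where e : ∀ M β → (+ 4 / 1) * (M * M) * ((+ 2 / 1) * (β * β * β * β)) ≡ (+ 8 / 1) * (M * M * (β * (β * β * β)))
                    e = solve-∀ ℚ-ring
            MMh≤ : (+ 8 / 1) * (M * M * (β * β * (β * h))) ≤ (+ 8 / 1) * (a * a * η)
            MMh≤ = *-monoˡ (nonNegative⁻¹ (+ 8 / 1)) (≤-trans (≤-reflexive (e M β h)) (*-monoʳ 0≤η (*-mono 0≤M (0≤M ⊛ 0≤h) M≤a Mh≤a)))
              where e : ∀ M β h → M * M * (β * β * (β * h)) ≡ M * (M * h) * (β * β * β)
                    e = solve-∀ ℚ-ring
            e₁ : ∀ p t δ M d K → p * t + δ * ((+ 2 / 1) * M * t) + (+ 2 / 1) * (d * ((+ 2 / 1) * M * t * ((+ 2 / 1) * M * t) * K)) * (p * (t * t) + δ * ((+ 2 / 1) * M * t * ((+ 2 / 1) * M * t)))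
              ≡ t * (p + (+ 2 / 1) * M * δ + (+ 8 / 1) * (M * M * (d * (t * t) * (t * K))) * (p + (+ 4 / 1) * (M * M) * δ))
            e₁ = solve-∀ ℚ-ring
            e₂ : ∀ P ξ η γ a → (1ℚ - P * (1ℚ + ξ * η)) * (γ + (+ 64 / 1) * (a * a * η)) - (P + η + η + (+ 8 / 1) * (a * a * η) * 1ℚ)
              ≡ (1ℚ - P) * γ - P + ((1ℚ - P - ½) * ((+ 64 / 1) * (a * a * η)) + η * ((+ 24 / 1) * (a * a - 1ℚ) + (+ 20 / 1) + ((+ 2 / 1) - P * ξ * (γ + (+ 64 / 1) * (a * a * η)))))
            e₂ = solve-∀ ℚ-ring
            e₃ : ∀ p γ t δ → (1ℚ - p + δ) * (γ * t) - t * ((1ℚ - p) * γ) ≡ δ * (γ * t)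
            e₃ = solve-∀ ℚ-ring
            e₄ : ∀ P W → P - P + W ≡ W
            e₄ = solve-∀ ℚ-ring

          -- The factor h² with h = k/ℓ makes d h² = k², so that `spread-φ` can pass from ℓ²
          -- coordinates to the exponent k² of the blue edge weights.
          φ : ℚ
          φ = 1ℚ + h * h * (b * η)
          0≤φ : 0ℚ ≤ φ
          0≤φ = 0≤1 ⊕ 0≤h ⊛ 0≤h ⊛ (0≤b ⊛ 0≤η)
          0≤ω : 0ℚ ≤ ω
          0≤ω = ≤-trans 0≤p p≤q ⊕ 0≤δ

          -- σ k = γ′ β h, so the cube is h³ γ′³ η. One factor h is bounded by c, and c γ² ≤ 1 - g;
          -- passing from γ to γ′ costs at most 7 c κ ≤ χ.
          cubic : (+ 1 / 6) * (σ * σ * σ * (K * (K - 1ℚ) * (K - (+ 2 / 1)))) ≤ h * h * (((+ 1 / 6) * ((1ℚ - g) * γ) + χ) * η)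
          cubic = begin
            (+ 1 / 6) * (σ * σ * σ * (K * (K - 1ℚ) * (K - (+ 2 / 1))))
              ≤⟨ *-monoˡ (nonNegative⁻¹ (+ 1 / 6)) (*-monoˡ (0≤σ ⊛ 0≤σ ⊛ 0≤σ) (by-diff (K * ((+ 3 / 1) * (K - 1ℚ) + 1ℚ)) (0≤K ⊛ (nonNegative⁻¹ (+ 3 / 1) ⊛ sub⁺ 1≤K ⊕ 0≤1)) (e₁ K))) ⟩
            (+ 1 / 6) * (σ * σ * σ * (K * K * K))  ≡⟨ e₂ γ′ β r K ⟩
            h * h * ((+ 1 / 6) * (h * (γ′ * γ′ * γ′)) * η)
              ≤⟨ *-monoˡ (0≤h ⊛ 0≤h) (*-monoʳ 0≤η (*-monoˡ (nonNegative⁻¹ (+ 1 / 6)) (≤-trans (*-mono 0≤h (0≤γ′ ⊛ 0≤γ′ ⊛ 0≤γ′) h≤c ≤-refl) cγ′³))) ⟩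
            h * h * ((+ 1 / 6) * ((1ℚ - g) * γ + χ) * η)
              ≤⟨ *-monoˡ (0≤h ⊛ 0≤h) (*-monoʳ {a = (+ 1 / 6) * ((1ℚ - g) * γ + χ)} {b = (+ 1 / 6) * ((1ℚ - g) * γ) + χ} 0≤η (by-diff ((+ 5 / 6) * χ) (nonNegative⁻¹ (+ 5 / 6) ⊛ 0≤χ) (e₃ ((1ℚ - g) * γ) χ))) ⟩
            h * h * (((+ 1 / 6) * ((1ℚ - g) * γ) + χ) * η) ∎
            where
            open ≤-Reasoning
            e₁ : ∀ K → K * K * K - K * (K - 1ℚ) * (K - (+ 2 / 1)) ≡ K * ((+ 3 / 1) * (K - 1ℚ) + 1ℚ)
            e₁ = solve-∀ ℚ-ring
            e₂ : ∀ γ β r K → (+ 1 / 6) * (γ * (β * r) * (γ * (β * r)) * (γ * (β * r)) * (K * K * K)) ≡ K * r * (K * r) * ((+ 1 / 6) * (K * r * (γ * γ * γ)) * (β * β * β))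
            e₂ = solve-∀ ℚ-ring
            e₃ : ∀ x χ → (+ 1 / 6) * x + χ - (+ 1 / 6) * (x + χ) ≡ (+ 5 / 6) * χ
            e₃ = solve-∀ ℚ-ring
            cγ′³ : c * (γ′ * γ′ * γ′) ≤ (1ℚ - g) * γ + χ
            cγ′³ = begin
              c * (γ′ * γ′ * γ′)
                ≤⟨ *-monoˡ 0≤c (by-diff (κ * ((+ 3 / 1) * (1ℚ - γ * γ) + (+ 3 / 1) * (1ℚ - γ * κ) + (1ℚ - κ * κ)))
                     (0≤κ ⊛ (nonNegative⁻¹ (+ 3 / 1) ⊛ sub⁺ (*-mono 0≤γ 0≤γ γ≤1 γ≤1) ⊕ nonNegative⁻¹ (+ 3 / 1) ⊛ sub⁺ (*-mono 0≤γ 0≤κ γ≤1 κ≤1) ⊕ sub⁺ (*-mono 0≤κ 0≤κ κ≤1 κ≤1))) (e₅ γ κ)) ⟩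
              c * (γ * γ * γ + (+ 7 / 1) * κ)         ≡⟨ e₆ c γ ((+ 7 / 1) * κ) ⟩
              c * (γ * γ) * γ + c * ((+ 7 / 1) * κ)   ≤⟨ +-mono-≤ (*-monoʳ 0≤γ cγ²) c7κ≤χ ⟩
              (1ℚ - g) * γ + χ ∎
              where
              e₅ : ∀ γ κ → γ * γ * γ + (+ 7 / 1) * κ - (γ + κ) * (γ + κ) * (γ + κ) ≡ κ * ((+ 3 / 1) * (1ℚ - γ * γ) + (+ 3 / 1) * (1ℚ - γ * κ) + (1ℚ - κ * κ))
              e₅ = solve-∀ ℚ-ring
              e₆ : ∀ c γ k → c * (γ * γ * γ + k) ≡ c * (γ * γ) * γ + c * k
              e₆ = solve-∀ ℚ-ring

          quartic : (+ 162 / 1) * (τm * K) ^ 4 ≤ h * h * (χ * η)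
          quartic = begin
            (+ 162 / 1) * (τm * K) ^ 4              ≡⟨ trans (cong (λ z → (+ 162 / 1) * z ^ 4) τmK) (e₁ M h β) ⟩
            h * h * ((+ 2592 / 1) * (M * M * (M * h) * (M * h) * β) * η)
              ≤⟨ *-monoˡ (0≤h ⊛ 0≤h) (*-monoʳ 0≤η (≤-trans (*-monoˡ (nonNegative⁻¹ (+ 2592 / 1)) (*-monoʳ 0≤β
                   (*-mono (0≤M ⊛ 0≤M ⊛ (0≤M ⊛ 0≤h)) (0≤M ⊛ 0≤h) (*-mono (0≤M ⊛ 0≤M) (0≤M ⊛ 0≤h) (*-mono 0≤M 0≤M M≤a M≤a) Mh≤a) Mh≤a))) big)) ⟩
            h * h * (χ * η) ∎
            where
            open ≤-Reasoning
            e₁ : ∀ M h β → (+ 162 / 1) * ((+ 2 / 1) * (M * h * β) * ((+ 2 / 1) * (M * h * β) * ((+ 2 / 1) * (M * h * β) * ((+ 2 / 1) * (M * h * β) * 1ℚ))))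
              ≡ h * h * ((+ 2592 / 1) * (M * M * (M * h) * (M * h) * β) * (β * β * β))
            e₁ = solve-∀ ℚ-ring

          blue-bound : ∀ {n} {is : List (Fin n)} → Unique is → length is ≡ k →
            Ops.𝔼 (Weighting.Ω {n} d p τ m) (λ x → ∏L (λ e → Weighting.Blue d p τ m e x) (pairs is)) ≤ ω ^ ∑↓ k * φ ^ d
          blue-bound {is = is} u refl = ≤-trans
            (Weighting.𝔼-blue d p τ m 0≤p p≤q 0≤τ (ℕ.s≤s ℕ.z≤n) mτ δ Kδ u (<⇒≤ (proj₁ (proj₂ K⁻¹))) (trans (*-comm (proj₁ K⁻¹) K) (proj₂ (proj₂ K⁻¹))) σ 0≤σ σ≤τm 3τmK≤1 dτm≤ σ-large)
            (≤-trans (≤-reflexive (cong (λ z → ω ^ z * F ^ d) (length-pairs-∑↓ is)))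
              (*-monoˡ (0≤^ (∑↓ k) 0≤ω) (^-mono d F≥0 (≤-trans (≤-reflexive (+-assoc 1ℚ F₁ F₂)) (+-monoʳ-≤ 1ℚ (≤-trans (+-mono-≤ quartic cubic) (≤-reflexive (e (h * h) χ η ((+ 1 / 6) * ((1ℚ - g) * γ))))))))))
            where
            K⁻¹ = inverse (<-≤-trans 0<1 1≤K)
            e : ∀ h χ η x → h * (χ * η) + h * ((x + χ) * η) ≡ h * ((x + (+ 2 / 1) * χ) * η)
            e = solve-∀ ℚ-ring
            F₁ F₂ F : ℚ
            F₁ = (+ 162 / 1) * (τm * K) ^ 4
            F₂ = (+ 1 / 6) * (σ * σ * σ * (K * (K - 1ℚ) * (K - (+ 2 / 1))))
            F = 1ℚ + F₁ + F₂
            F≥0 : 0ℚ ≤ F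
            F≥0 = 0≤1 ⊕ nonNegative⁻¹ (+ 162 / 1) ⊛ 0≤^ 4 (0≤τm ⊛ 0≤K) ⊕ nonNegative⁻¹ (+ 1 / 6) ⊛ (0≤σ ⊛ 0≤σ ⊛ 0≤σ ⊛ 0≤falling k)

          spread-φ : φ ^ d ≤ (1ℚ + b * η) ^ (k ℕ.* k)
          spread-φ = subst (λ z → φ ^ d ≤ (1ℚ + b * η) ^ z) kk (spread (k ℕ.* k ℕ.∸ d) (ℓ′ ℕ.+ ℓ′ ℕ.* suc ℓ′) (0≤h ⊛ 0≤h ⊛ (0≤b ⊛ 0≤η)) (0≤b ⊛ 0≤η)
            (trans (cong (λ z → ι z * (b * η)) kk) (trans (cong (_* (b * η)) (ι-* k k)) (trans (sym (trans (e L K r (b * η)) (trans (cong (λ z → z * z * (K * K * (b * η))) Lr) (e′ K (b * η))))) (cong (_* (h * h * (b * η))) (sym (ι-* ℓ ℓ)))))))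
            where
            kk : k ℕ.* k ℕ.∸ d ℕ.+ d ≡ k ℕ.* k
            kk = ℕ.m∸n+n≡m (ℕ.*-mono-≤ ℓ≤k ℓ≤k)
            e : ∀ L K r z → L * L * (K * r * (K * r) * z) ≡ L * r * (L * r) * (K * K * z)
            e = solve-∀ ℚ-ring
            e′ : ∀ K z → 1ℚ * 1ℚ * (K * K * z) ≡ K * K * z
            e′ = solve-∀ ℚ-ring

          module _ (0<lo : 0ℚ < lo) {n : ℕ} {S : ℚ} (0≤S : 0ℚ ≤ S) (hS : S * S * P ≤ 1ℚ + χ * η) (link : Q ^ suc k ≤ P ^ ℓ)
            (far : (+ 32 / 1) * (1ℚ - χ * η) ^ ℓ ≤ lo) (n≤ : ι n ≤ S ^ ℓ) where
            private
              0≤1-χη : 0ℚ ≤ 1ℚ - χ * η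
              0≤1-χη = sub⁺ (*-mono 0≤χ 0≤η χ≤1 η≤1)
              1-χη≤1 : 1ℚ - χ * η ≤ 1ℚ
              1-χη≤1 = by-diff (χ * η) (0≤χ ⊛ 0≤η) (e (χ * η))
                where e : ∀ x → 1ℚ - (1ℚ - x) ≡ x
                      e = solve-∀ ℚ-ring
              0≤1+χη : 0ℚ ≤ 1ℚ + χ * η
              0≤1+χη = 0≤1 ⊕ 0≤χ ⊛ 0≤η
              0≤y : 0ℚ ≤ ι n
              0≤y = 0≤ι n
              ∑↓-pow : ∀ x i → x ^ ∑↓ i * x ^ ∑↓ i * x ^ i ≡ x ^ (i ℕ.* i)
              ∑↓-pow x i = trans (cong (_* x ^ i) (trans (sym (^-+ x (∑↓ i) (∑↓ i))) (cong (λ z → x ^ (∑↓ i ℕ.+ z)) (sym (ℕ.+-identityʳ (∑↓ i))))))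
                (trans (sym (^-+ x (2 ℕ.* ∑↓ i) i)) (cong (x ^_) (∑↓-square i)))
              sq-pow : ∀ x i → x ^ i * x ^ i ≡ (x * x) ^ i
              sq-pow x i = sym (*-^ x x i)
              eighth : ∀ i → 1 ℕ.≤ i → (+ 1 / 8) ^ i ≤ + 1 / 8
              eighth i h = ≤-trans (^-antitone (nonNegative⁻¹ (+ 1 / 8)) (from-yes ((+ 1 / 8) ≤? 1ℚ)) h) (≤-reflexive (*-identityʳ (+ 1 / 8)))
              -- x^i is the diagonal factor missing in `∑↓-square`. From 8 D ≤ x follows X² ≤
              -- (1/8)^i ≤ 1/8, which is less than 1/4.
              conclude : ∀ {X x D} i → 1 ℕ.≤ i → 0ℚ < x → 0ℚ ≤ D → X * X * x ^ i ≤ D ^ i → (+ 8 / 1) * D ≤ x → X < ½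
              conclude {X} {x} {D} i 1≤i 0<x 0≤D h h₈ = <½ (*-cancel (0<^ i 0<x) (begin
                X * X * x ^ i           ≤⟨ h ⟩
                D ^ i                   ≤⟨ ^-mono i 0≤D (≤-trans (≤-reflexive (e D)) (*-monoˡ (nonNegative⁻¹ (+ 1 / 8)) h₈)) ⟩
                ((+ 1 / 8) * x) ^ i     ≡⟨ *-^ (+ 1 / 8) x i ⟩
                (+ 1 / 8) ^ i * x ^ i   ≤⟨ *-monoʳ (0≤^ i (<⇒≤ 0<x)) (eighth i 1≤i) ⟩
                (+ 1 / 8) * x ^ i ∎))
                where
                open ≤-Reasoning
                e : ∀ D → D ≡ (+ 1 / 8) * ((+ 8 / 1) * D)
                e = solve-∀ ℚ-ring

              -- Squared and completed by p^ℓ, the total is at most the ℓ²-th power of S² p ρ²,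
              -- because n ≤ S^ℓ; `red-base` bounds that base by 1 - χ η, and `far` makes its ℓ-th
              -- power small.
              red-total : ι n ^ ℓ * (p ^ ∑↓ ℓ * ρ ^ d) < ½
              red-total = conclude {x = p} {D = (1ℚ - χ * η) ^ ℓ} ℓ (ℕ.s≤s ℕ.z≤n) (<-≤-trans 0<lo (≤-trans lo≤P P≤p)) (0≤^ ℓ 0≤1-χη) (begin
                ι n ^ ℓ * (p ^ ∑↓ ℓ * ρ ^ d) * (ι n ^ ℓ * (p ^ ∑↓ ℓ * ρ ^ d)) * p ^ ℓ
                  ≡⟨ e (ι n ^ ℓ) (p ^ ∑↓ ℓ) (ρ ^ d) (p ^ ℓ) ⟩
                ι n ^ ℓ * ι n ^ ℓ * (p ^ ∑↓ ℓ * p ^ ∑↓ ℓ * p ^ ℓ) * (ρ ^ d * ρ ^ d)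
                  ≡⟨ cong₂ (λ x y → ι n ^ ℓ * ι n ^ ℓ * x * y) (∑↓-pow p ℓ) (sq-pow ρ d) ⟩
                ι n ^ ℓ * ι n ^ ℓ * p ^ d * (ρ * ρ) ^ d
                  ≤⟨ *-monoʳ (0≤^ d (0≤ρ ⊛ 0≤ρ)) (*-monoʳ (0≤^ d 0≤p) (*-mono (0≤^ ℓ 0≤y) (0≤^ ℓ 0≤y) (^-mono ℓ 0≤y n≤) (^-mono ℓ 0≤y n≤))) ⟩
                (S ^ ℓ) ^ ℓ * (S ^ ℓ) ^ ℓ * p ^ d * (ρ * ρ) ^ d
                  ≡⟨ trans (cong (λ x → x * x * p ^ d * (ρ * ρ) ^ d) (sym (^-* S ℓ ℓ))) (cong (λ x → x * p ^ d * (ρ * ρ) ^ d) (sq-pow S d)) ⟩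
                (S * S) ^ d * p ^ d * (ρ * ρ) ^ d
                  ≡⟨ trans (cong (_* (ρ * ρ) ^ d) (sym (*-^ (S * S) p d))) (sym (*-^ (S * S * p) (ρ * ρ) d)) ⟩
                (S * S * p * (ρ * ρ)) ^ d
                  ≤⟨ ^-mono d (0≤S ⊛ 0≤S ⊛ 0≤p ⊛ (0≤ρ ⊛ 0≤ρ)) (≤-trans (*-monoʳ (0≤ρ ⊛ 0≤ρ) (≤-trans (≤-reflexive (sym (*-assoc (S * S) P (1ℚ + ξ * η)))) (*-monoʳ (0≤1 ⊕ 0≤ξ ⊛ 0≤η) hS))) red-base) ⟩
                (1ℚ - χ * η) ^ d          ≡⟨ ^-* (1ℚ - χ * η) ℓ ℓ ⟩
                ((1ℚ - χ * η) ^ ℓ) ^ ℓ ∎)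
                (≤-trans (*-monoʳ (0≤^ ℓ 0≤1-χη) (from-yes ((+ 8 / 1) ≤? (+ 32 / 1)))) (≤-trans far (≤-trans lo≤P P≤p)))
                where
                open ≤-Reasoning
                e : ∀ a b c x → a * (b * c) * (a * (b * c)) * x ≡ a * a * (b * b * x) * (c * c)
                e = solve-∀ ℚ-ring

              D : ℚ
              D = (1ℚ - χ * η) ^ k
              F : ℚ
              F = (1ℚ + b * η) * (1ℚ + b * η)
              0≤F : 0ℚ ≤ F
              0≤F = (0≤1 ⊕ 0≤b ⊛ 0≤η) ⊛ (0≤1 ⊕ 0≤b ⊛ 0≤η)
              kk = k ℕ.* k
              -- `link` trades the blue density Q for P, whose product with S² is nearly 1. The
              -- slack is raised from the exponent ℓ to k to match `blue-base`.
              linked : (S * S) ^ ℓ * Q ^ suc k ≤ (1ℚ + χ * η) ^ k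
              linked = begin
                (S * S) ^ ℓ * Q ^ suc k   ≤⟨ *-monoˡ (0≤^ ℓ (0≤S ⊛ 0≤S)) link ⟩
                (S * S) ^ ℓ * P ^ ℓ       ≡⟨ sym (*-^ (S * S) P ℓ) ⟩
                (S * S * P) ^ ℓ           ≤⟨ ^-mono ℓ (0≤S ⊛ 0≤S ⊛ 0≤P) hS ⟩
                (1ℚ + χ * η) ^ ℓ          ≤⟨ ^-monotone (subst (_≤ 1ℚ + χ * η) (+-identityʳ 1ℚ) (+-monoʳ-≤ 1ℚ (0≤χ ⊛ 0≤η))) ℓ≤k ⟩
                (1ℚ + χ * η) ^ k ∎
                where open ≤-Reasoning
              S-pow : (S ^ ℓ) ^ k * (S ^ ℓ) ^ k ≡ ((S * S) ^ ℓ) ^ k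
              S-pow = trans (sq-pow (S ^ ℓ) k) (cong (_^ k) (sq-pow S ℓ))
              Q-pow : Q ^ kk * Q ^ k ≡ (Q ^ suc k) ^ k
              Q-pow = trans (sym (^-+ Q kk k)) (trans (cong (Q ^_) (trans (ℕ.+-comm kk k) (sym (ℕ.*-suc k k)))) (^-* Q k (suc k)))

              -- The normaliser is (ω Q)^k and not ω^k: the extra Q^k completes Q^(k²) to (Q^(k +
              -- 1))^k, as rounding only grants C ℓ < k + 1 and hence a link with exponent k + 1.
              blue-total : ι n ^ k * (ω ^ ∑↓ k * φ ^ d) < ½
              blue-total = conclude {x = ω * Q} {D = D} k (ℕ.≤-trans (ℕ.s≤s ℕ.z≤n) ℓ≤k) (0<ω ⊛< 0<Q) (0≤^ k 0≤1-χη) (begin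
                ι n ^ k * (ω ^ ∑↓ k * φ ^ d) * (ι n ^ k * (ω ^ ∑↓ k * φ ^ d)) * (ω * Q) ^ k
                  ≡⟨ trans (cong (ι n ^ k * (ω ^ ∑↓ k * φ ^ d) * (ι n ^ k * (ω ^ ∑↓ k * φ ^ d)) *_) (*-^ ω Q k)) (e (ι n ^ k) (ω ^ ∑↓ k) (φ ^ d) (ω ^ k) (Q ^ k)) ⟩
                ι n ^ k * ι n ^ k * (ω ^ ∑↓ k * ω ^ ∑↓ k * ω ^ k) * Q ^ k * (φ ^ d * φ ^ d)
                  ≡⟨ cong (λ x → ι n ^ k * ι n ^ k * x * Q ^ k * (φ ^ d * φ ^ d)) (∑↓-pow ω k) ⟩
                ι n ^ k * ι n ^ k * ω ^ kk * Q ^ k * (φ ^ d * φ ^ d)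
                  ≤⟨ *-mono (0≤^ k 0≤y ⊛ 0≤^ k 0≤y ⊛ 0≤^ kk 0≤ω ⊛ 0≤^ k 0≤Q) (0≤^ d 0≤φ ⊛ 0≤^ d 0≤φ)
                       (*-monoʳ (0≤^ k 0≤Q) (*-mono (0≤^ k 0≤y ⊛ 0≤^ k 0≤y) (0≤^ kk 0≤ω) (*-mono (0≤^ k 0≤y) (0≤^ k 0≤y) (^-mono k 0≤y n≤) (^-mono k 0≤y n≤)) (^-mono kk 0≤ω ω≤Qv)))
                       (*-mono (0≤^ d 0≤φ) (0≤^ d 0≤φ) spread-φ spread-φ) ⟩
                (S ^ ℓ) ^ k * (S ^ ℓ) ^ k * (Q * v) ^ kk * Q ^ k * ((1ℚ + b * η) ^ kk * (1ℚ + b * η) ^ kk)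
                  ≡⟨ cong₂ _*_ (cong₂ (λ x y → x * y * Q ^ k) S-pow (*-^ Q v kk)) (sq-pow (1ℚ + b * η) kk) ⟩
                ((S * S) ^ ℓ) ^ k * (Q ^ kk * v ^ kk) * Q ^ k * F ^ kk
                  ≡⟨ trans (e′ (((S * S) ^ ℓ) ^ k) (Q ^ kk) (v ^ kk) (Q ^ k) (F ^ kk)) (cong (λ x → ((S * S) ^ ℓ) ^ k * x * v ^ kk * F ^ kk) Q-pow) ⟩
                ((S * S) ^ ℓ) ^ k * (Q ^ suc k) ^ k * v ^ kk * F ^ kk
                  ≡⟨ cong (λ x → x * v ^ kk * F ^ kk) (sym (*-^ ((S * S) ^ ℓ) (Q ^ suc k) k)) ⟩
                ((S * S) ^ ℓ * Q ^ suc k) ^ k * v ^ kk * F ^ kk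
                  ≤⟨ *-monoʳ (0≤^ kk 0≤F) (*-monoʳ (0≤^ kk 0≤v) (^-mono k (0≤^ ℓ (0≤S ⊛ 0≤S) ⊛ 0≤^ (suc k) 0≤Q) linked)) ⟩
                ((1ℚ + χ * η) ^ k) ^ k * v ^ kk * F ^ kk
                  ≡⟨ trans (cong (λ x → x * v ^ kk * F ^ kk) (sym (^-* (1ℚ + χ * η) k k))) (trans (cong (_* F ^ kk) (sym (*-^ (1ℚ + χ * η) v kk))) (sym (*-^ ((1ℚ + χ * η) * v) F kk))) ⟩
                ((1ℚ + χ * η) * v * F) ^ kk
                  ≤⟨ ^-mono kk (0≤1+χη ⊛ 0≤v ⊛ 0≤F) (blue-base 0≤s s≤1 0≤b b≤1 s-large) ⟩
                (1ℚ - χ * η) ^ kk         ≡⟨ ^-* (1ℚ - χ * η) k k ⟩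
                D ^ k ∎)
                (begin
                (+ 8 / 1) * D             ≤⟨ *-monoˡ (nonNegative⁻¹ (+ 8 / 1)) (^-antitone 0≤1-χη 1-χη≤1 ℓ≤k) ⟩
                (+ 8 / 1) * (1ℚ - χ * η) ^ ℓ  ≡⟨ e″ ((1ℚ - χ * η) ^ ℓ) ⟩
                (+ 1 / 4) * ((+ 32 / 1) * (1ℚ - χ * η) ^ ℓ)  ≤⟨ *-monoˡ (nonNegative⁻¹ (+ 1 / 4)) (≤-trans far lo≤1) ⟩
                (+ 1 / 4) * 1ℚ            ≤⟨ from-yes ((+ 1 / 4) * 1ℚ ≤? ½ * ½) ⟩
                ½ * ½                     ≤⟨ *-mono (nonNegative⁻¹ ½) (nonNegative⁻¹ ½) ½≤ω ½≤Q ⟩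
                ω * Q ∎)
                where
                open ≤-Reasoning
                ½≤ω : ½ ≤ ω
                ½≤ω = ≤-trans ½≤1-p (subst (_≤ ω) (+-identityʳ (1ℚ - p)) (+-monoʳ-≤ (1ℚ - p) 0≤δ))
                0<ω : 0ℚ < ω
                0<ω = <-≤-trans (positive⁻¹ ½) ½≤ω
                e : ∀ a b c x y → a * (b * c) * (a * (b * c)) * (x * y) ≡ a * a * (b * b * x) * y * (c * c)
                e = solve-∀ ℚ-ring
                e′ : ∀ a b c x y → a * (b * c) * x * y ≡ a * (b * x) * c * y
                e′ = solve-∀ ℚ-ring
                e″ : ∀ x → (+ 8 / 1) * x ≡ (+ 1 / 4) * ((+ 32 / 1) * x)
                e″ = solve-∀ ℚ-ring

            no-arrows : ¬ Arrows ℓ k n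
            no-arrows arr = <-irrefl refl (≤-<-trans
              -- `union-bound` expects the predecessor of the exponent m = 4 (j′ + 1).
              (union-bound {ℓ} {k} {n} d p τ (j′ ℕ.+ 3 ℕ.* suc j′) {ρ} {ω} {φ} 0≤p 0≤τ (≤-trans τ≤β β≤1) arr red-bound blue-bound 0≤ρ (0≤^ (∑↓ k) 0≤ω ⊛ 0≤^ d 0≤φ))
              (<-≤-trans (+-mono-< red-total blue-total) ≤-refl))

-- Uniform choice of the gain and of the threshold

module ExponentialGain where
  open Rationals
  open UnionBound
  open Inequalities
  open Growth
  open Scales
  open import Defs using (Arrows)
  open import Data.Integer.Base using (+_)
  open import Data.Rational
  open import Data.Rational.Properties

  2^j½^j : ∀ j → ι (2 ℕ.^ j) * ½ ^ j ≡ 1ℚ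
  2^j½^j j = trans (cong (_* ½ ^ j) (ι-^ 2 j)) (trans (sym (*-^ (ι 2) ½ j)) (trans (cong (λ z → (z * ½) ^ j) (ι-def 2)) (1^ j)))

  ι-quartic : ∀ X m → ι (X ℕ.* (m ℕ.* m ℕ.* m ℕ.* m)) ≡ ι X * (ι m * ι m * ι m * ι m)
  ι-quartic X m = trans (ι-* X _) (cong (ι X *_) (trans (ι-* (m ℕ.* m ℕ.* m) m) (cong (_* ι m) (trans (ι-* (m ℕ.* m) m) (cong (_* ι m) (ι-* m m))))))

  module Gain (c g lo : ℚ) (1≤c : 1ℚ ≤ c) (0<g : 0ℚ < g) (g≤1 : g ≤ 1ℚ) (0<lo : 0ℚ < lo) (lo≤1 : lo ≤ 1ℚ)
    (X j′ : ℕ) (hX : (+ 2592 / 1) * (c * c * c * c) ≤ ι X * ((+ 1 / 48) * (g * lo)))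
    (grow : X ℕ.* ((4 ℕ.* suc j′) ℕ.* (4 ℕ.* suc j′) ℕ.* (4 ℕ.* suc j′) ℕ.* (4 ℕ.* suc j′)) ℕ.≤ 2 ℕ.^ suc j′) where
    open Scale c g lo 1≤c (<⇒≤ 0<g) g≤1 (<⇒≤ 0<lo) lo≤1 j′ public
    big : (+ 2592 / 1) * t ≤ χ
    big = begin
      (+ 2592 / 1) * t                                          ≡⟨ e₁ M c β ⟩
      (+ 2592 / 1) * (c * c * c * c) * (M * M * M * M * β)       ≤⟨ *-monoʳ (0≤M ⊛ 0≤M ⊛ 0≤M ⊛ 0≤M ⊛ 0≤β) hX ⟩
      ι X * χ * (M * M * M * M * β)                              ≡⟨ e₂ (ι X) χ (M * M * M * M) β ⟩
      χ * (ι X * (M * M * M * M) * β)                            ≡⟨ cong (λ z → χ * (z * β)) (sym (ι-quartic X m)) ⟩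
      χ * (ι (X ℕ.* (m ℕ.* m ℕ.* m ℕ.* m)) * β)                  ≤⟨ *-monoˡ 0≤χ (*-monoʳ 0≤β (ι-mono grow)) ⟩
      χ * (ι (2 ℕ.^ j) * β)                                      ≡⟨ trans (cong (χ *_) (2^j½^j j)) (*-identityʳ χ) ⟩
      χ ∎
      where
      open ≤-Reasoning
      e₁ : ∀ M c β → (+ 2592 / 1) * (M * c * (M * c) * (M * c) * (M * c) * β) ≡ (+ 2592 / 1) * (c * c * c * c) * (M * M * M * M * β)
      e₁ = solve-∀ ℚ-ring
      e₂ : ∀ X χ M β → X * χ * (M * β) ≡ χ * (X * M * β)
      e₂ = solve-∀ ℚ-ring
    open Small big
    0<χη : 0ℚ < χ * η
    0<χη = positive⁻¹ (+ 1 / 48) ⊛< (0<g ⊛< 0<lo) ⊛< (0<β ⊛< 0<β ⊛< 0<β)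
    χη≤1 : χ * η ≤ 1ℚ
    χη≤1 = *-mono 0≤χ 0≤η χ≤1 η≤1
    -- 32 = 8 · 4: both totals need the factor 8, and on the blue side it is compared with ω Q ≥
    -- 1/4.
    lim = vanishing 0<χη χη≤1 (positive⁻¹ (+ 1 / 32) ⊛< 0<lo)
    L = proj₁ lim
    far : ∀ ℓ′ → suc L ℕ.+ 2 ℕ.^ j ℕ.≤ suc ℓ′ → (+ 32 / 1) * (1ℚ - χ * η) ^ suc ℓ′ ≤ lo
    far ℓ′ h = ≤-trans (*-monoˡ (nonNegative⁻¹ (+ 32 / 1)) (proj₂ lim (suc ℓ′) (ℕ.≤-trans (ℕ.n≤1+n L) (ℕ.≤-trans (ℕ.m≤m+n (suc L) (2 ℕ.^ j)) h)))) (≤-reflexive (e lo))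
      where e : ∀ x → (+ 32 / 1) * ((+ 1 / 32) * x) ≡ x
            e = solve-∀ ℚ-ring
    big-ℓ : ∀ ℓ′ → suc L ℕ.+ 2 ℕ.^ j ℕ.≤ suc ℓ′ → 1ℚ ≤ β * ι (suc ℓ′)
    big-ℓ ℓ′ h = ≤-trans (≤-reflexive (sym (trans (*-comm β (ι (2 ℕ.^ j))) (2^j½^j j)))) (*-monoˡ 0≤β (ι-mono (ℕ.≤-trans (ℕ.m≤n+m (2 ℕ.^ j) (suc L)) h)))

    excluded : ∀ P S → lo ≤ P → P ≤ 1ℚ → c * (P * P) ≤ (1ℚ - g) * ((1ℚ - P) * (1ℚ - P)) → 0ℚ ≤ S → S * S * P ≤ 1ℚ + χ * η →
      ∀ ℓ k n → suc L ℕ.+ 2 ℕ.^ j ℕ.≤ ℓ → ℓ ℕ.≤ k → ι k ≤ c * ι ℓ → (1ℚ - P) ^ suc k ≤ P ^ ℓ → ι n ≤ S ^ ℓ → ¬ Arrows ℓ k n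
    excluded P S lo≤P P≤1 hP 0≤S hS (suc ℓ′) k n large ℓ≤k k≤cℓ link n≤ =
      AtP.AtSize.no-arrows P lo≤P P≤1 hP ℓ′ k ℓ≤k k≤cℓ (big-ℓ ℓ′ large) 0<lo {n} {S} 0≤S hS link (far ℓ′ large) n≤

  -- θ and ℓ₀ depend on c, g and lo only. This order of quantifiers lets P and S be chosen
  -- afterwards, close enough to p and p^(-1/2) for S² P ≤ 1 + θ.
  exponential-gain : ∀ c g lo → 1ℚ ≤ c → 0ℚ < g → g ≤ 1ℚ → 0ℚ < lo → lo ≤ 1ℚ →
    ∃[ θ ] (0ℚ < θ × ∃[ ℓ₀ ] (∀ P S → lo ≤ P → P ≤ 1ℚ → c * (P * P) ≤ (1ℚ - g) * ((1ℚ - P) * (1ℚ - P)) → 0ℚ ≤ S → S * S * P ≤ 1ℚ + θ →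
      ∀ ℓ k n → ℓ₀ ℕ.≤ ℓ → ℓ ℕ.≤ k → ι k ≤ c * ι ℓ → (1ℚ - P) ^ suc k ≤ P ^ ℓ → ι n ≤ S ^ ℓ → ¬ Arrows ℓ k n))
  exponential-gain c g lo 1≤c 0<g g≤1 0<lo lo≤1 = go (archimedean* (positive⁻¹ (+ 1 / 48) ⊛< (0<g ⊛< 0<lo)) ((+ 2592 / 1) * (c * c * c * c)))
    where
    Goal = ∃[ θ ] (0ℚ < θ × ∃[ ℓ₀ ] (∀ P S → lo ≤ P → P ≤ 1ℚ → c * (P * P) ≤ (1ℚ - g) * ((1ℚ - P) * (1ℚ - P)) → 0ℚ ≤ S → S * S * P ≤ 1ℚ + θ →
      ∀ ℓ k n → ℓ₀ ℕ.≤ ℓ → ℓ ℕ.≤ k → ι k ≤ c * ι ℓ → (1ℚ - P) ^ suc k ≤ P ^ ℓ → ι n ≤ S ^ ℓ → ¬ Arrows ℓ k n))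
    go′ : ∀ X → (+ 2592 / 1) * (c * c * c * c) ≤ ι X * ((+ 1 / 48) * (g * lo)) →
      ∃[ j ] (1 ℕ.≤ j × X ℕ.* ((4 ℕ.* j) ℕ.* (4 ℕ.* j) ℕ.* (4 ℕ.* j) ℕ.* (4 ℕ.* j)) ℕ.≤ 2 ℕ.^ j) → Goal
    go′ X hX (suc j′ , _ , grow) = let open Gain c g lo 1≤c 0<g g≤1 0<lo lo≤1 X j′ hX grow in χ * η , 0<χη , suc L ℕ.+ 2 ℕ.^ j , excluded
    go : ∃[ X ] (+ 2592 / 1) * (c * c * c * c) ≤ ι X * ((+ 1 / 48) * (g * lo)) → Goal
    go (X , hX) = go′ X hX (exponential-beats-quartic X)

-- Partial sums of the exponential series at rational points

module PartialSums where
  open Rationals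
  open Inequalities using (vanishing)
  open import Data.Integer.Base using (+_)
  import Data.Integer.Base as ℤ
  import Data.Integer.Properties as ℤ
  open import Data.Nat.Base using (ℕ; zero; suc; _!)
  import Data.Nat.Combinatorics as ℕ
  open import Data.Rational
  open import Data.Rational.Properties
  open import Data.Rational.Unnormalised.Base using (mkℚᵘ; *≡*)
  import Data.Rational.Unnormalised.Base as ℚᵘ
  import Data.Rational.Unnormalised.Properties as ℚᵘ

  recip : ∀ m .{{_ : ℕ.NonZero m}} → ι m * (+ 1 / m) ≡ 1ℚ
  recip (suc m) = trans (cong (_* (+ 1 / suc m)) (ι-def (suc m))) (toℚᵘ-injective (begin
    toℚᵘ ((+ suc m / 1) * (+ 1 / suc m))           ≈⟨ toℚᵘ-homo-* (+ suc m / 1) (+ 1 / suc m) ⟩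
    toℚᵘ (+ suc m / 1) ℚᵘ.* toℚᵘ (+ 1 / suc m)     ≈⟨ ℚᵘ.*-cong (toℚᵘ-fromℚᵘ (mkℚᵘ (+ suc m) 0)) (toℚᵘ-fromℚᵘ (mkℚᵘ (+ 1) m)) ⟩
    mkℚᵘ (+ suc m) 0 ℚᵘ.* mkℚᵘ (+ 1) m             ≈⟨ *≡* (trans (ℤ.*-identityʳ _) (trans (ℤ.*-identityʳ (+ suc m)) (sym (trans (ℤ.*-identityˡ _) (ℤ.*-identityˡ (+ suc m)))))) ⟩
    toℚᵘ 1ℚ ∎))
    where open import Relation.Binary.Reasoning.Setoid ℚᵘ.≃-setoid

  opaque
    1/! : ℕ → ℚ
    1/! n = _/_ (+ 1) (n !) {{ n ℕ.!≢0 }}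

    1/!-def : ∀ n → 1/! n ≡ _/_ (+ 1) (n !) {{ n ℕ.!≢0 }}
    1/!-def n = refl

    1/!-0 : 1/! 0 ≡ 1ℚ
    1/!-0 = refl

    1/!-nonneg : ∀ n → 0ℚ ≤ 1/! n
    1/!-nonneg n = nonNegative⁻¹ _ {{normalize-nonNeg 1 (n !) {{ n ℕ.!≢0 }}}}

    1/!-suc : ∀ n → ι (suc n) * 1/! (suc n) ≡ 1/! n
    1/!-suc n = begin
      ι (suc n) * 1/! (suc n)                             ≡⟨ sym (*-identityˡ _) ⟩
      1ℚ * (ι (suc n) * 1/! (suc n))                      ≡⟨ cong (_* (ι (suc n) * 1/! (suc n))) (sym (recip (n !) {{ n ℕ.!≢0 }})) ⟩
      ι (n !) * 1/! n * (ι (suc n) * 1/! (suc n))         ≡⟨ e (ι (n !)) (1/! n) (ι (suc n)) (1/! (suc n)) ⟩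
      ι (suc n) * ι (n !) * 1/! (suc n) * 1/! n           ≡⟨ cong (λ z → z * 1/! (suc n) * 1/! n) (sym (ι-* (suc n) (n !))) ⟩
      ι (suc n !) * 1/! (suc n) * 1/! n                   ≡⟨ cong (_* 1/! n) (recip (suc n !) {{ suc n ℕ.!≢0 }}) ⟩
      1ℚ * 1/! n                                          ≡⟨ *-identityˡ _ ⟩
      1/! n ∎
      where
      open ≡-Reasoning
      e : ∀ a b c d → a * b * (c * d) ≡ c * a * d * b
      e = solve-∀ ℚ-ring

  term : ℚ → ℕ → ℚ
  term x i = 1/! i * x ^ i

  E : ℚ → ℕ → ℚ
  E x zero    = 0ℚ
  E x (suc n) = E x n + term x n

  term-0 : ∀ x → term x 0 ≡ 1ℚ
  term-0 x = trans (*-identityʳ _) 1/!-0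

  -- The equation exp′ = exp, coefficient by coefficient; it spares later arguments from handling
  -- factorials.
  term-suc : ∀ x i → ι (suc i) * term x (suc i) ≡ x * term x i
  term-suc x i = trans (e₁ (ι (suc i)) (1/! (suc i)) x (x ^ i)) (trans (cong (λ z → z * (x * x ^ i)) (1/!-suc i)) (e₂ (1/! i) x (x ^ i)))
    where
    e₁ : ∀ a b x p → a * (b * (x * p)) ≡ a * b * (x * p)
    e₁ = solve-∀ ℚ-ring
    e₂ : ∀ b x p → b * (x * p) ≡ x * (b * p)
    e₂ = solve-∀ ℚ-ring

  term-nonneg : ∀ {x} i → 0ℚ ≤ x → 0ℚ ≤ term x i
  term-nonneg i h = 1/!-nonneg i ⊛ 0≤^ i h

  ∣∣≤ : ∀ {x a} → x ≤ a → - x ≤ a → ∣ x ∣ ≤ a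
  ∣∣≤ {x} p q with ∣p∣≡p∨∣p∣≡-p x
  ... | inj₁ e = ≤-trans (≤-reflexive e) p
  ... | inj₂ e = ≤-trans (≤-reflexive e) q

  x≤∣x∣ : ∀ x → x ≤ ∣ x ∣
  x≤∣x∣ x with ≤-total 0ℚ x
  ... | inj₁ h = ≤-reflexive (sym (0≤p⇒∣p∣≡p h))
  ... | inj₂ h = ≤-trans h (0≤∣p∣ x)

  -x≤∣x∣ : ∀ x → - x ≤ ∣ x ∣
  -x≤∣x∣ x = subst (- x ≤_) (∣-p∣≡∣p∣ x) (x≤∣x∣ (- x))

  ∣^∣ : ∀ x n → ∣ x ^ n ∣ ≡ ∣ x ∣ ^ n
  ∣^∣ x zero    = refl
  ∣^∣ x (suc n) = trans (∣p*q∣≡∣p∣*∣q∣ x (x ^ n)) (cong (∣ x ∣ *_) (∣^∣ x n))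

  ∣term∣ : ∀ x i → ∣ term x i ∣ ≡ term ∣ x ∣ i
  ∣term∣ x i = trans (∣p*q∣≡∣p∣*∣q∣ (1/! i) (x ^ i)) (cong₂ _*_ (0≤p⇒∣p∣≡p (1/!-nonneg i)) (∣^∣ x i))

  term-mono : ∀ {x y} i → 0ℚ ≤ x → x ≤ y → term x i ≤ term y i
  term-mono i h l = *-monoˡ (1/!-nonneg i) (^-mono i h l)

  ∣term∣≤ : ∀ {x X} i → ∣ x ∣ ≤ X → ∣ term x i ∣ ≤ term X i
  ∣term∣≤ {x} i h = ≤-trans (≤-reflexive (∣term∣ x i)) (term-mono i (0≤∣p∣ x) h)

  -- Each new term moves the partial sums at x and y apart by at most a term at X.
  term-lipschitz : ∀ {x y X} i → ∣ x ∣ ≤ X → ∣ y ∣ ≤ X → ∣ term x (suc i) - term y (suc i) ∣ ≤ ∣ x - y ∣ * term X i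
  term-lipschitz {x} {y} {X} i hx hy = *-cancel {c = ι (suc i)} (0<ι i) (begin
    ∣ term x (suc i) - term y (suc i) ∣ * ι (suc i)
      ≡⟨ trans (cong (∣ term x (suc i) - term y (suc i) ∣ *_) (sym (0≤p⇒∣p∣≡p (0≤ι (suc i))))) (trans (sym (∣p*q∣≡∣p∣*∣q∣ (term x (suc i) - term y (suc i)) (ι (suc i)))) (cong ∣_∣ (trans (e₁ (term x (suc i)) (term y (suc i)) (ι (suc i))) (cong₂ _-_ (term-suc x i) (term-suc y i))))) ⟩
    ∣ x * term x i - y * term y i ∣  ≡⟨ cong ∣_∣ (e₂ x y (term x i) (term y i)) ⟩
    ∣ x * (term x i - term y i) + (x - y) * term y i ∣
      ≤⟨ ∣p+q∣≤∣p∣+∣q∣ (x * (term x i - term y i)) ((x - y) * term y i) ⟩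
    ∣ x * (term x i - term y i) ∣ + ∣ (x - y) * term y i ∣
      ≡⟨ cong₂ _+_ (∣p*q∣≡∣p∣*∣q∣ x (term x i - term y i)) (∣p*q∣≡∣p∣*∣q∣ (x - y) (term y i)) ⟩
    ∣ x ∣ * ∣ term x i - term y i ∣ + ∣ x - y ∣ * ∣ term y i ∣
      ≤⟨ +-mono-≤ (≤-trans (*-monoʳ (0≤∣p∣ (term x i - term y i)) hx) (inner i)) (*-monoˡ (0≤∣p∣ (x - y)) (∣term∣≤ i hy)) ⟩
    ∣ x - y ∣ * (ι i * term X i) + ∣ x - y ∣ * term X i
      ≡⟨ trans (e₃ ∣ x - y ∣ (ι i) (term X i)) (cong (λ z → ∣ x - y ∣ * term X i * z) (sym (ι-suc i))) ⟩
    ∣ x - y ∣ * term X i * ι (suc i) ∎)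
    where
    open ≤-Reasoning
    inner : ∀ i → X * ∣ term x i - term y i ∣ ≤ ∣ x - y ∣ * (ι i * term X i)
    inner zero    = ≤-reflexive (trans (cong (λ z → X * ∣ z ∣) (trans (cong₂ _-_ (term-0 x) (term-0 y)) (+-inverseʳ 1ℚ))) (trans (*-zeroʳ X) (sym (trans (cong (λ z → ∣ x - y ∣ * (z * term X 0)) ι-0) (trans (cong (∣ x - y ∣ *_) (*-zeroˡ (term X 0))) (*-zeroʳ ∣ x - y ∣))))))
    inner (suc i) = ≤-trans (*-monoˡ (≤-trans (0≤∣p∣ x) hx) (term-lipschitz i hx hy)) (≤-reflexive (trans (e₄ X ∣ x - y ∣ (term X i)) (cong (∣ x - y ∣ *_) (sym (term-suc X i)))))
      where e₄ : ∀ X d t → X * (d * t) ≡ d * (X * t)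
            e₄ = solve-∀ ℚ-ring
    e₁ : ∀ a b n → (a - b) * n ≡ n * a - n * b
    e₁ = solve-∀ ℚ-ring
    e₂ : ∀ x y s t → x * s - y * t ≡ x * (s - t) + (x - y) * t
    e₂ = solve-∀ ℚ-ring
    e₃ : ∀ d i t → d * (i * t) + d * t ≡ d * t * (1ℚ + i)
    e₃ = solve-∀ ℚ-ring

  E-nonneg : ∀ {x} n → 0ℚ ≤ x → 0ℚ ≤ E x n
  E-nonneg zero    h = ≤-refl
  E-nonneg (suc n) h = E-nonneg n h ⊕ term-nonneg n h

  E-lipschitz : ∀ {x y X} n → ∣ x ∣ ≤ X → ∣ y ∣ ≤ X → ∣ E x n - E y n ∣ ≤ ∣ x - y ∣ * E X n
  E-lipschitz {x} {y} {X} zero    hx hy = ≤-reflexive (sym (*-zeroʳ ∣ x - y ∣))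
  E-lipschitz {x} {y} {X} (suc n) hx hy = ≤-trans (go n) (*-monoˡ (0≤∣p∣ (x - y)) (subst (_≤ E X (suc n)) (+-identityʳ (E X n)) (+-monoʳ-≤ (E X n) (term-nonneg n (≤-trans (0≤∣p∣ x) hx)))))
    where
    e : ∀ a b c d → (a + b) - (c + d) ≡ (a - c) + (b - d)
    e = solve-∀ ℚ-ring
    go : ∀ n → ∣ E x (suc n) - E y (suc n) ∣ ≤ ∣ x - y ∣ * E X n
    go zero    = ≤-reflexive (trans (cong (λ z → ∣ z ∣) (trans (cong₂ (λ a b → 0ℚ + a - (0ℚ + b)) (term-0 x) (term-0 y)) refl)) (sym (*-zeroʳ ∣ x - y ∣)))
    go (suc n) = ≤-trans (≤-reflexive (cong ∣_∣ (e (E x (suc n)) (term x (suc n)) (E y (suc n)) (term y (suc n)))))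
      (≤-trans (∣p+q∣≤∣p∣+∣q∣ (E x (suc n) - E y (suc n)) (term x (suc n) - term y (suc n)))
      (≤-trans (+-mono-≤ (go n) (term-lipschitz n hx hy)) (≤-reflexive (sym (*-distribˡ-+ ∣ x - y ∣ (E X n) (term X n))))))

  E-mono : ∀ {x} m k → 0ℚ ≤ x → E x m ≤ E x (k ℕ.+ m)
  E-mono m zero    h = ≤-refl
  E-mono {x} m (suc k) h = ≤-trans (E-mono m k h) (subst (_≤ E x (suc (k ℕ.+ m))) (+-identityʳ _) (+-monoʳ-≤ (E x (k ℕ.+ m)) (term-nonneg (k ℕ.+ m) h)))

  ∣E-E∣≤ : ∀ {x X} m k → ∣ x ∣ ≤ X → ∣ E x (k ℕ.+ m) - E x m ∣ ≤ E X (k ℕ.+ m) - E X m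
  ∣E-E∣≤ {x} {X} m zero    h = ≤-reflexive (trans (cong ∣_∣ (+-inverseʳ (E x m))) (sym (+-inverseʳ (E X m))))
  ∣E-E∣≤ {x} {X} m (suc k) h = begin
    ∣ E x (k ℕ.+ m) + term x (k ℕ.+ m) - E x m ∣          ≡⟨ cong ∣_∣ (e (E x (k ℕ.+ m)) (term x (k ℕ.+ m)) (E x m)) ⟩
    ∣ (E x (k ℕ.+ m) - E x m) + term x (k ℕ.+ m) ∣        ≤⟨ ∣p+q∣≤∣p∣+∣q∣ (E x (k ℕ.+ m) - E x m) (term x (k ℕ.+ m)) ⟩
    ∣ E x (k ℕ.+ m) - E x m ∣ + ∣ term x (k ℕ.+ m) ∣      ≤⟨ +-mono-≤ (∣E-E∣≤ m k h) (∣term∣≤ (k ℕ.+ m) h) ⟩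
    E X (k ℕ.+ m) - E X m + term X (k ℕ.+ m)              ≡⟨ sym (e (E X (k ℕ.+ m)) (term X (k ℕ.+ m)) (E X m)) ⟩
    E X (k ℕ.+ m) + term X (k ℕ.+ m) - E X m ∎
    where
    open ≤-Reasoning
    e : ∀ a b c → a + b - c ≡ a - c + b
    e = solve-∀ ℚ-ring

  -- Once i exceeds 2 X the terms at least halve, so the tail is at most twice its first term.
  term-halves : ∀ {X} i → 0ℚ ≤ X → (+ 2 / 1) * X ≤ ι (suc i) → (+ 2 / 1) * term X (suc i) ≤ term X i
  term-halves {X} i 0≤X h = *-cancel {c = ι (suc i)} (0<ι i) (begin
    (+ 2 / 1) * term X (suc i) * ι (suc i)    ≡⟨ e (term X (suc i)) (ι (suc i)) ⟩
    (+ 2 / 1) * (ι (suc i) * term X (suc i))  ≡⟨ cong ((+ 2 / 1) *_) (term-suc X i) ⟩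
    (+ 2 / 1) * (X * term X i)                ≡⟨ e′ X (term X i) ⟩
    term X i * ((+ 2 / 1) * X)                ≤⟨ *-monoˡ (term-nonneg i 0≤X) h ⟩
    term X i * ι (suc i) ∎)
    where
    open ≤-Reasoning
    e : ∀ t n → (+ 2 / 1) * t * n ≡ (+ 2 / 1) * (n * t)
    e = solve-∀ ℚ-ring
    e′ : ∀ x t → (+ 2 / 1) * (x * t) ≡ t * ((+ 2 / 1) * x)
    e′ = solve-∀ ℚ-ring

  E-shift : ∀ x i u → E x (suc u ℕ.+ i) ≡ E x (u ℕ.+ suc i)
  E-shift x i u = cong (E x) (sym (ℕ.+-suc u i))

  tail≤ : ∀ {X} u i → 0ℚ ≤ X → (+ 2 / 1) * X ≤ ι (suc i) → E X (u ℕ.+ i) - E X i ≤ (+ 2 / 1) * term X i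
  tail≤ {X} zero    i 0≤X h = ≤-trans (≤-reflexive (+-inverseʳ (E X i))) (nonNegative⁻¹ (+ 2 / 1) ⊛ term-nonneg i 0≤X)
  tail≤ {X} (suc u) i 0≤X h = begin
    E X (suc u ℕ.+ i) - E X i                       ≡⟨ trans (cong (_- E X i) (E-shift X i u)) (e (E X (u ℕ.+ suc i)) (E X i) (term X i)) ⟩
    E X (u ℕ.+ suc i) - E X (suc i) + term X i      ≤⟨ +-monoˡ-≤ (term X i) (tail≤ u (suc i) 0≤X (≤-trans h (ι-mono (ℕ.n≤1+n (suc i))))) ⟩
    (+ 2 / 1) * term X (suc i) + term X i           ≤⟨ +-monoˡ-≤ (term X i) (term-halves i 0≤X h) ⟩
    term X i + term X i                             ≡⟨ e′ (term X i) ⟩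
    (+ 2 / 1) * term X i ∎
    where
    open ≤-Reasoning
    e : ∀ a b c → a - b ≡ a - (b + c) + c
    e = solve-∀ ℚ-ring
    e′ : ∀ c → c + c ≡ (+ 2 / 1) * c
    e′ = solve-∀ ℚ-ring

  term-decay : ∀ {X} t i → 0ℚ ≤ X → (+ 2 / 1) * X ≤ ι (suc i) → term X (t ℕ.+ i) ≤ (1ℚ - ½) ^ t * term X i
  term-decay zero    i 0≤X h = ≤-reflexive (sym (*-identityˡ _))
  term-decay {X} (suc t) i 0≤X h = begin
    term X (suc t ℕ.+ i)             ≡⟨ e (term X (suc (t ℕ.+ i))) ⟩
    ½ * ((+ 2 / 1) * term X (suc (t ℕ.+ i)))  ≤⟨ *-monoˡ (nonNegative⁻¹ ½) (term-halves (t ℕ.+ i) 0≤X (≤-trans h (ι-mono (ℕ.s≤s (ℕ.m≤n+m i t))))) ⟩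
    ½ * term X (t ℕ.+ i)             ≤⟨ *-monoˡ (nonNegative⁻¹ ½) (term-decay t i 0≤X h) ⟩
    ½ * ((1ℚ - ½) ^ t * term X i)    ≡⟨ sym (*-assoc ½ ((1ℚ - ½) ^ t) (term X i)) ⟩
    (1ℚ - ½) ^ suc t * term X i ∎
    where
    open ≤-Reasoning
    e : ∀ a → a ≡ ½ * ((+ 2 / 1) * a)
    e = solve-∀ ℚ-ring

  -- From n₀ ≥ 2 X on the terms at least halve, so the tail is at most 2 · 2^(n₀ - i) K with K the
  -- term at n₀. Since K may vanish, 1 + K is inverted instead.
  E-tail : ∀ {X} → 0ℚ ≤ X → ∀ {δ} → 0ℚ < δ → ∃[ N ] (∀ i → N ℕ.≤ i → ∀ u → E X (u ℕ.+ i) - E X i ≤ δ)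
  E-tail {X} 0≤X {δ} 0<δ = T ℕ.+ n₀ , λ i N≤i u → begin
    E X (u ℕ.+ i) - E X i                 ≤⟨ tail≤ u i 0≤X (≤-trans hn₀ (ι-mono (ℕ.m≤n⇒m≤1+n (ℕ.≤-trans (ℕ.m≤n+m n₀ T) N≤i)))) ⟩
    (+ 2 / 1) * term X i                  ≡⟨ cong (λ z → (+ 2 / 1) * term X z) (sym (ℕ.m∸n+n≡m (ℕ.≤-trans (ℕ.m≤n+m n₀ T) N≤i))) ⟩
    (+ 2 / 1) * term X (i ℕ.∸ n₀ ℕ.+ n₀)  ≤⟨ *-monoˡ (nonNegative⁻¹ (+ 2 / 1)) (term-decay (i ℕ.∸ n₀) n₀ 0≤X (≤-trans hn₀ (ι-mono (ℕ.n≤1+n n₀)))) ⟩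
    (+ 2 / 1) * ((1ℚ - ½) ^ (i ℕ.∸ n₀) * K) ≤⟨ *-monoˡ (nonNegative⁻¹ (+ 2 / 1)) (*-monoʳ 0≤K (proj₂ van (i ℕ.∸ n₀) (subst (ℕ._≤ i ℕ.∸ n₀) (ℕ.m+n∸n≡m T n₀) (ℕ.∸-monoˡ-≤ n₀ N≤i)))) ⟩
    (+ 2 / 1) * (½ * δ * K⁺ * K)          ≤⟨ by-diff (δ * K⁺) (<⇒≤ (0<δ ⊛< 0<K⁺)) (e δ K⁺ K) ⟩
    δ * ((1ℚ + K) * K⁺)                   ≡⟨ trans (cong (δ *_) KK⁺) (*-identityʳ δ) ⟩
    δ ∎
    where
    open ≤-Reasoning
    open Inequalities using (archimedean)
    open EdgeReplacement using (inverse)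
    arch = archimedean ((+ 2 / 1) * X)
    n₀ = proj₁ arch
    hn₀ : (+ 2 / 1) * X ≤ ι n₀
    hn₀ = proj₂ arch
    K : ℚ
    K = term X n₀
    0≤K : 0ℚ ≤ K
    0≤K = term-nonneg n₀ 0≤X
    inv = inverse (0<1 ⊕< 0≤K)
    K⁺ : ℚ
    K⁺ = proj₁ inv
    0<K⁺ : 0ℚ < K⁺
    0<K⁺ = proj₁ (proj₂ inv)
    KK⁺ : (1ℚ + K) * K⁺ ≡ 1ℚ
    KK⁺ = proj₂ (proj₂ inv)
    van = vanishing {½} (positive⁻¹ ½) (<⇒≤ (*<* (ℤ.+<+ (ℕ.s≤s (ℕ.s≤s ℕ.z≤n))))) {½ * δ * K⁺} (positive⁻¹ ½ ⊛< 0<δ ⊛< 0<K⁺)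
    T = proj₁ van
    e : ∀ δ k K → δ * ((1ℚ + K) * k) - (+ 2 / 1) * (½ * δ * k * K) ≡ δ * k
    e = solve-∀ ℚ-ring

  1+x≤E : ∀ {x} n → 0ℚ ≤ x → 1ℚ + x ≤ E x (n ℕ.+ 2)
  1+x≤E {x} n h = ≤-trans (≤-reflexive (sym two)) (E-mono 2 n h)
    where
    term-1 : term x 1 ≡ x
    term-1 = trans (sym (*-identityˡ _)) (trans (cong (_* term x 1) (sym ι-1)) (trans (term-suc x 0) (trans (cong (x *_) (term-0 x)) (*-identityʳ x))))
    two : E x 2 ≡ 1ℚ + x
    two = trans (cong₂ (λ a b → 0ℚ + a + b) (term-0 x) term-1) (cong (_+ x) (+-identityˡ 1ℚ))

  1/!≤1 : ∀ n → 1/! n ≤ 1ℚ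
  1/!≤1 zero    = ≤-reflexive 1/!-0
  1/!≤1 (suc n) = ≤-trans (subst (_≤ ι (suc n) * 1/! (suc n)) (*-identityˡ _) (*-monoʳ (1/!-nonneg (suc n)) (subst (_≤ ι (suc n)) ι-1 (ι-mono (ℕ.s≤s ℕ.z≤n)))))
    (≤-trans (≤-reflexive (1/!-suc n)) (1/!≤1 n))

  -- 1/n! ≤ 1 compares with the geometric series; in the limit exp h (1 - h) ≤ 1.
  E≤geometric : ∀ {h} n → 0ℚ ≤ h → h ≤ 1ℚ → E h n * (1ℚ - h) ≤ 1ℚ - h ^ n
  E≤geometric {h} zero    0≤h h≤1 = ≤-reflexive (trans (*-zeroˡ (1ℚ - h)) (sym (+-inverseʳ 1ℚ)))
  E≤geometric {h} (suc n) 0≤h h≤1 = begin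
    (E h n + term h n) * (1ℚ - h)               ≡⟨ *-distribʳ-+ (1ℚ - h) (E h n) (term h n) ⟩
    E h n * (1ℚ - h) + term h n * (1ℚ - h)      ≤⟨ +-mono-≤ (E≤geometric n 0≤h h≤1) (*-monoʳ (sub⁺ h≤1) (≤-trans (*-monoʳ (0≤^ n 0≤h) (1/!≤1 n)) (≤-reflexive (*-identityˡ (h ^ n))))) ⟩
    1ℚ - h ^ n + h ^ n * (1ℚ - h)               ≡⟨ e h (h ^ n) ⟩
    1ℚ - h * h ^ n ∎
    where
    open ≤-Reasoning
    e : ∀ h p → 1ℚ - p + p * (1ℚ - h) ≡ 1ℚ - h * p
    e = solve-∀ ℚ-ring

-- The addition formula through Cauchy products

module PartialSumsAddition where
  open Rationals
  open PartialSums
  open import Data.Integer.Base using (+_)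
  open import Data.Rational
  open import Data.Rational.Properties
  open import Function.Base using (_∘_)

  Seq : Set
  Seq = ℕ → ℚ

  sum : Seq → ℕ → ℚ
  sum f zero    = 0ℚ
  sum f (suc n) = f 0 + sum (f ∘ suc) n

  conv : Seq → Seq → Seq
  conv f g zero    = f 0 * g 0
  conv f g (suc n) = f 0 * g (suc n) + conv (f ∘ suc) g n

  derivative : Seq → Seq
  derivative f i = ι (suc i) * f (suc i)

  sum-cong : ∀ {f g} → (∀ i → f i ≡ g i) → ∀ n → sum f n ≡ sum g n
  sum-cong h zero    = refl
  sum-cong h (suc n) = cong₂ _+_ (h 0) (sum-cong (h ∘ suc) n)

  sum-linear : ∀ c f g n → sum (λ i → c * f i + g i) n ≡ c * sum f n + sum g n
  sum-linear c f g zero    = sym (trans (+-identityʳ (c * 0ℚ)) (*-zeroʳ c))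
  sum-linear c f g (suc n) = trans (cong (_+_ (c * f 0 + g 0)) (sum-linear c (f ∘ suc) (g ∘ suc) n)) (e c (f 0) (g 0) (sum (f ∘ suc) n) (sum (g ∘ suc) n))
    where e : ∀ c a b s t → c * a + b + (c * s + t) ≡ c * (a + s) + (b + t)
          e = solve-∀ ℚ-ring

  sum-last : ∀ f n → sum f (suc n) ≡ sum f n + f n
  sum-last f zero    = +-comm (f 0) 0ℚ
  sum-last f (suc n) = trans (cong (_+_ (f 0)) (sum-last (f ∘ suc) n)) (sym (+-assoc (f 0) (sum (f ∘ suc) n) (f (suc n))))

  sum-term : ∀ x n → sum (term x) n ≡ E x n
  sum-term x zero    = refl
  sum-term x (suc n) = trans (sum-last (term x) n) (cong (_+ term x n) (sum-term x n))

  conv-cong : ∀ {f f′ g g′} → (∀ i → f i ≡ f′ i) → (∀ i → g i ≡ g′ i) → ∀ n → conv f g n ≡ conv f′ g′ n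
  conv-cong h k zero    = cong₂ _*_ (h 0) (k 0)
  conv-cong h k (suc n) = cong₂ _+_ (cong₂ _*_ (h 0) (k (suc n))) (conv-cong (h ∘ suc) k n)

  conv-+ˡ : ∀ f f′ g n → conv (λ i → f i + f′ i) g n ≡ conv f g n + conv f′ g n
  conv-+ˡ f f′ g zero    = *-distribʳ-+ (g 0) (f 0) (f′ 0)
  conv-+ˡ f f′ g (suc n) = trans (cong (_+_ ((f 0 + f′ 0) * g (suc n))) (conv-+ˡ (f ∘ suc) (f′ ∘ suc) g n)) (e (f 0) (f′ 0) (g (suc n)) (conv (f ∘ suc) g n) (conv (f′ ∘ suc) g n))
    where e : ∀ a b c d e → (a + b) * c + (d + e) ≡ a * c + d + (b * c + e)
          e = solve-∀ ℚ-ring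

  conv-*ˡ : ∀ c f g n → conv (λ i → c * f i) g n ≡ c * conv f g n
  conv-*ˡ c f g zero    = *-assoc c (f 0) (g 0)
  conv-*ˡ c f g (suc n) = trans (cong (_+_ (c * f 0 * g (suc n))) (conv-*ˡ c (f ∘ suc) g n)) (e c (f 0) (g (suc n)) (conv (f ∘ suc) g n))
    where e : ∀ c a b d → c * a * b + c * d ≡ c * (a * b + d)
          e = solve-∀ ℚ-ring

  conv-*ʳ : ∀ c f g n → conv f (λ i → c * g i) n ≡ c * conv f g n
  conv-*ʳ c f g zero    = e c (f 0) (g 0)
    where e : ∀ c a b → a * (c * b) ≡ c * (a * b)
          e = solve-∀ ℚ-ring
  conv-*ʳ c f g (suc n) = trans (cong (_+_ (f 0 * (c * g (suc n)))) (conv-*ʳ c (f ∘ suc) g n)) (e c (f 0) (g (suc n)) (conv (f ∘ suc) g n))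
    where e : ∀ c a b d → a * (c * b) + c * d ≡ c * (a * b + d)
          e = solve-∀ ℚ-ring

  -- The product rule for formal power series. In the induction one unit of the factor n + 2
  -- supplies the summands missing in the derivative of the shifted `f`.
  leibniz : ∀ f g n → ι (suc n) * conv f g (suc n) ≡ conv (derivative f) g n + conv f (derivative g) n
  leibniz f g zero = trans (cong (_* (f 0 * g 1 + f 1 * g 0)) ι-1) (trans (e (f 0) (g 1) (f 1) (g 0)) (cong₂ (λ a b → a * f 1 * g 0 + f 0 * (b * g 1)) (sym ι-1) (sym ι-1)))
    where e : ∀ a b c d → 1ℚ * (a * b + c * d) ≡ 1ℚ * c * d + a * (1ℚ * b)
          e = solve-∀ ℚ-ring
  leibniz f g (suc m) = begin
    ι (suc (suc m)) * (f 0 * g (suc (suc m)) + A)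
      ≡⟨ e₁ (ι (suc (suc m))) (f 0) (g (suc (suc m))) A ⟩
    f 0 * (ι (suc (suc m)) * g (suc (suc m))) + ι (suc (suc m)) * A
      ≡⟨ cong (λ z → f 0 * (ι (suc (suc m)) * g (suc (suc m))) + z * A) (ι-suc (suc m)) ⟩
    f 0 * (ι (suc (suc m)) * g (suc (suc m))) + (1ℚ + ι (suc m)) * A
      ≡⟨ trans (cong (_+_ (f 0 * (ι (suc (suc m)) * g (suc (suc m))))) (trans (*-distribʳ-+ A 1ℚ (ι (suc m))) (cong₂ _+_ (*-identityˡ A) (leibniz (f ∘ suc) g m)))) (e₂ (f 0 * (ι (suc (suc m)) * g (suc (suc m)))) (f 1 * g (suc m)) (conv (f ∘ suc ∘ suc) g m) (conv (derivative (f ∘ suc)) g m) (conv (f ∘ suc) (derivative g) m)) ⟩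
    f 1 * g (suc m) + (conv (f ∘ suc ∘ suc) g m + conv (derivative (f ∘ suc)) g m) + (f 0 * (ι (suc (suc m)) * g (suc (suc m))) + conv (f ∘ suc) (derivative g) m)
      ≡⟨ cong (_+ (f 0 * (ι (suc (suc m)) * g (suc (suc m))) + conv (f ∘ suc) (derivative g) m)) (cong₂ _+_ (cong (_* g (suc m)) (sym (trans (cong (_* f 1) ι-1) (*-identityˡ (f 1)))))
           (trans (sym (conv-+ˡ (f ∘ suc ∘ suc) (derivative (f ∘ suc)) g m)) (conv-cong (λ i → trans (e₃ (f (suc (suc i))) (ι (suc i))) (cong (_* f (suc (suc i))) (sym (ι-suc (suc i))))) (λ _ → refl) m))) ⟩
    conv (derivative f) g (suc m) + conv f (derivative g) (suc m) ∎
    where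
    open ≡-Reasoning
    A = conv (f ∘ suc) g (suc m)
    e₁ : ∀ n a b c → n * (a * b + c) ≡ a * (n * b) + n * c
    e₁ = solve-∀ ℚ-ring
    e₂ : ∀ p q r s t → p + (q + r + (s + t)) ≡ q + (r + s) + (p + t)
    e₂ = solve-∀ ℚ-ring
    e₃ : ∀ a n → a + n * a ≡ (1ℚ + n) * a
    e₃ = solve-∀ ℚ-ring

  -- The binomial theorem without binomial coefficients: by `leibniz` and `term-suc` both sides
  -- satisfy (n + 1) c (n + 1) = (x + y) c n.
  conv-term : ∀ x y n → conv (term x) (term y) n ≡ term (x + y) n
  conv-term x y zero    = trans (cong₂ _*_ (term-0 x) (term-0 y)) (sym (term-0 (x + y)))
  conv-term x y (suc n) = *-cancelˡ-≡ (begin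
    ι (suc n) * conv (term x) (term y) (suc n)  ≡⟨ leibniz (term x) (term y) n ⟩
    conv (derivative (term x)) (term y) n + conv (term x) (derivative (term y)) n
      ≡⟨ cong₂ _+_ (trans (conv-cong (term-suc x) (λ _ → refl) n) (conv-*ˡ x (term x) (term y) n)) (trans (conv-cong (λ _ → refl) (term-suc y) n) (conv-*ʳ y (term x) (term y) n)) ⟩
    x * conv (term x) (term y) n + y * conv (term x) (term y) n   ≡⟨ trans (sym (*-distribʳ-+ _ x y)) (cong ((x + y) *_) (conv-term x y n)) ⟩
    (x + y) * term (x + y) n      ≡⟨ sym (term-suc (x + y) n) ⟩
    ι (suc n) * term (x + y) (suc n) ∎)
    where
    open ≡-Reasoning
    *-cancelˡ-≡ : ∀ {a b} → ι (suc n) * a ≡ ι (suc n) * b → a ≡ b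
    *-cancelˡ-≡ {a} {b} h = ≤-antisym (*-cancel (0<ι n) (≤-reflexive (trans (*-comm a _) (trans h (*-comm _ b))))) (*-cancel (0<ι n) (≤-reflexive (trans (*-comm b _) (trans (sym h) (*-comm _ a)))))

  -- The sum of f i * g j over i + j < n, arranged by antidiagonals.
  triangle : Seq → Seq → ℕ → ℚ
  triangle f g = sum (conv f g)

  triangle-suc : ∀ f g n → triangle f g (suc n) ≡ f 0 * sum g (suc n) + triangle (f ∘ suc) g n
  triangle-suc f g n = trans (cong (_+_ (f 0 * g 0)) (sum-linear (f 0) (g ∘ suc) (conv (f ∘ suc) g) n)) (e (f 0) (g 0) (sum (g ∘ suc) n) (sum (conv (f ∘ suc) g) n))
    where e : ∀ a b s t → a * b + (a * s + t) ≡ a * (b + s) + t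
          e = solve-∀ ℚ-ring

  triangle-term : ∀ x y n → triangle (term x) (term y) n ≡ E (x + y) n
  triangle-term x y n = trans (sum-cong (conv-term x y) n) (sum-term (x + y) n)

  sum-nonneg : ∀ {f} → (∀ i → 0ℚ ≤ f i) → ∀ n → 0ℚ ≤ sum f n
  sum-nonneg h zero    = ≤-refl
  sum-nonneg h (suc n) = h 0 ⊕ sum-nonneg (h ∘ suc) n

  sum-tail : ∀ {f F} → (∀ i → ∣ f i ∣ ≤ F i) → ∀ m k → ∣ sum f (k ℕ.+ m) - sum f m ∣ ≤ sum F (k ℕ.+ m) - sum F m
  sum-tail {f} {F} h m zero    = ≤-reflexive (trans (cong ∣_∣ (+-inverseʳ (sum f m))) (sym (+-inverseʳ (sum F m))))
  sum-tail {f} {F} h m (suc k) = begin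
    ∣ sum f (suc k ℕ.+ m) - sum f m ∣                          ≡⟨ cong ∣_∣ (trans (cong (_- sum f m) (sum-last f (k ℕ.+ m))) (e (sum f (k ℕ.+ m)) (f (k ℕ.+ m)) (sum f m))) ⟩
    ∣ (sum f (k ℕ.+ m) - sum f m) + f (k ℕ.+ m) ∣              ≤⟨ ∣p+q∣≤∣p∣+∣q∣ (sum f (k ℕ.+ m) - sum f m) (f (k ℕ.+ m)) ⟩
    ∣ sum f (k ℕ.+ m) - sum f m ∣ + ∣ f (k ℕ.+ m) ∣            ≤⟨ +-mono-≤ (sum-tail h m k) (h (k ℕ.+ m)) ⟩
    sum F (k ℕ.+ m) - sum F m + F (k ℕ.+ m)                    ≡⟨ sym (trans (cong (_- sum F m) (sum-last F (k ℕ.+ m))) (e (sum F (k ℕ.+ m)) (F (k ℕ.+ m)) (sum F m))) ⟩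
    sum F (suc k ℕ.+ m) - sum F m ∎
    where
    open ≤-Reasoning
    e : ∀ a b c → a + b - c ≡ a - c + b
    e = solve-∀ ℚ-ring

  -- The difference sums f i * g j over the part of a rectangle outside the triangle, so it is
  -- bounded termwise. The rectangle is wider than the triangle by k because removing a row shortens
  -- the triangle but not the other rows.
  square-triangle : ∀ {f g F G} → (∀ i → ∣ f i ∣ ≤ F i) → (∀ i → ∣ g i ∣ ≤ G i) → ∀ n k →
    ∣ sum f n * sum g (k ℕ.+ n) - triangle f g n ∣ ≤ sum F n * sum G (k ℕ.+ n) - triangle F G n
  square-triangle {f} {g} {F} {G} hf hg zero k = ≤-reflexive (trans (cong ∣_∣ (e (sum g (k ℕ.+ 0)))) (sym (e (sum G (k ℕ.+ 0)))))
    where e : ∀ a → 0ℚ * a - 0ℚ ≡ 0ℚ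
          e = solve-∀ ℚ-ring
  square-triangle {f} {g} {F} {G} hf hg (suc n) k = begin
    ∣ (f 0 + sum (f ∘ suc) n) * sum g m - triangle f g (suc n) ∣
      ≡⟨ cong ∣_∣ (trans (cong (λ z → (f 0 + sum (f ∘ suc) n) * sum g m - z) (triangle-suc f g n)) (e (f 0) (sum (f ∘ suc) n) (sum g m) (sum g (suc n)) (triangle (f ∘ suc) g n))) ⟩
    ∣ f 0 * (sum g m - sum g (suc n)) + (sum (f ∘ suc) n * sum g m - triangle (f ∘ suc) g n) ∣
      ≤⟨ ∣p+q∣≤∣p∣+∣q∣ (f 0 * (sum g m - sum g (suc n))) (sum (f ∘ suc) n * sum g m - triangle (f ∘ suc) g n) ⟩
    ∣ f 0 * (sum g m - sum g (suc n)) ∣ + ∣ sum (f ∘ suc) n * sum g m - triangle (f ∘ suc) g n ∣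
      ≤⟨ +-mono-≤ (≤-trans (≤-reflexive (∣p*q∣≡∣p∣*∣q∣ (f 0) (sum g m - sum g (suc n)))) (*-mono (0≤∣p∣ (f 0)) (0≤∣p∣ (sum g m - sum g (suc n))) (hf 0) (sum-tail hg (suc n) k)))
           (subst (λ j → ∣ sum (f ∘ suc) n * sum g j - triangle (f ∘ suc) g n ∣ ≤ sum (F ∘ suc) n * sum G j - triangle (F ∘ suc) G n) (sym (ℕ.+-suc k n)) (square-triangle (hf ∘ suc) hg n (suc k))) ⟩
    F 0 * (sum G m - sum G (suc n)) + (sum (F ∘ suc) n * sum G m - triangle (F ∘ suc) G n)
      ≡⟨ sym (trans (cong (λ z → (F 0 + sum (F ∘ suc) n) * sum G m - z) (triangle-suc F G n)) (e (F 0) (sum (F ∘ suc) n) (sum G m) (sum G (suc n)) (triangle (F ∘ suc) G n))) ⟩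
    (F 0 + sum (F ∘ suc) n) * sum G m - triangle F G (suc n) ∎
    where
    open ≤-Reasoning
    m = k ℕ.+ suc n
    e : ∀ a s t u v → (a + s) * t - (a * u + v) ≡ a * (t - u) + (s * t - v)
    e = solve-∀ ℚ-ring

  sum-monotone : ∀ {f} → (∀ i → 0ℚ ≤ f i) → ∀ k m → sum f m ≤ sum f (k ℕ.+ m)
  sum-monotone {f} h zero    m = ≤-refl
  sum-monotone {f} h (suc k) m = ≤-trans (sum-monotone h k m) (subst₂ _≤_ (+-identityʳ _) (sym (sum-last f (k ℕ.+ m))) (+-monoʳ-≤ (sum f (k ℕ.+ m)) (h (k ℕ.+ m))))

  -- i < n and j < m give i + j < n + m.
  square≤triangle : ∀ {F G} → (∀ i → 0ℚ ≤ F i) → (∀ i → 0ℚ ≤ G i) → ∀ n m → sum F n * sum G m ≤ triangle F G (n ℕ.+ m)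
  square≤triangle {F} {G} hF hG zero    m = ≤-trans (≤-reflexive (*-zeroˡ (sum G m))) (sum-nonneg (conv-nonneg hF) m)
    where conv-nonneg : ∀ {F} → (∀ i → 0ℚ ≤ F i) → ∀ i → 0ℚ ≤ conv F G i
          conv-nonneg h zero    = h 0 ⊛ hG 0
          conv-nonneg h (suc i) = h 0 ⊛ hG (suc i) ⊕ conv-nonneg (h ∘ suc) i
  square≤triangle {F} {G} hF hG (suc n) m = begin
    (F 0 + sum (F ∘ suc) n) * sum G m             ≡⟨ *-distribʳ-+ (sum G m) (F 0) (sum (F ∘ suc) n) ⟩
    F 0 * sum G m + sum (F ∘ suc) n * sum G m     ≤⟨ +-mono-≤ (*-monoˡ (hF 0) (sum-monotone hG (suc n) m)) (square≤triangle (hF ∘ suc) hG n m) ⟩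
    F 0 * sum G (suc n ℕ.+ m) + triangle (F ∘ suc) G (n ℕ.+ m)  ≡⟨ sym (triangle-suc F G (n ℕ.+ m)) ⟩
    triangle F G (suc n ℕ.+ m) ∎
    where open ≤-Reasoning

  -- The error is at most what the square has beyond the triangle at X and Y; the triangle of twice
  -- the size contains that square, which leaves a tail of the series at X + Y.
  E-add : ∀ {x y X Y} n → ∣ x ∣ ≤ X → ∣ y ∣ ≤ Y → ∣ E x n * E y n - E (x + y) n ∣ ≤ E (X + Y) (n ℕ.+ n) - E (X + Y) n
  E-add {x} {y} {X} {Y} n hx hy = begin
    ∣ E x n * E y n - E (x + y) n ∣
      ≡⟨ cong₂ (λ a b → ∣ a - b ∣) (cong₂ _*_ (sym (sum-term x n)) (sym (sum-term y n))) (sym (triangle-term x y n)) ⟩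
    ∣ sum (term x) n * sum (term y) n - triangle (term x) (term y) n ∣
      ≤⟨ square-triangle (λ i → ∣term∣≤ i hx) (λ i → ∣term∣≤ i hy) n 0 ⟩
    sum (term X) n * sum (term Y) n - triangle (term X) (term Y) n
      ≤⟨ +-monoˡ-≤ (- triangle (term X) (term Y) n) (square≤triangle (λ i → term-nonneg i (≤-trans (0≤∣p∣ x) hx)) (λ i → term-nonneg i (≤-trans (0≤∣p∣ y) hy)) n n) ⟩
    triangle (term X) (term Y) (n ℕ.+ n) - triangle (term X) (term Y) n
      ≡⟨ cong₂ _-_ (triangle-term X Y (n ℕ.+ n)) (triangle-term X Y n) ⟩
    E (X + Y) (n ℕ.+ n) - E (X + Y) n ∎
    where open ≤-Reasoning

-- Order and arithmetic of Cauchy reals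

module RealOrder where
  open Rationals
  open PartialSums using (∣∣≤; x≤∣x∣; -x≤∣x∣)
  open EdgeReplacement using (inverse)
  open import Defs using (ℝ; seq; cauchy; fromℚ; 0ℝ; 1ℝ) renaming (_≃_ to _≃ʳ_; _+_ to _+ʳ_; _*_ to _*ʳ_; -_ to -ʳ_; _-_ to _-ʳ_; _<_ to _<ʳ_; _≤_ to _≤ʳ_; _^_ to _^ʳ_)
  open import Data.Integer.Base using (+_)
  open import Data.Rational
  open import Data.Rational.Properties
  open import Relation.Binary.Definitions using (tri<; tri≈; tri>)

  Eventually : (ℕ → Set) → Set
  Eventually P = ∃[ N ] ∀ n → N ℕ.≤ n → P n

  infixr 4 _⊓ᵉ_
  _⊓ᵉ_ : ∀ {P Q} → Eventually P → Eventually Q → Eventually λ n → P n × Q n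
  (M , p) ⊓ᵉ (N , q) = M ℕ.⊔ N , λ n h → p n (ℕ.m⊔n≤o⇒m≤o M N h) , q n (ℕ.m⊔n≤o⇒n≤o M N h)

  mapᵉ : ∀ {P Q : ℕ → Set} → (∀ {n} → P n → Q n) → Eventually P → Eventually Q
  mapᵉ f (N , p) = N , λ n h → f (p n h)

  alwaysᵉ : ∀ {P : ℕ → Set} → (∀ n → P n) → Eventually P
  alwaysᵉ p = 0 , λ n _ → p n

  someᵉ : ∀ {P : ℕ → Set} {A : Set} → Eventually P → (∀ {n} → P n → A) → A
  someᵉ (N , p) f = f (p N ℕ.≤-refl)

  0<½* : ∀ {δ} → 0ℚ < δ → 0ℚ < ½ * δ
  0<½* h = positive⁻¹ ½ ⊛< h

  halves : ∀ δ → ½ * δ + ½ * δ ≡ δ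
  halves = solve-∀ ℚ-ring

  -- A positively formulated equivalent of ≤.
  infix 4 _⊑_ _≈_ _≐_
  _⊑_ : ℝ → ℝ → Set
  x ⊑ y = ∀ δ → 0ℚ < δ → Eventually λ n → seq x n ≤ seq y n + δ

  record _≈_ (x y : ℝ) : Set where
    constructor mk≈
    field below : x ⊑ y
          above : y ⊑ x
  open _≈_ public

  _≐_ : ℝ → ℝ → Set
  x ≐ y = ∀ n → seq x n ≡ seq y n

  ≤+ : ∀ {a δ} → 0ℚ ≤ δ → a ≤ a + δ
  ≤+ {a} {δ} h = subst (_≤ a + δ) (+-identityʳ a) (+-monoʳ-≤ a h)

  ⊑-refl : ∀ {x} → x ⊑ x
  ⊑-refl δ 0<δ = alwaysᵉ λ n → ≤+ (<⇒≤ 0<δ)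

  ⊑-trans : ∀ {x y z} → x ⊑ y → y ⊑ z → x ⊑ z
  ⊑-trans {x} {y} {z} p q δ 0<δ = mapᵉ
    (λ {n} (a , b) → ≤-trans a (≤-trans (+-monoˡ-≤ (½ * δ) b) (≤-reflexive (trans (+-assoc (seq z n) (½ * δ) (½ * δ)) (cong (_+_ (seq z n)) (halves δ))))))
    (p (½ * δ) (0<½* 0<δ) ⊓ᵉ q (½ * δ) (0<½* 0<δ))

  ≐⇒≈ : ∀ {x y} → x ≐ y → x ≈ y
  ≐⇒≈ {x} {y} h = mk≈ (λ δ 0<δ → alwaysᵉ λ n → subst (λ z → z ≤ seq y n + δ) (sym (h n)) (≤+ (<⇒≤ 0<δ))) (λ δ 0<δ → alwaysᵉ λ n → subst (λ z → z ≤ seq x n + δ) (h n) (≤+ (<⇒≤ 0<δ)))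

  ≈-refl : ∀ {x} → x ≈ x
  ≈-refl {x} = mk≈ (⊑-refl {x}) (⊑-refl {x})

  ≈-sym : ∀ {x y} → x ≈ y → y ≈ x
  ≈-sym (mk≈ p q) = mk≈ q p

  ≈-trans : ∀ {x y z} → x ≈ y → y ≈ z → x ≈ z
  ≈-trans {x} {y} {z} (mk≈ p q) (mk≈ p′ q′) = mk≈ (⊑-trans {x} {y} {z} p p′) (⊑-trans {z} {y} {x} q′ q)

  ⊑⇒≤ : ∀ {x y} → x ⊑ y → x ≤ʳ y
  ⊑⇒≤ {x} {y} h (δ , 0<δ , e) = someᵉ (e ⊓ᵉ h (½ * δ) (0<½* 0<δ)) λ {n} (a , b) →
    <-irrefl refl (≤-<-trans (≤-trans a b) (+-monoʳ-< (seq y n) (by-diff< (½ * δ) (0<½* 0<δ) (r δ))))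
    where r : ∀ δ → δ - ½ * δ ≡ ½ * δ
          r = solve-∀ ℚ-ring

  ∣-∣-sym : ∀ a b → ∣ a - b ∣ ≡ ∣ b - a ∣
  ∣-∣-sym a b = trans (sym (∣-p∣≡∣p∣ (a - b))) (cong ∣_∣ (e a b))
    where e : ∀ a b → - (a - b) ≡ b - a
          e = solve-∀ ℚ-ring

  close : ∀ {a b δ} → ∣ a - b ∣ < δ → a ≤ b + δ
  close {a} {b} {δ} h = by-diff (δ - (a - b)) (sub⁺ (≤-trans (x≤∣x∣ (a - b)) (<⇒≤ h))) (e a b δ)
    where e : ∀ a b δ → b + δ - a ≡ δ - (a - b)
          e = solve-∀ ℚ-ring

  near : ∀ x {ε} → 0ℚ < ε → ∃[ N ] (∀ n m → N ℕ.≤ n → N ℕ.≤ m → seq x n ≤ seq x m + ε)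
  near x {ε} 0<ε = proj₁ (cauchy x ε 0<ε) , λ n m hn hm → close {seq x n} {seq x m} (proj₂ (cauchy x ε 0<ε) n m hn hm)

  -- Rational comparisons are decidable. A failure by δ at an index where both sequences have
  -- settled within δ/4 would persist with gap δ/4 and prove y < x, which the hypothesis refutes.
  ≤⇒⊑ : ∀ {x y} → x ≤ʳ y → x ⊑ y
  ≤⇒⊑ {x} {y} h δ 0<δ = decide (≤-total (seq x K) (seq y K + ½ * δ))
    where
    0<δ/4 : 0ℚ < (+ 1 / 4) * δ
    0<δ/4 = positive⁻¹ (+ 1 / 4) ⊛< 0<δ
    M N K : ℕ
    M = proj₁ (near x 0<δ/4)
    N = proj₁ (near y 0<δ/4)
    K = M ℕ.⊔ N
    px : ∀ n m → K ℕ.≤ n → K ℕ.≤ m → seq x n ≤ seq x m + (+ 1 / 4) * δ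
    px n m hn hm = proj₂ (near x 0<δ/4) n m (ℕ.m⊔n≤o⇒m≤o M N hn) (ℕ.m⊔n≤o⇒m≤o M N hm)
    py : ∀ n m → K ℕ.≤ n → K ℕ.≤ m → seq y n ≤ seq y m + (+ 1 / 4) * δ
    py n m hn hm = proj₂ (near y 0<δ/4) n m (ℕ.m⊔n≤o⇒n≤o M N hn) (ℕ.m⊔n≤o⇒n≤o M N hm)
    e₁ : ∀ y δ → y + (+ 1 / 4) * δ + ½ * δ + (+ 1 / 4) * δ ≡ y + δ
    e₁ = solve-∀ ℚ-ring
    e₂ : ∀ a b c d δ → a - (b + (+ 1 / 4) * δ) - (c - (d + δ)) ≡ a + (+ 1 / 4) * δ - c + (d + (+ 1 / 4) * δ - b) + (+ 1 / 4) * δ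
    e₂ = solve-∀ ℚ-ring
    small : ∀ n → K ℕ.≤ n → seq x n ≤ seq y n + δ ⊎ seq y n + δ ≤ seq x n → seq x n ≤ seq y n + δ
    small n hn (inj₁ l) = l
    small n hn (inj₂ l) = contradiction ((+ 1 / 4) * δ , 0<δ/4 , K , λ m hm → sub⁻ (≤-trans (sub⁺ l)
      (by-diff (seq x m + (+ 1 / 4) * δ - seq x n + (seq y n + (+ 1 / 4) * δ - seq y m) + (+ 1 / 4) * δ)
        (sub⁺ (px n m hn hm) ⊕ sub⁺ (py m n hm hn) ⊕ <⇒≤ 0<δ/4) (e₂ (seq x m) (seq y m) (seq x n) (seq y n) δ)))) h
    decide : seq x K ≤ seq y K + ½ * δ ⊎ seq y K + ½ * δ ≤ seq x K → Eventually λ n → seq x n ≤ seq y n + δ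
    decide (inj₁ l) = K , λ n hn → ≤-trans (px n K hn ℕ.≤-refl) (≤-trans (+-monoˡ-≤ ((+ 1 / 4) * δ) (≤-trans l (+-monoˡ-≤ (½ * δ) (py K n ℕ.≤-refl hn)))) (≤-reflexive (e₁ (seq y n) δ)))
    decide (inj₂ l) = K , λ n hn → small n hn (≤-total (seq x n) (seq y n + δ))

  ≈⇒≃ : ∀ {x y} → x ≈ y → x ≃ʳ y
  ≈⇒≃ {x} {y} (mk≈ p q) = ⊑⇒≤ {x} {y} p , ⊑⇒≤ {y} {x} q

  ≃⇒≈ : ∀ {x y} → x ≃ʳ y → x ≈ y
  ≃⇒≈ {x} {y} (p , q) = mk≈ (≤⇒⊑ {x} {y} p) (≤⇒⊑ {y} {x} q)

  ⊑-+ : ∀ {x y x′ y′} → x ⊑ y → x′ ⊑ y′ → x +ʳ x′ ⊑ y +ʳ y′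
  ⊑-+ {x} {y} {x′} {y′} p q δ 0<δ = mapᵉ (λ {n} (a , b) → ≤-trans (+-mono-≤ a b) (≤-reflexive (e (seq y n) (seq y′ n) δ))) (p (½ * δ) (0<½* 0<δ) ⊓ᵉ q (½ * δ) (0<½* 0<δ))
    where e : ∀ a b δ → a + ½ * δ + (b + ½ * δ) ≡ a + b + δ
          e = solve-∀ ℚ-ring

  ⊑-neg : ∀ {x y} → x ⊑ y → -ʳ y ⊑ -ʳ x
  ⊑-neg {x} {y} p δ 0<δ = mapᵉ (λ {n} a → by-diff (seq y n + δ - seq x n) (sub⁺ a) (e (seq x n) (seq y n) δ)) (p δ 0<δ)
    where e : ∀ a b δ → - a + δ - - b ≡ b + δ - a
          e = solve-∀ ℚ-ring

  ≈-+ : ∀ {x y x′ y′} → x ≈ y → x′ ≈ y′ → x +ʳ x′ ≈ y +ʳ y′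
  ≈-+ {x} {y} {x′} {y′} (mk≈ p q) (mk≈ p′ q′) = mk≈ (⊑-+ {x} {y} {x′} {y′} p p′) (⊑-+ {y} {x} {y′} {x′} q q′)

  ≈-neg : ∀ {x y} → x ≈ y → -ʳ x ≈ -ʳ y
  ≈-neg {x} {y} (mk≈ p q) = mk≈ (⊑-neg {y} {x} q) (⊑-neg {x} {y} p)

  bounded : ∀ x → ∃[ B ] (1ℚ ≤ B × Eventually λ n → ∣ seq x n ∣ ≤ B)
  bounded x = 1ℚ + ∣ seq x N ∣ , ≤+ (0≤∣p∣ (seq x N)) , N , λ n hn →
    ≤-trans (≤-reflexive (cong ∣_∣ (e (seq x n) (seq x N)))) (≤-trans (∣p+q∣≤∣p∣+∣q∣ (seq x n - seq x N) (seq x N)) (+-monoˡ-≤ ∣ seq x N ∣ (<⇒≤ (proj₂ (cauchy x 1ℚ 0<1) n N hn ℕ.≤-refl))))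
    where
    N : ℕ
    N = proj₁ (cauchy x 1ℚ 0<1)
    e : ∀ a b → a ≡ a - b + b
    e = solve-∀ ℚ-ring

  -- u ≥ -ε and z ≥ -ε give u z ≥ -ε (u + z + ε), from (u + ε)(z + ε) ≥ 0.
  0⊑* : ∀ {x y} → 0ℝ ⊑ x → 0ℝ ⊑ y → 0ℝ ⊑ x *ʳ y
  0⊑* {x} {y} p q δ 0<δ = mapᵉ (λ {n} (a , b , c , d) → step {seq x n} {seq y n} a b (≤-trans (x≤∣x∣ (seq x n)) c) (≤-trans (x≤∣x∣ (seq y n)) d)) (p ε 0<ε ⊓ᵉ q ε 0<ε ⊓ᵉ proj₂ (proj₂ bx) ⊓ᵉ proj₂ (proj₂ by))
    where
    bx = bounded x
    by = bounded y
    A B D : ℚ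
    A = proj₁ bx
    B = proj₁ by
    D = A + B + δ
    1≤A = proj₁ (proj₂ bx)
    1≤B = proj₁ (proj₂ by)
    0<D : 0ℚ < D
    0<D = <-≤-trans (<-≤-trans 0<1 1≤A) (≤-trans (≤+ (≤-trans 0≤1 1≤B)) (≤+ (<⇒≤ 0<δ)))
    inv = inverse 0<D
    ε : ℚ
    ε = δ * proj₁ inv
    0<ε : 0ℚ < ε
    0<ε = 0<δ ⊛< proj₁ (proj₂ inv)
    εD : ε * D ≡ δ
    εD = trans (*-assoc δ _ D) (trans (cong (δ *_) (trans (*-comm _ D) (proj₂ (proj₂ inv)))) (*-identityʳ δ))
    ε≤δ : ε ≤ δ
    ε≤δ = ≤-trans (≤-reflexive (sym (*-identityʳ ε))) (≤-trans (*-monoˡ (<⇒≤ 0<ε) (≤-trans 1≤A (≤-trans (≤+ (≤-trans 0≤1 1≤B)) (≤+ (<⇒≤ 0<δ))))) (≤-reflexive εD))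
    step : ∀ {u z} → 0ℚ ≤ u + ε → 0ℚ ≤ z + ε → u ≤ A → z ≤ B → 0ℚ ≤ u * z + δ
    step {u} {z} a b c d = subst (0ℚ ≤_) (trans (e₁ u z ε A B δ) (cong (_+_ (u * z)) εD))
      (a ⊛ b ⊕ <⇒≤ 0<ε ⊛ (sub⁺ c ⊕ sub⁺ d ⊕ sub⁺ ε≤δ))
      where e₁ : ∀ u z ε A B δ → (u + ε) * (z + ε) + ε * (A - u + (B - z) + (δ - ε)) ≡ u * z + ε * (A + B + δ)
            e₁ = solve-∀ ℚ-ring

  ⊑⇒0⊑ : ∀ {x y} → x ⊑ y → 0ℝ ⊑ y -ʳ x
  ⊑⇒0⊑ {x} {y} p δ 0<δ = mapᵉ (λ {n} a → by-diff (seq y n + δ - seq x n) (sub⁺ a) (e (seq x n) (seq y n) δ)) (p δ 0<δ)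
    where e : ∀ a b δ → b - a + δ - 0ℚ ≡ b + δ - a
          e = solve-∀ ℚ-ring

  0⊑⇒⊑ : ∀ {x y} → 0ℝ ⊑ y -ʳ x → x ⊑ y
  0⊑⇒⊑ {x} {y} p δ 0<δ = mapᵉ (λ {n} a → by-diff (seq y n - seq x n + δ) a (e (seq x n) (seq y n) δ)) (p δ 0<δ)
    where e : ∀ a b δ → b + δ - a ≡ b - a + δ
          e = solve-∀ ℚ-ring

  ⊑-resp : ∀ {x x′ y y′} → x ≈ x′ → y ≈ y′ → x ⊑ y → x′ ⊑ y′
  ⊑-resp {x} {x′} {y} {y′} p q h = ⊑-trans {x′} {x} {y′} (above p) (⊑-trans {x} {y} {y′} h (below q))

  ⊑-*ʳ : ∀ {x y z} → 0ℝ ⊑ z → x ⊑ y → x *ʳ z ⊑ y *ʳ z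
  ⊑-*ʳ {x} {y} {z} p q = 0⊑⇒⊑ {x *ʳ z} {y *ʳ z} (⊑-resp {0ℝ} {0ℝ} {(y -ʳ x) *ʳ z} {y *ʳ z -ʳ x *ʳ z} (≈-refl {0ℝ}) (≐⇒≈ {(y -ʳ x) *ʳ z} {y *ʳ z -ʳ x *ʳ z} λ n → e (seq x n) (seq y n) (seq z n)) (0⊑* {y -ʳ x} {z} (⊑⇒0⊑ {x} {y} q) p))
    where e : ∀ a b c → (b - a) * c ≡ b * c - a * c
          e = solve-∀ ℚ-ring

  *ʳ-comm : ∀ x y → x *ʳ y ≈ y *ʳ x
  *ʳ-comm x y = ≐⇒≈ {x *ʳ y} {y *ʳ x} λ n → *-comm (seq x n) (seq y n)

  ⊑-*ˡ : ∀ {x y z} → 0ℝ ⊑ z → x ⊑ y → z *ʳ x ⊑ z *ʳ y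
  ⊑-*ˡ {x} {y} {z} p q = ⊑-resp {x *ʳ z} {z *ʳ x} {y *ʳ z} {z *ʳ y} (*ʳ-comm x z) (*ʳ-comm y z) (⊑-*ʳ {x} {y} {z} p q)

  ⊑-* : ∀ {x y x′ y′} → 0ℝ ⊑ x → 0ℝ ⊑ y′ → x ⊑ y → x′ ⊑ y′ → x *ʳ x′ ⊑ y *ʳ y′
  ⊑-* {x} {y} {x′} {y′} p p′ q q′ = ⊑-trans {x *ʳ x′} {x *ʳ y′} {y *ʳ y′} (⊑-*ˡ {x′} {y′} {x} p q′) (⊑-*ʳ {x} {y} {y′} p′ q)

  -- The error x y - x′ y′ = (x - x′) y + x′ (y - y′) is small as y and x′ are bounded.
  ≈0-* : ∀ {x y} → x ≈ 0ℝ → x *ʳ y ≈ 0ℝ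
  ≈0-* {x} {y} (mk≈ p q) = mk≈ (λ δ 0<δ → mapᵉ (λ {n} h → ≤-trans (x≤∣x∣ (seq x n * seq y n)) (≤-trans h (≤-reflexive (sym (+-identityˡ δ))))) (small δ 0<δ))
    (λ δ 0<δ → mapᵉ (λ {n} h → by-diff (δ - - (seq x n * seq y n)) (sub⁺ (≤-trans (-x≤∣x∣ (seq x n * seq y n)) h)) (e (seq x n * seq y n) δ)) (small δ 0<δ))
    where
    e : ∀ a δ → a + δ - 0ℚ ≡ δ - - a
    e = solve-∀ ℚ-ring
    by = bounded y
    B = proj₁ by
    0<B = <-≤-trans 0<1 (proj₁ (proj₂ by))
    inv = inverse 0<B
    small : ∀ δ → 0ℚ < δ → Eventually λ n → ∣ seq x n * seq y n ∣ ≤ δ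
    small δ 0<δ = mapᵉ (λ {n} (a , b , c) → ≤-trans (≤-reflexive (∣p*q∣≡∣p∣*∣q∣ (seq x n) (seq y n)))
        (≤-trans (*-mono (0≤∣p∣ (seq x n)) (0≤∣p∣ (seq y n)) (∣∣≤ (≤-trans a (≤-reflexive (+-identityˡ ε))) (by-diff (seq x n + ε - 0ℚ) (sub⁺ b) (e′ (seq x n) ε))) c) (≤-reflexive εB)))
      (p ε 0<ε ⊓ᵉ q ε 0<ε ⊓ᵉ proj₂ (proj₂ by))
      where
      ε : ℚ
      ε = δ * proj₁ inv
      0<ε = 0<δ ⊛< proj₁ (proj₂ inv)
      εB : ε * B ≡ δ
      εB = trans (*-assoc δ _ B) (trans (cong (δ *_) (trans (*-comm _ B) (proj₂ (proj₂ inv)))) (*-identityʳ δ))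
      e′ : ∀ a δ → δ - - a ≡ a + δ - 0ℚ
      e′ = solve-∀ ℚ-ring

  infix  3 _∎ʳ
  infixr 2 _≈⟨_⟩_
  _≈⟨_⟩_ : ∀ x {y z} → x ≈ y → y ≈ z → x ≈ z
  x ≈⟨ p ⟩ q = ≈-trans {x} p q

  _∎ʳ : ∀ x → x ≈ x
  x ∎ʳ = ≈-refl {x}

  pointwise : ∀ x y → x ≐ y → x ≈ y
  pointwise x y = ≐⇒≈ {x} {y}

  ≈⇒-≈0 : ∀ {x y} → x ≈ y → x -ʳ y ≈ 0ℝ
  ≈⇒-≈0 {x} {y} h = x -ʳ y ≈⟨ ≈-+ {x} {y} { -ʳ y} { -ʳ y} h (≈-refl { -ʳ y}) ⟩ y -ʳ y ≈⟨ pointwise (y -ʳ y) 0ℝ (λ n → +-inverseʳ (seq y n)) ⟩ 0ℝ ∎ʳ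

  -≈0⇒≈ : ∀ {x y} → x -ʳ y ≈ 0ℝ → x ≈ y
  -≈0⇒≈ {x} {y} h = x ≈⟨ pointwise x ((x -ʳ y) +ʳ y) (λ n → e (seq x n) (seq y n)) ⟩ (x -ʳ y) +ʳ y ≈⟨ ≈-+ {x -ʳ y} {0ℝ} {y} {y} h (≈-refl {y}) ⟩
    0ℝ +ʳ y ≈⟨ pointwise (0ℝ +ʳ y) y (λ n → +-identityˡ (seq y n)) ⟩ y ∎ʳ
    where e : ∀ a b → a ≡ a - b + b
          e = solve-∀ ℚ-ring

  ≈-* : ∀ {x y x′ y′} → x ≈ y → x′ ≈ y′ → x *ʳ x′ ≈ y *ʳ y′
  ≈-* {x} {y} {x′} {y′} p q = -≈0⇒≈ {x *ʳ x′} {y *ʳ y′} (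
    x *ʳ x′ -ʳ y *ʳ y′ ≈⟨ pointwise (x *ʳ x′ -ʳ y *ʳ y′) ((x -ʳ y) *ʳ x′ +ʳ (x′ -ʳ y′) *ʳ y) (λ n → e (seq x n) (seq y n) (seq x′ n) (seq y′ n)) ⟩
    (x -ʳ y) *ʳ x′ +ʳ (x′ -ʳ y′) *ʳ y
      ≈⟨ ≈-+ {(x -ʳ y) *ʳ x′} {0ℝ} {(x′ -ʳ y′) *ʳ y} {0ℝ} (≈0-* {x -ʳ y} {x′} (≈⇒-≈0 {x} {y} p)) (≈0-* {x′ -ʳ y′} {y} (≈⇒-≈0 {x′} {y′} q)) ⟩
    0ℝ +ʳ 0ℝ ≈⟨ pointwise (0ℝ +ʳ 0ℝ) 0ℝ (λ n → +-identityˡ 0ℚ) ⟩ 0ℝ ∎ʳ)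
    where e : ∀ a b c d → a * c - b * d ≡ (a - b) * c + (c - d) * b
          e = solve-∀ ℚ-ring

  <⇒⊑ : ∀ {x y} → x <ʳ y → x ⊑ y
  <⇒⊑ {x} {y} (δ , 0<δ , h) ε 0<ε = mapᵉ (λ {n} a → ≤-trans (≤+ (<⇒≤ 0<δ)) (≤-trans a (≤+ (<⇒≤ 0<ε)))) h

  <-⊑-trans : ∀ {x y z} → x <ʳ y → y ⊑ z → x <ʳ z
  <-⊑-trans {x} {y} {z} (δ , 0<δ , h) p = ½ * δ , 0<½* 0<δ , mapᵉ (λ {n} (a , b) → by-diff ((seq y n - (seq x n + δ)) + (seq z n + ½ * δ - seq y n)) (sub⁺ a ⊕ sub⁺ b) (e (seq x n) (seq y n) (seq z n) δ)) (h ⊓ᵉ p (½ * δ) (0<½* 0<δ))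
    where e : ∀ x y z δ → z - (x + ½ * δ) ≡ (y - (x + δ)) + (z + ½ * δ - y)
          e = solve-∀ ℚ-ring

  ⊑-<-trans : ∀ {x y z} → x ⊑ y → y <ʳ z → x <ʳ z
  ⊑-<-trans {x} {y} {z} p (δ , 0<δ , h) = ½ * δ , 0<½* 0<δ , mapᵉ (λ {n} (a , b) → by-diff ((seq z n - (seq y n + δ)) + (seq y n + ½ * δ - seq x n)) (sub⁺ a ⊕ sub⁺ b) (e (seq x n) (seq y n) (seq z n) δ)) (h ⊓ᵉ p (½ * δ) (0<½* 0<δ))
    where e : ∀ x y z δ → z - (x + ½ * δ) ≡ (z - (y + δ)) + (y + ½ * δ - x)
          e = solve-∀ ℚ-ring

  <ʳ-trans : ∀ {x y z} → x <ʳ y → y <ʳ z → x <ʳ z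
  <ʳ-trans {x} {y} {z} p q = <-⊑-trans {x} {y} {z} p (<⇒⊑ {y} {z} q)

  <ʳ-irrefl : ∀ {x y} → x ⊑ y → ¬ (y <ʳ x)
  <ʳ-irrefl {x} {y} = ⊑⇒≤ {x} {y}

  <ʳ-resp : ∀ {x x′ y y′} → x ≈ x′ → y ≈ y′ → x <ʳ y → x′ <ʳ y′
  <ʳ-resp {x} {x′} {y} {y′} p q h = ⊑-<-trans {x′} {x} {y′} (above p) (<-⊑-trans {x} {y} {y′} h (below q))

  -- The constructive substitute for trichotomy. z is compared with x + δ/2 at one late index, after
  -- which no sequence moves by δ/8 or more.
  cotrans : ∀ {x y} → x <ʳ y → ∀ z → x <ʳ z ⊎ z <ʳ y
  cotrans {x} {y} (δ , 0<δ , N , h) z = decide (≤-total (seq x K + ½ * δ) (seq z K))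
    where
    0<δ/8 : 0ℚ < (+ 1 / 8) * δ
    0<δ/8 = positive⁻¹ (+ 1 / 8) ⊛< 0<δ
    cx = near x 0<δ/8
    cy = near y 0<δ/8
    cz = near z 0<δ/8
    Nx Ny Nz K : ℕ
    Nx = proj₁ cx
    Ny = proj₁ cy
    Nz = proj₁ cz
    K = N ℕ.⊔ (Nx ℕ.⊔ (Ny ℕ.⊔ Nz))
    px = proj₂ cx
    py = proj₂ cy
    pz = proj₂ cz
    K≥N : N ℕ.≤ K
    K≥N = ℕ.m≤m⊔n N _
    K≥Nx : Nx ℕ.≤ K
    K≥Nx = ℕ.≤-trans (ℕ.m≤m⊔n Nx _) (ℕ.m≤n⊔m N _)
    K≥Ny : Ny ℕ.≤ K
    K≥Ny = ℕ.≤-trans (ℕ.≤-trans (ℕ.m≤m⊔n Ny _) (ℕ.m≤n⊔m Nx _)) (ℕ.m≤n⊔m N _)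
    K≥Nz : Nz ℕ.≤ K
    K≥Nz = ℕ.≤-trans (ℕ.≤-trans (ℕ.m≤n⊔m Ny _) (ℕ.m≤n⊔m Nx _)) (ℕ.m≤n⊔m N _)
    decide : seq x K + ½ * δ ≤ seq z K ⊎ seq z K ≤ seq x K + ½ * δ → x <ʳ z ⊎ z <ʳ y
    decide (inj₁ l) = inj₁ ((+ 1 / 4) * δ , positive⁻¹ (+ 1 / 4) ⊛< 0<δ , K , λ n hn →
      by-diff ((seq x K + (+ 1 / 8) * δ - seq x n) + (seq z n + (+ 1 / 8) * δ - seq z K) + (seq z K - (seq x K + ½ * δ)))
        (sub⁺ ((px n K (ℕ.≤-trans K≥Nx hn) K≥Nx)) ⊕ sub⁺ ((pz K n K≥Nz (ℕ.≤-trans K≥Nz hn))) ⊕ sub⁺ l) (e (seq x n) (seq z n) (seq x K) (seq z K) δ))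
      where e : ∀ a b c d δ → b - (a + (+ 1 / 4) * δ) ≡ (c + (+ 1 / 8) * δ - a) + (b + (+ 1 / 8) * δ - d) + (d - (c + ½ * δ))
            e = solve-∀ ℚ-ring
    decide (inj₂ l) = inj₂ ((+ 1 / 4) * δ , positive⁻¹ (+ 1 / 4) ⊛< 0<δ , K , λ n hn →
      by-diff ((seq y n + (+ 1 / 8) * δ - seq y K) + (seq z K + (+ 1 / 8) * δ - seq z n) + (seq x K + ½ * δ - seq z K) + (seq y K - (seq x K + δ)))
        (sub⁺ ((py K n K≥Ny (ℕ.≤-trans K≥Ny hn))) ⊕ sub⁺ ((pz n K (ℕ.≤-trans K≥Nz hn) K≥Nz)) ⊕ sub⁺ l ⊕ sub⁺ (h K K≥N)) (e (seq y n) (seq z n) (seq y K) (seq z K) (seq x K) δ))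
      where e : ∀ a b c d x δ → a - (b + (+ 1 / 4) * δ) ≡ (a + (+ 1 / 8) * δ - c) + (d + (+ 1 / 8) * δ - b) + (x + ½ * δ - d) + (c - (x + δ))
            e = solve-∀ ℚ-ring

  +ʳ-mono-<⊑ : ∀ {x y x′ y′} → x <ʳ y → x′ ⊑ y′ → x +ʳ x′ <ʳ y +ʳ y′
  +ʳ-mono-<⊑ {x} {y} {x′} {y′} (δ , 0<δ , h) p = ½ * δ , 0<½* 0<δ , mapᵉ (λ {n} (a , b) → by-diff ((seq y n - (seq x n + δ)) + (seq y′ n + ½ * δ - seq x′ n)) (sub⁺ a ⊕ sub⁺ b) (e (seq x n) (seq y n) (seq x′ n) (seq y′ n) δ)) (h ⊓ᵉ p (½ * δ) (0<½* 0<δ))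
    where e : ∀ a b c d δ → b + d - (a + c + ½ * δ) ≡ (b - (a + δ)) + (d + ½ * δ - c)
          e = solve-∀ ℚ-ring

  0<ʳ* : ∀ {x y} → 0ℝ <ʳ x → 0ℝ <ʳ y → 0ℝ <ʳ x *ʳ y
  0<ʳ* {x} {y} (δ , 0<δ , h) (ε , 0<ε , k) = δ * ε , 0<δ ⊛< 0<ε , mapᵉ (λ {n} (a , b) → ≤-trans (≤-reflexive (+-identityˡ (δ * ε)))
    (*-mono (<⇒≤ 0<δ) (<⇒≤ 0<ε) (≤-trans (≤-reflexive (sym (+-identityˡ δ))) a) (≤-trans (≤-reflexive (sym (+-identityˡ ε))) b))) (h ⊓ᵉ k)

  -ʳ-pos : ∀ {x y} → x <ʳ y → 0ℝ <ʳ y -ʳ x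
  -ʳ-pos {x} {y} (δ , 0<δ , h) = δ , 0<δ , mapᵉ (λ {n} a → by-diff (seq y n - (seq x n + δ)) (sub⁺ a) (e (seq x n) (seq y n) δ)) h
    where e : ∀ a b δ → b - a - (0ℚ + δ) ≡ b - (a + δ)
          e = solve-∀ ℚ-ring

  -ʳ-pos⁻ : ∀ {x y} → 0ℝ <ʳ y -ʳ x → x <ʳ y
  -ʳ-pos⁻ {x} {y} (δ , 0<δ , h) = δ , 0<δ , mapᵉ (λ {n} a → by-diff (seq y n - seq x n - (0ℚ + δ)) (sub⁺ a) (e (seq x n) (seq y n) δ)) h
    where e : ∀ a b δ → b - (a + δ) ≡ b - a - (0ℚ + δ)
          e = solve-∀ ℚ-ring

  <ʳ-*ʳ : ∀ {x y z} → 0ℝ <ʳ z → x <ʳ y → x *ʳ z <ʳ y *ʳ z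
  <ʳ-*ʳ {x} {y} {z} p q = -ʳ-pos⁻ {x *ʳ z} {y *ʳ z} (<ʳ-resp {0ℝ} {0ℝ} {(y -ʳ x) *ʳ z} {y *ʳ z -ʳ x *ʳ z} (≈-refl {0ℝ}) (≐⇒≈ {(y -ʳ x) *ʳ z} {y *ʳ z -ʳ x *ʳ z} λ n → e (seq x n) (seq y n) (seq z n)) (0<ʳ* {y -ʳ x} {z} (-ʳ-pos {x} {y} q) p))
    where e : ∀ a b c → (b - a) * c ≡ b * c - a * c
          e = solve-∀ ℚ-ring

  fromℚ-< : ∀ {a b} → a < b → fromℚ a <ʳ fromℚ b
  fromℚ-< {a} {b} h = b - a , sub⁺< h , alwaysᵉ λ n → ≤-reflexive (e a b)
    where e : ∀ a b → a + (b - a) ≡ b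
          e = solve-∀ ℚ-ring

  fromℚ-⊑ : ∀ {a b} → a ≤ b → fromℚ a ⊑ fromℚ b
  fromℚ-⊑ h δ 0<δ = alwaysᵉ λ n → ≤-trans h (≤+ (<⇒≤ 0<δ))

  fromℚ-<⁻ : ∀ {a b} → fromℚ a <ʳ fromℚ b → a < b
  fromℚ-<⁻ {a} {b} (δ , 0<δ , h) = someᵉ h λ l → <-≤-trans (by-diff< δ 0<δ (e a δ)) l
    where e : ∀ a δ → a + δ - a ≡ δ
          e = solve-∀ ℚ-ring

  fromℚ-⊑⁻ : ∀ {a b} → fromℚ a ⊑ fromℚ b → a ≤ b
  fromℚ-⊑⁻ {a} {b} h with ≤-total a b
  ... | inj₁ l = l
  ... | inj₂ l with <-cmp b a
  ...   | tri< p _ _ = contradiction (fromℚ-< p) (<ʳ-irrefl {fromℚ a} {fromℚ b} h)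
  ...   | tri≈ _ p _ = ≤-reflexive (sym p)
  ...   | tri> _ _ p = <⇒≤ p

  above-ℚ : ∀ {x y} → x <ʳ y → ∃[ q ] (x <ʳ fromℚ q × fromℚ q <ʳ y)
  above-ℚ {x} {y} (δ , 0<δ , N , h) = seq x K + ½ * δ ,
      ((+ 1 / 4) * δ , positive⁻¹ (+ 1 / 4) ⊛< 0<δ , K , λ n hn → by-diff ((seq x K + (+ 1 / 8) * δ - seq x n) + (+ 1 / 8) * δ) (sub⁺ ((proj₂ cx n K (ℕ.≤-trans K≥Nx hn) K≥Nx)) ⊕ <⇒≤ 0<δ/8) (e₁ (seq x n) (seq x K) δ)) ,
      ((+ 1 / 4) * δ , positive⁻¹ (+ 1 / 4) ⊛< 0<δ , K , λ n hn → by-diff ((seq y n + (+ 1 / 8) * δ - seq y K) + (seq y K - (seq x K + δ)) + (+ 1 / 8) * δ) (sub⁺ ((proj₂ cy K n K≥Ny (ℕ.≤-trans K≥Ny hn))) ⊕ sub⁺ (h K K≥N) ⊕ <⇒≤ 0<δ/8) (e₂ (seq y n) (seq y K) (seq x K) δ))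
    where
    0<δ/8 : 0ℚ < (+ 1 / 8) * δ
    0<δ/8 = positive⁻¹ (+ 1 / 8) ⊛< 0<δ
    cx = near x 0<δ/8
    cy = near y 0<δ/8
    K : ℕ
    K = N ℕ.⊔ (proj₁ cx ℕ.⊔ proj₁ cy)
    K≥N : N ℕ.≤ K
    K≥N = ℕ.m≤m⊔n N _
    K≥Nx : proj₁ cx ℕ.≤ K
    K≥Nx = ℕ.≤-trans (ℕ.m≤m⊔n (proj₁ cx) _) (ℕ.m≤n⊔m N _)
    K≥Ny : proj₁ cy ℕ.≤ K
    K≥Ny = ℕ.≤-trans (ℕ.m≤n⊔m (proj₁ cx) _) (ℕ.m≤n⊔m N _)
    e₁ : ∀ a c δ → c + ½ * δ - (a + (+ 1 / 4) * δ) ≡ (c + (+ 1 / 8) * δ - a) + (+ 1 / 8) * δ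
    e₁ = solve-∀ ℚ-ring
    e₂ : ∀ y z x δ → y - (x + ½ * δ + (+ 1 / 4) * δ) ≡ (y + (+ 1 / 8) * δ - z) + (z - (x + δ)) + (+ 1 / 8) * δ
    e₂ = solve-∀ ℚ-ring

  0⊑^ : ∀ {x} n → 0ℝ ⊑ x → 0ℝ ⊑ x ^ʳ n
  0⊑^ zero    h = fromℚ-⊑ 0≤1
  0⊑^ {x} (suc n) h = 0⊑* {x} {x ^ʳ n} h (0⊑^ {x} n h)

  ^ʳ-mono : ∀ {x y} n → 0ℝ ⊑ x → x ⊑ y → x ^ʳ n ⊑ y ^ʳ n
  ^ʳ-mono zero    h l = ⊑-refl {1ℝ}
  ^ʳ-mono {x} {y} (suc n) h l = ⊑-* {x} {y} {x ^ʳ n} {y ^ʳ n} h (0⊑^ {y} n (⊑-trans {0ℝ} {x} {y} h l)) l (^ʳ-mono {x} {y} n h l)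

  ^ʳ-cong : ∀ {x y} n → x ≈ y → x ^ʳ n ≈ y ^ʳ n
  ^ʳ-cong zero    h = ≈-refl {1ℝ}
  ^ʳ-cong {x} {y} (suc n) h = ≈-* {x} {y} {x ^ʳ n} {y ^ʳ n} h (^ʳ-cong {x} {y} n h)

  fromℚ-^ : ∀ a n → fromℚ a ^ʳ n ≐ fromℚ (a ^ n)
  fromℚ-^ a zero    k = refl
  fromℚ-^ a (suc n) k = cong (a *_) (fromℚ-^ a n k)

-- The real exponential function and its basic bounds

module Exponential where
  open Rationals
  open Inequalities using (least-positive)
  open PartialSums
  open PartialSumsAddition using (E-add)
  open RealOrder
  open EdgeReplacement using (inverse)
  open import Defs using (ℝ; mkℝ; seq; cauchy; Cauchy; 0ℝ; 1ℝ) renaming (_+_ to _+ʳ_; _*_ to _*ʳ_; -_ to -ʳ_; _-_ to _-ʳ_)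
  open import Data.Integer.Base using (+_)
  open import Data.Rational
  open import Data.Rational.Properties

  E-bounded : ∀ {X} → 0ℚ ≤ X → ∃[ K ] (1ℚ ≤ K × ∀ n → E X n ≤ K)
  E-bounded {X} 0≤X = E X N + 1ℚ , ≤-trans (≤-reflexive (sym (+-identityˡ 1ℚ))) (+-monoˡ-≤ 1ℚ (E-nonneg N 0≤X)) , bound
    where
    tail = E-tail 0≤X 0<1
    N : ℕ
    N = proj₁ tail
    bound : ∀ n → E X n ≤ E X N + 1ℚ
    bound n = ≤-trans (E-mono n N 0≤X) (by-diff (1ℚ - (E X (n ℕ.+ N) - E X N)) (sub⁺ (proj₂ tail N ℕ.≤-refl n))
      (trans (cong (λ z → E X N + 1ℚ - E X z) (ℕ.+-comm N n)) (e (E X N) (E X (n ℕ.+ N)))))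
      where e : ∀ a b → a + 1ℚ - b ≡ 1ℚ - (b - a)
            e = solve-∀ ℚ-ring

  scale-down : ∀ {K δ} → 1ℚ ≤ K → 0ℚ < δ → ∃[ ε ] (0ℚ < ε × ε * K ≡ δ)
  scale-down {K} {δ} 1≤K 0<δ = δ * proj₁ inv , 0<δ ⊛< proj₁ (proj₂ inv) ,
    trans (*-assoc δ (proj₁ inv) K) (trans (cong (δ *_) (trans (*-comm (proj₁ inv) K) (proj₂ (proj₂ inv)))) (*-identityʳ δ))
    where inv = inverse (<-≤-trans 0<1 1≤K)

  ∣-∣≤ : ∀ {a b δ} → a ≤ b + δ → b ≤ a + δ → ∣ a - b ∣ ≤ δ
  ∣-∣≤ {a} {b} {δ} h k = ∣∣≤ (by-diff (b + δ - a) (sub⁺ h) (e₁ a b δ)) (by-diff (a + δ - b) (sub⁺ k) (e₂ a b δ))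
    where
    e₁ : ∀ a b δ → δ - (a - b) ≡ b + δ - a
    e₁ = solve-∀ ℚ-ring
    e₂ : ∀ a b δ → δ - - (a - b) ≡ a + δ - b
    e₂ = solve-∀ ℚ-ring

  ∣-∣≤⁻ : ∀ {a b δ} → ∣ a - b ∣ ≤ δ → a ≤ b + δ
  ∣-∣≤⁻ {a} {b} {δ} h = by-diff (δ - (a - b)) (sub⁺ (≤-trans (x≤∣x∣ (a - b)) h)) (e a b δ)
    where e : ∀ a b δ → b + δ - a ≡ δ - (a - b)
          e = solve-∀ ℚ-ring

  module Bounds (y : ℝ) where
    X K : ℚ
    X = proj₁ (bounded y)
    0≤X : 0ℚ ≤ X
    0≤X = ≤-trans 0≤1 (proj₁ (proj₂ (bounded y)))
    eventually≤X : Eventually λ n → ∣ seq y n ∣ ≤ X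
    eventually≤X = proj₂ (proj₂ (bounded y))
    K = proj₁ (E-bounded 0≤X)
    1≤K : 1ℚ ≤ K
    1≤K = proj₁ (proj₂ (E-bounded 0≤X))
    E≤K : ∀ n → E X n ≤ K
    E≤K = proj₂ (proj₂ (E-bounded 0≤X))

    shift : ∀ {δ} → 0ℚ < δ → ∃[ N ] (∀ i → N ℕ.≤ i → ∀ n → N ℕ.≤ n → ∀ m → i ℕ.≤ m → ∣ E (seq y n) m - E (seq y n) i ∣ ≤ δ)
    shift {δ} 0<δ = N₁ ℕ.⊔ N₂ , λ i hi n hn m i≤m →
      subst (λ j → ∣ E (seq y n) j - E (seq y n) i ∣ ≤ δ) (ℕ.m∸n+n≡m i≤m)
        (≤-trans (∣E-E∣≤ i (m ℕ.∸ i) (proj₂ eventually≤X n (ℕ.m⊔n≤o⇒n≤o N₁ N₂ hn))) (proj₂ (E-tail 0≤X 0<δ) i (ℕ.m⊔n≤o⇒m≤o N₁ N₂ hi) (m ℕ.∸ i)))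
      where
      N₁ N₂ : ℕ
      N₁ = proj₁ (E-tail 0≤X 0<δ)
      N₂ = proj₁ eventually≤X

  -- The sequence is diagonal: term count and argument move together. The comparison passes through
  -- the N-th partial sum, with a truncation error uniform in the bounded arguments and a Lipschitz
  -- bound for the change of argument.
  exp-cauchy : ∀ y → Cauchy λ n → E (seq y n) n
  exp-cauchy y ε 0<ε = N , λ m n hm hn → ≤-<-trans (bound m n hm hn) (by-diff< ((+ 1 / 4) * ε) 0<ε/4 (e ε))
    where
    open Bounds y
    0<ε/4 : 0ℚ < (+ 1 / 4) * ε
    0<ε/4 = positive⁻¹ (+ 1 / 4) ⊛< 0<ε
    sd = scale-down 1≤K 0<ε/4
    N₁ N₂ N₃ N : ℕ
    N₁ = proj₁ (shift 0<ε/4)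
    N₂ = proj₁ (cauchy y (proj₁ sd) (proj₁ (proj₂ sd)))
    N₃ = proj₁ eventually≤X
    N = N₁ ℕ.⊔ (N₂ ℕ.⊔ N₃)
    N≥₁ : N₁ ℕ.≤ N
    N≥₁ = ℕ.m≤m⊔n N₁ _
    N≥₂ : N₂ ℕ.≤ N
    N≥₂ = ℕ.≤-trans (ℕ.m≤m⊔n N₂ N₃) (ℕ.m≤n⊔m N₁ _)
    N≥₃ : N₃ ℕ.≤ N
    N≥₃ = ℕ.≤-trans (ℕ.m≤n⊔m N₂ N₃) (ℕ.m≤n⊔m N₁ _)
    e : ∀ ε → ε - ((+ 1 / 4) * ε + ((+ 1 / 4) * ε + (+ 1 / 4) * ε)) ≡ (+ 1 / 4) * ε
    e = solve-∀ ℚ-ring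
    e′ : ∀ a b c d → a - d ≡ (a - b) + ((b - c) + (c - d))
    e′ = solve-∀ ℚ-ring
    bound : ∀ m n → N ℕ.≤ m → N ℕ.≤ n → ∣ E (seq y m) m - E (seq y n) n ∣ ≤ (+ 1 / 4) * ε + ((+ 1 / 4) * ε + (+ 1 / 4) * ε)
    bound m n hm hn = begin
      ∣ E (seq y m) m - E (seq y n) n ∣  ≡⟨ cong ∣_∣ (e′ (E (seq y m) m) (E (seq y m) N) (E (seq y n) N) (E (seq y n) n)) ⟩
      ∣ (E (seq y m) m - E (seq y m) N) + ((E (seq y m) N - E (seq y n) N) + (E (seq y n) N - E (seq y n) n)) ∣
        ≤⟨ ≤-trans (∣p+q∣≤∣p∣+∣q∣ (E (seq y m) m - E (seq y m) N) _) (+-monoʳ-≤ ∣ E (seq y m) m - E (seq y m) N ∣ (∣p+q∣≤∣p∣+∣q∣ (E (seq y m) N - E (seq y n) N) (E (seq y n) N - E (seq y n) n))) ⟩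
      ∣ E (seq y m) m - E (seq y m) N ∣ + (∣ E (seq y m) N - E (seq y n) N ∣ + ∣ E (seq y n) N - E (seq y n) n ∣)
        ≤⟨ +-mono-≤ (proj₂ (shift 0<ε/4) N N≥₁ m (ℕ.≤-trans N≥₁ hm) m hm) (+-mono-≤
             (≤-trans (E-lipschitz N (proj₂ eventually≤X m (ℕ.≤-trans N≥₃ hm)) (proj₂ eventually≤X n (ℕ.≤-trans N≥₃ hn)))
               (≤-trans (*-mono (0≤∣p∣ (seq y m - seq y n)) (E-nonneg N 0≤X) (<⇒≤ (proj₂ (cauchy y (proj₁ sd) (proj₁ (proj₂ sd))) m n (ℕ.≤-trans N≥₂ hm) (ℕ.≤-trans N≥₂ hn))) (E≤K N)) (≤-reflexive (proj₂ (proj₂ sd)))))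
             (≤-trans (≤-reflexive (∣-∣-sym (E (seq y n) N) (E (seq y n) n))) (proj₂ (shift 0<ε/4) N N≥₁ n (ℕ.≤-trans N≥₁ hn) n hn))) ⟩
      (+ 1 / 4) * ε + ((+ 1 / 4) * ε + (+ 1 / 4) * ε) ∎
      where open ≤-Reasoning

  exp : ℝ → ℝ
  exp y = mkℝ (λ n → E (seq y n) n) (exp-cauchy y)

  ∣-∣⇒≈ : ∀ x y → (∀ δ → 0ℚ < δ → Eventually λ n → ∣ seq x n - seq y n ∣ ≤ δ) → x ≈ y
  ∣-∣⇒≈ x y h = mk≈ (λ δ 0<δ → mapᵉ (λ {n} → ∣-∣≤⁻ {seq x n} {seq y n}) (h δ 0<δ))
    (λ δ 0<δ → mapᵉ (λ {n} a → ∣-∣≤⁻ {seq y n} {seq x n} (≤-trans (≤-reflexive (∣-∣-sym (seq y n) (seq x n))) a)) (h δ 0<δ))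

  ≈⇒∣-∣ : ∀ {x y} → x ≈ y → ∀ δ → 0ℚ < δ → Eventually λ n → ∣ seq x n - seq y n ∣ ≤ δ
  ≈⇒∣-∣ {x} {y} (mk≈ p q) δ 0<δ = mapᵉ (λ {n} (a , b) → ∣-∣≤ {seq x n} {seq y n} a b) (p δ 0<δ ⊓ᵉ q δ 0<δ)

  exp-cong : ∀ {x y} → x ≈ y → exp x ≈ exp y
  exp-cong {x} {y} h = ∣-∣⇒≈ (exp x) (exp y) λ δ 0<δ → let ε , 0<ε , εK = scale-down 1≤K 0<δ in
    mapᵉ (λ {n} (a , b , c) → ≤-trans (E-lipschitz n (≤-trans b (≤+ 0≤Y)) (≤-trans c (≤-trans (≤+ 0≤X) (≤-reflexive (+-comm Y X)))))
      (≤-trans (*-mono (0≤∣p∣ (seq x n - seq y n)) (E-nonneg n 0≤XY) a (E≤K n)) (≤-reflexive εK))) (≈⇒∣-∣ h ε 0<ε ⊓ᵉ Bounds.eventually≤X x ⊓ᵉ Bounds.eventually≤X y)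
    where
    X Y : ℚ
    X = Bounds.X x
    Y = Bounds.X y
    0≤X : 0ℚ ≤ X
    0≤X = Bounds.0≤X x
    0≤Y : 0ℚ ≤ Y
    0≤Y = Bounds.0≤X y
    0≤XY : 0ℚ ≤ X + Y
    0≤XY = 0≤X ⊕ 0≤Y
    K : ℚ
    K = proj₁ (E-bounded 0≤XY)
    1≤K : 1ℚ ≤ K
    1≤K = proj₁ (proj₂ (E-bounded 0≤XY))
    E≤K : ∀ n → E (X + Y) n ≤ K
    E≤K = proj₂ (proj₂ (E-bounded 0≤XY))

  exp-+ : ∀ x y → exp (x +ʳ y) ≈ exp x *ʳ exp y
  exp-+ x y = ≈-sym (∣-∣⇒≈ (exp x *ʳ exp y) (exp (x +ʳ y)) λ δ 0<δ → mapᵉ (λ {n} (a , b , c) → ≤-trans (E-add n a b) (c n))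
    (Bounds.eventually≤X x ⊓ᵉ Bounds.eventually≤X y ⊓ᵉ E-tail (Bounds.0≤X x ⊕ Bounds.0≤X y) 0<δ))

  E0 : ∀ n → 1ℚ ≤ E 0ℚ (n ℕ.+ 2) × E 0ℚ n ≤ 1ℚ
  E0 n = ≤-trans (≤-reflexive (sym (+-identityʳ 1ℚ))) (1+x≤E n ≤-refl) ,
    ≤-trans (≤-reflexive (e (E 0ℚ n))) (≤-trans (E≤geometric n ≤-refl 0≤1) (by-diff (0ℚ ^ n) (0≤^ n ≤-refl) (e′ (0ℚ ^ n))))
    where
    e : ∀ a → a ≡ a * (1ℚ - 0ℚ)
    e = solve-∀ ℚ-ring
    e′ : ∀ a → 1ℚ - (1ℚ - a) ≡ a
    e′ = solve-∀ ℚ-ring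

  2≤ᵉ : Eventually λ n → ∃[ m ] n ≡ m ℕ.+ 2
  2≤ᵉ = 2 , λ n h → n ℕ.∸ 2 , sym (ℕ.m∸n+n≡m h)

  ∣x∣≤-neg : ∀ {x ε} → x ≤ 0ℚ → 0ℚ ≤ x + ε → ∣ x - 0ℚ ∣ ≤ ε
  ∣x∣≤-neg {x} {ε} h k = ∣-∣≤ {x} {0ℚ} (≤-trans h (≤-trans (≤-trans k (+-monoˡ-≤ ε h)) ≤-refl)) k

  module _ (x : ℝ) (h : 0ℝ ⊑ x) where
    open Bounds x
    private
      -- At indices where xₙ is slightly negative, E xₙ is compared with E 0.
      near0 : ∀ {n ε} → ∣ seq x n ∣ ≤ X → seq x n ≤ 0ℚ → 0ℚ ≤ seq x n + ε → ∣ E (seq x n) n - E 0ℚ n ∣ ≤ ε * K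
      near0 {n} {ε} b neg k = ≤-trans (E-lipschitz n b 0≤X) (*-mono (0≤∣p∣ (seq x n - 0ℚ)) (E-nonneg n 0≤X) (∣x∣≤-neg neg k) (E≤K n))

    1+x⊑exp : 1ℝ +ʳ x ⊑ exp x
    1+x⊑exp δ 0<δ = let ε , 0<ε , εK = scale-down 1≤K 0<δ in
      mapᵉ (λ {n} (a , b , m , eq) → case n m eq (≤-total 0ℚ (seq x n)) b ε εK a) (h ε 0<ε′ ⊓ᵉ eventually≤X ⊓ᵉ 2≤ᵉ)
      where
      0<ε′ : 0ℚ < proj₁ (scale-down 1≤K 0<δ)
      0<ε′ = proj₁ (proj₂ (scale-down 1≤K 0<δ))
      case : ∀ n m → n ≡ m ℕ.+ 2 → 0ℚ ≤ seq x n ⊎ seq x n ≤ 0ℚ → ∣ seq x n ∣ ≤ X → ∀ ε → ε * K ≡ δ → 0ℚ ≤ seq x n + ε → 1ℚ + seq x n ≤ E (seq x n) n + δ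
      case n m eq (inj₁ p) b ε εK a = ≤-trans (subst (λ j → 1ℚ + seq x n ≤ E (seq x n) j) (sym eq) (1+x≤E m p)) (≤+ (<⇒≤ 0<δ))
      case n m eq (inj₂ p) b ε εK a = ≤-trans (≤-trans (+-monoʳ-≤ 1ℚ p) (≤-trans (≤-reflexive (+-identityʳ 1ℚ)) (subst (λ j → 1ℚ ≤ E 0ℚ j) (sym eq) (proj₁ (E0 m)))))
        (∣-∣≤⁻ {E 0ℚ n} {E (seq x n) n} (≤-trans (≤-reflexive (∣-∣-sym (E 0ℚ n) (E (seq x n) n))) (≤-trans (near0 b p a) (≤-reflexive εK))))

    exp*1-x⊑1 : exp x *ʳ (1ℝ -ʳ x) ⊑ 1ℝ
    exp*1-x⊑1 δ 0<δ = mapᵉ (λ {n} (a , b) → case n (≤-total 0ℚ (seq x n)) (≤-total (seq x n) 1ℚ) b a) (h ε 0<ε ⊓ᵉ eventually≤X)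
      where
      D : ℚ
      -- For ε ≤ 1, (1 + ε K)(1 + ε) ≤ 1 + ε (2 K + 1); hence this constant and the cut of δ at 1.
      D = (K + 1ℚ) + K * 1ℚ
      1≤D : 1ℚ ≤ D
      1≤D = ≤-trans 1≤K (≤-trans (≤+ 0≤1) (≤+ (≤-trans 0≤1 1≤K ⊛ 0≤1)))
      δ′ : ℚ
      δ′ = δ ⊓ 1ℚ
      0<δ′ : 0ℚ < δ′
      0<δ′ = proj₁ (proj₂ (least-positive 0<δ 0<1))
      sd = scale-down 1≤D 0<δ′
      ε : ℚ
      ε = proj₁ sd
      0<ε : 0ℚ < ε
      0<ε = proj₁ (proj₂ sd)
      εD≤δ : ε * D ≤ δ
      εD≤δ = ≤-trans (≤-reflexive (proj₂ (proj₂ sd))) (p⊓q≤p δ 1ℚ)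
      ε≤1 : ε ≤ 1ℚ
      ε≤1 = ≤-trans (subst (_≤ ε * D) (*-identityʳ ε) (*-monoˡ (<⇒≤ 0<ε) 1≤D)) (≤-trans (≤-reflexive (proj₂ (proj₂ sd))) (p⊓q≤q δ 1ℚ))
      case : ∀ n → 0ℚ ≤ seq x n ⊎ seq x n ≤ 0ℚ → seq x n ≤ 1ℚ ⊎ 1ℚ ≤ seq x n → ∣ seq x n ∣ ≤ X → 0ℚ ≤ seq x n + ε → E (seq x n) n * (1ℚ - seq x n) ≤ 1ℚ + δ
      case n (inj₁ p) (inj₁ q) b a = ≤-trans (E≤geometric n p q) (by-diff (seq x n ^ n + δ) (0≤^ n p ⊕ <⇒≤ 0<δ) (e (seq x n ^ n) δ))
        where e : ∀ a δ → 1ℚ + δ - (1ℚ - a) ≡ a + δ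
              e = solve-∀ ℚ-ring
      case n (inj₁ p) (inj₂ q) b a = by-diff (1ℚ + δ + E (seq x n) n * (seq x n - 1ℚ)) (0≤1 ⊕ <⇒≤ 0<δ ⊕ E-nonneg n p ⊛ sub⁺ q) (e (E (seq x n) n) (seq x n) δ)
        where e : ∀ a x δ → 1ℚ + δ - a * (1ℚ - x) ≡ 1ℚ + δ + a * (x - 1ℚ)
              e = solve-∀ ℚ-ring
      case n (inj₂ p) _ b a = begin
        E (seq x n) n * (1ℚ - seq x n)      ≤⟨ *-monoʳ (sub⁺ (≤-trans p 0≤1)) (≤-trans (∣-∣≤⁻ {E (seq x n) n} {E 0ℚ n} (near0 b p a)) (+-monoˡ-≤ (ε * K) (proj₂ (E0 n)))) ⟩
        (1ℚ + ε * K) * (1ℚ - seq x n)       ≤⟨ *-monoˡ (0≤1 ⊕ <⇒≤ 0<ε ⊛ ≤-trans 0≤1 1≤K) (by-diff (seq x n + ε) a (e₁ (seq x n) ε)) ⟩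
        (1ℚ + ε * K) * (1ℚ + ε)             ≤⟨ by-diff (ε * K * (1ℚ - ε)) (<⇒≤ 0<ε ⊛ ≤-trans 0≤1 1≤K ⊛ sub⁺ ε≤1) (e₂ ε K) ⟩
        1ℚ + ε * D                          ≤⟨ +-monoʳ-≤ 1ℚ εD≤δ ⟩
        1ℚ + δ ∎
        where
        open ≤-Reasoning
        e₁ : ∀ x ε → 1ℚ + ε - (1ℚ - x) ≡ x + ε
        e₁ = solve-∀ ℚ-ring
        e₂ : ∀ ε K → 1ℚ + ε * ((K + 1ℚ) + K * 1ℚ) - (1ℚ + ε * K) * (1ℚ + ε) ≡ ε * K * (1ℚ - ε)
        e₂ = solve-∀ ℚ-ring

-- Positivity, monotonicity, powers and logarithms

module ExponentialLaws where
  open Rationals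
  open Inequalities using (0≤sq)
  open PartialSums
  open RealOrder
  open Exponential
  open import Defs using (ℝ; seq; fromℚ; 0ℝ; 1ℝ; ½ℝ; expSum; IsLog) renaming (_+_ to _+ʳ_; _*_ to _*ʳ_; -_ to -ʳ_; _-_ to _-ʳ_; _<_ to _<ʳ_; _^_ to _^ʳ_)
  open import Data.Integer.Base using (+_)
  open import Data.Rational
  open import Data.Rational.Properties

  ⊑-limit : ∀ x y → (∀ δ → 0ℚ < δ → x ⊑ y +ʳ fromℚ δ) → x ⊑ y
  ⊑-limit x y h δ 0<δ = mapᵉ (λ {n} a → ≤-trans a (≤-reflexive (e (seq y n) δ))) (h (½ * δ) (0<½* 0<δ) (½ * δ) (0<½* 0<δ))
    where e : ∀ a δ → a + ½ * δ + ½ * δ ≡ a + δ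
          e = solve-∀ ℚ-ring

  exp-0 : exp 0ℝ ≈ 1ℝ
  exp-0 = mk≈
    (⊑-resp {exp 0ℝ *ʳ (1ℝ -ʳ 0ℝ)} {exp 0ℝ} {1ℝ} {1ℝ} (pointwise (exp 0ℝ *ʳ (1ℝ -ʳ 0ℝ)) (exp 0ℝ) λ n → *-identityʳ (E 0ℚ n)) (≈-refl {1ℝ}) (exp*1-x⊑1 0ℝ (⊑-refl {0ℝ})))
    (⊑-resp {1ℝ +ʳ 0ℝ} {1ℝ} {exp 0ℝ} {exp 0ℝ} (pointwise (1ℝ +ʳ 0ℝ) 1ℝ λ n → +-identityʳ 1ℚ) (≈-refl {exp 0ℝ}) (1+x⊑exp 0ℝ (⊑-refl {0ℝ})))

  exp-neg : ∀ x → exp x *ʳ exp (-ʳ x) ≈ 1ℝ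
  exp-neg x = exp x *ʳ exp (-ʳ x) ≈⟨ ≈-sym (exp-+ x (-ʳ x)) ⟩
    exp (x +ʳ (-ʳ x)) ≈⟨ exp-cong {x +ʳ (-ʳ x)} {0ℝ} (pointwise (x +ʳ (-ʳ x)) 0ℝ λ n → +-inverseʳ (seq x n)) ⟩
    exp 0ℝ ≈⟨ exp-0 ⟩ 1ℝ ∎ʳ

  -- exp x is the square of exp (x/2).
  0⊑exp : ∀ x → 0ℝ ⊑ exp x
  0⊑exp x = ⊑-resp {0ℝ} {0ℝ} {exp h *ʳ exp h} {exp x} (≈-refl {0ℝ}) (≈-sym (
      exp x ≈⟨ exp-cong {x} {h +ʳ h} (pointwise x (h +ʳ h) λ n → sym (halves (seq x n))) ⟩
      exp (h +ʳ h) ≈⟨ exp-+ h h ⟩ exp h *ʳ exp h ∎ʳ))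
    λ δ 0<δ → alwaysᵉ λ n → ≤-trans (0≤sq (E (½ * seq x n) n)) (≤+ (<⇒≤ 0<δ))
    where
    h : ℝ
    h = ½ℝ *ʳ x

  -- With |b| ≤ B = 1/ε, the product being near 1 forces |a| ≥ ε/2 eventually; a ≥ - ε/4 excludes
  -- the negative sign.
  0<-invertible : ∀ a b → 0ℝ ⊑ a → a *ʳ b ≈ 1ℝ → 0ℝ <ʳ a
  0<-invertible a b 0⊑a ab = (+ 1 / 4) * ε , 0<ε/4 , mapᵉ (λ {n} (p , q , r) → ≤-trans (≤-reflexive (+-identityˡ _)) (bound (seq a n) (seq b n) p q r (≤-total 0ℚ (seq a n))))
    (0⊑a ((+ 1 / 4) * ε) 0<ε/4 ⊓ᵉ above ab ½ (positive⁻¹ ½) ⊓ᵉ proj₂ (proj₂ (bounded b)))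
    where
    B : ℚ
    B = proj₁ (bounded b)
    1≤B = proj₁ (proj₂ (bounded b))
    sd = scale-down 1≤B 0<1
    ε : ℚ
    ε = proj₁ sd
    0<ε = proj₁ (proj₂ sd)
    εB : ε * B ≡ 1ℚ
    εB = proj₂ (proj₂ sd)
    0<ε/4 : 0ℚ < (+ 1 / 4) * ε
    0<ε/4 = positive⁻¹ (+ 1 / 4) ⊛< 0<ε
    half : ∀ {x y} → 1ℚ ≤ x * y + ½ → ½ ≤ ∣ x ∣ * ∣ y ∣
    half {x} {y} h = ≤-trans (by-diff (x * y + ½ - 1ℚ) (sub⁺ h) (e (x * y))) (≤-trans (x≤∣x∣ (x * y)) (≤-reflexive (∣p*q∣≡∣p∣*∣q∣ x y)))
      where e : ∀ a → a - ½ ≡ a + ½ - 1ℚ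
            e = solve-∀ ℚ-ring
    lower : ∀ x y → 1ℚ ≤ x * y + ½ → ∣ y ∣ ≤ B → ½ * ε ≤ ∣ x ∣
    lower x y h k = begin
      ½ * ε              ≤⟨ *-monoʳ (<⇒≤ 0<ε) (≤-trans (half {x} {y} h) (*-monoˡ (0≤∣p∣ x) k)) ⟩
      ∣ x ∣ * B * ε      ≡⟨ trans (*-assoc ∣ x ∣ B ε) (trans (cong (∣ x ∣ *_) (trans (*-comm B ε) εB)) (*-identityʳ ∣ x ∣)) ⟩
      ∣ x ∣ ∎
      where open ≤-Reasoning
    ¼≤½ : (+ 1 / 4) * ε ≤ ½ * ε
    ¼≤½ = *-monoʳ (<⇒≤ 0<ε) (from-yes ((+ 1 / 4) ≤? ½))
    bound : ∀ x y → 0ℚ ≤ x + (+ 1 / 4) * ε → 1ℚ ≤ x * y + ½ → ∣ y ∣ ≤ B → 0ℚ ≤ x ⊎ x ≤ 0ℚ → (+ 1 / 4) * ε ≤ x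
    bound x y h k l (inj₁ p) = ≤-trans ¼≤½ (≤-trans (lower x y k l) (≤-reflexive (0≤p⇒∣p∣≡p p)))
    bound x y h k l (inj₂ p) = contradiction (≤-trans (lower x y k l) (∣∣≤ {x} {(+ 1 / 4) * ε} (≤-trans p (<⇒≤ 0<ε/4)) (by-diff (x + (+ 1 / 4) * ε) h (e x ((+ 1 / 4) * ε)))))
      λ q → <-irrefl refl (<-≤-trans (*-monoˡ-<-pos ε {{positive 0<ε}} (from-yes ((+ 1 / 4) <? ½))) q)
      where e : ∀ a b → b - - a ≡ a + b
            e = solve-∀ ℚ-ring

  0<exp : ∀ x → 0ℝ <ʳ exp x
  0<exp x = 0<-invertible (exp x) (exp (-ʳ x)) (0⊑exp x) (exp-neg x)

  exp-split : ∀ x y → exp y ≈ exp x *ʳ exp (y -ʳ x)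
  exp-split x y = exp y ≈⟨ exp-cong {y} {x +ʳ (y -ʳ x)} (pointwise y (x +ʳ (y -ʳ x)) λ n → e (seq x n) (seq y n)) ⟩ exp (x +ʳ (y -ʳ x)) ≈⟨ exp-+ x (y -ʳ x) ⟩ exp x *ʳ exp (y -ʳ x) ∎ʳ
    where e : ∀ a b → b ≡ a + (b - a)
          e = solve-∀ ℚ-ring

  *-oneʳ : ∀ x → x *ʳ 1ℝ ≈ x
  *-oneʳ x = pointwise (x *ʳ 1ℝ) x λ n → *-identityʳ (seq x n)

  exp-mono : ∀ {x y} → x ⊑ y → exp x ⊑ exp y
  exp-mono {x} {y} h = ⊑-resp {exp x *ʳ 1ℝ} {exp x} {exp x *ʳ exp (y -ʳ x)} {exp y} (*-oneʳ (exp x)) (≈-sym (exp-split x y))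
    (⊑-*ˡ {1ℝ} {exp (y -ʳ x)} {exp x} (0⊑exp x) (⊑-trans {1ℝ} {1ℝ +ʳ (y -ʳ x)} {exp (y -ʳ x)} 1⊑ (1+x⊑exp (y -ʳ x) 0⊑)))
    where
    0⊑ : 0ℝ ⊑ y -ʳ x
    0⊑ = ⊑⇒0⊑ {x} {y} h
    1⊑ : 1ℝ ⊑ 1ℝ +ʳ (y -ʳ x)
    1⊑ = ⊑-resp {1ℝ +ʳ 0ℝ} {1ℝ} {1ℝ +ʳ (y -ʳ x)} {1ℝ +ʳ (y -ʳ x)} (pointwise (1ℝ +ʳ 0ℝ) 1ℝ λ n → +-identityʳ 1ℚ) (≈-refl {1ℝ +ʳ (y -ʳ x)}) (⊑-+ {1ℝ} {1ℝ} {0ℝ} {y -ʳ x} (⊑-refl {1ℝ}) 0⊑)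

  exp-mono-< : ∀ {x y} → x <ʳ y → exp x <ʳ exp y
  exp-mono-< {x} {y} h = <ʳ-resp {1ℝ *ʳ exp x} {exp x} {exp (y -ʳ x) *ʳ exp x} {exp y}
    (pointwise (1ℝ *ʳ exp x) (exp x) λ n → *-identityˡ _)
    (exp (y -ʳ x) *ʳ exp x ≈⟨ *ʳ-comm (exp (y -ʳ x)) (exp x) ⟩ exp x *ʳ exp (y -ʳ x) ≈⟨ ≈-sym (exp-split x y) ⟩ exp y ∎ʳ)
    (<ʳ-*ʳ {1ℝ} {exp (y -ʳ x)} {exp x} (0<exp x) (<-⊑-trans {1ℝ} {1ℝ +ʳ (y -ʳ x)} {exp (y -ʳ x)} 1< (1+x⊑exp (y -ʳ x) (<⇒⊑ {0ℝ} {y -ʳ x} 0<))))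
    where
    0< : 0ℝ <ʳ y -ʳ x
    0< = -ʳ-pos {x} {y} h
    1< : 1ℝ <ʳ 1ℝ +ʳ (y -ʳ x)
    1< = <ʳ-resp {0ℝ +ʳ 1ℝ} {1ℝ} {(y -ʳ x) +ʳ 1ℝ} {1ℝ +ʳ (y -ʳ x)} (pointwise (0ℝ +ʳ 1ℝ) 1ℝ λ n → +-identityˡ 1ℚ) (pointwise ((y -ʳ x) +ʳ 1ℝ) (1ℝ +ʳ (y -ʳ x)) λ n → +-comm (seq y n - seq x n) 1ℚ)
      (+ʳ-mono-<⊑ {0ℝ} {y -ʳ x} {1ℝ} {1ℝ} 0< (⊑-refl {1ℝ}))

  exp-*0 : ∀ x → exp (fromℚ (ι 0) *ʳ x) ≈ 1ℝ
  exp-*0 x = ≈-trans {exp (fromℚ (ι 0) *ʳ x)} {exp 0ℝ} {1ℝ} (exp-cong {fromℚ (ι 0) *ʳ x} {0ℝ} (pointwise (fromℚ (ι 0) *ʳ x) 0ℝ λ n → trans (cong (_* seq x n) ι-0) (*-zeroˡ (seq x n)))) exp-0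

  exp-*suc : ∀ x n → exp x *ʳ exp (fromℚ (ι n) *ʳ x) ≈ exp (fromℚ (ι (suc n)) *ʳ x)
  exp-*suc x n = ≈-trans {exp x *ʳ exp (fromℚ (ι n) *ʳ x)} {exp (x +ʳ fromℚ (ι n) *ʳ x)} {exp (fromℚ (ι (suc n)) *ʳ x)} (≈-sym {exp (x +ʳ fromℚ (ι n) *ʳ x)} {exp x *ʳ exp (fromℚ (ι n) *ʳ x)} (exp-+ x (fromℚ (ι n) *ʳ x)))
    (exp-cong {x +ʳ fromℚ (ι n) *ʳ x} {fromℚ (ι (suc n)) *ʳ x} (pointwise (x +ʳ fromℚ (ι n) *ʳ x) (fromℚ (ι (suc n)) *ʳ x) λ k → trans (e (seq x k) (ι n)) (cong (_* seq x k) (sym (ι-suc n)))))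
    where e : ∀ x n → x + n * x ≡ (1ℚ + n) * x
          e = solve-∀ ℚ-ring

  ^ʳ-unique : ∀ (a : ℝ) (f : ℕ → ℝ) → f 0 ≈ 1ℝ → (∀ n → a *ʳ f n ≈ f (suc n)) → ∀ n → a ^ʳ n ≈ f n
  ^ʳ-unique a f h k zero    = ≈-sym {f 0} {1ℝ} h
  ^ʳ-unique a f h k (suc n) = ≈-trans {a *ʳ a ^ʳ n} {a *ʳ f n} {f (suc n)} (≈-* {a} {a} {a ^ʳ n} {f n} (≈-refl {a}) (^ʳ-unique a f h k n)) (k n)

  exp-^ : ∀ x n → exp x ^ʳ n ≈ exp (fromℚ (ι n) *ʳ x)
  exp-^ x = ^ʳ-unique (exp x) (λ n → exp (fromℚ (ι n) *ʳ x)) (exp-*0 x) (exp-*suc x)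

  seq-^ : ∀ y n k → seq (y ^ʳ n) k ≡ seq y k ^ n
  seq-^ y zero    k = refl
  seq-^ y (suc n) k = cong (seq y k *_) (seq-^ y n k)

  seq-expSum : ∀ y n k → seq (expSum y n) k ≡ E (seq y k) n
  seq-expSum y zero    k = refl
  seq-expSum y (suc n) k = cong₂ _+_ (seq-expSum y n k) (cong₂ _*_ (sym (1/!-def n)) (seq-^ y n k))

  module _ {x y : ℝ} where
    open Bounds y

    private
      -- `IsLog` speaks of the limit of the real partial sums, `exp` of their diagonal. This
      -- estimate lets each be exchanged for the other.
      partial : ∀ {δ} → 0ℚ < δ → ∃[ N ] (∀ n → N ℕ.≤ n → Eventually λ k → ∣ seq (exp y) k - seq (expSum y n) k ∣ ≤ δ)
      partial {δ} 0<δ = proj₁ (shift 0<δ) , λ n hn → n ℕ.⊔ proj₁ (shift 0<δ) , λ k hk →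
        subst (λ z → ∣ E (seq y k) k - z ∣ ≤ δ) (sym (seq-expSum y n k)) (proj₂ (shift 0<δ) n hn k (ℕ.m⊔n≤o⇒n≤o n _ hk) k (ℕ.m⊔n≤o⇒m≤o n _ hk))

    isLog : x ≈ exp y → IsLog x y
    isLog h ε (δ , 0<δ , δ≤ε) = proj₁ (partial 0<δ/4) , λ n hn →
      (½ * δ , 0<½* 0<δ , mapᵉ (λ {k} (a , b , c) → by-diff ((seq ε k - (0ℚ + δ)) + (seq (exp y) k + (+ 1 / 4) * δ - seq x k) + (seq (expSum y n) k + (+ 1 / 4) * δ - seq (exp y) k))
         (sub⁺ a ⊕ sub⁺ (∣-∣≤⁻ {seq x k} {seq (exp y) k} b) ⊕ sub⁺ (∣-∣≤⁻ {seq (exp y) k} {seq (expSum y n) k} c)) (e₁ (seq ε k) (seq (exp y) k) (seq x k) (seq (expSum y n) k) δ)) (δ≤ε ⊓ᵉ ≈⇒∣-∣ h ((+ 1 / 4) * δ) 0<δ/4 ⊓ᵉ proj₂ (partial 0<δ/4) n hn)) ,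
      (½ * δ , 0<½* 0<δ , mapᵉ (λ {k} (a , b , c) → by-diff ((seq ε k - (0ℚ + δ)) + (seq x k + (+ 1 / 4) * δ - seq (exp y) k) + (seq (exp y) k + (+ 1 / 4) * δ - seq (expSum y n) k))
         (sub⁺ a ⊕ sub⁺ (∣-∣≤⁻ {seq (exp y) k} {seq x k} (≤-trans (≤-reflexive (∣-∣-sym (seq (exp y) k) (seq x k))) b)) ⊕ sub⁺ (∣-∣≤⁻ {seq (expSum y n) k} {seq (exp y) k} (≤-trans (≤-reflexive (∣-∣-sym (seq (expSum y n) k) (seq (exp y) k))) c))) (e₂ (seq ε k) (seq (exp y) k) (seq x k) (seq (expSum y n) k) δ)) (δ≤ε ⊓ᵉ ≈⇒∣-∣ h ((+ 1 / 4) * δ) 0<δ/4 ⊓ᵉ proj₂ (partial 0<δ/4) n hn))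
      where
      0<δ/4 : 0ℚ < (+ 1 / 4) * δ
      0<δ/4 = positive⁻¹ (+ 1 / 4) ⊛< 0<δ
      e₁ : ∀ ε e x s δ → s - (x - ε + ½ * δ) ≡ (ε - (0ℚ + δ)) + (e + (+ 1 / 4) * δ - x) + (s + (+ 1 / 4) * δ - e)
      e₁ = solve-∀ ℚ-ring
      e₂ : ∀ ε e x s δ → x + ε - (s + ½ * δ) ≡ (ε - (0ℚ + δ)) + (x + (+ 1 / 4) * δ - e) + (e + (+ 1 / 4) * δ - s)
      e₂ = solve-∀ ℚ-ring

    isLog⁻ : IsLog x y → x ≈ exp y
    isLog⁻ h = ∣-∣⇒≈ x (exp y) λ δ 0<δ → close-to δ 0<δ
      where
      close-to : ∀ δ → 0ℚ < δ → Eventually λ k → ∣ seq x k - seq (exp y) k ∣ ≤ δ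
      close-to δ 0<δ = mapᵉ (λ {k} (a , b , c) → ∣-∣≤ {seq x k} {seq (exp y) k}
          (by-diff ((seq (expSum y n) k - (seq x k - ½ * δ + proj₁ lo)) + (seq (exp y) k + ½ * δ - seq (expSum y n) k) + proj₁ lo)
            (sub⁺ a ⊕ sub⁺ (∣-∣≤⁻ {seq (expSum y n) k} {seq (exp y) k} (≤-trans (≤-reflexive (∣-∣-sym (seq (expSum y n) k) (seq (exp y) k))) c)) ⊕ <⇒≤ (proj₁ (proj₂ lo))) (e₁ (seq x k) (seq (expSum y n) k) (seq (exp y) k) δ (proj₁ lo)))
          (by-diff ((seq x k + ½ * δ - (seq (expSum y n) k + proj₁ hi)) + (seq (expSum y n) k + ½ * δ - seq (exp y) k) + proj₁ hi)
            (sub⁺ b ⊕ sub⁺ (∣-∣≤⁻ {seq (exp y) k} {seq (expSum y n) k} c) ⊕ <⇒≤ (proj₁ (proj₂ hi))) (e₂ (seq x k) (seq (expSum y n) k) (seq (exp y) k) δ (proj₁ hi))))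
        (proj₂ (proj₂ lo) ⊓ᵉ proj₂ (proj₂ hi) ⊓ᵉ proj₂ (partial (0<½* 0<δ)) n (ℕ.m≤n⊔m (proj₁ lim) (proj₁ (partial (0<½* 0<δ)))))
        where
        lim = h (fromℚ (½ * δ)) (fromℚ-< (0<½* 0<δ))
        n : ℕ
        n = proj₁ lim ℕ.⊔ proj₁ (partial (0<½* 0<δ))
        lo = proj₁ (proj₂ lim n (ℕ.m≤m⊔n _ _))
        hi = proj₂ (proj₂ lim n (ℕ.m≤m⊔n _ _))
        e₁ : ∀ x s e δ g → e + δ - x ≡ (s - (x - ½ * δ + g)) + (e + ½ * δ - s) + g
        e₁ = solve-∀ ℚ-ring
        e₂ : ∀ x s e δ g → x + δ - e ≡ (x + ½ * δ - (s + g)) + (s + ½ * δ - e) + g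
        e₂ = solve-∀ ℚ-ring

-- Roots of increasing functions by trisection

module Trisecting where
  open Rationals
  open PartialSums
  open RealOrder
  open Exponential
  open ExponentialLaws
  open Inequalities using (vanishing)
  open import Defs using (ℝ; mkℝ; seq; fromℚ; 0ℝ; 1ℝ) renaming (_+_ to _+ʳ_; _*_ to _*ʳ_; _<_ to _<ʳ_)
  open import Data.Integer.Base using (+_)
  open import Data.Rational
  open import Data.Rational.Properties

  exp-⊑-near : ∀ x y {X η} (0≤X : 0ℚ ≤ X) → (Eventually λ n → ∣ seq x n ∣ ≤ X) → (Eventually λ n → ∣ seq y n ∣ ≤ X) → (Eventually λ n → ∣ seq x n - seq y n ∣ ≤ η) →
    exp x ⊑ exp y +ʳ fromℚ (η * proj₁ (E-bounded 0≤X))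
  exp-⊑-near x y {X} {η} 0≤X hx hy h δ 0<δ = mapᵉ (λ {n} (a , b , c) →
      ≤-trans (∣-∣≤⁻ {E (seq x n) n} {E (seq y n) n} (≤-trans (E-lipschitz n a b) (*-mono (0≤∣p∣ (seq x n - seq y n)) (E-nonneg n 0≤X) c (proj₂ (proj₂ (E-bounded 0≤X)) n)))) (≤+ (<⇒≤ 0<δ)))
    (hx ⊓ᵉ hy ⊓ᵉ h)

  -- Bisection would have to decide how G at one point compares with 1. Trisection needs only
  -- `cotrans`, applied to two points where G differs strictly.
  module Trisection (G : ℝ → ℝ) (D : ℚ) (1≤D : 1ℚ ≤ D) (G-mono-< : ∀ {x y} → x <ʳ y → G x <ʳ G y)
    (G-near : ∀ x y η → 0ℚ ≤ η → (Eventually λ n → ∣ seq x n ∣ ≤ 1ℚ) → (Eventually λ n → ∣ seq y n ∣ ≤ 1ℚ) → (Eventually λ n → ∣ seq x n - seq y n ∣ ≤ η) → G x ⊑ G y +ʳ fromℚ (η * D))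
    (G-1<1 : G (fromℚ (- 1ℚ)) <ʳ 1ℝ) (1<G0 : 1ℝ <ʳ G 0ℝ) where

    record Bracket : Set where
      field
        l r  : ℚ
        l<r  : l < r
        Gl<1 : G (fromℚ l) <ʳ 1ℝ
        1<Gr : 1ℝ <ʳ G (fromℚ r)
    open Bracket

    -- Comparing 1 with the values at both third points discards a third of the bracket.
    module Step (s : Bracket) where
      w m₁ m₂ : ℚ
      w = r s - l s
      0<w : 0ℚ < w
      0<w = sub⁺< (l<r s)
      m₁ = l s + (+ 1 / 3) * w
      m₂ = l s + (+ 2 / 3) * w
      0<w/3 : 0ℚ < (+ 1 / 3) * w
      0<w/3 = positive⁻¹ (+ 1 / 3) ⊛< 0<w
      m₁<m₂ : m₁ < m₂
      m₁<m₂ = by-diff< ((+ 1 / 3) * w) 0<w/3 (e (l s) w)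
        where e : ∀ l w → l + (+ 2 / 3) * w - (l + (+ 1 / 3) * w) ≡ (+ 1 / 3) * w
              e = solve-∀ ℚ-ring
      m₂<r : m₂ < r s
      m₂<r = by-diff< ((+ 1 / 3) * w) 0<w/3 (e (l s) (r s))
        where e : ∀ l r → r - (l + (+ 2 / 3) * (r - l)) ≡ (+ 1 / 3) * (r - l)
              e = solve-∀ ℚ-ring
      l<m₁ : l s < m₁
      l<m₁ = by-diff< ((+ 1 / 3) * w) 0<w/3 (e (l s) w)
        where e : ∀ l w → l + (+ 1 / 3) * w - l ≡ (+ 1 / 3) * w
              e = solve-∀ ℚ-ring
      Shrunk : Bracket → Set
      Shrunk s′ = l s ≤ l s′ × r s′ ≤ r s × r s′ - l s′ ≡ (+ 2 / 3) * w
      pick : G (fromℚ m₁) <ʳ 1ℝ ⊎ 1ℝ <ʳ G (fromℚ m₂) → ∃[ s′ ] Shrunk s′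
      pick (inj₁ h) = record { l = m₁ ; r = r s ; l<r = <-trans m₁<m₂ m₂<r ; Gl<1 = h ; 1<Gr = 1<Gr s } , <⇒≤ l<m₁ , ≤-refl , e (l s) (r s)
        where e : ∀ l r → r - (l + (+ 1 / 3) * (r - l)) ≡ (+ 2 / 3) * (r - l)
              e = solve-∀ ℚ-ring
      pick (inj₂ h) = record { l = l s ; r = m₂ ; l<r = <-trans l<m₁ m₁<m₂ ; Gl<1 = Gl<1 s ; 1<Gr = h } , ≤-refl , <⇒≤ m₂<r , e (l s) w
        where e : ∀ l w → l + (+ 2 / 3) * w - l ≡ (+ 2 / 3) * w
              e = solve-∀ ℚ-ring
      next : ∃[ s′ ] Shrunk s′
      next = pick (cotrans {G (fromℚ m₁)} {G (fromℚ m₂)} (G-mono-< {fromℚ m₁} {fromℚ m₂} (fromℚ-< m₁<m₂)) 1ℝ)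

    brackets : ℕ → Bracket
    brackets zero    = record { l = - 1ℚ ; r = 0ℚ ; l<r = from-yes (- 1ℚ <? 0ℚ) ; Gl<1 = G-1<1 ; 1<Gr = 1<G0 }
    brackets (suc n) = proj₁ (Step.next (brackets n))

    lo hi : ℕ → ℚ
    lo n = l (brackets n)
    hi n = r (brackets n)

    lo-step : ∀ n → lo n ≤ lo (suc n)
    lo-step n = proj₁ (proj₂ (Step.next (brackets n)))
    hi-step : ∀ n → hi (suc n) ≤ hi n
    hi-step n = proj₁ (proj₂ (proj₂ (Step.next (brackets n))))

    width : ∀ n → hi n - lo n ≡ (1ℚ - (+ 1 / 3)) ^ n
    width zero    = refl
    width (suc n) = trans (proj₂ (proj₂ (proj₂ (Step.next (brackets n))))) (cong ((1ℚ - (+ 1 / 3)) *_) (width n))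

    lo-mono : ∀ k n → lo n ≤ lo (k ℕ.+ n)
    lo-mono zero    n = ≤-refl
    lo-mono (suc k) n = ≤-trans (lo-mono k n) (lo-step (k ℕ.+ n))

    hi-mono : ∀ k n → hi (k ℕ.+ n) ≤ hi n
    hi-mono zero    n = ≤-refl
    hi-mono (suc k) n = ≤-trans (hi-step (k ℕ.+ n)) (hi-mono k n)

    lo-mono-≤ : ∀ {m n} → m ℕ.≤ n → lo m ≤ lo n
    lo-mono-≤ {m} {n} h = subst (λ j → lo m ≤ lo j) (ℕ.m∸n+n≡m h) (lo-mono (n ℕ.∸ m) m)

    lo≤hi : ∀ {m n} → m ℕ.≤ n → lo n ≤ hi m
    lo≤hi {m} {n} h = ≤-trans (<⇒≤ (l<r (brackets n))) (subst (λ j → hi j ≤ hi m) (ℕ.m∸n+n≡m h) (hi-mono (n ℕ.∸ m) m))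

    lo-close : ∀ {N m n} → N ℕ.≤ m → N ℕ.≤ n → lo m ≤ lo n + (1ℚ - (+ 1 / 3)) ^ N
    lo-close {N} {m} {n} hm hn = ≤-trans (lo≤hi hm) (by-diff (lo n - lo N) (sub⁺ (lo-mono-≤ hn)) (trans (cong (λ z → lo n + z - hi N) (sym (width N))) (e (lo n) (hi N) (lo N))))
      where e : ∀ a h l → a + (h - l) - h ≡ a - l
            e = solve-∀ ℚ-ring

    shrinking : ∀ {δ} → 0ℚ < δ → ∃[ N ] (1ℚ - (+ 1 / 3)) ^ N ≤ δ
    shrinking 0<δ = let N , h = vanishing (positive⁻¹ (+ 1 / 3)) (from-yes ((+ 1 / 3) ≤? 1ℚ)) 0<δ in N , h N ℕ.≤-refl

    b : ℝ
    b = mkℝ lo λ ε 0<ε → let N , h = shrinking (0<½* 0<ε) in N , λ m n hm hn →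
      ≤-<-trans (∣-∣≤ {lo m} {lo n} (≤-trans (lo-close hm hn) (+-monoʳ-≤ (lo n) h)) (≤-trans (lo-close hn hm) (+-monoʳ-≤ (lo m) h))) (by-diff< (½ * ε) (0<½* 0<ε) (e ε))
      where e : ∀ ε → ε - ½ * ε ≡ ½ * ε
            e = solve-∀ ℚ-ring

    lo-bounded : ∀ n → ∣ lo n ∣ ≤ 1ℚ
    lo-bounded n = ∣∣≤ (≤-trans (lo≤hi {0} {n} ℕ.z≤n) 0≤1) (≤-trans (neg-antimono-≤ (lo-mono-≤ {0} {n} ℕ.z≤n)) ≤-refl)

    hi-bounded : ∀ n → ∣ hi n ∣ ≤ 1ℚ
    hi-bounded n = ∣∣≤ (≤-trans (subst (λ j → hi j ≤ 0ℚ) (ℕ.+-identityʳ n) (hi-mono n 0)) 0≤1) (≤-trans (neg-antimono-≤ (≤-trans (lo-mono-≤ {0} {n} ℕ.z≤n) (<⇒≤ (l<r (brackets n))))) ≤-refl)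

    lo≤b : ∀ n → Eventually λ k → lo n ≤ lo k × lo k ≤ hi n
    lo≤b n = n , λ k h → lo-mono-≤ h , lo≤hi h

    -- A bracket of width at most ε contains b, and `G-near` turns this into G b being within ε D of
    -- 1 on either side.
    root : G b ≈ 1ℝ
    root = mk≈ (⊑-limit (G b) 1ℝ upper) (⊑-limit 1ℝ (G b) lower)
      where
      upper : ∀ δ → 0ℚ < δ → G b ⊑ 1ℝ +ʳ fromℚ δ
      upper δ 0<δ = ⊑-trans {G b} {G (fromℚ (lo N)) +ʳ fromℚ (ε * D)} {1ℝ +ʳ fromℚ δ}
        (G-near b (fromℚ (lo N)) ε (<⇒≤ 0<ε) (alwaysᵉ lo-bounded) (alwaysᵉ λ _ → lo-bounded N)
          (mapᵉ (λ {k} (p , q) → ∣-∣≤ {lo k} {lo N} (≤-trans q (≤-trans (≤-reflexive (e (hi N) (lo N))) (+-monoʳ-≤ (lo N) (≤-trans (≤-reflexive (width N)) hN)))) (≤-trans p (≤+ (<⇒≤ 0<ε)))) (lo≤b N)))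
        (⊑-+ {G (fromℚ (lo N))} {1ℝ} {fromℚ (ε * D)} {fromℚ δ} (<⇒⊑ {G (fromℚ (lo N))} {1ℝ} (Gl<1 (brackets N))) (fromℚ-⊑ (≤-reflexive εD)))
        where
        sd = scale-down 1≤D 0<δ
        ε = proj₁ sd
        0<ε = proj₁ (proj₂ sd)
        εD = proj₂ (proj₂ sd)
        N = proj₁ (shrinking 0<ε)
        hN = proj₂ (shrinking 0<ε)
        e : ∀ h l → h ≡ l + (h - l)
        e = solve-∀ ℚ-ring
      lower : ∀ δ → 0ℚ < δ → 1ℝ ⊑ G b +ʳ fromℚ δ
      lower δ 0<δ = ⊑-trans {1ℝ} {G (fromℚ (hi N))} {G b +ʳ fromℚ δ} (<⇒⊑ {1ℝ} {G (fromℚ (hi N))} (1<Gr (brackets N)))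
        (⊑-trans {G (fromℚ (hi N))} {G b +ʳ fromℚ (ε * D)} {G b +ʳ fromℚ δ}
          (G-near (fromℚ (hi N)) b ε (<⇒≤ 0<ε) (alwaysᵉ λ _ → hi-bounded N) (alwaysᵉ lo-bounded)
            (mapᵉ (λ {k} (p , q) → ∣-∣≤ {hi N} {lo k} (≤-trans (≤-reflexive (e (hi N) (lo N))) (+-mono-≤ p (≤-trans (≤-reflexive (width N)) hN))) (≤-trans q (≤+ (<⇒≤ 0<ε)))) (lo≤b N)))
          (⊑-+ {G b} {G b} {fromℚ (ε * D)} {fromℚ δ} (⊑-refl {G b}) (fromℚ-⊑ (≤-reflexive εD))))
        where
        sd = scale-down 1≤D 0<δ
        ε = proj₁ sd
        0<ε = proj₁ (proj₂ sd)
        εD = proj₂ (proj₂ sd)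
        N = proj₁ (shrinking 0<ε)
        hN = proj₂ (shrinking 0<ε)
        e : ∀ h l → h ≡ l + (h - l)
        e = solve-∀ ℚ-ring

    -1⊑b : fromℚ (- 1ℚ) ⊑ b
    -1⊑b δ 0<δ = alwaysᵉ λ n → ≤-trans (lo-mono-≤ {0} {n} ℕ.z≤n) (≤+ (<⇒≤ 0<δ))

    b⊑0 : b ⊑ 0ℝ
    b⊑0 δ 0<δ = alwaysᵉ λ n → ≤-trans (lo≤hi {0} {n} ℕ.z≤n) (≤+ (<⇒≤ 0<δ))

  module Sum (C : ℝ) (0⊑C : 0ℝ ⊑ C) where
    G : ℝ → ℝ
    G t = exp (C *ʳ t) +ʳ exp t

    C*-mono : ∀ {x y} → x ⊑ y → C *ʳ x ⊑ C *ʳ y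
    C*-mono {x} {y} = ⊑-*ˡ {x} {y} {C} 0⊑C

    G-mono-< : ∀ {x y} → x <ʳ y → G x <ʳ G y
    G-mono-< {x} {y} h = <ʳ-resp {exp x +ʳ exp (C *ʳ x)} {G x} {exp y +ʳ exp (C *ʳ y)} {G y}
      (pointwise (exp x +ʳ exp (C *ʳ x)) (G x) λ n → +-comm (seq (exp x) n) (seq (exp (C *ʳ x)) n)) (pointwise (exp y +ʳ exp (C *ʳ y)) (G y) λ n → +-comm (seq (exp y) n) (seq (exp (C *ʳ y)) n))
      (+ʳ-mono-<⊑ {exp x} {exp y} {exp (C *ʳ x)} {exp (C *ʳ y)} (exp-mono-< {x} {y} h) (exp-mono {C *ʳ x} {C *ʳ y} (C*-mono {x} {y} (<⇒⊑ {x} {y} h))))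

    1<G0 : 1ℝ <ʳ G 0ℝ
    1<G0 = <ʳ-resp {0ℝ +ʳ 1ℝ} {1ℝ} {1ℝ +ʳ 1ℝ} {G 0ℝ} (pointwise (0ℝ +ʳ 1ℝ) 1ℝ λ n → +-identityˡ 1ℚ)
      (≈-sym {G 0ℝ} {1ℝ +ʳ 1ℝ} (≈-+ {exp (C *ʳ 0ℝ)} {1ℝ} {exp 0ℝ} {1ℝ} (≈-trans {exp (C *ʳ 0ℝ)} {exp 0ℝ} {1ℝ} (exp-cong {C *ʳ 0ℝ} {0ℝ} (pointwise (C *ʳ 0ℝ) 0ℝ λ n → *-zeroʳ (seq C n))) exp-0) exp-0))
      (+ʳ-mono-<⊑ {0ℝ} {1ℝ} {1ℝ} {1ℝ} (fromℚ-< 0<1) (⊑-refl {1ℝ}))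

    B : ℚ
    B = proj₁ (bounded C)
    1≤B : 1ℚ ≤ B
    1≤B = proj₁ (proj₂ (bounded C))
    0≤B : 0ℚ ≤ B
    0≤B = ≤-trans 0≤1 1≤B
    K₁ K₂ : ℚ
    K₁ = proj₁ (E-bounded 0≤B)
    K₂ = proj₁ (E-bounded 0≤1)
    D : ℚ
    -- The Lipschitz constant on [-1, 1]: the first summand for exp (C t), the second for exp t.
    D = B * K₁ + K₂
    1≤D : 1ℚ ≤ D
    1≤D = ≤-trans (proj₁ (proj₂ (E-bounded 0≤1))) (≤-trans (≤-reflexive (sym (+-identityˡ K₂))) (+-monoˡ-≤ K₂ (0≤B ⊛ ≤-trans 0≤1 (proj₁ (proj₂ (E-bounded 0≤B))))))

    G-near : ∀ x y η → 0ℚ ≤ η → (Eventually λ n → ∣ seq x n ∣ ≤ 1ℚ) → (Eventually λ n → ∣ seq y n ∣ ≤ 1ℚ) → (Eventually λ n → ∣ seq x n - seq y n ∣ ≤ η) →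
      G x ⊑ G y +ʳ fromℚ (η * D)
    G-near x y η 0≤η hx hy h = ⊑-resp {G x} {G x} {(exp (C *ʳ y) +ʳ fromℚ (B * η * K₁)) +ʳ (exp y +ʳ fromℚ (η * K₂))} {G y +ʳ fromℚ (η * D)}
      (≈-refl {G x}) (pointwise ((exp (C *ʳ y) +ʳ fromℚ (B * η * K₁)) +ʳ (exp y +ʳ fromℚ (η * K₂))) (G y +ʳ fromℚ (η * D)) λ n → e (seq (exp (C *ʳ y)) n) (seq (exp y) n) B η K₁ K₂)
      (⊑-+ {exp (C *ʳ x)} {exp (C *ʳ y) +ʳ fromℚ (B * η * K₁)} {exp x} {exp y +ʳ fromℚ (η * K₂)}
        (exp-⊑-near (C *ʳ x) (C *ʳ y) 0≤B (scaled {x} hx) (scaled {y} hy) (mapᵉ (λ {n} (p , q) → ≤-trans (≤-reflexive (trans (cong ∣_∣ (e′ (seq C n) (seq x n) (seq y n))) (∣p*q∣≡∣p∣*∣q∣ (seq C n) (seq x n - seq y n)))) (*-mono (0≤∣p∣ (seq C n)) (0≤∣p∣ (seq x n - seq y n)) p q)) (proj₂ (proj₂ (bounded C)) ⊓ᵉ h)))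
        (exp-⊑-near x y 0≤1 hx hy h))
      where
      e : ∀ a b B η K L → a + B * η * K + (b + η * L) ≡ a + b + η * (B * K + L)
      e = solve-∀ ℚ-ring
      e′ : ∀ c x y → c * x - c * y ≡ c * (x - y)
      e′ = solve-∀ ℚ-ring
      scaled : ∀ {z} → (Eventually λ n → ∣ seq z n ∣ ≤ 1ℚ) → Eventually λ n → ∣ seq (C *ʳ z) n ∣ ≤ B
      scaled {z} hz = mapᵉ (λ {n} (p , q) → ≤-trans (≤-reflexive (∣p*q∣≡∣p∣*∣q∣ (seq C n) (seq z n))) (≤-trans (*-mono (0≤∣p∣ (seq C n)) (0≤∣p∣ (seq z n)) p q) (≤-reflexive (*-identityʳ B)))) (proj₂ (proj₂ (bounded C)) ⊓ᵉ hz)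

-- Existence of the root b

module Existence where
  open Rationals
  open RealOrder
  open Exponential
  open ExponentialLaws
  open Trisecting
  open import Defs using (ℝ; seq; fromℚ; 0ℝ; 1ℝ; ½ℝ) renaming (_+_ to _+ʳ_; _*_ to _*ʳ_; -_ to -ʳ_; _-_ to _-ʳ_; _<_ to _<ʳ_)
  open import Data.Integer.Base using (+_)
  open import Data.Rational
  open import Data.Rational.Properties

  -- 2/e < 1, because e is the square of exp ½ ≥ 3/2 and 9/4 > 2.
  exp-1<½ : exp (fromℚ (- 1ℚ)) +ʳ exp (fromℚ (- 1ℚ)) <ʳ 1ℝ
  exp-1<½ = from (exp (fromℚ (- 1ℚ))) (exp 1ℝ) (exp ½ℝ) (0<exp (fromℚ (- 1ℚ)))
    (≈-trans {exp 1ℝ *ʳ exp (fromℚ (- 1ℚ))} {exp 1ℝ *ʳ exp (-ʳ 1ℝ)} {1ℝ} (≈-* {exp 1ℝ} {exp 1ℝ} {exp (fromℚ (- 1ℚ))} {exp (-ʳ 1ℝ)} (≈-refl {exp 1ℝ}) (exp-cong {fromℚ (- 1ℚ)} { -ʳ 1ℝ} (pointwise (fromℚ (- 1ℚ)) (-ʳ 1ℝ) λ _ → refl))) (exp-neg 1ℝ))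
    (≈-trans {exp 1ℝ} {exp (½ℝ +ʳ ½ℝ)} {exp ½ℝ *ʳ exp ½ℝ} (exp-cong {1ℝ} {½ℝ +ʳ ½ℝ} (pointwise 1ℝ (½ℝ +ʳ ½ℝ) λ _ → refl)) (exp-+ ½ℝ ½ℝ))
    (1+x⊑exp ½ℝ (fromℚ-⊑ (nonNegative⁻¹ ½)))
    where
    from : ∀ x y z → 0ℝ <ʳ x → y *ʳ x ≈ 1ℝ → y ≈ z *ʳ z → 1ℝ +ʳ ½ℝ ⊑ z → x +ʳ x <ʳ 1ℝ
    from x y z 0<x yx yz h = <ʳ-resp {fromℚ (+ 2 / 1) *ʳ x} {x +ʳ x} {y *ʳ x} {1ℝ} (pointwise (fromℚ (+ 2 / 1) *ʳ x) (x +ʳ x) λ n → e (seq x n)) yx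
      (<ʳ-*ʳ {fromℚ (+ 2 / 1)} {y} {x} 0<x (<ʳ-resp {fromℚ (+ 2 / 1)} {fromℚ (+ 2 / 1)} {z *ʳ z} {y} (≈-refl {fromℚ (+ 2 / 1)}) (≈-sym yz)
        (<-⊑-trans {fromℚ (+ 2 / 1)} {fromℚ (+ 9 / 4)} {z *ʳ z} (fromℚ-< (from-yes ((+ 2 / 1) <? (+ 9 / 4)))) (⊑-* {1ℝ +ʳ ½ℝ} {z} {1ℝ +ʳ ½ℝ} {z} 0⊑ (⊑-trans {0ℝ} {1ℝ +ʳ ½ℝ} {z} 0⊑ h) h h))))
      where
      e : ∀ a → (+ 2 / 1) * a ≡ a + a
      e = solve-∀ ℚ-ring
      0⊑ : 0ℝ ⊑ 1ℝ +ʳ ½ℝ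
      0⊑ = fromℚ-⊑ {0ℚ} {1ℚ + ½} (from-yes (0ℚ ≤? 1ℚ + ½))

  module Exists (C : ℝ) (1<C : 1ℝ <ʳ C) where
    0<C : 0ℝ <ʳ C
    0<C = <ʳ-trans {0ℝ} {1ℝ} {C} (fromℚ-< 0<1) 1<C
    open Sum C (<⇒⊑ {0ℝ} {C} 0<C)

    G-1<1 : G (fromℚ (- 1ℚ)) <ʳ 1ℝ
    G-1<1 = ⊑-<-trans {G (fromℚ (- 1ℚ))} {exp (fromℚ (- 1ℚ)) +ʳ exp (fromℚ (- 1ℚ))} {1ℝ}
      (⊑-+ {exp (C *ʳ fromℚ (- 1ℚ))} {exp (fromℚ (- 1ℚ))} {exp (fromℚ (- 1ℚ))} {exp (fromℚ (- 1ℚ))}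
        (exp-mono {C *ʳ fromℚ (- 1ℚ)} {fromℚ (- 1ℚ)} (⊑-resp { -ʳ C} {C *ʳ fromℚ (- 1ℚ)} { -ʳ 1ℝ} {fromℚ (- 1ℚ)} (pointwise (-ʳ C) (C *ʳ fromℚ (- 1ℚ)) λ n → e (seq C n)) (pointwise (-ʳ 1ℝ) (fromℚ (- 1ℚ)) λ _ → refl) (⊑-neg {1ℝ} {C} (<⇒⊑ {1ℝ} {C} 1<C))))
        (⊑-refl {exp (fromℚ (- 1ℚ))}))
      exp-1<½
      where e : ∀ a → - a ≡ a * - 1ℚ
            e = solve-∀ ℚ-ring

    open Trisection G D 1≤D (λ {x} {y} → G-mono-< {x} {y}) G-near G-1<1 1<G0 using (b; root; -1⊑b; b⊑0)

    G-root : ∃[ b ] (G b ≈ 1ℝ × fromℚ (- 1ℚ) ⊑ b × b ⊑ 0ℝ)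
    G-root = b , root , -1⊑b , b⊑0

-- Properties of p, q = 1 - p and s = p^(-1/2)

module SolutionProperties where
  open Rationals
  open RealOrder
  open Exponential
  open ExponentialLaws
  open Trisecting
  open import Defs using (ℝ; seq; fromℚ; 0ℝ; 1ℝ; ½ℝ) renaming (_+_ to _+ʳ_; _*_ to _*ʳ_; -_ to -ʳ_; _-_ to _-ʳ_; _<_ to _<ʳ_)
  open import Data.Integer.Base using (+_)
  open import Data.Rational
  open import Data.Rational.Properties

  -- With q = 1 - p the hypotheses give p (1 + (C - 1) h) ≤ q and (1 - h/2)² ≤ q, hence C p² + (C - 1) p h²/4 ≤ q².
  square-gap : ∀ C p q h f e → 0ℝ <ʳ C -ʳ 1ℝ → 0ℝ <ʳ p → 0ℝ <ʳ h → h ⊑ 1ℝ → 1ℝ -ʳ p ≈ q → f *ʳ f ≈ q → q ≈ p *ʳ e → 1ℝ -ʳ ½ℝ *ʳ h ⊑ f → 1ℝ +ʳ (C -ʳ 1ℝ) *ʳ h ⊑ e →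
    C *ʳ (p *ʳ p) <ʳ (1ℝ -ʳ p) *ʳ (1ℝ -ʳ p)
  square-gap C p q h f e 0<C-1 0<p 0<h h⊑1 pq ff qpe hf he = <-⊑-trans {C *ʳ (p *ʳ p)} {C *ʳ (p *ʳ p) +ʳ m} {r} strict bound
    where
    0⊑p = <⇒⊑ {0ℝ} {p} 0<p
    0⊑C-1 = <⇒⊑ {0ℝ} {C -ʳ 1ℝ} 0<C-1
    q′ = 1ℝ -ʳ p
    r = q′ *ʳ q′
    k = h *ʳ h *ʳ fromℚ (+ 1 / 4)
    m = (C -ʳ 1ℝ) *ʳ p *ʳ k
    0<m : 0ℝ <ʳ m
    0<m = 0<ʳ* {(C -ʳ 1ℝ) *ʳ p} {k} (0<ʳ* {C -ʳ 1ℝ} {p} 0<C-1 0<p) (0<ʳ* {h *ʳ h} {fromℚ (+ 1 / 4)} (0<ʳ* {h} {h} 0<h 0<h) (fromℚ-< (positive⁻¹ (+ 1 / 4))))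
    strict : C *ʳ (p *ʳ p) <ʳ C *ʳ (p *ʳ p) +ʳ m
    strict = <ʳ-resp {0ℝ +ʳ C *ʳ (p *ʳ p)} {C *ʳ (p *ʳ p)} {m +ʳ C *ʳ (p *ʳ p)} {C *ʳ (p *ʳ p) +ʳ m} (pointwise (0ℝ +ʳ C *ʳ (p *ʳ p)) (C *ʳ (p *ʳ p)) λ n → +-identityˡ _) (pointwise (m +ʳ C *ʳ (p *ʳ p)) (C *ʳ (p *ʳ p) +ʳ m) λ n → +-comm (seq m n) _)
      (+ʳ-mono-<⊑ {0ℝ} {m} {C *ʳ (p *ʳ p)} {C *ʳ (p *ʳ p)} 0<m (⊑-refl {C *ʳ (p *ʳ p)}))
    g = 1ℝ -ʳ ½ℝ *ʳ h
    0⊑g : 0ℝ ⊑ g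
    0⊑g δ 0<δ = mapᵉ (λ {n} a → by-diff (½ * (1ℚ + δ - seq h n) + (½ * δ + ½)) (nonNegative⁻¹ ½ ⊛ sub⁺ a ⊕ (<⇒≤ (0<½* 0<δ) ⊕ nonNegative⁻¹ ½)) (e₁ (seq h n) δ)) (h⊑1 δ 0<δ)
      where e₁ : ∀ h δ → 1ℚ - ½ * h + δ - 0ℚ ≡ ½ * (1ℚ + δ - h) + (½ * δ + ½)
            e₁ = solve-∀ ℚ-ring
    gg⊑q′ : g *ʳ g ⊑ q′
    gg⊑q′ = ⊑-trans {g *ʳ g} {f *ʳ f} {q′} (⊑-* {g} {f} {g} {f} 0⊑g (⊑-trans {0ℝ} {g} {f} 0⊑g hf) hf hf) (below (≈-trans {f *ʳ f} {q} {q′} ff (≈-sym {q′} {q} pq)))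
    u = 1ℝ +ʳ (C -ʳ 1ℝ) *ʳ h
    pu⊑q′ : p *ʳ u ⊑ q′
    pu⊑q′ = ⊑-trans {p *ʳ u} {p *ʳ e} {q′} (⊑-*ˡ {u} {e} {p} 0⊑p he) (below (≈-trans {p *ʳ e} {q} {q′} (≈-sym {q} {p *ʳ e} qpe) (≈-sym {q′} {q} pq)))
    d = (q′ -ʳ p *ʳ u) +ʳ ((C -ʳ 1ℝ) *ʳ p) *ʳ (q′ -ʳ g *ʳ g)
    0⊑d : 0ℝ ⊑ d
    0⊑d = ⊑-resp {0ℝ +ʳ 0ℝ} {0ℝ} {d} {d} (pointwise (0ℝ +ʳ 0ℝ) 0ℝ λ _ → refl) (≈-refl {d}) (⊑-+ {0ℝ} {q′ -ʳ p *ʳ u} {0ℝ} {((C -ʳ 1ℝ) *ʳ p) *ʳ (q′ -ʳ g *ʳ g)} (⊑⇒0⊑ {p *ʳ u} {q′} pu⊑q′)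
      (0⊑* {(C -ʳ 1ℝ) *ʳ p} {q′ -ʳ g *ʳ g} (0⊑* {C -ʳ 1ℝ} {p} 0⊑C-1 0⊑p) (⊑⇒0⊑ {g *ʳ g} {q′} gg⊑q′)))
    bound : C *ʳ (p *ʳ p) +ʳ m ⊑ r
    bound = 0⊑⇒⊑ {C *ʳ (p *ʳ p) +ʳ m} {r} (⊑-resp {0ℝ} {0ℝ} {d} {r -ʳ (C *ʳ (p *ʳ p) +ʳ m)} (≈-refl {0ℝ}) (pointwise d (r -ʳ (C *ʳ (p *ʳ p) +ʳ m)) λ n → e₂ (seq C n) (seq p n) (seq h n)) 0⊑d)
      where e₂ : ∀ C p h → (1ℚ - p - p * (1ℚ + (C - 1ℚ) * h)) + (C - 1ℚ) * p * (1ℚ - p - (1ℚ - ½ * h) * (1ℚ - ½ * h))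
                 ≡ (1ℚ - p) * (1ℚ - p) - (C * (p * p) + (C - 1ℚ) * p * (h * h * (+ 1 / 4)))
            e₂ = solve-∀ ℚ-ring

  module Solution (C a b p q s : ℝ) (1<C : 1ℝ <ʳ C) (a≈C*b : a ≈ C *ʳ b) (p≈exp-a : p ≈ exp a) (q≈exp-b : q ≈ exp b) (s≈exp : s ≈ exp (-ʳ (½ℝ *ʳ a)))
    (p+q≈1 : p +ʳ q ≈ 1ℝ) (-1⊑b : fromℚ (- 1ℚ) ⊑ b) (b⊑0 : b ⊑ 0ℝ) where
    0<C : 0ℝ <ʳ C
    0<C = <ʳ-trans {0ℝ} {1ℝ} {C} (fromℚ-< 0<1) 1<C
    open Sum C (<⇒⊑ {0ℝ} {C} 0<C) using (G; G-mono-<)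

    root : G b ≈ 1ℝ
    root = ≈-trans {G b} {p +ʳ q} {1ℝ} (≈-+ {exp (C *ʳ b)} {p} {exp b} {q} (≈-sym {p} {exp (C *ʳ b)} (≈-trans {p} {exp a} {exp (C *ʳ b)} p≈exp-a (exp-cong {a} {C *ʳ b} a≈C*b))) (≈-sym {q} {exp b} q≈exp-b)) p+q≈1

    unique-root : ∀ x → G x ≈ 1ℝ → x ≈ b
    unique-root x h = mk≈ (≤⇒⊑ {x} {b} λ b<x → <ʳ-irrefl {G x} {G b} (below (≈-trans {G x} {1ℝ} {G b} h (≈-sym {G b} {1ℝ} root))) (G-mono-< {b} {x} b<x))
      (≤⇒⊑ {b} {x} λ x<b → <ʳ-irrefl {G b} {G x} (below (≈-trans {G b} {1ℝ} {G x} root (≈-sym {G x} {1ℝ} h))) (G-mono-< {x} {b} x<b))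

    h : ℝ
    h = -ʳ b

    0<p : 0ℝ <ʳ p
    0<p = <ʳ-resp {0ℝ} {0ℝ} {exp a} {p} (≈-refl {0ℝ}) (≈-sym {p} {exp a} p≈exp-a) (0<exp a)

    q≈1-p : 1ℝ -ʳ p ≈ q
    q≈1-p = from p q p+q≈1
      where
      from : ∀ p q → p +ʳ q ≈ 1ℝ → 1ℝ -ʳ p ≈ q
      from p q h = ≈-trans {1ℝ -ʳ p} {(p +ʳ q) -ʳ p} {q} (≈-+ {1ℝ} {p +ʳ q} { -ʳ p} { -ʳ p} (≈-sym {p +ʳ q} {1ℝ} h) (≈-refl { -ʳ p})) (pointwise ((p +ʳ q) -ʳ p) q λ n → e (seq p n) (seq q n))
        where e : ∀ a b → a + b - a ≡ b
              e = solve-∀ ℚ-ring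

    0⊑h : 0ℝ ⊑ h
    0⊑h = ⊑-resp { -ʳ 0ℝ} {0ℝ} { -ʳ b} {h} (pointwise (-ʳ 0ℝ) 0ℝ λ _ → refl) (≈-refl {h}) (⊑-neg {b} {0ℝ} b⊑0)

    -- exp x (1 - x) ≤ 1 is multiplied by exp (- x).
    1-x⊑exp- : ∀ x → 0ℝ ⊑ x → 1ℝ -ʳ x ⊑ exp (-ʳ x)
    1-x⊑exp- x 0⊑x = from (exp x) (exp (-ʳ x)) x (exp-neg x) (0⊑exp (-ʳ x)) (exp*1-x⊑1 x 0⊑x)
      where
      from : ∀ e f x → e *ʳ f ≈ 1ℝ → 0ℝ ⊑ f → e *ʳ (1ℝ -ʳ x) ⊑ 1ℝ → 1ℝ -ʳ x ⊑ f
      from e f x ef 0⊑f k = ⊑-resp {(e *ʳ (1ℝ -ʳ x)) *ʳ f} {1ℝ -ʳ x} {1ℝ *ʳ f} {f}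
        (≈-trans {(e *ʳ (1ℝ -ʳ x)) *ʳ f} {(e *ʳ f) *ʳ (1ℝ -ʳ x)} {1ℝ -ʳ x} (pointwise ((e *ʳ (1ℝ -ʳ x)) *ʳ f) ((e *ʳ f) *ʳ (1ℝ -ʳ x)) λ n → r (seq e n) (1ℚ - seq x n) (seq f n))
          (≈-trans {(e *ʳ f) *ʳ (1ℝ -ʳ x)} {1ℝ *ʳ (1ℝ -ʳ x)} {1ℝ -ʳ x} (≈-* {e *ʳ f} {1ℝ} {1ℝ -ʳ x} {1ℝ -ʳ x} ef (≈-refl {1ℝ -ʳ x})) (pointwise (1ℝ *ʳ (1ℝ -ʳ x)) (1ℝ -ʳ x) λ n → *-identityˡ _)))
        (pointwise (1ℝ *ʳ f) f λ n → *-identityˡ (seq f n))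
        (⊑-*ʳ {e *ʳ (1ℝ -ʳ x)} {1ℝ} {f} 0⊑f k)
        where r : ∀ a b c → a * b * c ≡ a * c * b
              r = solve-∀ ℚ-ring

    exp-h≈q : exp (-ʳ h) ≈ q
    exp-h≈q = ≈-trans {exp (-ʳ h)} {exp b} {q} (exp-cong { -ʳ h} {b} (pointwise (-ʳ h) b λ n → e (seq b n))) (≈-sym {q} {exp b} q≈exp-b)
      where e : ∀ a → - - a ≡ a
            e = solve-∀ ℚ-ring

    -- 1 - h ≤ exp (- h) = q = 1 - p. Only b ≤ 0 is given; strictness of h = - b > 0 is recovered
    -- from 0 < p by this bound.
    p⊑h : p ⊑ h
    p⊑h = from p q h q≈1-p (⊑-resp {1ℝ -ʳ h} {1ℝ -ʳ h} {exp (-ʳ h)} {q} (≈-refl {1ℝ -ʳ h}) exp-h≈q (1-x⊑exp- h 0⊑h))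
      where
      from : ∀ p q h → 1ℝ -ʳ p ≈ q → 1ℝ -ʳ h ⊑ q → p ⊑ h
      from p q h e k = 0⊑⇒⊑ {p} {h} (⊑-resp {0ℝ} {0ℝ} {(1ℝ -ʳ p) -ʳ (1ℝ -ʳ h)} {h -ʳ p} (≈-refl {0ℝ}) (pointwise ((1ℝ -ʳ p) -ʳ (1ℝ -ʳ h)) (h -ʳ p) λ n → r (seq p n) (seq h n))
        (⊑⇒0⊑ {1ℝ -ʳ h} {1ℝ -ʳ p} (⊑-trans {1ℝ -ʳ h} {q} {1ℝ -ʳ p} k (above e))))
        where r : ∀ a b → (1ℚ - a) - (1ℚ - b) ≡ b - a
              r = solve-∀ ℚ-ring

    0<h : 0ℝ <ʳ h
    0<h = <-⊑-trans {0ℝ} {p} {h} 0<p p⊑h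

    b<0 : b <ʳ 0ℝ
    b<0 = -ʳ-pos⁻ {b} {0ℝ} (<ʳ-resp {0ℝ} {0ℝ} {h} {0ℝ -ʳ b} (≈-refl {0ℝ}) (pointwise h (0ℝ -ʳ b) λ n → sym (+-identityˡ (- seq b n))) 0<h)

    0<C-1 : 0ℝ <ʳ C -ʳ 1ℝ
    0<C-1 = -ʳ-pos {1ℝ} {C} 1<C

    a<b : a <ʳ b
    a<b = -ʳ-pos⁻ {a} {b} (<ʳ-resp {0ℝ} {0ℝ} {(C -ʳ 1ℝ) *ʳ h} {b -ʳ a} (≈-refl {0ℝ})
      (≈-trans {(C -ʳ 1ℝ) *ʳ h} {b -ʳ C *ʳ b} {b -ʳ a} (pointwise ((C -ʳ 1ℝ) *ʳ h) (b -ʳ C *ʳ b) λ n → e (seq C n) (seq b n)) (≈-+ {b} {b} { -ʳ (C *ʳ b)} { -ʳ a} (≈-refl {b}) (≈-neg {C *ʳ b} {a} (≈-sym {a} {C *ʳ b} a≈C*b))))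
      (0<ʳ* {C -ʳ 1ℝ} {h} 0<C-1 0<h))
      where e : ∀ c b → (c - 1ℚ) * - b ≡ b - c * b
            e = solve-∀ ℚ-ring

    p<½ : p <ʳ ½ℝ
    p<½ = from p q (<ʳ-resp {exp a} {p} {exp b} {q} (≈-sym {p} {exp a} p≈exp-a) (≈-sym {q} {exp b} q≈exp-b) (exp-mono-< {a} {b} a<b)) p+q≈1
      where
      from : ∀ p q → p <ʳ q → p +ʳ q ≈ 1ℝ → p <ʳ ½ℝ
      from p q k e = <ʳ-resp {(p +ʳ p) *ʳ ½ℝ} {p} {1ℝ *ʳ ½ℝ} {½ℝ} (pointwise ((p +ʳ p) *ʳ ½ℝ) p λ n → r (seq p n)) (pointwise (1ℝ *ʳ ½ℝ) ½ℝ λ _ → refl)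
        (<ʳ-*ʳ {p +ʳ p} {1ℝ} {½ℝ} (fromℚ-< (positive⁻¹ ½)) (<ʳ-resp {p +ʳ p} {p +ʳ p} {q +ʳ p} {1ℝ} (≈-refl {p +ʳ p}) (≈-trans {q +ʳ p} {p +ʳ q} {1ℝ} (pointwise (q +ʳ p) (p +ʳ q) λ n → +-comm (seq q n) (seq p n)) e) (+ʳ-mono-<⊑ {p} {q} {p} {p} k (⊑-refl {p}))))
        where r : ∀ a → (a + a) * ½ ≡ a
              r = solve-∀ ℚ-ring

    0<s : 0ℝ <ʳ s
    0<s = <ʳ-resp {0ℝ} {0ℝ} {exp (-ʳ (½ℝ *ʳ a))} {s} (≈-refl {0ℝ}) (≈-sym {s} {exp (-ʳ (½ℝ *ʳ a))} s≈exp) (0<exp (-ʳ (½ℝ *ʳ a)))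

    ss*p : (s *ʳ s) *ʳ p ≈ 1ℝ
    ss*p = from (-ʳ (½ℝ *ʳ a)) s≈exp (pointwise ((-ʳ (½ℝ *ʳ a)) +ʳ (-ʳ (½ℝ *ʳ a))) (-ʳ a) λ n → e (seq a n))
      where
      e : ∀ a → - (½ * a) + - (½ * a) ≡ - a
      e = solve-∀ ℚ-ring
      from : ∀ t → s ≈ exp t → t +ʳ t ≈ -ʳ a → (s *ʳ s) *ʳ p ≈ 1ℝ
      from t s≈ 2t = ≈-trans {(s *ʳ s) *ʳ p} {exp (-ʳ a) *ʳ exp a} {1ℝ}
        (≈-* {s *ʳ s} {exp (-ʳ a)} {p} {exp a} (≈-trans {s *ʳ s} {exp t *ʳ exp t} {exp (-ʳ a)} (≈-* {s} {exp t} {s} {exp t} s≈ s≈)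
          (≈-trans {exp t *ʳ exp t} {exp (t +ʳ t)} {exp (-ʳ a)} (≈-sym {exp (t +ʳ t)} {exp t *ʳ exp t} (exp-+ t t)) (exp-cong {t +ʳ t} { -ʳ a} 2t))) p≈exp-a)
        (≈-trans {exp (-ʳ a) *ʳ exp a} {exp a *ʳ exp (-ʳ a)} {1ℝ} (*ʳ-comm (exp (-ʳ a)) (exp a)) (exp-neg a))

    -- `square-gap` is applied with the square root exp (- h/2) of q and with the ratio q/p = exp
    -- ((C - 1) h), both bounded below to first order in h.
    Cpp<qq : C *ʳ (p *ʳ p) <ʳ (1ℝ -ʳ p) *ʳ (1ℝ -ʳ p)
    Cpp<qq = square-gap C p q h (exp (-ʳ (½ℝ *ʳ h))) (exp ((C -ʳ 1ℝ) *ʳ h)) 0<C-1 0<p 0<h h⊑1 q≈1-p qs qe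
        (1-x⊑exp- (½ℝ *ʳ h) 0⊑½h) (1+x⊑exp ((C -ʳ 1ℝ) *ʳ h) (<⇒⊑ {0ℝ} {(C -ʳ 1ℝ) *ʳ h} (0<ʳ* {C -ʳ 1ℝ} {h} 0<C-1 0<h)))
      where
      0⊑½h : 0ℝ ⊑ ½ℝ *ʳ h
      0⊑½h = 0⊑* {½ℝ} {h} (fromℚ-⊑ (nonNegative⁻¹ ½)) 0⊑h
      h⊑1 : h ⊑ 1ℝ
      h⊑1 = ⊑-resp { -ʳ b} {h} { -ʳ fromℚ (- 1ℚ)} {1ℝ} (≈-refl {h}) (pointwise (-ʳ fromℚ (- 1ℚ)) 1ℝ λ _ → refl) (⊑-neg {fromℚ (- 1ℚ)} {b} -1⊑b)
      qs : exp (-ʳ (½ℝ *ʳ h)) *ʳ exp (-ʳ (½ℝ *ʳ h)) ≈ q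
      qs = double (-ʳ (½ℝ *ʳ h)) (pointwise ((-ʳ (½ℝ *ʳ h)) +ʳ (-ʳ (½ℝ *ʳ h))) b λ n → e (seq b n))
        where
        e : ∀ b → - (½ * - b) + - (½ * - b) ≡ b
        e = solve-∀ ℚ-ring
        double : ∀ t → t +ʳ t ≈ b → exp t *ʳ exp t ≈ q
        double t 2t = ≈-trans {exp t *ʳ exp t} {exp (t +ʳ t)} {q} (≈-sym {exp (t +ʳ t)} {exp t *ʳ exp t} (exp-+ t t))
          (≈-trans {exp (t +ʳ t)} {exp b} {q} (exp-cong {t +ʳ t} {b} 2t) (≈-sym {q} {exp b} q≈exp-b))
      qe : q ≈ p *ʳ exp ((C -ʳ 1ℝ) *ʳ h)
      qe = ≈-trans {q} {exp b} {p *ʳ exp ((C -ʳ 1ℝ) *ʳ h)} q≈exp-b (≈-trans {exp b} {exp (C *ʳ b +ʳ (C -ʳ 1ℝ) *ʳ h)} {p *ʳ exp ((C -ʳ 1ℝ) *ʳ h)}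
        (exp-cong {b} {C *ʳ b +ʳ (C -ʳ 1ℝ) *ʳ h} (pointwise b (C *ʳ b +ʳ (C -ʳ 1ℝ) *ʳ h) λ n → e (seq C n) (seq b n)))
        (≈-trans {exp (C *ʳ b +ʳ (C -ʳ 1ℝ) *ʳ h)} {exp (C *ʳ b) *ʳ exp ((C -ʳ 1ℝ) *ʳ h)} {p *ʳ exp ((C -ʳ 1ℝ) *ʳ h)} (exp-+ (C *ʳ b) ((C -ʳ 1ℝ) *ʳ h))
          (≈-* {exp (C *ʳ b)} {p} {exp ((C -ʳ 1ℝ) *ʳ h)} {exp ((C -ʳ 1ℝ) *ʳ h)} (≈-sym {p} {exp (C *ʳ b)} (≈-trans {p} {exp a} {exp (C *ʳ b)} p≈exp-a (exp-cong {a} {C *ʳ b} a≈C*b))) (≈-refl {exp ((C -ʳ 1ℝ) *ʳ h)}))))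
        where e : ∀ c b → b ≡ c * b + (c - 1ℚ) * - b
              e = solve-∀ ℚ-ring

-- Rational points that keep the strict inequalities

module RationalApproximation where
  open Rationals
  open Inequalities using (least-positive)
  open PartialSums
  open RealOrder
  open Exponential
  open import Defs using (seq; fromℚ; 0ℝ; 1ℝ; ½ℝ) renaming (_*_ to _*ʳ_; -_ to -ʳ_; _-_ to _-ʳ_; _<_ to _<ʳ_)
  open import Data.Integer.Base using (+_)
  open import Data.Rational
  open import Data.Rational.Properties

  -- A late approximation is off by at most η, so adding 2 η gives a rational strictly above x that
  -- is still close to it.
  snapshot : ∀ x {η} → 0ℚ < η → Eventually λ n → x <ʳ fromℚ (seq x n + (η + η))
  snapshot x {η} 0<η = N , λ n hn → η , 0<η , N , λ m hm → by-diff (seq x n + η - seq x m) (sub⁺ (h m n hm hn)) (e (seq x m) (seq x n) η)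
    where
    N : ℕ
    N = proj₁ (near x 0<η)
    h : ∀ n m → N ℕ.≤ n → N ℕ.≤ m → seq x n ≤ seq x m + η
    h = proj₂ (near x 0<η)
    e : ∀ a b η → b + (η + η) - (a + η) ≡ b + η - a
    e = solve-∀ ℚ-ring

  -- In `rational-gap`, x + 2 η becomes c₀, the further η leads to c, y + 2 η is P, and η itself
  -- serves as g. These perturbations together use up at most η (4 B + 8) of the gap δ.
  square-gap-stable : ∀ {η B δ x y} → 0ℚ < η → η * ((+ 4 / 1) * B + (+ 8 / 1)) ≤ δ → (+ 12 / 1) * η ≤ 1ℚ → 0ℚ ≤ B → x ≤ B → 0ℚ ≤ y + η → y ≤ ½ + η →
    x * (y * y) + δ ≤ (1ℚ - y) * (1ℚ - y) →
    y + (η + η) ≤ 1ℚ × (x + (η + η) + η) * ((y + (η + η)) * (y + (η + η))) ≤ (1ℚ - η) * ((1ℚ - (y + (η + η))) * (1ℚ - (y + (η + η))))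
  square-gap-stable {η} {B} {δ} {x} {y} 0<η hδ hη 0≤B x≤B y≥ y≤ h =
    P≤1 , by-diff (((1ℚ - y) * (1ℚ - y) - (x * (y * y) + δ)) + (δ - η * ((+ 4 / 1) * B + (+ 8 / 1))) + η * R) (sub⁺ h ⊕ sub⁺ hδ ⊕ (0≤η ⊛ 0≤R)) (e₂ x y η B δ)
    where
    0≤η = <⇒≤ 0<η
    e₀ : ∀ y η → 1ℚ - (y + (η + η)) ≡ (½ + η - y) + ((+ 1 / 4) * (1ℚ - (+ 12 / 1) * η) + (+ 1 / 4))
    e₀ = solve-∀ ℚ-ring
    P≤1 : y + (η + η) ≤ 1ℚ
    P≤1 = by-diff ((½ + η - y) + ((+ 1 / 4) * (1ℚ - (+ 12 / 1) * η) + (+ 1 / 4))) (sub⁺ y≤ ⊕ (nonNegative⁻¹ (+ 1 / 4) ⊛ sub⁺ hη ⊕ nonNegative⁻¹ (+ 1 / 4))) (e₀ y η)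
    P : ℚ
    P = y + (η + η)
    0≤P : 0ℚ ≤ P
    0≤P = ≤-trans (y≥ ⊕ 0≤η) (≤-reflexive (+-assoc y η η))
    e₁ : ∀ y η → 1ℚ - (y + η) ≡ 1ℚ - (y + (η + η)) + η
    e₁ = solve-∀ ℚ-ring
    z≤1 : 0ℚ ≤ 1ℚ - (y + η)
    z≤1 = subst (0ℚ ≤_) (sym (e₁ y η)) (sub⁺ P≤1 ⊕ 0≤η)
    R : ℚ
    R = (+ 4 / 1) * ((B - x) * (y + η)) + (+ 4 / 1) * (B * (1ℚ - (y + η))) + P * (1ℚ + (1ℚ - P)) + (+ 3 / 1) * ((1ℚ - P) * (1ℚ + P)) + (+ 4 / 1) * (y + η)
    0≤R : 0ℚ ≤ R
    0≤R = (nonNegative⁻¹ (+ 4 / 1) ⊛ (sub⁺ x≤B ⊛ y≥)) ⊕ (nonNegative⁻¹ (+ 4 / 1) ⊛ (0≤B ⊛ z≤1)) ⊕ (0≤P ⊛ (0≤1 ⊕ sub⁺ P≤1)) ⊕ (nonNegative⁻¹ (+ 3 / 1) ⊛ (sub⁺ P≤1 ⊛ (0≤1 ⊕ 0≤P))) ⊕ (nonNegative⁻¹ (+ 4 / 1) ⊛ y≥)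
    e₂ : ∀ x y η B δ → (1ℚ - η) * ((1ℚ - (y + (η + η))) * (1ℚ - (y + (η + η)))) - (x + (η + η) + η) * ((y + (η + η)) * (y + (η + η)))
      ≡ ((1ℚ - y) * (1ℚ - y) - (x * (y * y) + δ)) + (δ - η * ((+ 4 / 1) * B + (+ 8 / 1)))
        + η * ((+ 4 / 1) * ((B - x) * (y + η)) + (+ 4 / 1) * (B * (1ℚ - (y + η))) + (y + (η + η)) * (1ℚ + (1ℚ - (y + (η + η)))) + (+ 3 / 1) * ((1ℚ - (y + (η + η))) * (1ℚ + (y + (η + η)))) + (+ 4 / 1) * (y + η))
    e₂ = solve-∀ ℚ-ring

  inverse-sqrt-stable : ∀ {η B θ u v} → 0ℚ < η → η * ((+ 4 / 1) * (B + 1ℚ) + (+ 2 / 1) * (B * B)) ≤ ½ * θ → η ≤ 1ℚ → ∣ u ∣ ≤ B → 0ℚ ≤ u + η → v + (η + η) ≤ 1ℚ →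
    u * u * v ≤ 1ℚ + ½ * θ → (u + (η + η)) * (u + (η + η)) * (v + (η + η)) ≤ 1ℚ + θ
  inverse-sqrt-stable {η} {B} {θ} {u} {v} 0<η hθ hη ∣u∣≤B u≥ V≤1 h =
    by-diff ((1ℚ + ½ * θ - u * u * v) + (½ * θ - η * ((+ 4 / 1) * (B + 1ℚ) + (+ 2 / 1) * (B * B))) + η * R) (sub⁺ h ⊕ sub⁺ hθ ⊕ (<⇒≤ 0<η ⊛ 0≤R)) (e u v η B θ)
    where
    0≤B-u : 0ℚ ≤ B - u
    0≤B-u = sub⁺ (≤-trans (x≤∣x∣ u) ∣u∣≤B)
    0≤B+u : 0ℚ ≤ B + u
    0≤B+u = subst (0ℚ ≤_) (e₁ B u) (sub⁺ (≤-trans (-x≤∣x∣ u) ∣u∣≤B))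
      where e₁ : ∀ B u → B - - u ≡ B + u
            e₁ = solve-∀ ℚ-ring
    R : ℚ
    R = (+ 4 / 1) * ((B - u) + (1ℚ - η)) + (+ 4 / 1) * ((u + η) * (1ℚ - (v + (η + η)))) + (+ 2 / 1) * ((B - u) * (B + u))
    0≤R : 0ℚ ≤ R
    0≤R = (nonNegative⁻¹ (+ 4 / 1) ⊛ (0≤B-u ⊕ sub⁺ hη)) ⊕ (nonNegative⁻¹ (+ 4 / 1) ⊛ (u≥ ⊛ sub⁺ V≤1)) ⊕ (nonNegative⁻¹ (+ 2 / 1) ⊛ (0≤B-u ⊛ 0≤B+u))
    e : ∀ u v η B θ → 1ℚ + θ - (u + (η + η)) * (u + (η + η)) * (v + (η + η)) ≡ (1ℚ + ½ * θ - u * u * v) + (½ * θ - η * ((+ 4 / 1) * (B + 1ℚ) + (+ 2 / 1) * (B * B)))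
       + η * ((+ 4 / 1) * ((B - u) + (1ℚ - η)) + (+ 4 / 1) * ((u + η) * (1ℚ - (v + (η + η)))) + (+ 2 / 1) * ((B - u) * (B + u)))
    e = solve-∀ ℚ-ring

  small-step : ∀ {D K δ} → 1ℚ ≤ K → K ≤ D → 0ℚ < δ → ∃[ η ] (0ℚ < η × η * D ≤ δ × η * K ≤ 1ℚ)
  small-step {D} {K} {δ} 1≤K K≤D 0<δ = from (least-positive 0<δ 0<1)
    where
    from : ∃[ m ] (0ℚ < m × m ≤ δ × m ≤ 1ℚ) → ∃[ η ] (0ℚ < η × η * D ≤ δ × η * K ≤ 1ℚ)
    from (m , 0<m , m≤δ , m≤1) = let η , 0<η , ηD = scale-down {D} (≤-trans 1≤K K≤D) 0<m in
      η , 0<η , ≤-trans (≤-reflexive ηD) m≤δ , ≤-trans (*-monoˡ (<⇒≤ 0<η) K≤D) (≤-trans (≤-reflexive ηD) m≤1)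

  -- Two rational bounds c₀ < c above C are produced: their distance absorbs the rounding of C ℓ, so
  -- that k ≤ c ℓ for large ℓ.
  rational-gap : ∀ C p → C *ʳ (p *ʳ p) <ʳ (1ℝ -ʳ p) *ʳ (1ℝ -ʳ p) → 0ℝ ⊑ p → p ⊑ ½ℝ →
    ∃[ c₀ ] (C <ʳ fromℚ c₀ × ∃[ c ] (c₀ < c × ∃[ P ] (p <ʳ fromℚ P × P ≤ 1ℚ × ∃[ g ] (0ℚ < g × g ≤ 1ℚ × c * (P * P) ≤ (1ℚ - g) * ((1ℚ - P) * (1ℚ - P))))))
  rational-gap C p (δ , 0<δ , hδ) 0⊑p p⊑½ = bound (bounded C)
    where
    Goal : Set
    Goal = ∃[ c₀ ] (C <ʳ fromℚ c₀ × ∃[ c ] (c₀ < c × ∃[ P ] (p <ʳ fromℚ P × P ≤ 1ℚ × ∃[ g ] (0ℚ < g × g ≤ 1ℚ × c * (P * P) ≤ (1ℚ - g) * ((1ℚ - P) * (1ℚ - P))))))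
    12≤ : ∀ {B} → 1ℚ ≤ B → (+ 12 / 1) ≤ (+ 4 / 1) * B + (+ 8 / 1)
    12≤ {B} 1≤B = by-diff ((+ 4 / 1) * (B - 1ℚ)) (nonNegative⁻¹ (+ 4 / 1) ⊛ sub⁺ 1≤B) (e B)
      where e : ∀ B → (+ 4 / 1) * B + (+ 8 / 1) - (+ 12 / 1) ≡ (+ 4 / 1) * (B - 1ℚ)
            e = solve-∀ ℚ-ring
    module Step {η : ℚ} (0<η : 0ℚ < η) (η12≤1 : η * (+ 12 / 1) ≤ 1ℚ) where
      12η≤1 : (+ 12 / 1) * η ≤ 1ℚ
      12η≤1 = ≤-trans (≤-reflexive (*-comm (+ 12 / 1) η)) η12≤1
      η≤1 : η ≤ 1ℚ
      η≤1 = ≤-trans (by-diff ((+ 11 / 1) * η) (nonNegative⁻¹ (+ 11 / 1) ⊛ <⇒≤ 0<η) (e η)) 12η≤1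
        where e : ∀ η → (+ 12 / 1) * η - η ≡ (+ 11 / 1) * η
              e = solve-∀ ℚ-ring
      <+ : ∀ a → a < a + η
      <+ a = by-diff< η 0<η (e a η)
        where e : ∀ a η → a + η - a ≡ η
              e = solve-∀ ℚ-ring
      finish : ∀ {c₀ P} → C <ʳ fromℚ c₀ → p <ʳ fromℚ P → P ≤ 1ℚ × (c₀ + η) * (P * P) ≤ (1ℚ - η) * ((1ℚ - P) * (1ℚ - P)) → Goal
      finish {c₀} {P} C< p< (P≤1 , h) = c₀ , C< , c₀ + η , <+ c₀ , P , p< , P≤1 , η , 0<η , η≤1 , h
    step : ∀ {B η} → 1ℚ ≤ B → Eventually (λ n → ∣ seq C n ∣ ≤ B) → 0ℚ < η × η * ((+ 4 / 1) * B + (+ 8 / 1)) ≤ δ × η * (+ 12 / 1) ≤ 1ℚ → Goal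
    step {B} {η} 1≤B C≤B (0<η , ηD≤δ , η12≤1) = someᵉ (snapshot C 0<η ⊓ᵉ snapshot p 0<η ⊓ᵉ C≤B ⊓ᵉ 0⊑p η 0<η ⊓ᵉ p⊑½ η 0<η ⊓ᵉ hδ)
      λ {n} (C< , p< , C≤ , p≥ , p≤ , gap) → finish C< p< (square-gap-stable {η} {B} {δ} {seq C n} {seq p n} 0<η ηD≤δ 12η≤1 (≤-trans 0≤1 1≤B) (≤-trans (x≤∣x∣ (seq C n)) C≤) p≥ p≤ gap)
      where open Step 0<η η12≤1
    bound : ∃[ B ] (1ℚ ≤ B × Eventually λ n → ∣ seq C n ∣ ≤ B) → Goal
    bound (B , 1≤B , C≤B) = let η , h = small-step {(+ 4 / 1) * B + (+ 8 / 1)} {+ 12 / 1} (from-yes (1ℚ ≤? (+ 12 / 1))) (12≤ 1≤B) 0<δ in step {B} {η} 1≤B C≤B h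

  -- θ is known only after c and g have been fixed with the help of P₁. The final P therefore comes
  -- second and stays below P₁, which lets it inherit the gap.
  rational-inverse-sqrt : ∀ p s {P₁ θ} → p <ʳ fromℚ P₁ → P₁ ≤ 1ℚ → 0ℚ < θ → 0ℝ ⊑ s → (s *ʳ s) *ʳ p ≈ 1ℝ →
    ∃[ P ] (p <ʳ fromℚ P × P ≤ P₁ × ∃[ S ] (s <ʳ fromℚ S × S * S * P ≤ 1ℚ + θ))
  rational-inverse-sqrt p s {P₁} {θ} (δ , 0<δ , hδ) P₁≤1 0<θ 0⊑s ssp = bound (bounded s) (least-positive 0<δ (0<½* 0<θ))
    where
    Goal : Set
    Goal = ∃[ P ] (p <ʳ fromℚ P × P ≤ P₁ × ∃[ S ] (s <ʳ fromℚ S × S * S * P ≤ 1ℚ + θ))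
    4≤ : ∀ {B} → 0ℚ ≤ B → (+ 4 / 1) ≤ (+ 4 / 1) * (B + 1ℚ) + (+ 2 / 1) * (B * B)
    4≤ {B} 0≤B = by-diff ((+ 4 / 1) * B + (+ 2 / 1) * (B * B)) (nonNegative⁻¹ (+ 4 / 1) ⊛ 0≤B ⊕ nonNegative⁻¹ (+ 2 / 1) ⊛ (0≤B ⊛ 0≤B)) (e B)
      where e : ∀ B → (+ 4 / 1) * (B + 1ℚ) + (+ 2 / 1) * (B * B) - (+ 4 / 1) ≡ (+ 4 / 1) * B + (+ 2 / 1) * (B * B)
            e = solve-∀ ℚ-ring
    finish : ∀ {P S} → p <ʳ fromℚ P → s <ʳ fromℚ S → P ≤ P₁ → S * S * P ≤ 1ℚ + θ → Goal
    finish {P} {S} p< s< P≤ h = P , p< , P≤ , S , s< , h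
    module Step {η : ℚ} (0<η : 0ℚ < η) (η4≤1 : η * (+ 4 / 1) ≤ 1ℚ) (η4≤δ : η * (+ 4 / 1) ≤ δ) where
      η≤1 : η ≤ 1ℚ
      η≤1 = ≤-trans (by-diff ((+ 3 / 1) * η) (nonNegative⁻¹ (+ 3 / 1) ⊛ <⇒≤ 0<η) (e η)) η4≤1
        where e : ∀ η → η * (+ 4 / 1) - η ≡ (+ 3 / 1) * η
              e = solve-∀ ℚ-ring
      inside : ∀ {y} → y + δ ≤ P₁ → y + (η + η) ≤ P₁
      inside {y} = ≤-trans (by-diff (δ - η * (+ 4 / 1) + (+ 2 / 1) * η) (sub⁺ η4≤δ ⊕ nonNegative⁻¹ (+ 2 / 1) ⊛ <⇒≤ 0<η) (e y δ η))
        where e : ∀ y δ η → y + δ - (y + (η + η)) ≡ δ - η * (+ 4 / 1) + (+ 2 / 1) * η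
              e = solve-∀ ℚ-ring
    step : ∀ {B η} → 1ℚ ≤ B → Eventually (λ n → ∣ seq s n ∣ ≤ B) → 0ℚ < η → η * ((+ 4 / 1) * (B + 1ℚ) + (+ 2 / 1) * (B * B)) ≤ ½ * θ → η * (+ 4 / 1) ≤ δ → η * (+ 4 / 1) ≤ 1ℚ → Goal
    step {B} {η} 1≤B s≤B 0<η ηD≤ η4≤δ η4≤1 = someᵉ (snapshot p 0<η ⊓ᵉ snapshot s 0<η ⊓ᵉ s≤B ⊓ᵉ 0⊑s η 0<η ⊓ᵉ below ssp (½ * θ) (0<½* 0<θ) ⊓ᵉ hδ)
      λ {n} (p< , s< , ∣s∣≤ , s≥ , ss≤ , p+δ≤) → finish p< s< (inside {seq p n} p+δ≤) (inverse-sqrt-stable {η} {B} {θ} {seq s n} {seq p n} 0<η ηD≤ η≤1 ∣s∣≤ s≥ (≤-trans (inside {seq p n} p+δ≤) P₁≤1) ss≤)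
      where open Step 0<η η4≤1 η4≤δ
    bound : ∃[ B ] (1ℚ ≤ B × Eventually λ n → ∣ seq s n ∣ ≤ B) → ∃[ m ] (0ℚ < m × m ≤ δ × m ≤ ½ * θ) → Goal
    bound (B , 1≤B , s≤B) (m , 0<m , m≤δ , m≤½θ) =
      let η , 0<η , ηD≤m , η4≤1 = small-step {(+ 4 / 1) * (B + 1ℚ) + (+ 2 / 1) * (B * B)} {+ 4 / 1} (from-yes (1ℚ ≤? (+ 4 / 1))) (4≤ (≤-trans 0≤1 1≤B)) 0<m in
      step {B} {η} 1≤B s≤B 0<η (≤-trans ηD≤m m≤½θ) (≤-trans (*-monoˡ (<⇒≤ 0<η) (4≤ (≤-trans 0≤1 1≤B))) (≤-trans ηD≤m m≤δ)) η4≤1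

-- Rounding, uniqueness of the solution, and the lower bound

module LowerBound where
  open Rationals
  open Inequalities using (archimedean*)
  open RealOrder
  open Exponential
  open ExponentialLaws
  open Existence
  open SolutionProperties
  open RationalApproximation
  open ExponentialGain
  open import Defs using (ℝ; seq; fromℚ; fromℕ; 0ℝ; 1ℝ; ½ℝ; IsSolution; IsRounding; IsInverseSqrt; R; R-arrows; Arrows) renaming (_≃_ to _≃ʳ_; _+_ to _+ʳ_; _*_ to _*ʳ_; -_ to -ʳ_; _-_ to _-ʳ_; _<_ to _<ʳ_; _≤_ to _≤ʳ_; _^_ to _^ʳ_)
  open import Data.Rational
  open import Data.Rational.Properties

  fromℕ≈ι : ∀ n → fromℕ n ≈ fromℚ (ι n)
  fromℕ≈ι n = pointwise (fromℕ n) (fromℚ (ι n)) λ _ → sym (ι-def n)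

  module Rounding (C : ℝ) {ℓ k : ℕ} (Cℓ<k+1 : C *ʳ fromℕ ℓ <ʳ fromℕ k +ʳ 1ℝ) (k<Cℓ+1 : fromℕ k <ʳ C *ʳ fromℕ ℓ +ʳ 1ℝ) where
    private
      L : ℝ
      L = fromℚ (ι ℓ)
      0⊑L : 0ℝ ⊑ L
      0⊑L = fromℚ-⊑ (0≤ι ℓ)
      C*fromℕ : C *ʳ fromℕ ℓ ≈ C *ʳ L
      C*fromℕ = ≈-* {C} {C} {fromℕ ℓ} {L} (≈-refl {C}) (fromℕ≈ι ℓ)

    below-suc : C *ʳ L <ʳ fromℚ (ι (suc k))
    below-suc = <ʳ-resp {C *ʳ fromℕ ℓ} {C *ʳ L} {fromℕ k +ʳ 1ℝ} {fromℚ (ι (suc k))} C*fromℕ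
      (≈-trans {fromℕ k +ʳ 1ℝ} {fromℚ (ι k) +ʳ 1ℝ} {fromℚ (ι (suc k))} (≈-+ {fromℕ k} {fromℚ (ι k)} {1ℝ} {1ℝ} (fromℕ≈ι k) (≈-refl {1ℝ}))
        (pointwise (fromℚ (ι k) +ʳ 1ℝ) (fromℚ (ι (suc k))) λ _ → trans (+-comm (ι k) 1ℚ) (sym (ι-suc k))))
      Cℓ<k+1

    -- ℓ ≤ C ℓ < k + 1, and both outer terms are integers.
    ℓ≤k : 1ℝ <ʳ C → ℓ ℕ.≤ k
    ℓ≤k 1<C = ℕ.≮⇒≥ λ k<ℓ → <-irrefl refl (<-≤-trans (fromℚ-<⁻ L<) (ι-mono k<ℓ))
      where
      L< : L <ʳ fromℚ (ι (suc k))
      L< = ⊑-<-trans {L} {C *ʳ L} {fromℚ (ι (suc k))} (⊑-resp {1ℝ *ʳ L} {L} {C *ʳ L} {C *ʳ L} (pointwise (1ℝ *ʳ L) L λ _ → *-identityˡ (ι ℓ)) (≈-refl {C *ʳ L}) (⊑-*ʳ {1ℝ} {C} {L} 0⊑L (<⇒⊑ {1ℝ} {C} 1<C))) below-suc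

    -- The rounding error is below 1, and ℓ (c - c₀) ≥ 1 pays for it.
    k≤c*ℓ : ∀ {c₀ c} → C <ʳ fromℚ c₀ → 1ℚ ≤ ι ℓ * (c - c₀) → ι k ≤ c * ι ℓ
    k≤c*ℓ {c₀} {c} C<c₀ h = ≤-trans (<⇒≤ (fromℚ-<⁻ k<)) (by-diff (ι ℓ * (c - c₀) - 1ℚ) (sub⁺ h) (e c c₀ (ι ℓ)))
      where
      e : ∀ c d l → c * l - (d * l + 1ℚ) ≡ l * (c - d) - 1ℚ
      e = solve-∀ ℚ-ring
      k< : fromℚ (ι k) <ʳ fromℚ (c₀ * ι ℓ + 1ℚ)
      k< = <-⊑-trans {fromℚ (ι k)} {C *ʳ L +ʳ 1ℝ} {fromℚ (c₀ * ι ℓ + 1ℚ)}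
        (<ʳ-resp {fromℕ k} {fromℚ (ι k)} {C *ʳ fromℕ ℓ +ʳ 1ℝ} {C *ʳ L +ʳ 1ℝ} (fromℕ≈ι k) (≈-+ {C *ʳ fromℕ ℓ} {C *ʳ L} {1ℝ} {1ℝ} C*fromℕ (≈-refl {1ℝ})) k<Cℓ+1)
        (⊑-resp {C *ʳ L +ʳ 1ℝ} {C *ʳ L +ʳ 1ℝ} {fromℚ c₀ *ʳ L +ʳ 1ℝ} {fromℚ (c₀ * ι ℓ + 1ℚ)} (≈-refl {C *ʳ L +ʳ 1ℝ}) (pointwise (fromℚ c₀ *ʳ L +ʳ 1ℝ) (fromℚ (c₀ * ι ℓ + 1ℚ)) λ _ → refl)
          (⊑-+ {C *ʳ L} {fromℚ c₀ *ʳ L} {1ℝ} {1ℝ} (⊑-*ʳ {C} {fromℚ c₀} {L} 0⊑L (<⇒⊑ {C} {fromℚ c₀} C<c₀)) (⊑-refl {1ℝ})))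

  module Parameters (C a b p q s : ℝ) (1<C : 1ℝ <ʳ C) (a≈C*b : a ≈ C *ʳ b) (p≈exp-a : p ≈ exp a) (q≈exp-b : q ≈ exp b) (s≈exp : s ≈ exp (-ʳ (½ℝ *ʳ a)))
    (p+q≈1 : p +ʳ q ≈ 1ℝ) (-1⊑b : fromℚ (- 1ℚ) ⊑ b) (b⊑0 : b ⊑ 0ℝ) where
    open Solution C a b p q s 1<C a≈C*b p≈exp-a q≈exp-b s≈exp p+q≈1 -1⊑b b⊑0

    isSolution : IsSolution C p
    isSolution = record
      { 0<p = 0<p ; p<½ = p<½ ; a = a ; b = b ; a-log = isLog {p} {a} p≈exp-a
      ; b-log = isLog {1ℝ -ʳ p} {b} (≈-trans {1ℝ -ʳ p} {q} {exp b} q≈1-p q≈exp-b)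
      ; equation = inj₁ b<0 , ≈⇒≃ {C *ʳ b} {a} (≈-sym {a} {C *ʳ b} a≈C*b) }

    -- The logarithm b′ of 1 - x satisfies exp (C b′) + exp b′ = x + (1 - x) = 1. The sum on the
    -- left is strictly increasing in b′, so b′ = b and x = exp (C b′) = p.
    solution-unique : ∀ x → IsSolution C x → x ≃ʳ p
    solution-unique x sol = from (IsSolution.a sol) (IsSolution.b sol) (isLog⁻ {x} {IsSolution.a sol} (IsSolution.a-log sol)) (isLog⁻ {1ℝ -ʳ x} {IsSolution.b sol} (IsSolution.b-log sol)) (≃⇒≈ {C *ʳ IsSolution.b sol} {IsSolution.a sol} (proj₂ (IsSolution.equation sol)))
      where
      from : ∀ a′ b′ → x ≈ exp a′ → 1ℝ -ʳ x ≈ exp b′ → C *ʳ b′ ≈ a′ → x ≃ʳ p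
      from a′ b′ xa xb e = ≈⇒≃ {x} {p} (≈-trans {x} {exp (C *ʳ b′)} {p} x≈ (≈-trans {exp (C *ʳ b′)} {exp (C *ʳ b)} {p}
          (exp-cong {C *ʳ b′} {C *ʳ b} (≈-* {C} {C} {b′} {b} (≈-refl {C}) (unique-root b′ root′)))
          (≈-trans {exp (C *ʳ b)} {exp a} {p} (exp-cong {C *ʳ b} {a} (≈-sym {a} {C *ʳ b} a≈C*b)) (≈-sym {p} {exp a} p≈exp-a))))
        where
        x≈ : x ≈ exp (C *ʳ b′)
        x≈ = ≈-trans {x} {exp a′} {exp (C *ʳ b′)} xa (exp-cong {a′} {C *ʳ b′} (≈-sym {C *ʳ b′} {a′} e))
        r : ∀ a → a + (1ℚ - a) ≡ 1ℚ
        r = solve-∀ ℚ-ring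
        root′ : exp (C *ʳ b′) +ʳ exp b′ ≈ 1ℝ
        root′ = ≈-trans {exp (C *ʳ b′) +ʳ exp b′} {x +ʳ (1ℝ -ʳ x)} {1ℝ} (≈-+ {exp (C *ʳ b′)} {x} {exp b′} {1ℝ -ʳ x} (≈-sym {x} {exp (C *ʳ b′)} x≈) (≈-sym {1ℝ -ʳ x} {exp b′} xb)) (pointwise (x +ʳ (1ℝ -ʳ x)) 1ℝ λ n → r (seq x n))

    isInverseSqrt : IsInverseSqrt p s
    isInverseSqrt = 0<s , ≈⇒≃ {(s *ʳ s) *ʳ p} {1ℝ} ss*p

    -- q^(k+1) = exp ((k+1) b) ≤ exp (ℓ C b) = p^ℓ, because b ≤ 0 and C ℓ < k + 1.
    q^k⊑p^ℓ : ∀ {ℓ k} → C *ʳ fromℚ (ι ℓ) <ʳ fromℚ (ι k) → q ^ʳ k ⊑ p ^ʳ ℓ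
    q^k⊑p^ℓ {ℓ} {k} h = ⊑-resp {exp (fromℚ (ι k) *ʳ b)} {q ^ʳ k} {exp (fromℚ (ι ℓ) *ʳ a)} {p ^ʳ ℓ} (power q b k q≈exp-b) (power p a ℓ p≈exp-a)
        (exp-mono {fromℚ (ι k) *ʳ b} {fromℚ (ι ℓ) *ʳ a} exponents)
      where
      power : ∀ x y n → x ≈ exp y → exp (fromℚ (ι n) *ʳ y) ≈ x ^ʳ n
      power x y n e = ≈-sym {x ^ʳ n} {exp (fromℚ (ι n) *ʳ y)} (≈-trans {x ^ʳ n} {exp y ^ʳ n} {exp (fromℚ (ι n) *ʳ y)} (^ʳ-cong {x} {exp y} n e) (exp-^ y n))
      r₁ : ∀ k b → - (k * - b) ≡ k * b
      r₁ = solve-∀ ℚ-ring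
      r₂ : ∀ C l b → - (C * l * - b) ≡ l * (C * b)
      r₂ = solve-∀ ℚ-ring
      exponents : fromℚ (ι k) *ʳ b ⊑ fromℚ (ι ℓ) *ʳ a
      exponents = ⊑-resp { -ʳ (fromℚ (ι k) *ʳ h′)} {fromℚ (ι k) *ʳ b} { -ʳ ((C *ʳ fromℚ (ι ℓ)) *ʳ h′)} {fromℚ (ι ℓ) *ʳ a}
        (pointwise (-ʳ (fromℚ (ι k) *ʳ h′)) (fromℚ (ι k) *ʳ b) λ n → r₁ (ι k) (seq b n))
        (≈-trans { -ʳ ((C *ʳ fromℚ (ι ℓ)) *ʳ h′)} {fromℚ (ι ℓ) *ʳ (C *ʳ b)} {fromℚ (ι ℓ) *ʳ a} (pointwise (-ʳ ((C *ʳ fromℚ (ι ℓ)) *ʳ h′)) (fromℚ (ι ℓ) *ʳ (C *ʳ b)) λ n → r₂ (seq C n) (ι ℓ) (seq b n))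
          (≈-* {fromℚ (ι ℓ)} {fromℚ (ι ℓ)} {C *ʳ b} {a} (≈-refl {fromℚ (ι ℓ)}) (≈-sym {a} {C *ʳ b} a≈C*b)))
        (⊑-neg {(C *ʳ fromℚ (ι ℓ)) *ʳ h′} {fromℚ (ι k) *ʳ h′} (⊑-*ʳ {C *ʳ fromℚ (ι ℓ)} {fromℚ (ι k)} {h′} 0⊑h (<⇒⊑ {C *ʳ fromℚ (ι ℓ)} {fromℚ (ι k)} h)))
        where
        h′ : ℝ
        h′ = -ʳ b

    -- Raising p to P lowers q to 1 - P, so both sides move in the favourable direction.
    rational-powers : ∀ {P} ℓ k → p <ʳ fromℚ P → P ≤ 1ℚ → q ^ʳ k ⊑ p ^ʳ ℓ → (1ℚ - P) ^ k ≤ P ^ ℓ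
    rational-powers {P} ℓ k p<P P≤1 h = fromℚ-⊑⁻ (⊑-resp {fromℚ (1ℚ - P) ^ʳ k} {fromℚ ((1ℚ - P) ^ k)} {fromℚ P ^ʳ ℓ} {fromℚ (P ^ ℓ)}
        (pointwise (fromℚ (1ℚ - P) ^ʳ k) (fromℚ ((1ℚ - P) ^ k)) (fromℚ-^ (1ℚ - P) k)) (pointwise (fromℚ P ^ʳ ℓ) (fromℚ (P ^ ℓ)) (fromℚ-^ P ℓ))
        (⊑-trans {fromℚ (1ℚ - P) ^ʳ k} {q ^ʳ k} {fromℚ P ^ʳ ℓ} (^ʳ-mono {fromℚ (1ℚ - P)} {q} k (fromℚ-⊑ (sub⁺ P≤1)) 1-P⊑q)
          (⊑-trans {q ^ʳ k} {p ^ʳ ℓ} {fromℚ P ^ʳ ℓ} h (^ʳ-mono {p} {fromℚ P} ℓ (<⇒⊑ {0ℝ} {p} 0<p) (<⇒⊑ {p} {fromℚ P} p<P)))))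
      where
      1-P⊑q : fromℚ (1ℚ - P) ⊑ q
      1-P⊑q = ⊑-resp {1ℝ -ʳ fromℚ P} {fromℚ (1ℚ - P)} {1ℝ -ʳ p} {q} (pointwise (1ℝ -ʳ fromℚ P) (fromℚ (1ℚ - P)) λ _ → refl) q≈1-p
        (⊑-+ {1ℝ} {1ℝ} { -ʳ fromℚ P} { -ʳ p} (⊑-refl {1ℝ}) (⊑-neg {p} {fromℚ P} (<⇒⊑ {p} {fromℚ P} p<P)))

    Bound : Set
    Bound = ∃[ ε ] (0ℝ <ʳ ε × ∃[ L ] (∀ ℓ → L ℕ.≤ ℓ → ∀ k → IsRounding (C *ʳ fromℕ ℓ) k → (s +ʳ ε) ^ʳ ℓ ≤ʳ fromℕ (R ℓ k)))

    bound : Bound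
    bound = from-gap (rational-gap C p Cpp<qq (<⇒⊑ {0ℝ} {p} 0<p) (<⇒⊑ {p} {½ℝ} p<½)) (above-ℚ {0ℝ} {p} 0<p)
      where
      s+ε≈ : ∀ S → s +ʳ (fromℚ S -ʳ s) ≈ fromℚ S
      s+ε≈ S = pointwise (s +ʳ (fromℚ S -ʳ s)) (fromℚ S) λ n → e (seq s n) S
        where e : ∀ a b → a + (b - a) ≡ b
              e = solve-∀ ℚ-ring
      1≤ : ∀ {c₀ c} → C <ʳ fromℚ c₀ → c₀ < c → 1ℚ ≤ c
      1≤ {c₀} C<c₀ c₀<c = <⇒≤ (<-trans (fromℚ-<⁻ (<ʳ-trans {1ℝ} {C} {fromℚ c₀} 1<C C<c₀)) c₀<c)
      at-most : ∀ {x y} → fromℚ x <ʳ p → p <ʳ fromℚ y → x ≤ y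
      at-most {x} {y} h k = <⇒≤ (fromℚ-<⁻ (<ʳ-trans {fromℚ x} {p} {fromℚ y} h k))
      few : ∀ {S ℓ} n → fromℕ n <ʳ (s +ʳ (fromℚ S -ʳ s)) ^ʳ ℓ → ι n ≤ S ^ ℓ
      few {S} {ℓ} n h = <⇒≤ (fromℚ-<⁻ (<ʳ-resp {fromℕ n} {fromℚ (ι n)} {(s +ʳ (fromℚ S -ʳ s)) ^ʳ ℓ} {fromℚ (S ^ ℓ)} (fromℕ≈ι n)
        (≈-trans {(s +ʳ (fromℚ S -ʳ s)) ^ʳ ℓ} {fromℚ S ^ʳ ℓ} {fromℚ (S ^ ℓ)} (^ʳ-cong {s +ʳ (fromℚ S -ʳ s)} {fromℚ S} ℓ (s+ε≈ S)) (pointwise (fromℚ S ^ʳ ℓ) (fromℚ (S ^ ℓ)) (fromℚ-^ S ℓ))) h))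

      squares : ∀ {c g P P₁} → 1ℚ ≤ c → g ≤ 1ℚ → 0ℚ ≤ P → P ≤ P₁ → P₁ ≤ 1ℚ → c * (P₁ * P₁) ≤ (1ℚ - g) * ((1ℚ - P₁) * (1ℚ - P₁)) → c * (P * P) ≤ (1ℚ - g) * ((1ℚ - P) * (1ℚ - P))
      squares {c} {g} {P} {P₁} 1≤c g≤1 0≤P P≤P₁ P₁≤1 h = ≤-trans (*-monoˡ (≤-trans 0≤1 1≤c) (*-mono 0≤P 0≤P P≤P₁ P≤P₁))
        (≤-trans h (*-monoˡ (sub⁺ g≤1) (*-mono {1ℚ - P₁} {1ℚ - P} {1ℚ - P₁} {1ℚ - P} (sub⁺ P₁≤1) (sub⁺ P₁≤1) 1-P 1-P)))
        where
        1-P : 1ℚ - P₁ ≤ 1ℚ - P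
        1-P = +-monoʳ-≤ 1ℚ (neg-antimono-≤ P≤P₁)

      from-gap : ∃[ c₀ ] (C <ʳ fromℚ c₀ × ∃[ c ] (c₀ < c × ∃[ P ] (p <ʳ fromℚ P × P ≤ 1ℚ × ∃[ g ] (0ℚ < g × g ≤ 1ℚ × c * (P * P) ≤ (1ℚ - g) * ((1ℚ - P) * (1ℚ - P)))))) →
        ∃[ lo ] (0ℝ <ʳ fromℚ lo × fromℚ lo <ʳ p) → Bound
      from-gap (c₀ , C<c₀ , c , c₀<c , P₁ , p<P₁ , P₁≤1 , g , 0<g , g≤1 , gap) (lo , 0<lo , lo<p) =
        from-gain (exponential-gain c g lo (1≤ C<c₀ c₀<c) 0<g g≤1 (fromℚ-<⁻ 0<lo) (≤-trans (at-most lo<p p<P₁) P₁≤1))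
        where
        from-gain : ∃[ θ ] (0ℚ < θ × ∃[ ℓ₀ ] (∀ P S → lo ≤ P → P ≤ 1ℚ → c * (P * P) ≤ (1ℚ - g) * ((1ℚ - P) * (1ℚ - P)) → 0ℚ ≤ S → S * S * P ≤ 1ℚ + θ →
          ∀ ℓ k n → ℓ₀ ℕ.≤ ℓ → ℓ ℕ.≤ k → ι k ≤ c * ι ℓ → (1ℚ - P) ^ suc k ≤ P ^ ℓ → ι n ≤ S ^ ℓ → ¬ Arrows ℓ k n)) → Bound
        from-gain (θ , 0<θ , ℓ₀ , no-arrows) = from-point (rational-inverse-sqrt p s p<P₁ P₁≤1 0<θ (<⇒⊑ {0ℝ} {s} 0<s) ss*p) (archimedean* (sub⁺< c₀<c) 1ℚ)
          where
          from-point : ∃[ P ] (p <ʳ fromℚ P × P ≤ P₁ × ∃[ S ] (s <ʳ fromℚ S × S * S * P ≤ 1ℚ + θ)) → ∃[ n ] 1ℚ ≤ ι n * (c - c₀) → Bound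
          -- ε = S - s makes s + ε the rational S. The order on reals is a negation, so `R ℓ k` is
          -- assumed to be smaller than S^ℓ, and `R-arrows` contradicts `no-arrows` at that number
          -- of vertices.
          from-point (P , p<P , P≤P₁ , S , s<S , SSP) (n₀ , hn₀) = fromℚ S -ʳ s , -ʳ-pos {s} {fromℚ S} s<S , ℓ₀ ℕ.⊔ n₀ , λ ℓ large k (Cℓ<k+1 , k<Cℓ+1) few-vertices →
            let open Rounding C {ℓ} {k} Cℓ<k+1 k<Cℓ+1 in
            no-arrows P S (at-most lo<p p<P) (≤-trans P≤P₁ P₁≤1)
              (squares {c} {g} (1≤ C<c₀ c₀<c) g≤1 (<⇒≤ (fromℚ-<⁻ (<ʳ-trans {0ℝ} {p} {fromℚ P} 0<p p<P))) P≤P₁ P₁≤1 gap)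
              (<⇒≤ (fromℚ-<⁻ (<ʳ-trans {0ℝ} {s} {fromℚ S} 0<s s<S))) SSP ℓ k (R ℓ k) (ℕ.m⊔n≤o⇒m≤o ℓ₀ n₀ large) (ℓ≤k 1<C)
              (k≤c*ℓ {c₀} {c} C<c₀ (≤-trans hn₀ (*-monoʳ (<⇒≤ (sub⁺< c₀<c)) (ι-mono (ℕ.m⊔n≤o⇒n≤o ℓ₀ n₀ large)))))
              (rational-powers ℓ (suc k) p<P (≤-trans P≤P₁ P₁≤1) (q^k⊑p^ℓ {ℓ} {suc k} below-suc))
              (few {S} {ℓ} (R ℓ k) few-vertices) (R-arrows ℓ k)

  lower-bound : ∀ C → 1ℝ <ʳ C → Σ[ p ∈ ℝ ] (IsSolution C p × (∀ q → IsSolution C q → q ≃ʳ p) × (Σ[ s ∈ ℝ ] (IsInverseSqrt p s ×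
    (Σ[ ε ∈ ℝ ] (0ℝ <ʳ ε × (Σ[ L ∈ ℕ ] (∀ ℓ → L ℕ.≤ ℓ → ∀ k → IsRounding (C *ʳ fromℕ ℓ) k → (s +ʳ ε) ^ʳ ℓ ≤ʳ fromℕ (R ℓ k))))))))
  lower-bound C 1<C = from (Exists.G-root C 1<C)
    where
    Goal : Set
    Goal = Σ[ p ∈ ℝ ] (IsSolution C p × (∀ q → IsSolution C q → q ≃ʳ p) × (Σ[ s ∈ ℝ ] (IsInverseSqrt p s ×
      (Σ[ ε ∈ ℝ ] (0ℝ <ʳ ε × (Σ[ L ∈ ℕ ] (∀ ℓ → L ℕ.≤ ℓ → ∀ k → IsRounding (C *ʳ fromℕ ℓ) k → (s +ʳ ε) ^ʳ ℓ ≤ʳ fromℕ (R ℓ k))))))))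
    at : ∀ a b p q s → a ≈ C *ʳ b → p ≈ exp a → q ≈ exp b → s ≈ exp (-ʳ (½ℝ *ʳ a)) → p +ʳ q ≈ 1ℝ → fromℚ (- 1ℚ) ⊑ b → b ⊑ 0ℝ → Goal
    at a b p q s h₁ h₂ h₃ h₄ h₅ h₆ h₇ = p , isSolution , solution-unique , s , isInverseSqrt , bound
      where open Parameters C a b p q s 1<C h₁ h₂ h₃ h₄ h₅ h₆ h₇
    from : ∃[ b ] (exp (C *ʳ b) +ʳ exp b ≈ 1ℝ × fromℚ (- 1ℚ) ⊑ b × b ⊑ 0ℝ) → Goal
    from (b , root , -1⊑b , b⊑0) = at (C *ʳ b) b (exp (C *ʳ b)) (exp b) (exp (-ʳ (½ℝ *ʳ (C *ʳ b))))
      (≈-refl {C *ʳ b}) (≈-refl {exp (C *ʳ b)}) (≈-refl {exp b}) (≈-refl {exp (-ʳ (½ℝ *ʳ (C *ʳ b)))}) root -1⊑b b⊑0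

open import Defs
open import Data.Nat.Base using () renaming (_≤_ to _≤ᴺ_)

theorem1p1 : (C : ℝ) → 1ℝ < C →
    Σ[ p ∈ ℝ ] (IsSolution C p × (∀ q → IsSolution C q → q ≃ p) ×
    (Σ[ s ∈ ℝ ] (IsInverseSqrt p s ×
    (Σ[ ε ∈ ℝ ] (0ℝ < ε ×
    (Σ[ L ∈ ℕ ] (∀ ℓ → L ≤ᴺ ℓ → ∀ k → IsRounding (C * fromℕ ℓ) k →
    (s + ε) ^ ℓ ≤ fromℕ (R ℓ k))))))))
theorem1p1 = LowerBound.lower-bound
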